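{- Let $\nu,\delta\in\mathbb{N}$ and suppose $(\nu,\delta)$ is a universal pair over $\mathbb{N}$. Then $\big(11,\eta(\nu,\delta)\big)$ is a universal pair over $\mathbb{Z}$, where \[ \eta(\nu,\delta)=15\,616+233\,856\,\delta+233\,952\,\delta\,(2\delta+1)^{\nu+1}+467\,712\,\delta^2\,(2\delta+1)^{\nu+1}. \]
   Context: $\mathbb{N}=\{0,1,2,\dots\}$. A set $\mathcal{A}\subseteq\mathbb{N}$ is Diophantine if there exist $m\in\mathbb{N}$ and a polynomial $P\in\mathbb{Z}[X_0,X_1,\dots,X_m]$ such that for all $a\in\mathbb{N}$: $a\in\mathcal{A}\iff\exists\,\mathbf{z}\in\mathbb{N}^m: P(a,\mathbf{z})=0$ (equivalently, with $\mathbf{z}\in\mathbb{Z}^m$ for a suitable other polynomial); $P$ is then said to represent $\mathcal{A}$ over $\mathbb{N}$ (resp. over $\mathbb{Z}$ if the unknowns $\mathbf z$ range over $\mathbb{Z}$). The first argument $a$ is the parameter, the remaining arguments are the unknowns. A pair $(\nu,\delta)\in\mathbb{N}^2$ is a universal pair over $\mathbb{N}$ (resp. over $\mathbb{Z}$) if every Diophantine set $\mathcal{A}\subseteq\mathbb{N}$ is represented by some polynomial $P_{\mathcal A}\in\mathbb{Z}[a,z_1,\dots,z_k]$ with $k\le\nu$ unknowns ranging over $\mathbb{N}$ (resp. over $\mathbb{Z}$) and of total degree at most $\delta$, i.e. $a\in\mathcal{A}\iff\exists\,\mathbf z: P_{\mathcal A}(a,\mathbf z)=0$ for all $a\in\mathbb{N}$.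 -}

module Defs where

open import Data.Nat as N using (ℕ; _≤_)
open import Data.Integer as ℤ using (ℤ; +_)
open import Data.List using (List; []; _∷_)
open import Data.List.Relation.Unary.All using (All)
open import Data.Vec as Vec using (Vec; []; _∷_)
open import Data.Product using (Σ; ∃; _×_; _,_)
open import Function.Bundles using (_⇔_)
open import Relation.Binary.PropositionalEquality using (_≡_)
open import Relation.Nullary using (¬_)

Monomial : ℕ → Set
Monomial n = ℤ × Vec ℕ n

-- A polynomial in ℤ[X_0,…,X_{n-1}], given as a finite formal sum of monomials.
Poly : ℕ → Set
Poly n = List (Monomial n)

expDeg : ∀ {n} → Vec ℕ n → ℕ
expDeg [] = 0
expDeg (e ∷ es) = e N.+ expDeg es

monVal : ∀ {n} → Vec ℕ n → Vec ℤ n → ℤ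
monVal [] [] = ℤ.+ 1
monVal (e ∷ es) (x ∷ xs) = (x ℤ.^ e) ℤ.* monVal es xs

eval : ∀ {n} → Poly n → Vec ℤ n → ℤ
eval [] xs = ℤ.+ 0
eval ((c , e) ∷ ms) xs = c ℤ.* monVal e xs ℤ.+ eval ms xs

DegreeAtMost : ∀ {n} → ℕ → Poly n → Set
DegreeAtMost δ P = All (λ m → ¬ (Data.Product.proj₁ m ≡ ℤ.+ 0) → expDeg (Data.Product.proj₂ m) ≤ δ) P

RepresentsOverℕ : ∀ {k} → (ℕ → Set) → Poly (N.suc k) → Set
RepresentsOverℕ {k} A P =
  (a : ℕ) → A a ⇔ (Σ (Vec ℕ k) λ z → eval P ((+ a) ∷ Vec.map +_ z) ≡ ℤ.+ 0)

RepresentsOverℤ : ∀ {k} → (ℕ → Set) → Poly (N.suc k) → Set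
RepresentsOverℤ {k} A P =
  (a : ℕ) → A a ⇔ (Σ (Vec ℤ k) λ z → eval P ((+ a) ∷ z) ≡ ℤ.+ 0)

Diophantine : (ℕ → Set) → Set
Diophantine A = Σ ℕ λ m → Σ (Poly (N.suc m)) λ P → RepresentsOverℕ A P

UniversalPairℕ : ℕ → ℕ → Set₁
UniversalPairℕ ν δ = (A : ℕ → Set) → Diophantine A →
  Σ ℕ λ k → k ≤ ν × Σ (Poly (N.suc k)) λ P → DegreeAtMost δ P × RepresentsOverℕ A P

UniversalPairℤ : ℕ → ℕ → Set₁
UniversalPairℤ ν δ = (A : ℕ → Set) → Diophantine A →
  Σ ℕ λ k → k ≤ ν × Σ (Poly (N.suc k)) λ P → DegreeAtMost δ P × RepresentsOverℤ A P

η : ℕ → ℕ → ℕ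
η ν δ = 15616 + 233856 * δ + 233952 * δ * (2 * δ + 1) ^ (ν + 1)
        + 467712 * δ ^ 2 * (2 * δ + 1) ^ (ν + 1)
  where open N using (_+_; _*_; _^_)

-- A zero (z₁ , … , z_k) of P(a , –) is coded in the digits of a number g in a base ℬ that is a power of two.  That
-- g is such a code means that no carry occurs in an addition S + T, hence, by Kummer's theorem, that N² divides the
-- central binomial coefficient of 2X, where X and N are polynomials in a, b, g; the quotient is then odd.
-- This coefficient is read off the integer part of (V + 1)²ˣ / Vˣ, which is approximated by the quotient of the Pell
-- solutions C = Y α (2X + 1) and K = Y κ (X + 1).  That C, K are these solutions and that b is a power of two follows
-- from three squares F, I, S₂, one divisibility S₀ ∣ T₀ and one inequality R > 0.  The three squares are pairwise
-- coprime, so it is enough that J = F I S₂ is a square.  The inequality R > 0 holds iff (4R − 2) J y² + 1 is a square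
-- for some y ≠ 0, a Pell equation, and a nonzero y is written (2u + 1)(3v + 1).  This number is coprime to J, so both
-- are squares iff their product Q is.  Finally "S₀ ∣ T₀ and Q is a square" becomes (S₀ n + T₀)² = S₀² Q, which leaves the
-- eleven unknowns b, g, h, k, l, w, x, y, u, v, n.

{-# OPTIONS --safe #-}
module Submission where

open import Data.Nat as ℕ
open import Data.Nat.Properties
open import Data.Nat.Divisibility
open import Data.Nat.DivMod using (m≡m%n+[m/n]*n; m%n<n; _/_; _%_)
open import Data.Nat.GCD using (gcd; gcd[m,n]∣m; gcd[m,n]∣n; gcd[m,n]≢0; gcd-GCD; GCD-*)
open import Data.Nat.Coprimality using (Coprime; coprime-divisor; GCD≡1⇒coprime)
import Data.Nat.Coprimality as Coprime
open import Data.Nat.Induction using (<-rec)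
open import Data.Nat.Tactic.RingSolver using (solve-∀)
open import Data.Integer as ℤ using (ℤ; +_; -[1+_]; ∣_∣)
import Data.Integer.Properties as ℤ
import Data.Integer.Tactic.RingSolver as ℤ-Solver
open import Data.Fin as Fin using (Fin; #_)
import Data.Fin.Properties as Fin
open import Data.List as List using (List; []; _∷_; _++_)
open import Data.List.Relation.Unary.All as All using (All; []; _∷_)
open import Data.List.Relation.Unary.Any using (here; there)
open import Data.List.Membership.Propositional using (_∈_)
open import Data.List.Membership.Propositional.Properties using (∈-map⁺; ∈-++⁺ˡ; ∈-++⁺ʳ)
open import Data.Vec as Vec using (Vec; []; _∷_)
import Data.Vec.Relation.Unary.All as VAll
open VAll using ([]; _∷_)
open import Data.Product using (Σ; ∃; ∃₂; _×_; _,_; proj₁; proj₂)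
open import Data.Sum using (_⊎_; inj₁; inj₂)
open import Data.Empty using (⊥; ⊥-elim)
open import Function.Base using (_∘_; _$_; case_of_; flip)
open import Function.Bundles using (_⇔_; mk⇔; Equivalence)
open import Relation.Nullary using (¬_; yes; no; contradiction)
open import Relation.Binary.Definitions using (tri<; tri≈; tri>)
open import Relation.Binary.PropositionalEquality using (_≡_; _≢_; refl; sym; trans; cong; cong₂; subst; subst₂; module ≡-Reasoning)
open import Defs

-- The unknowns are integers, and none can be spent on making another positive or nonzero. So the
-- quantities are built to be harmless for every sign: 3b + 1, 2l + 1, 2u + 1 and 3v + 1 never
-- vanish, `U` is 64 times one plus a square, and congruences are kept up to sign. The single
-- inequality R > 0 carries all size conditions at once: x ≠ 0, |g| < M, a < (3b + 1)² and 4 |C - K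
-- L| < |K|. This dictates the order of the soundness argument. The bounds on g and a are what makes
-- X a natural number; the Pell conditions can be exploited only then, and the base is known to be a
-- power of two only after that. A second circularity lies in the quotient: its integer part is
-- controlled once V outgrows 2²ˣ, which is known only after w has been identified, while
-- identifying w needs a huge modulus. A lower bound for L, valid for every w, breaks this circle.
-- The three squares are pairwise coprime because E is given the factors D and S₂. The coefficient
-- 4R - 2 is chosen because twice an odd number is never a square.

IsSquare : ℕ → Set
IsSquare n = ∃ λ r → n ≡ r * r

-- Squares, coprime factors and parity

sq-mono-≤ : ∀ {m n} → m ≤ n → m * m ≤ n * n
sq-mono-≤ m≤n = *-mono-≤ m≤n m≤n

sq-cancel-≤ : ∀ {m n} → m * m ≤ n * n → m ≤ n
sq-cancel-≤ {m} {n} h with m ≤? n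
... | yes p = p
... | no ¬p = contradiction h (<⇒≱ (*-mono-< (≰⇒> ¬p) (≰⇒> ¬p)))

sq-cancel-< : ∀ {m n} → m * m < n * n → m < n
sq-cancel-< {m} {n} h with m <? n
... | yes p = p
... | no ¬p = contradiction h (≤⇒≯ (sq-mono-≤ (≮⇒≥ ¬p)))

sq-injective : ∀ {m n} → m * m ≡ n * n → m ≡ n
sq-injective e = ≤-antisym (sq-cancel-≤ (≤-reflexive e)) (sq-cancel-≤ (≤-reflexive (sym e)))

coprime-*ʳ : ∀ {a b c} → Coprime a b → Coprime a c → Coprime a (b * c)
coprime-*ʳ {a} {b} {c} ab ac {d} (d∣a , d∣bc) =
  ac (d∣a , coprime-divisor (λ (e∣d , e∣b) → ab (∣-trans e∣d d∣a , e∣b)) d∣bc)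

∣-suc⇒coprime : ∀ {a b t} → b ≡ suc (a * t) → Coprime a b
∣-suc⇒coprime {a} {b} {t} refl {d} (d∣a , d∣b) =
  ∣1⇒≡1 (∣m+n∣m⇒∣n (subst (d ∣_) (+-comm 1 (a * t)) d∣b) (∣m⇒∣m*n t d∣a))

gcd-decompose : ∀ a c → 0 < a → ∃ λ g → ∃₂ λ a′ c′ → a ≡ a′ * g × c ≡ c′ * g × Coprime a′ c′ × 0 < g
gcd-decompose a c 0<a with gcd[m,n]∣m a c | gcd[m,n]∣n a c
... | divides a′ ea | divides c′ ec =
  gcd a c , a′ , c′ , ea , ec , GCD≡1⇒coprime (GCD-* {c = gcd a c} ⦃ nz ⦄ G) , n≢0⇒n>0 g≢0
  where
  g≢0 : gcd a c ≢ 0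
  g≢0 = gcd[m,n]≢0 a c (inj₁ (λ { refl → <-irrefl refl 0<a }))
  nz : NonZero (gcd a c)
  nz = ≢-nonZero g≢0
  G = subst (λ z → GCDof (a′ * gcd a c) (c′ * gcd a c) z) (sym (*-identityˡ _))
        (subst₂ (λ u v → GCDof u v (gcd a c)) ea ec (gcd-GCD a c))
    where open import Data.Nat.GCD renaming (module GCD to GCDm; GCD to GCDof)

-- Let g be the gcd of a and c, with a = a′ g and c = c′ g. Then a′ b = g c′², and a′ is coprime to
-- c′, so g = t a′ and b = t c′². As t divides both a and b, it is 1.
coprime-product-square : ∀ {a b} → 0 < a → 0 < b → Coprime a b → IsSquare (a * b) → IsSquare a × IsSquare b
coprime-product-square {a} {b} 0<a 0<b cop (c , e)
  with gcd-decompose a c 0<a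
... | g , a′ , c′ , refl , refl , cop′ , 0<g = sq-a , sq-b
  where
  instance
    nzg : NonZero g
    nzg = >-nonZero 0<g
  e₁ : a′ * b ≡ g * (c′ * c′)
  e₁ = *-cancelˡ-≡ (a′ * b) (g * (c′ * c′)) g
         (trans (l₁ g a′ b) (trans e (l₂ g c′)))
    where
    l₁ : ∀ g a b → g * (a * b) ≡ a * g * b
    l₁ = solve-∀
    l₂ : ∀ g c → (c * g) * (c * g) ≡ g * (g * (c * c))
    l₂ = solve-∀
  a′∣g : a′ ∣ g
  a′∣g = coprime-divisor (coprime-*ʳ cop′ cop′)
           (subst (a′ ∣_) (trans e₁ (*-comm g (c′ * c′))) (m∣m*n b))
  instance
    nza : NonZero a′
    nza = m*n≢0⇒m≢0 a′ ⦃ >-nonZero 0<a ⦄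
  t = quotient a′∣g
  g≡ : g ≡ t * a′
  g≡ = m∣n⇒n≡quotient*m a′∣g
  b≡ : b ≡ t * (c′ * c′)
  b≡ = *-cancelˡ-≡ b (t * (c′ * c′)) a′ (trans e₁ (trans (cong (_* (c′ * c′)) g≡) (l t a′ (c′ * c′))))
    where
    l : ∀ t a c → t * a * c ≡ a * (t * c)
    l = solve-∀
  t≡1 : t ≡ 1
  t≡1 = cop (∣n⇒∣m*n a′ (quotient-∣ a′∣g) , subst (t ∣_) (sym b≡) (m∣m*n (c′ * c′)))
  sq-a : IsSquare (a′ * g)
  sq-a = a′ , cong (a′ *_) (trans g≡ (trans (cong (_* a′) t≡1) (*-identityˡ a′)))
  sq-b : IsSquare b
  sq-b = c′ , trans b≡ (trans (cong (_* (c′ * c′)) t≡1) (*-identityˡ _))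

-- After division by the gcd, a′² ∣ b′² with a′ and b′ coprime, which forces a′ = 1.
sq-∣⇒∣ : ∀ {a b} → a * a ∣ b * b → a ∣ b
sq-∣⇒∣ {zero} {b} h with m*n≡0⇒m≡0∨n≡0 b (0∣⇒≡0 h)
... | inj₁ refl = ∣-refl
... | inj₂ refl = ∣-refl
sq-∣⇒∣ {a@(suc _)} {b} h with gcd-decompose a b z<s
... | g , a′ , b′ , ea , refl , cop′ , 0<g = subst (_∣ b′ * g) (sym a≡g) (n∣m*n b′)
  where
  instance
    nzg : NonZero g
    nzg = >-nonZero 0<g
  h′ : a′ * a′ ∣ b′ * b′
  h′ = *-cancelʳ-∣ (g * g) ⦃ m*n≢0 g g ⦄
         (subst₂ _∣_ (trans (cong₂ _*_ ea ea) (l a′ g)) (l b′ g) h)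
    where
    l : ∀ a g → a * g * (a * g) ≡ a * a * (g * g)
    l = solve-∀
  a′≡1 : a′ ≡ 1
  a′≡1 = coprime-*ʳ cop′ cop′ (∣-refl , ∣-trans (m∣m*n a′) h′)
  a≡g : a ≡ g
  a≡g = trans ea (trans (cong (_* g) a′≡1) (*-identityˡ g))

Odd : ℕ → Set
Odd n = ∃ λ k → n ≡ suc (2 * k)

odd-* : ∀ {m n} → Odd m → Odd n → Odd (m * n)
odd-* (k , refl) (l , refl) = k * suc (2 * l) + l , lem k l
  where
  lem : ∀ k l → suc (2 * k) * suc (2 * l) ≡ suc (2 * (k * suc (2 * l) + l))
  lem = solve-∀

even⊎odd : ∀ n → (∃ λ k → n ≡ 2 * k) ⊎ Odd n
even⊎odd zero = inj₁ (0 , refl)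
even⊎odd (suc n) with even⊎odd n
... | inj₁ (k , refl) = inj₂ (k , refl)
... | inj₂ (k , refl) = inj₁ (suc k , lem k)
  where
  lem : ∀ k → suc (suc (2 * k)) ≡ 2 * suc k
  lem = solve-∀

∣2^⇒2^ : ∀ n {d} → d ∣ 2 ^ n → ∃ λ j → d ≡ 2 ^ j
∣2^⇒2^ zero h = 0 , ∣1⇒≡1 h
∣2^⇒2^ (suc n) {d} h with even⊎odd d
... | inj₁ (k , refl) with ∣2^⇒2^ n {k} (*-cancelˡ-∣ 2 h)
...   | j , refl = suc j , refl
∣2^⇒2^ (suc n) {d} h | inj₂ (k , refl) = ∣2^⇒2^ n (coprime-divisor cop h)
  where
  cop : Coprime (suc (2 * k)) 2
  cop = Coprime.sym (∣-suc⇒coprime {t = k} refl)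

¬≡2-mod-4-square : ∀ k s → ¬ (2 + 4 * k ≡ s * s)
¬≡2-mod-4-square k s e with even⊎odd s
... | inj₁ (t , refl) = even≢odd (t * t) k (*-cancelˡ-≡ (2 * (t * t)) (suc (2 * k)) 2 (trans (l₁ t) (trans (sym e) (l₂ k))))
  where
  l₁ : ∀ t → 2 * (2 * (t * t)) ≡ 2 * t * (2 * t)
  l₁ = solve-∀
  l₂ : ∀ k → 2 + 4 * k ≡ 2 * suc (2 * k)
  l₂ = solve-∀
... | inj₂ (t , refl) = even≢odd (suc (2 * k)) (2 * (t * t) + 2 * t) (trans (l₂ k) (trans e (l₁ t)))
  where
  l₁ : ∀ t → suc (2 * t) * suc (2 * t) ≡ suc (2 * (2 * (t * t) + 2 * t))
  l₁ = solve-∀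
  l₂ : ∀ k → 2 * suc (2 * k) ≡ 2 + 4 * k
  l₂ = solve-∀

-- The Pell equation for an arbitrary non-square D

i*i≡+∣i∣*∣i∣ : ∀ i → i ℤ.* i ≡ + (∣ i ∣ * ∣ i ∣)
i*i≡+∣i∣*∣i∣ (+ n) = sym (ℤ.pos-* n n)
i*i≡+∣i∣*∣i∣ -[1+ n ] = refl

-- Walking along Conway's river of the form x² − D y²: a basis of ℤ² on which the
-- form takes a positive value a and a negative value −c is replaced by the adjacent
-- such basis.  The triples (a , h , c) with h² + a c = D are finite in number and the
-- walk is reversible, so it returns to its start, and the basis reached is an automorph.
module River (D : ℕ) (¬sq : ¬ IsSquare D) where

  open import Data.Integer using (0ℤ; 1ℤ) renaming (_+_ to _⊕_; _*_ to _⊛_; _-_ to _⊝_; _<_ to _≺_)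

  private
    𝔻 : ℤ
    𝔻 = + D

  -- n counts the steps of the walk. `y₁-cases` serves to exclude the trivial solution: as long as
  -- the first vector is still (1, 0), every step has enlarged x₂ by one, so the polar value h is n,
  -- and h cannot be 0 again after a positive number of steps.
  record Basis (n : ℕ) : Set where
    field
      a h c x₁ y₁ x₂ y₂ : ℤ
      disc : h ⊛ h ⊕ a ⊛ c ≡ 𝔻
      a>0 : 0ℤ ≺ a
      c>0 : 0ℤ ≺ c
      form₁ : x₁ ⊛ x₁ ⊝ 𝔻 ⊛ (y₁ ⊛ y₁) ≡ a
      polar : x₁ ⊛ x₂ ⊝ 𝔻 ⊛ (y₁ ⊛ y₂) ≡ h
      form₂ : 𝔻 ⊛ (y₂ ⊛ y₂) ⊝ x₂ ⊛ x₂ ≡ c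
      y₂>0 : 0ℤ ≺ y₂
      y₁-cases : (y₁ ≡ 0ℤ × x₁ ≡ 1ℤ × x₂ ≡ + n) ⊎ 0ℤ ≺ y₁

  open Basis

  core : ∀ {n} → Basis n → ℤ × ℤ × ℤ
  core s = a s , h s , c s

  -- The form at the sum of the two basis vectors. Its sign decides which of them the sum replaces.
  value : ∀ {n} → Basis n → ℤ
  value s = a s ⊕ h s ⊕ h s ⊝ c s

  -- Because h² + a c = (h + a)² - a · `value`, a zero would make D a square.
  value≢0 : ∀ {n} (s : Basis n) → value s ≢ 0ℤ
  value≢0 s e = ¬sq (∣ t ∣ , ℤ.+-injective (trans (sym (disc s)) eq))
    where
    t = h s ⊕ a s
    l : ∀ a h c → h ⊛ h ⊕ a ⊛ c ≡ (h ⊕ a) ⊛ (h ⊕ a) ⊝ a ⊛ (a ⊕ h ⊕ h ⊝ c)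
    l = ℤ-Solver.solve-∀
    l₂ : ∀ t a → t ⊛ t ⊝ a ⊛ 0ℤ ≡ t ⊛ t
    l₂ = ℤ-Solver.solve-∀
    eq : h s ⊛ h s ⊕ a s ⊛ c s ≡ + (∣ t ∣ * ∣ t ∣)
    eq = trans (l (a s) (h s) (c s)) (trans (cong (λ v → t ⊛ t ⊝ a s ⊛ v) e) (trans (l₂ t (a s)) (i*i≡+∣i∣*∣i∣ t)))

  private
    pos+nonneg : ∀ {i j} → 0ℤ ≺ i → 0ℤ ≺ j → 0ℤ ≺ i ⊕ j
    pos+nonneg p q = ℤ.+-mono-< p q

  step : ∀ {n} → Basis n → Basis (suc n)
  step {n} s with ℤ.<-cmp 0ℤ (value s)
  ... | tri≈ _ e _ = ⊥-elim (value≢0 s (sym e))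
  ... | tri< p _ _ = record
    { a = value s ; h = h s ⊝ c s ; c = c s
    ; x₁ = x₁ s ⊕ x₂ s ; y₁ = y₁ s ⊕ y₂ s ; x₂ = x₂ s ; y₂ = y₂ s
    ; disc = trans (l₁ (a s) (h s) (c s)) (disc s)
    ; a>0 = p ; c>0 = c>0 s
    ; form₁ = trans (l₂ 𝔻 (x₁ s) (x₂ s) (y₁ s) (y₂ s))
                (cong₂ _⊝_ (cong₂ _⊕_ (cong₂ _⊕_ (form₁ s) (polar s)) (polar s)) (form₂ s))
    ; polar = trans (l₃ 𝔻 (x₁ s) (x₂ s) (y₁ s) (y₂ s)) (cong₂ _⊝_ (polar s) (form₂ s))
    ; form₂ = form₂ s ; y₂>0 = y₂>0 s
    ; y₁-cases = inj₂ (y₁>0 (y₁-cases s)) }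
    where
    l₁ : ∀ a h c → (h ⊝ c) ⊛ (h ⊝ c) ⊕ (a ⊕ h ⊕ h ⊝ c) ⊛ c ≡ h ⊛ h ⊕ a ⊛ c
    l₁ = ℤ-Solver.solve-∀
    l₂ : ∀ d x₁ x₂ y₁ y₂ → (x₁ ⊕ x₂) ⊛ (x₁ ⊕ x₂) ⊝ d ⊛ ((y₁ ⊕ y₂) ⊛ (y₁ ⊕ y₂))
       ≡ (x₁ ⊛ x₁ ⊝ d ⊛ (y₁ ⊛ y₁)) ⊕ (x₁ ⊛ x₂ ⊝ d ⊛ (y₁ ⊛ y₂)) ⊕ (x₁ ⊛ x₂ ⊝ d ⊛ (y₁ ⊛ y₂)) ⊝ (d ⊛ (y₂ ⊛ y₂) ⊝ x₂ ⊛ x₂)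
    l₂ = ℤ-Solver.solve-∀
    l₃ : ∀ d x₁ x₂ y₁ y₂ → (x₁ ⊕ x₂) ⊛ x₂ ⊝ d ⊛ ((y₁ ⊕ y₂) ⊛ y₂)
       ≡ (x₁ ⊛ x₂ ⊝ d ⊛ (y₁ ⊛ y₂)) ⊝ (d ⊛ (y₂ ⊛ y₂) ⊝ x₂ ⊛ x₂)
    l₃ = ℤ-Solver.solve-∀
    y₁>0 : (y₁ s ≡ 0ℤ × x₁ s ≡ 1ℤ × x₂ s ≡ + n) ⊎ 0ℤ ≺ y₁ s → 0ℤ ≺ y₁ s ⊕ y₂ s
    y₁>0 (inj₁ (e , _)) = subst (0ℤ ≺_) (trans (sym (ℤ.+-identityˡ (y₂ s))) (cong (_⊕ y₂ s) (sym e))) (y₂>0 s)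
    y₁>0 (inj₂ q) = pos+nonneg q (y₂>0 s)
  ... | tri> _ _ p = record
    { a = a s ; h = h s ⊕ a s ; c = ℤ.- value s
    ; x₁ = x₁ s ; y₁ = y₁ s ; x₂ = x₁ s ⊕ x₂ s ; y₂ = y₁ s ⊕ y₂ s
    ; disc = trans (l₁ (a s) (h s) (c s)) (disc s)
    ; a>0 = a>0 s ; c>0 = ℤ.neg-mono-< p
    ; form₁ = form₁ s
    ; polar = trans (l₃ 𝔻 (x₁ s) (x₂ s) (y₁ s) (y₂ s)) (cong₂ _⊕_ (polar s) (form₁ s))
    ; form₂ = trans (l₂ 𝔻 (x₁ s) (x₂ s) (y₁ s) (y₂ s))
                (cong ℤ.-_ (cong₂ _⊝_ (cong₂ _⊕_ (cong₂ _⊕_ (form₁ s) (polar s)) (polar s)) (form₂ s)))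
    ; y₂>0 = y₂>0′ (y₁-cases s)
    ; y₁-cases = cases (y₁-cases s) }
    where
    l₁ : ∀ a h c → (h ⊕ a) ⊛ (h ⊕ a) ⊕ a ⊛ (ℤ.- (a ⊕ h ⊕ h ⊝ c)) ≡ h ⊛ h ⊕ a ⊛ c
    l₁ = ℤ-Solver.solve-∀
    l₂ : ∀ d x₁ x₂ y₁ y₂ → d ⊛ ((y₁ ⊕ y₂) ⊛ (y₁ ⊕ y₂)) ⊝ (x₁ ⊕ x₂) ⊛ (x₁ ⊕ x₂)
       ≡ ℤ.- ((x₁ ⊛ x₁ ⊝ d ⊛ (y₁ ⊛ y₁)) ⊕ (x₁ ⊛ x₂ ⊝ d ⊛ (y₁ ⊛ y₂)) ⊕ (x₁ ⊛ x₂ ⊝ d ⊛ (y₁ ⊛ y₂)) ⊝ (d ⊛ (y₂ ⊛ y₂) ⊝ x₂ ⊛ x₂))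
    l₂ = ℤ-Solver.solve-∀
    l₃ : ∀ d x₁ x₂ y₁ y₂ → x₁ ⊛ (x₁ ⊕ x₂) ⊝ d ⊛ (y₁ ⊛ (y₁ ⊕ y₂))
       ≡ (x₁ ⊛ x₂ ⊝ d ⊛ (y₁ ⊛ y₂)) ⊕ (x₁ ⊛ x₁ ⊝ d ⊛ (y₁ ⊛ y₁))
    l₃ = ℤ-Solver.solve-∀
    y₂>0′ : (y₁ s ≡ 0ℤ × x₁ s ≡ 1ℤ × x₂ s ≡ + n) ⊎ 0ℤ ≺ y₁ s → 0ℤ ≺ y₁ s ⊕ y₂ s
    y₂>0′ (inj₁ (e , _)) = subst (0ℤ ≺_) (trans (sym (ℤ.+-identityˡ (y₂ s))) (cong (_⊕ y₂ s) (sym e))) (y₂>0 s)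
    y₂>0′ (inj₂ q) = pos+nonneg q (y₂>0 s)
    cases : (y₁ s ≡ 0ℤ × x₁ s ≡ 1ℤ × x₂ s ≡ + n) ⊎ 0ℤ ≺ y₁ s
          → (y₁ s ≡ 0ℤ × x₁ s ≡ 1ℤ × x₁ s ⊕ x₂ s ≡ + suc n) ⊎ 0ℤ ≺ y₁ s
    cases (inj₁ (e , e′ , e″)) = inj₁ (e , e′ , cong₂ _⊕_ e′ e″)
    cases (inj₂ q) = inj₂ q

  private
    absurd-sum : ∀ {A H C i j} → 0ℤ ≺ i → 0ℤ ≺ j → i ≡ A ⊝ H ⊝ H ⊝ C → j ≡ C ⊕ H ⊕ H ⊝ A → ⊥
    absurd-sum {A} {H} {C} p q refl refl =
      ℤ.<-irrefl (sym (l A H C)) (ℤ.+-mono-< p q)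
      where
      l : ∀ A H C → (A ⊝ H ⊝ H ⊝ C) ⊕ (C ⊕ H ⊕ H ⊝ A) ≡ 0ℤ ⊕ 0ℤ
      l = ℤ-Solver.solve-∀

    triple : ∀ {a a′ h h′ c c′ : ℤ} → a ≡ a′ → h ≡ h′ → c ≡ c′ → (a , h , c) ≡ (a′ , h′ , c′)
    triple refl refl refl = refl

    up-a : ∀ a h c → a ≡ (a ⊕ h ⊕ h ⊝ c) ⊝ (h ⊝ c) ⊝ (h ⊝ c) ⊝ c
    up-a = ℤ-Solver.solve-∀
    up-h : ∀ h c → h ≡ (h ⊝ c) ⊕ c
    up-h = ℤ-Solver.solve-∀
    down-c : ∀ a h c → c ≡ (ℤ.- (a ⊕ h ⊕ h ⊝ c)) ⊕ (h ⊕ a) ⊕ (h ⊕ a) ⊝ a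
    down-c = ℤ-Solver.solve-∀
    down-h : ∀ a h → h ≡ (h ⊕ a) ⊝ a
    down-h = ℤ-Solver.solve-∀

  -- The new core (A, H, C) betrays the step that led to it. If the first vector was replaced, the
  -- old a is A - 2H - C; if the second was, the old c is C + 2H - A. These numbers are opposite, so
  -- they cannot both be positive.
  core-step-injective : ∀ {m n} (s : Basis m) (t : Basis n) → core (step s) ≡ core (step t) → core s ≡ core t
  core-step-injective s t e with ℤ.<-cmp 0ℤ (value s) | ℤ.<-cmp 0ℤ (value t)
  ... | tri≈ _ e₀ _ | _ = ⊥-elim (value≢0 s (sym e₀))
  ... | tri< _ _ _ | tri≈ _ e₀ _ = ⊥-elim (value≢0 t (sym e₀))
  ... | tri> _ _ _ | tri≈ _ e₀ _ = ⊥-elim (value≢0 t (sym e₀))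
  ... | tri< _ _ _ | tri< _ _ _ = triple
    (trans (up-a (a s) (h s) (c s)) (trans (cong (λ { (A , H , C) → A ⊝ H ⊝ H ⊝ C }) e) (sym (up-a (a t) (h t) (c t)))))
    (trans (up-h (h s) (c s)) (trans (cong (λ { (A , H , C) → H ⊕ C }) e) (sym (up-h (h t) (c t)))))
    (cong (λ { (A , H , C) → C }) e)
  ... | tri> _ _ _ | tri> _ _ _ = triple
    (cong proj₁ e)
    (trans (down-h (a s) (h s)) (trans (cong (λ { (A , H , C) → H ⊝ A }) e) (sym (down-h (a t) (h t)))))
    (trans (down-c (a s) (h s) (c s)) (trans (cong (λ { (A , H , C) → C ⊕ H ⊕ H ⊝ A }) e) (sym (down-c (a t) (h t) (c t)))))
  ... | tri< _ _ _ | tri> _ _ _ = ⊥-elim (absurd-sum {a t} {h t ⊕ a t} {ℤ.- value t} (a>0 s) (c>0 t)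
    (trans (up-a (a s) (h s) (c s)) (cong (λ { (A , H , C) → A ⊝ H ⊝ H ⊝ C }) e)) (down-c (a t) (h t) (c t)))
  ... | tri> _ _ _ | tri< _ _ _ = ⊥-elim (absurd-sum {a s} {h s ⊕ a s} {ℤ.- value s} (a>0 t) (c>0 s)
    (trans (up-a (a t) (h t) (c t)) (cong (λ { (A , H , C) → A ⊝ H ⊝ H ⊝ C }) (sym e))) (down-c (a s) (h s) (c s)))

  private
    D>0 : 0 < D
    D>0 = n≢0⇒n>0 (λ e → ¬sq (0 , e))

  start : Basis 0
  start = record
    { a = 1ℤ ; h = 0ℤ ; c = 𝔻 ; x₁ = 1ℤ ; y₁ = 0ℤ ; x₂ = 0ℤ ; y₂ = 1ℤ
    ; disc = trans (ℤ.+-identityˡ _) (ℤ.*-identityˡ 𝔻)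
    ; a>0 = ℤ.+<+ z<s ; c>0 = ℤ.+<+ D>0
    ; form₁ = l₁ 𝔻 ; polar = l₂ 𝔻 ; form₂ = l₃ 𝔻
    ; y₂>0 = ℤ.+<+ z<s ; y₁-cases = inj₁ (refl , refl , refl) }
    where
    l₁ : ∀ d → 1ℤ ⊛ 1ℤ ⊝ d ⊛ (0ℤ ⊛ 0ℤ) ≡ 1ℤ
    l₁ = ℤ-Solver.solve-∀
    l₂ : ∀ d → 1ℤ ⊛ 0ℤ ⊝ d ⊛ (0ℤ ⊛ 1ℤ) ≡ 0ℤ
    l₂ = ℤ-Solver.solve-∀
    l₃ : ∀ d → d ⊛ (1ℤ ⊛ 1ℤ) ⊝ 0ℤ ⊛ 0ℤ ≡ d
    l₃ = ℤ-Solver.solve-∀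

  run : ∀ n → Basis n
  run zero = start
  run (suc n) = step (run n)

  return : ∀ i j → core (run i) ≡ core (run (i + j)) → core (run 0) ≡ core (run j)
  return zero j e = e
  return (suc i) j e = return i j (core-step-injective (run i) (run (i + j)) e)

  private
    encode : ℤ → ℕ
    encode (+ n) = n
    encode -[1+ n ] = suc D + n

    encode-injective : ∀ i j → ∣ i ∣ ≤ D → ∣ j ∣ ≤ D → encode i ≡ encode j → i ≡ j
    encode-injective (+ m) (+ n) _ _ e = cong +_ e
    encode-injective (+ m) -[1+ n ] p _ e = ⊥-elim (<⇒≱ (≤-<-trans p (s≤s (m≤m+n D n))) (≤-reflexive (sym e)))
    encode-injective -[1+ m ] (+ n) _ p e = ⊥-elim (<⇒≱ (≤-<-trans p (s≤s (m≤m+n D m))) (≤-reflexive e))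
    encode-injective -[1+ m ] -[1+ n ] _ _ e = cong -[1+_] (+-cancelˡ-≡ (suc D) m n e)

    encode-< : ∀ i → ∣ i ∣ ≤ D → encode i < suc D + suc D
    encode-< (+ n) p = ≤-trans (s≤s p) (m≤m+n (suc D) (suc D))
    encode-< -[1+ n ] p = +-monoʳ-< (suc D) (m≤n⇒m≤1+n p)

    n≤n*n : ∀ n → n ≤ n * n
    n≤n*n zero = z≤n
    n≤n*n (suc n) = m≤m*n (suc n) (suc n)

    positive : ∀ {i} → 0ℤ ≺ i → + ∣ i ∣ ≡ i
    positive p = ℤ.0≤i⇒+∣i∣≡i (ℤ.<⇒≤ p)

    ∣i∣>0 : ∀ {i} → 0ℤ ≺ i → 0 < ∣ i ∣
    ∣i∣>0 (ℤ.+<+ p) = p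

    disc-ℕ : ∀ {n} (s : Basis n) → ∣ h s ∣ * ∣ h s ∣ + ∣ a s ∣ * ∣ c s ∣ ≡ D
    disc-ℕ s = ℤ.+-injective (trans (ℤ.pos-+ (∣ h s ∣ * ∣ h s ∣) (∣ a s ∣ * ∣ c s ∣))
      (trans (cong₂ _⊕_ (sym (i*i≡+∣i∣*∣i∣ (h s))) (trans (ℤ.pos-* ∣ a s ∣ ∣ c s ∣) (cong₂ _⊛_ (positive (a>0 s)) (positive (c>0 s))))) (disc s)))

    a≤D : ∀ {n} (s : Basis n) → ∣ a s ∣ ≤ D
    a≤D s = ≤-trans (≤-trans (m≤m*n ∣ a s ∣ ∣ c s ∣ ⦃ >-nonZero (∣i∣>0 (c>0 s)) ⦄) (m≤n+m _ (∣ h s ∣ * ∣ h s ∣))) (≤-reflexive (disc-ℕ s))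
    c≤D : ∀ {n} (s : Basis n) → ∣ c s ∣ ≤ D
    c≤D s = ≤-trans (≤-trans (m≤n*m ∣ c s ∣ ∣ a s ∣ ⦃ >-nonZero (∣i∣>0 (a>0 s)) ⦄) (m≤n+m _ (∣ h s ∣ * ∣ h s ∣))) (≤-reflexive (disc-ℕ s))
    h≤D : ∀ {n} (s : Basis n) → ∣ h s ∣ ≤ D
    h≤D s = ≤-trans (≤-trans (n≤n*n ∣ h s ∣) (m≤m+n _ (∣ a s ∣ * ∣ c s ∣))) (≤-reflexive (disc-ℕ s))

    code : ∀ {n} → Basis n → Fin (suc D * (suc D * (suc D + suc D)))
    code s = Fin.combine (Fin.fromℕ< (s≤s (a≤D s))) (Fin.combine (Fin.fromℕ< (s≤s (c≤D s))) (Fin.fromℕ< (encode-< (h s) (h≤D s))))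

    code⇒core : ∀ {m n} (s : Basis m) (t : Basis n) → code s ≡ code t → core s ≡ core t
    code⇒core s t e with Fin.combine-injective _ _ _ _ e
    ... | ea , e′ with Fin.combine-injective _ _ _ _ e′
    ...   | ec , eh = triple
      (trans (sym (positive (a>0 s))) (trans (cong +_ (Fin.fromℕ<-injective _ _ _ _ ea)) (positive (a>0 t))))
      (encode-injective _ _ (h≤D s) (h≤D t) (Fin.fromℕ<-injective _ _ _ _ eh))
      (trans (sym (positive (c>0 s))) (trans (cong +_ (Fin.fromℕ<-injective _ _ _ _ ec)) (positive (c>0 t))))

  pell-solution : ∃₂ λ x y → 0 < y × x * x ≡ suc (D * (y * y))
  pell-solution = repeated (Fin.pigeonhole (n<1+n _) (λ i → code (run (Fin.toℕ i))))
    where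
    no-fixpoint : ∀ d n {x₁ x₂ y₁ y₂} → x₁ ≡ 1ℤ → y₁ ≡ 0ℤ → x₂ ≡ + suc n → x₁ ⊛ x₂ ⊝ d ⊛ (y₁ ⊛ y₂) ≢ 0ℤ
    no-fixpoint d n {y₂ = y₂} refl refl refl q = case trans (sym (l d (+ suc n) y₂)) q of λ ()
      where
      l : ∀ d n y → 1ℤ ⊛ n ⊝ d ⊛ (0ℤ ⊛ y) ≡ n
      l = ℤ-Solver.solve-∀
    from-coordinates : ∀ {x y} → 0ℤ ≺ y → x ⊛ x ⊝ 𝔻 ⊛ (y ⊛ y) ≡ 1ℤ → ∃₂ λ x y → 0 < y × x * x ≡ suc (D * (y * y))
    from-coordinates {x} {y} y>0 e = ∣ x ∣ , ∣ y ∣ , ∣i∣>0 y>0 , ℤ.+-injective (trans (sym (i*i≡+∣i∣*∣i∣ x))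
      (trans (l 𝔻 x y) (trans (cong (_⊕ 𝔻 ⊛ (y ⊛ y)) e) (cong (1ℤ ⊕_) (trans (cong (𝔻 ⊛_) (i*i≡+∣i∣*∣i∣ y)) (sym (ℤ.pos-* D _)))))))
      where
      l : ∀ d x y → x ⊛ x ≡ (x ⊛ x ⊝ d ⊛ (y ⊛ y)) ⊕ d ⊛ (y ⊛ y)
      l = ℤ-Solver.solve-∀
    -- a = 1 says that the first vector solves the Pell equation; h = 0 rules out that it is still
    -- (1, 0).
    conclude : ∀ {k} (s : Basis (suc k)) → a s ≡ 1ℤ → h s ≡ 0ℤ → ∃₂ λ x y → 0 < y × x * x ≡ suc (D * (y * y))
    conclude {k} s ea eh with y₁-cases s
    ... | inj₁ (e₁ , e₂ , e₃) = ⊥-elim (no-fixpoint 𝔻 k e₂ e₁ e₃ (trans (polar s) eh))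
    ... | inj₂ y₁>0 = from-coordinates {x₁ s} {y₁ s} y₁>0 (trans (form₁ s) ea)
    finish : ∀ k → core start ≡ core (run (suc k)) → ∃₂ λ x y → 0 < y × x * x ≡ suc (D * (y * y))
    finish k e = conclude (run (suc k)) (sym (cong proj₁ e)) (sym (cong (proj₁ ∘ proj₂) e))
    repeated : (∃₂ λ i j → i Fin.< j × code (run (Fin.toℕ i)) ≡ code (run (Fin.toℕ j))) → ∃₂ λ x y → 0 < y × x * x ≡ suc (D * (y * y))
    repeated (i , j , i<j , e) = finish (proj₁ gap) (return (Fin.toℕ i) (suc (proj₁ gap))
      (trans (code⇒core (run (Fin.toℕ i)) (run (Fin.toℕ j)) e) (cong (λ n → core (run n)) (trans (sym (proj₂ gap)) (sym (+-suc _ (proj₁ gap)))))))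
      where
      gap = m≤n⇒∃[o]m+o≡n i<j

abstract
  pell-exists : ∀ D → ¬ IsSquare D → ∃₂ λ x y → 0 < y × x * x ≡ suc (D * (y * y))
  pell-exists D ¬sq = River.pell-solution D ¬sq

-- The Pell equation for D = α² − 1

≤-of-+ : ∀ {m n} k → n ≡ m + k → m ≤ n
≤-of-+ {m} k refl = m≤m+n m k

-- Congruences of natural numbers, also up to sign

Cong : ℕ → ℕ → ℕ → Set
Cong m a b = ∃₂ λ k l → a + k * m ≡ b + l * m

cong-refl : ∀ {m a} → Cong m a a
cong-refl = 0 , 0 , refl

cong-reflexive : ∀ {m a b} → a ≡ b → Cong m a b
cong-reflexive refl = cong-refl

cong-sym : ∀ {m a b} → Cong m a b → Cong m b a
cong-sym (k , l , e) = l , k , sym e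

cong-trans : ∀ {m a b c} → Cong m a b → Cong m b c → Cong m a c
cong-trans {m} {a} {b} {c} (k , l , e) (k′ , l′ , e′) = k + k′ , l′ + l ,
  trans (l₁ a k k′ m) (trans (cong (_+ k′ * m) e) (trans (l₂ b l k′ m) (trans (cong (_+ l * m) e′) (l₃ c l′ l m))))
  where
  l₁ : ∀ a k k′ m → a + (k + k′) * m ≡ (a + k * m) + k′ * m
  l₁ = solve-∀
  l₂ : ∀ b l k′ m → (b + l * m) + k′ * m ≡ (b + k′ * m) + l * m
  l₂ = solve-∀
  l₃ : ∀ c l′ l m → (c + l′ * m) + l * m ≡ c + (l′ + l) * m
  l₃ = solve-∀

cong-+ : ∀ {m a b c d} → Cong m a b → Cong m c d → Cong m (a + c) (b + d)
cong-+ {m} {a} {b} {c} {d} (k , l , e) (k′ , l′ , e′) = k + k′ , l + l′ ,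
  trans (l₁ a c k k′ m) (trans (cong₂ _+_ e e′) (sym (l₁ b d l l′ m)))
  where
  l₁ : ∀ a c k k′ m → a + c + (k + k′) * m ≡ (a + k * m) + (c + k′ * m)
  l₁ = solve-∀

cong-*ˡ : ∀ {m a b} c → Cong m a b → Cong m (c * a) (c * b)
cong-*ˡ {m} {a} {b} c (k , l , e) = c * k , c * l , trans (l₁ c a k m) (trans (cong (c *_) e) (sym (l₁ c b l m)))
  where
  l₁ : ∀ c a k m → c * a + c * k * m ≡ c * (a + k * m)
  l₁ = solve-∀

cong-* : ∀ {m a b c d} → Cong m a b → Cong m c d → Cong m (a * c) (b * d)
cong-* {m} {a} {b} {c} {d} p q =
  cong-trans (cong-*ˡ a q) (subst₂ (Cong m) (*-comm d a) (*-comm d b) (cong-*ˡ d p))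

cong-∣ : ∀ {m n a b} → n ∣ m → Cong m a b → Cong n a b
cong-∣ {m} {n} {a} {b} (divides q refl) (k , l , e) = k * q , l * q ,
  trans (cong (a ℕ.+_) (*-assoc k q n)) (trans e (cong (b ℕ.+_) (sym (*-assoc l q n))))

∣⇒cong-0 : ∀ {m a} → m ∣ a → Cong m a 0
∣⇒cong-0 (divides q refl) = 0 , q , +-identityʳ _

cong-0⇒∣ : ∀ {m a} → Cong m a 0 → m ∣ a
cong-0⇒∣ {m} {a} (k , l , e) = ∣m+n∣m⇒∣n (subst (m ∣_) (trans (sym e) (+-comm a (k * m))) (n∣m*n l)) (n∣m*n k)

cong-∣-resp : ∀ {m a b} → Cong m a b → m ∣ b → m ∣ a
cong-∣-resp p q = cong-0⇒∣ (cong-trans p (∣⇒cong-0 q))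

cong-+-cancelʳ : ∀ {m a b c d} → Cong m (a + c) (b + d) → Cong m c d → Cong m a b
cong-+-cancelʳ {m} {a} {b} {c} {d} (k , l , e) (k′ , l′ , e′) = k + l′ , l + k′ ,
  +-cancelʳ-≡ (c + k′ * m + d) _ _ (begin
    a + (k + l′) * m + (c + k′ * m + d)   ≡⟨ s₁ a c d k k′ l′ m ⟩
    (a + c + k * m) + (d + l′ * m) + k′ * m ≡⟨ cong₂ (λ u v → u + v + k′ * m) e (sym e′) ⟩
    (b + d + l * m) + (c + k′ * m) + k′ * m ≡⟨ s₂ b c d l k′ m ⟩
    b + (l + k′) * m + (c + k′ * m + d)   ∎)
  where
  open ≡-Reasoning
  s₁ : ∀ a c d k k′ l′ m → a + (k + l′) * m + (c + k′ * m + d) ≡ (a + c + k * m) + (d + l′ * m) + k′ * m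
  s₁ = solve-∀
  s₂ : ∀ b c d l k′ m → (b + d + l * m) + (c + k′ * m) + k′ * m ≡ b + (l + k′) * m + (c + k′ * m + d)
  s₂ = solve-∀

cong-small : ∀ {m a b} → Cong m a b → a < m → b < m → a ≡ b
cong-small {m} {a} {b} (k , l , e) a<m b<m with <-cmp k l
... | tri≈ _ refl _ = +-cancelʳ-≡ (k * m) a b e
... | tri< k<l _ _ = contradiction e (<⇒≢ (begin-strict
    a + k * m <⟨ +-monoˡ-< (k * m) a<m ⟩
    m + k * m ≤⟨ *-monoˡ-≤ m k<l ⟩
    l * m     ≤⟨ m≤n+m (l * m) b ⟩
    b + l * m ∎))
  where open ≤-Reasoning
... | tri> _ _ l<k = contradiction (sym e) (<⇒≢ (begin-strict
    b + l * m <⟨ +-monoˡ-< (l * m) b<m ⟩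
    m + l * m ≤⟨ *-monoˡ-≤ m l<k ⟩
    k * m     ≤⟨ m≤n+m (k * m) a ⟩
    a + k * m ∎))
  where open ≤-Reasoning

-- The second alternative is a ≡ -b. Integers are compared through their absolute values, so their
-- congruences survive only up to sign.
Cong± : ℕ → ℕ → ℕ → Set
Cong± m a b = Cong m a b ⊎ m ∣ a + b

cong±-sym : ∀ {m a b} → Cong± m a b → Cong± m b a
cong±-sym (inj₁ p) = inj₁ (cong-sym p)
cong±-sym {m} {a} {b} (inj₂ p) = inj₂ (subst (m ∣_) (+-comm a b) p)

cong±-trans : ∀ {m a b c} → Cong± m a b → Cong± m b c → Cong± m a c
cong±-trans (inj₁ p) (inj₁ q) = inj₁ (cong-trans p q)
cong±-trans {c = c} (inj₁ p) (inj₂ q) = inj₂ (cong-∣-resp (cong-+ p (cong-refl {a = c})) q)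
cong±-trans {a = a} (inj₂ p) (inj₁ q) = inj₂ (cong-∣-resp (cong-+ (cong-refl {a = a}) (cong-sym q)) p)
cong±-trans {m} {a} {b} {c} (inj₂ p) (inj₂ q) =
  inj₁ (cong-+-cancelʳ {c = b} {d = b} (cong-trans (∣⇒cong-0 p) (cong-sym (∣⇒cong-0 (subst (m ∣_) (+-comm b c) q)))) cong-refl)

cong±-∣ : ∀ {m n a b} → n ∣ m → Cong± m a b → Cong± n a b
cong±-∣ n∣m (inj₁ p) = inj₁ (cong-∣ n∣m p)
cong±-∣ n∣m (inj₂ p) = inj₂ (∣-trans n∣m p)

∣-small : ∀ {m a} → m ∣ a → a < m → a ≡ 0
∣-small {a = zero} _ _ = refl
∣-small {a = suc a} h p = contradiction (∣⇒≤ h) (<⇒≱ p)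

cong±-small : ∀ {m a b} → Cong± m a b → a + b < m → a ≡ b
cong±-small {m} {a} {b} (inj₁ p) h = cong-small p (≤-<-trans (m≤m+n a b) h) (≤-<-trans (m≤n+m b a) h)
cong±-small {m} {a} {b} (inj₂ p) h = trans (m+n≡0⇒m≡0 a e) (sym (m+n≡0⇒n≡0 a e))
  where e = ∣-small p h

cong±-half : ∀ {c a b} → Cong± (2 * c) a b → 0 < a → 0 < b → a ≤ c → b ≤ c → a ≡ b
cong±-half {c} {a} {b} h 0<a 0<b a≤c b≤c with m≤n⇒m<n∨m≡n a≤c
... | inj₁ a<c = cong±-small h (<-≤-trans (+-mono-<-≤ a<c b≤c) (≤-reflexive (cong (c ℕ.+_) (sym (+-identityʳ c)))))
... | inj₂ refl with m≤n⇒m<n∨m≡n b≤c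
...   | inj₂ refl = refl
...   | inj₁ b<c = cong±-small h (<-≤-trans (+-monoʳ-< c b<c) (≤-reflexive (cong (c ℕ.+_) (sym (+-identityʳ c)))))

-- The solutions (X a n , Y a n) of x² − (α² − 1) y² = 1 for α = 1 + a, so that α² − 1 = a (2 + a).
mutual
  X : ℕ → ℕ → ℕ
  X a zero = 1
  X a (suc n) = suc a * X a n + a * (2 + a) * Y a n

  Y : ℕ → ℕ → ℕ
  Y a zero = 0
  Y a (suc n) = X a n + suc a * Y a n

pell-XY : ∀ a n → X a n * X a n ≡ suc (a * (2 + a) * (Y a n * Y a n))
pell-XY a zero = cong suc (sym (*-zeroʳ (a * (2 + a))))
pell-XY a (suc n) = +-cancelʳ-≡ (X a n * X a n) _ _
  (trans (cong (X a (suc n) * X a (suc n) ℕ.+_) (pell-XY a n)) (l a (X a n) (Y a n)))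
  where
  l : ∀ a x y → (suc a * x + a * (2 + a) * y) * (suc a * x + a * (2 + a) * y) + suc (a * (2 + a) * (y * y))
    ≡ suc (a * (2 + a) * ((x + suc a * y) * (x + suc a * y))) + x * x
  l = solve-∀

mutual
  X-+ : ∀ a m n → X a (m + n) ≡ X a m * X a n + a * (2 + a) * (Y a m * Y a n)
  X-+ a zero n = l a (X a n)
    where
    l : ∀ a x → x ≡ 1 * x + a * (2 + a) * 0
    l = solve-∀
  X-+ a (suc m) n = trans (cong₂ (λ u v → suc a * u + a * (2 + a) * v) (X-+ a m n) (Y-+ a m n))
    (l a (X a m) (Y a m) (X a n) (Y a n))
    where
    l : ∀ a x y x′ y′ → suc a * (x * x′ + a * (2 + a) * (y * y′)) + a * (2 + a) * (x * y′ + y * x′)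
      ≡ (suc a * x + a * (2 + a) * y) * x′ + a * (2 + a) * ((x + suc a * y) * y′)
    l = solve-∀

  Y-+ : ∀ a m n → Y a (m + n) ≡ X a m * Y a n + Y a m * X a n
  Y-+ a zero n = l (Y a n)
    where
    l : ∀ y → y ≡ 1 * y + 0
    l = solve-∀
  Y-+ a (suc m) n = trans (cong₂ (λ u v → u + suc a * v) (X-+ a m n) (Y-+ a m n))
    (l a (X a m) (Y a m) (X a n) (Y a n))
    where
    l : ∀ a x y x′ y′ → x * x′ + a * (2 + a) * (y * y′) + suc a * (x * y′ + y * x′)
      ≡ (suc a * x + a * (2 + a) * y) * y′ + (x + suc a * y) * x′
    l = solve-∀

X>0 : ∀ a n → 0 < X a n
X>0 a zero = z<s
X>0 a (suc n) = ≤-trans (X>0 a n) (≤-trans (m≤m+n _ (a * X a n)) (m≤m+n _ (a * (2 + a) * Y a n)))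

Y-< : ∀ a n → Y a n < Y a (suc n)
Y-< a n = +-mono-≤ (X>0 a n) (m≤m+n (Y a n) (a * Y a n))

n≤Y : ∀ a n → n ≤ Y a n
n≤Y a zero = z≤n
n≤Y a (suc n) = ≤-<-trans (n≤Y a n) (Y-< a n)

Y-mono-≤ : ∀ a {m n} → m ≤ n → Y a m ≤ Y a n
Y-mono-≤ a {m} m≤n with m≤n⇒∃[o]m+o≡n m≤n
... | k , refl = go k
  where
  go : ∀ k → Y a m ≤ Y a (m + k)
  go zero = ≤-reflexive (cong (Y a) (sym (+-identityʳ m)))
  go (suc k) = ≤-trans (go k) (≤-trans (<⇒≤ (Y-< a (m + k))) (≤-reflexive (cong (Y a) (sym (+-suc m k)))))

Y-mono-< : ∀ a {m n} → m < n → Y a m < Y a n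
Y-mono-< a {m} m<n = <-≤-trans (Y-< a m) (Y-mono-≤ a m<n)

coprime-XY : ∀ a n → Coprime (X a n) (Y a n)
coprime-XY a n {e} (e∣x , e∣y) = ∣1⇒≡1 (∣m+n∣m⇒∣n
  (subst (e ∣_) (trans (pell-XY a n) (+-comm 1 _)) (∣m⇒∣m*n _ e∣x)) (∣n⇒∣m*n (a * (2 + a)) (∣m⇒∣m*n _ e∣y)))

Y∣Y* : ∀ a m k → Y a m ∣ Y a (m * k)
Y∣Y* a m zero = subst (Y a m ∣_) (cong (Y a) (sym (*-zeroʳ m))) (Y a m ∣0)
Y∣Y* a m (suc k) = subst (Y a m ∣_) (sym (trans (cong (Y a) (*-suc m k)) (Y-+ a m (m * k))))
  (∣m∣n⇒∣m+n (∣n⇒∣m*n (X a m) (Y∣Y* a m k)) (∣m⇒∣m*n _ ∣-refl))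

-- With x = X a m and y = Y a m, expand (x + y √D)ᵏ = xᵏ + k xᵏ⁻¹ y √D + ... modulo y². The first
-- congruence is multiplied by x to avoid the exponent k - 1.
Y-*-cong : ∀ a m k → Cong (Y a m * Y a m) (X a m * Y a (m * k)) (k * (Y a m * X a m ^ k))
                   × Cong (Y a m * Y a m) (X a (m * k)) (X a m ^ k)
Y-*-cong a m zero = cong-reflexive (trans (cong (λ z → X a m * Y a z) (*-zeroʳ m)) (*-zeroʳ (X a m)))
                  , cong-reflexive (cong (X a) (*-zeroʳ m))
Y-*-cong a m (suc k) with Y-*-cong a m k
... | py , px = subst (λ z → Cong yy z (suc k * (y * (x * x ^ k)))) (sym e₁)
                  (subst (Cong yy _) (l₂ x (x ^ k) y k) (cong-+ (cong-*ˡ x py) (cong-*ˡ (x * y) px)))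
              , subst (λ z → Cong yy z (x * x ^ k)) (sym e₂)
                  (subst (Cong yy _) (+-identityʳ _) (cong-+ (cong-*ˡ x px) (∣⇒cong-0 yy∣)))
  where
  x = X a m
  y = Y a m
  yy = y * y
  l₁ : ∀ x y x′ y′ → x * (x * y′ + y * x′) ≡ x * (x * y′) + x * y * x′
  l₁ = solve-∀
  l₂ : ∀ x xk y k → x * (k * (y * xk)) + x * y * xk ≡ suc k * (y * (x * xk))
  l₂ = solve-∀
  e₁ : x * Y a (m * suc k) ≡ x * (x * Y a (m * k)) + x * y * X a (m * k)
  e₁ = trans (cong (λ z → x * Y a z) (*-suc m k)) (trans (cong (x *_) (Y-+ a m (m * k))) (l₁ x y (X a (m * k)) (Y a (m * k))))
  e₂ : X a (m * suc k) ≡ x * X a (m * k) + a * (2 + a) * (y * Y a (m * k))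
  e₂ = trans (cong (X a) (*-suc m k)) (X-+ a m (m * k))
  yy∣ : yy ∣ a * (2 + a) * (y * Y a (m * k))
  yy∣ = ∣n⇒∣m*n (a * (2 + a)) (*-monoʳ-∣ y (Y∣Y* a m k))

coprime-^ʳ : ∀ {a b} k → Coprime a b → Coprime a (b ^ k)
coprime-^ʳ zero h = Coprime.sym (Coprime.1-coprimeTo _)
coprime-^ʳ (suc k) h = coprime-*ʳ h (coprime-^ʳ k h)

-- Write n = m q + r with r < m. In the addition formula for Y a n, the number Y a m divides Y a (m
-- q) and is coprime to X a (m q), so it divides Y a r, which is smaller.
Y-∣⇒∣ : ∀ a m n → 0 < m → Y a m ∣ Y a n → m ∣ n
Y-∣⇒∣ a m@(suc _) n _ h = m%n≡0⇒n∣m n m (r≡0 (n % m) (m%n<n n m) e)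
  where
  q = n / m
  e : n ≡ m * q + n % m
  e = trans (m≡m%n+[m/n]*n n m) (trans (+-comm (n % m) (q * m)) (cong (_+ n % m) (*-comm q m)))
  r≡0 : ∀ r → r < m → n ≡ m * q + r → r ≡ 0
  r≡0 zero _ _ = refl
  r≡0 r@(suc _) r<m e = contradiction (∣⇒≤ ⦃ >-nonZero (≤-trans z<s (n≤Y a r)) ⦄ ym∣yr) (<⇒≱ (Y-mono-< a r<m))
    where
    h′ : Y a m ∣ Y a (m * q) * X a r + X a (m * q) * Y a r
    h′ = subst (Y a m ∣_) (trans (cong (Y a) e) (trans (Y-+ a (m * q) r) (+-comm (X a (m * q) * Y a r) _))) h
    cop : Coprime (Y a m) (X a (m * q))
    cop (d∣y , d∣x) = coprime-XY a (m * q) (d∣x , ∣-trans d∣y (Y∣Y* a m q))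
    ym∣yr : Y a m ∣ Y a r
    ym∣yr = coprime-divisor cop (∣m+n∣m⇒∣n h′ (∣m⇒∣m*n _ (Y∣Y* a m q)))

-- Here n = k m. Modulo y² the number x · Y a n is k y xᵏ, so y divides k xᵏ, and x is coprime to y.
Y²-∣⇒∣ : ∀ a m n → 0 < m → Y a m * Y a m ∣ Y a n → Y a m ∣ n
Y²-∣⇒∣ a m n 0<m h with Y-∣⇒∣ a m n 0<m (∣-trans (m∣m*n (Y a m)) h)
... | divides k refl = ∣m⇒∣m*n m ym∣k
  where
  instance
    nz : NonZero (Y a m)
    nz = >-nonZero (≤-trans 0<m (n≤Y a m))
  h′ : Y a m * Y a m ∣ Y a m * (X a m ^ k * k)
  h′ = subst (Y a m * Y a m ∣_) (l k (Y a m) (X a m ^ k))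
         (cong-∣-resp (cong-sym (proj₁ (Y-*-cong a m k))) (∣n⇒∣m*n (X a m) (subst (λ z → Y a m * Y a m ∣ Y a z) (*-comm k m) h)))
    where
    l : ∀ k y x → k * (y * x) ≡ y * (x * k)
    l = solve-∀
  ym∣k : Y a m ∣ k
  ym∣k = coprime-divisor (coprime-^ʳ k (Coprime.sym (coprime-XY a m))) (*-cancelˡ-∣ (Y a m) h′)

X-mod : ∀ a n → Cong a (X a n) 1
X-mod a zero = cong-refl
X-mod a (suc n) with X-mod a n
... | p = cong-trans (0 , X a n + (2 + a) * Y a n , l a (X a n) (Y a n)) p
  where
  l : ∀ a x y → suc a * x + a * (2 + a) * y + 0 * a ≡ x + (x + (2 + a) * y) * a
  l = solve-∀

Y-mod : ∀ a n → Cong a (Y a n) n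
Y-mod a zero = cong-refl
Y-mod a (suc n) = cong-+ (X-mod a n) (cong-trans (0 , Y a n , l a (Y a n)) (Y-mod a n))
  where
  l : ∀ a y → suc a * y + 0 * a ≡ y + y * a
  l = solve-∀

XY-cong : ∀ {m a b} → Cong m a b → ∀ n → Cong m (X a n) (X b n) × Cong m (Y a n) (Y b n)
XY-cong p zero = cong-refl , cong-refl
XY-cong {m} {a} {b} p (suc n) with XY-cong p n
... | px , py = cong-+ (cong-* p′ px) (cong-* (cong-* p (cong-+ (cong-refl {a = 2}) p)) py) , cong-+ px (cong-* p′ py)
  where
  p′ : Cong m (suc a) (suc b)
  p′ = cong-+ (cong-refl {a = 1}) p

-- Modulo X a q one has X a (2q) ≡ -1 and Y a (2q) ≡ 0, so a shift of the index by 2q changes the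
-- sign of Y.
Y-2q+ : ∀ a q r → X a q ∣ Y a (q + q + r) + Y a r
Y-2q+ a q r = divides (2 * X a q * Y a r + 2 * Y a q * X a r) (begin
    Y a (q + q + r) + Y a r
      ≡⟨ cong (_+ Y a r) (trans (Y-+ a (q + q) r) (cong₂ (λ u v → u * Y a r + v * X a r) (X-+ a q q) (Y-+ a q q))) ⟩
    (x * x + a * (2 + a) * (y * y)) * Y a r + (x * y + y * x) * X a r + Y a r
      ≡⟨ l a x y (X a r) (Y a r) ⟩
    (x * x + suc (a * (2 + a) * (y * y))) * Y a r + 2 * y * X a r * x
      ≡⟨ cong (λ z → (x * x + z) * Y a r + 2 * y * X a r * x) (sym (pell-XY a q)) ⟩
    (x * x + x * x) * Y a r + 2 * y * X a r * x
      ≡⟨ l₂ x y (X a r) (Y a r) ⟩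
    (2 * x * Y a r + 2 * y * X a r) * x ∎)
  where
  open ≡-Reasoning
  x = X a q
  y = Y a q
  l : ∀ a x y x′ y′ → (x * x + a * (2 + a) * (y * y)) * y′ + (x * y + y * x) * x′ + y′
    ≡ (x * x + suc (a * (2 + a) * (y * y))) * y′ + 2 * y * x′ * x
  l = solve-∀
  l₂ : ∀ x y x′ y′ → (x * x + x * x) * y′ + 2 * y * x′ * x ≡ (2 * x * y′ + 2 * y * x′) * x
  l₂ = solve-∀

-- With q = p + s this is the symmetry of Y modulo X a q under reflection of the index in q: q + s
-- and q - s give the same value.
Y-reflect : ∀ a p s → Cong (X a (p + s)) (Y a (p + s + s)) (Y a p)
Y-reflect a p s = 0 , 2 * Y a s , +-cancelʳ-≡ (a * (2 + a) * (Y a s * Y a s) * y) _ _ (begin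
    Y a (p + s + s) + 0 * X a (p + s) + e
      ≡⟨ cong (λ z → z + 0 * X a (p + s) + e) (Y-+ a (p + s) s) ⟩
    X a (p + s) * Y a s + Y a (p + s) * X a s + 0 * X a (p + s) + e
      ≡⟨ cong₂ (λ u v → u * Y a s + v * X a s + 0 * u + e) (X-+ a p s) (Y-+ a p s) ⟩
    (x * X a s + d * (y * Y a s)) * Y a s + (x * Y a s + y * X a s) * X a s + 0 * (x * X a s + d * (y * Y a s)) + e
      ≡⟨ l d x y (X a s) (Y a s) ⟩
    y * (X a s * X a s) + 2 * Y a s * (x * X a s + d * (y * Y a s))
      ≡⟨ cong₂ (λ u v → y * u + 2 * Y a s * v) (pell-XY a s) (sym (X-+ a p s)) ⟩
    y * suc (d * (Y a s * Y a s)) + 2 * Y a s * X a (p + s)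
      ≡⟨ l₂ d y (Y a s) (X a (p + s)) ⟩
    y + 2 * Y a s * X a (p + s) + e ∎)
  where
  open ≡-Reasoning
  x = X a p
  y = Y a p
  d = a * (2 + a)
  e = a * (2 + a) * (Y a s * Y a s) * y
  l : ∀ d x y x′ y′ → (x * x′ + d * (y * y′)) * y′ + (x * y′ + y * x′) * x′ + 0 * (x * x′ + d * (y * y′)) + d * (y′ * y′) * y
    ≡ y * (x′ * x′) + 2 * y′ * (x * x′ + d * (y * y′))
  l = solve-∀
  l₂ : ∀ d y y′ z → y * suc (d * (y′ * y′)) + 2 * y′ * z ≡ y + 2 * y′ * z + d * (y′ * y′) * y
  l₂ = solve-∀

-- The shift by 2q and the reflection in q change both the index modulo 2q and the value modulo X a
-- q at most by a sign. Together they bring every index down to at most q.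
Y-reduce : ∀ a q → 0 < q → ∀ r → ∃ λ r₀ → r₀ ≤ q × Cong± (2 * q) r r₀ × Cong± (X a q) (Y a r) (Y a r₀)
Y-reduce a q 0<q = <-rec _ go
  where
  go : ∀ r → (∀ {r′} → r′ < r → ∃ λ r₀ → r₀ ≤ q × Cong± (2 * q) r′ r₀ × Cong± (X a q) (Y a r′) (Y a r₀))
     → ∃ λ r₀ → r₀ ≤ q × Cong± (2 * q) r r₀ × Cong± (X a q) (Y a r) (Y a r₀)
  go r rec with r ≤? q
  ... | yes r≤q = r , r≤q , inj₁ cong-refl , inj₁ cong-refl
  ... | no r≰q with m≤n⇒∃[o]m+o≡n (<⇒≤ (≰⇒> r≰q))
  ...   | s , refl with s ≤? q
  ...     | yes s≤q with m≤n⇒∃[o]m+o≡n s≤q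
  ...       | p , refl = p , m≤n+m p s , inj₂ (divides 1 (l s p))
              , inj₁ (subst (λ z → Cong (X a z) (Y a (z + s)) (Y a p)) (+-comm p s) (Y-reflect a p s))
    where
    l : ∀ s p → s + p + s + p ≡ 1 * (2 * (s + p))
    l = solve-∀
  go r rec | no r≰q | s , refl | no s≰q with m≤n⇒∃[o]m+o≡n (<⇒≤ (≰⇒> s≰q))
  ...       | t , refl with rec {t} (<-≤-trans (m<n+m t 0<q) (m≤n+m (q + t) q))
  ...         | r₀ , r₀≤q , p , p′ = r₀ , r₀≤q
              , cong±-trans (inj₁ (0 , 1 , l q t)) p
              , cong±-trans (inj₂ (subst (λ z → X a q ∣ Y a z + Y a t) (+-assoc q q t) (Y-2q+ a q t))) p′
    where
    l : ∀ q t → q + (q + t) + 0 * (2 * q) ≡ t + 1 * (2 * q)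
    l = solve-∀

-- Every solution with t > 0 has the form s = a t + u, t = u + v, u = a v + w, where (w , v) is a smaller solution.
module PellDescent (a : ℕ) where

  Pell : ℕ → ℕ → Set
  Pell s t = s * s ≡ suc (a * (2 + a) * (t * t))

  s-above : ∀ {s t} → Pell s t → a * t < s
  s-above {s} {t} e = sq-cancel-< (≤-trans (m<m+n _ z<s) (≤-reflexive (trans (sym (l a t)) (sym e))))
    where
    l : ∀ a t → suc (a * (2 + a) * (t * t)) ≡ a * t * (a * t) + suc (2 * a * (t * t))
    l = solve-∀

  s-below : ∀ {s t} → 0 < t → Pell s t → s ≤ suc a * t
  s-below {s} {t@(suc t′)} _ e = sq-cancel-≤ (≤-trans (≤-reflexive e) (≤-trans (s≤s (m≤m+n _ (t′ + t′ * t))) (≤-reflexive (l a t′))))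
    where
    l : ∀ a t′ → suc (a * (2 + a) * (suc t′ * suc t′) + (t′ + t′ * suc t′)) ≡ suc a * suc t′ * (suc a * suc t′)
    l = solve-∀

  u-above : ∀ {u v} → 0 < u → Pell (a * (u + v) + u) (u + v) → a * v ≤ u
  u-above {u@(suc _)} {v} _ e = *-cancelʳ-≤ (a * v) u u (≤-trans (m≤m+n (a * v * u) (suc (a * v * u + 2 * a * v * v))) (≤-reflexive (trans (l a v u) (sym uu))))
    where
    l₁ : ∀ a u v → u * u + (a * a * (u + v) * (u + v) + 2 * a * u * (u + v)) ≡ (a * (u + v) + u) * (a * (u + v) + u)
    l₁ = solve-∀
    l₂ : ∀ a u v → suc (a * (2 + a) * ((u + v) * (u + v))) ≡ suc (2 * a * v * (u + v)) + (a * a * (u + v) * (u + v) + 2 * a * u * (u + v))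
    l₂ = solve-∀
    uu : u * u ≡ suc (2 * a * v * (u + v))
    uu = +-cancelʳ-≡ (a * a * (u + v) * (u + v) + 2 * a * u * (u + v)) _ _ (trans (l₁ a u v) (trans e (l₂ a u v)))
    l : ∀ a v u → a * v * u + suc (a * v * u + 2 * a * v * v) ≡ suc (2 * a * v * (u + v))
    l = solve-∀

  predecessor : ∀ {v w} → Pell (a * (a * v + w + v) + (a * v + w)) (a * v + w + v) → Pell w v
  predecessor {v} {w} e = +-cancelʳ-≡ (a * (2 + a) * ((a * v + w + v) * (a * v + w + v))) _ _
    (trans (l a v w) (trans (cong (_+ a * (2 + a) * (v * v)) e) (cong suc (+-comm (a * (2 + a) * ((a * v + w + v) * (a * v + w + v))) _))))
    where
    l : ∀ a v w → w * w + a * (2 + a) * ((a * v + w + v) * (a * v + w + v))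
      ≡ (a * (a * v + w + v) + (a * v + w)) * (a * (a * v + w + v) + (a * v + w)) + a * (2 + a) * (v * v)
    l = solve-∀

  descend : ∀ {t s} → 0 < t → Pell s t → ∃₂ λ v w → v < t × Pell w v × t ≡ w + suc a * v × s ≡ suc a * w + a * (2 + a) * v
  descend {t} {s} 0<t e = split-s (m≤n⇒∃[o]m+o≡n (<⇒≤ (s-above e)))
    where
    Goal = ∃₂ λ v w → v < t × Pell w v × t ≡ w + suc a * v × s ≡ suc a * w + a * (2 + a) * v
    l₁ : ∀ a v w → a * v + w + v ≡ w + suc a * v
    l₁ = solve-∀
    l₂ : ∀ a v w → a * (a * v + w + v) + (a * v + w) ≡ suc a * w + a * (2 + a) * v
    l₂ = solve-∀
    split-u : ∀ {u v} → 0 < u → u + v ≡ t → a * t + u ≡ s → (∃ λ w → a * v + w ≡ u) → Goal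
    split-u {v = v} 0<u refl refl (w , refl) = v , w , m<n+m v 0<u , predecessor {v} {w} e , l₁ a v w , l₂ a v w
    split-t : ∀ {u} → 0 < u → a * t + u ≡ s → (∃ λ v → u + v ≡ t) → Goal
    split-t {u} 0<u es (v , et) = split-u 0<u et es
      (m≤n⇒∃[o]m+o≡n (u-above 0<u (subst₂ Pell (trans (sym es) (cong (λ z → a * z + u) (sym et))) (sym et) e)))
    split-s : (∃ λ u → a * t + u ≡ s) → Goal
    split-s (u , es) = split-t
      (+-cancelˡ-< (a * t) 0 u (≤-trans (≤-reflexive (cong suc (+-identityʳ (a * t)))) (≤-trans (s-above e) (≤-reflexive (sym es))))) es
      (m≤n⇒∃[o]m+o≡n (+-cancelˡ-≤ (a * t) u t (≤-trans (≤-reflexive es) (≤-trans (s-below 0<t e) (≤-reflexive (+-comm t (a * t)))))))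

pell-classify : ∀ a t s → s * s ≡ suc (a * (2 + a) * (t * t)) → ∃ λ n → t ≡ Y a n × s ≡ X a n
pell-classify a = <-rec _ classify
  where
  open PellDescent a
  classify : ∀ t → (∀ {v} → v < t → ∀ s → Pell s v → ∃ λ n → v ≡ Y a n × s ≡ X a n) → ∀ s → Pell s t → ∃ λ n → t ≡ Y a n × s ≡ X a n
  classify zero rec s e = 0 , refl , sq-injective (trans e (cong suc (*-zeroʳ (a * (2 + a)))))
  classify t@(suc _) rec s e = from-predecessor (descend z<s e)
    where
    from-predecessor : (∃₂ λ v w → v < t × Pell w v × t ≡ w + suc a * v × s ≡ suc a * w + a * (2 + a) * v) → ∃ λ n → t ≡ Y a n × s ≡ X a n
    from-predecessor (v , w , v<t , p , et , es) = let n , ev , ew = rec v<t w p in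
      suc n , trans et (cong₂ (λ v w → w + suc a * v) ev ew) , trans es (cong₂ (λ v w → suc a * w + a * (2 + a) * v) ev ew)

aY≤X : ∀ a n → a * Y a n ≤ X a n
aY≤X a n = sq-cancel-≤ (≤-trans (≤-of-+ (suc (2 * a * (Y a n * Y a n))) (l a (Y a n))) (≤-reflexive (sym (pell-XY a n))))
  where
  l : ∀ a y → suc (a * (2 + a) * (y * y)) ≡ a * y * (a * y) + suc (2 * a * (y * y))
  l = solve-∀

X≤αY : ∀ a n → X a (suc n) ≤ suc a * Y a (suc n)
X≤αY a n = bound (≤-trans (s≤s z≤n) (n≤Y a (suc n))) (pell-XY a (suc n))
  where
  l : ∀ a y → suc a * suc y * (suc a * suc y) ≡ suc (a * (2 + a) * (suc y * suc y)) + (y + y * suc y)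
  l = solve-∀
  bound : ∀ {x y} → 0 < y → x * x ≡ suc (a * (2 + a) * (y * y)) → x ≤ suc a * y
  bound {y = suc y} _ e = sq-cancel-≤ (≤-trans (≤-reflexive e) (≤-of-+ (y + y * suc y) (l a y)))

Y-lower : ∀ a n → suc (2 * a) ^ n ≤ Y a (suc n)
Y-lower a zero = s≤s z≤n
Y-lower a (suc n) = begin
  suc (2 * a) * suc (2 * a) ^ n    ≤⟨ *-monoʳ-≤ (suc (2 * a)) (Y-lower a n) ⟩
  suc (2 * a) * Y a (suc n)        ≡⟨ l a (Y a (suc n)) ⟩
  a * Y a (suc n) + suc a * Y a (suc n) ≤⟨ +-monoˡ-≤ _ (aY≤X a (suc n)) ⟩
  Y a (2 + n) ∎
  where
  open ≤-Reasoning
  l : ∀ a y → suc (2 * a) * y ≡ a * y + suc a * y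
  l = solve-∀

Y-upper : ∀ a n → Y a (suc n) ≤ (2 * suc a) ^ n
Y-upper a zero = ≤-reflexive (cong suc (*-zeroʳ a))
Y-upper a (suc n) = begin
  Y a (2 + n)  ≤⟨ +-monoˡ-≤ _ (X≤αY a n) ⟩
  suc a * Y a (suc n) + suc a * Y a (suc n) ≡⟨ l a (Y a (suc n)) ⟩
  2 * suc a * Y a (suc n) ≤⟨ *-monoʳ-≤ (2 * suc a) (Y-upper a n) ⟩
  (2 * suc a) ^ suc n ∎
  where
  open ≤-Reasoning
  l : ∀ a y → suc a * y + suc a * y ≡ 2 * suc a * y
  l = solve-∀

Y-rec : ∀ a n → Y a (2 + n) + Y a n ≡ 2 * suc a * Y a (suc n)
Y-rec a n = l a (X a n) (Y a n)
  where
  l : ∀ a x y → suc a * x + a * (2 + a) * y + suc a * (x + suc a * y) + y ≡ 2 * suc a * (x + suc a * y)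
  l = solve-∀

-- Modulo 2A − 5 with A = 2 α the recurrence has the roots 2 and 1/2.
2^-Y-cong : ∀ a m → 4 * a ≡ suc m → ∀ n → Cong m (3 * (2 ^ n * Y a n) + 2) (2 * 4 ^ n)
2^-Y-cong a m e n = proj₁ (go n)
  where
  go : ∀ n → Cong m (3 * (2 ^ n * Y a n) + 2) (2 * 4 ^ n) × Cong m (3 * (2 ^ suc n * Y a (suc n)) + 2) (2 * 4 ^ suc n)
  go zero = cong-refl , cong-reflexive (l a)
    where
    l : ∀ a → 3 * (2 * 1 * (1 + suc a * 0)) + 2 ≡ 2 * (4 * 1)
    l = solve-∀
  go (suc n) with go n
  ... | p , q = q , cong-+-cancelʳ {c = 4 * (3 * t + 2)} {d = 4 * (2 * 4 ^ n)} r (cong-*ˡ 4 p)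
    where
    t = 2 ^ n * Y a n
    -- For uₙ = 2ⁿ Y a n the recurrence reads uₙ₊₂ + 4 uₙ = 4α uₙ₊₁, and 4α = m + 5. The right-hand
    -- sides 2 · 4ⁿ obey the same law because 16 + 4 = 5 · 4.
    r : Cong m (3 * (2 ^ (2 + n) * Y a (2 + n)) + 2 + 4 * (3 * t + 2)) (2 * 4 ^ (2 + n) + 4 * (2 * 4 ^ n))
    r = subst₂ (Cong m) (sym lhs) (l₄ (4 ^ n)) (cong-trans (0 , 3 * (2 * 2 ^ n * Y a (suc n)) , l₃) (cong-*ˡ 5 q))
      where
      l₁ : ∀ p y₂ y → 3 * (2 * (2 * p) * y₂) + 2 + 4 * (3 * (p * y) + 2) ≡ 12 * p * (y₂ + y) + 10
      l₁ = solve-∀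
      l₂ : ∀ a p y → 12 * p * (2 * suc a * y) + 10 ≡ 3 * (2 * p * y) * (4 * a + 4) + 10
      l₂ = solve-∀
      l₅ : ∀ m p y → 3 * (2 * p * y) * (suc m + 4) + 10 + 0 * m ≡ 5 * (3 * (2 * p * y) + 2) + 3 * (2 * p * y) * m
      l₅ = solve-∀
      l₃ = l₅ m (2 ^ n) (Y a (suc n))
      lhs : 3 * (2 ^ (2 + n) * Y a (2 + n)) + 2 + 4 * (3 * t + 2) ≡ 3 * (2 * 2 ^ n * Y a (suc n)) * (suc m + 4) + 10
      lhs = trans (l₁ (2 ^ n) (Y a (2 + n)) (Y a n)) (trans (cong (λ z → 12 * 2 ^ n * z + 10) (Y-rec a n))
              (trans (l₂ a (2 ^ n) (Y a (suc n))) (cong (λ z → 3 * (2 * 2 ^ n * Y a (suc n)) * (z + 4) + 10) e)))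
      l₄ : ∀ f → 5 * (2 * (4 * f)) ≡ 2 * (4 * (4 * f)) + 4 * (2 * f)
      l₄ = solve-∀

-- Matiyasevich and Robinson's criterion, with F = f² and I = i².
Y-criterion : ∀ {a c B E f G′ h i} → 2 ≤ a → 0 < B → B ≤ c → 0 < E → c * c ∣ E
  → f * f ≡ suc (a * (2 + a) * (E * E)) → i * i ≡ suc (G′ * (2 + G′) * (h * h))
  → Cong f G′ a → 2 * c ∣ G′ → Cong± f h c → Cong± (2 * c) h B → c ≡ Y a B
Y-criterion {a} {c} {B} {E} {f} {G′} {h} {i} 2≤a 0<B B≤c 0<E cc∣E ef ei G≡α G≡1 h≡c h≡B
  with pell-classify a E f ef | pell-classify G′ h i ei
... | q , refl , refl | r , refl , refl with Y-reduce a q (n≢0⇒n>0 (λ { refl → <-irrefl refl 0<E })) r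
...   | r₀ , r₀≤q , r≡r₀ , y≡y₀ = trans c≡ (cong (Y a) r₀≡B)
  where
  instance
    nzE : NonZero (Y a q)
    nzE = >-nonZero 0<E
  0<c : 0 < c
  0<c = <-≤-trans 0<B B≤c
  c≤E : c ≤ Y a q
  c≤E = ≤-trans (m≤m*n c c ⦃ >-nonZero 0<c ⦄) (∣⇒≤ cc∣E)
  small : c + Y a r₀ < X a q
  small = ≤-<-trans (+-mono-≤ c≤E (≤-trans (Y-mono-≤ a r₀≤q) (≤-reflexive (sym (+-identityʳ _)))))
    (sq-cancel-< (<-≤-trans (s≤s (≤-trans (≤-reflexive (l (Y a q))) (*-monoˡ-≤ (Y a q * Y a q) (*-mono-≤ {x = 1} {y = a} {u = 4} (≤-trans (s≤s z≤n) 2≤a) (+-monoʳ-≤ 2 2≤a))))) (≤-reflexive (sym (pell-XY a q)))))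
    where
    l : ∀ y → 2 * y * (2 * y) ≡ 4 * (y * y)
    l = solve-∀
  -- Modulo X a q the chain is ±c ≡ h = Y G′ r ≡ Y a r ≡ ±Y a r₀. Both ends are at most Y a q, and 2
  -- Y a q < X a q, so they are equal.
  c≡ : c ≡ Y a r₀
  c≡ = cong±-small (cong±-trans (cong±-sym h≡c) (cong±-trans (inj₁ (proj₂ (XY-cong G≡α r))) y≡y₀)) small
  0<r₀ : 0 < r₀
  0<r₀ = n≢0⇒n>0 (λ { refl → <-irrefl (sym c≡) 0<c })
  c∣q : c ∣ q
  c∣q = subst (_∣ q) (sym c≡) (Y²-∣⇒∣ a r₀ q 0<r₀ (subst (_∣ Y a q) (cong₂ _*_ c≡ c≡) cc∣E))
  -- h = Y G′ r ≡ r modulo G′, hence modulo 2c. As c divides q, the congruence r ≡ ±r₀ modulo 2q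
  -- also holds modulo 2c. Both B and r₀ are at most c.
  B≡r₀ : B ≡ r₀
  B≡r₀ = cong±-half (cong±-trans (cong±-sym h≡B) (cong±-trans (inj₁ (cong-∣ G≡1 (Y-mod G′ r))) (cong±-∣ (*-monoʳ-∣ 2 c∣q) r≡r₀)))
    0<B 0<r₀ B≤c (≤-trans (n≤Y a r₀) (≤-reflexive (sym c≡)))
  r₀≡B : r₀ ≡ B
  r₀≡B = sym B≡r₀

-- Binary digit sums and Kummer’s theorem

σ-fuel : ℕ → ℕ → ℕ
σ-fuel zero n = 0
σ-fuel (suc f) n with even⊎odd n
... | inj₁ (k , _) = σ-fuel f k
... | inj₂ (k , _) = suc (σ-fuel f k)

private
  half-≤ : ∀ k f → 2 * k ≤ suc f → k ≤ f
  half-≤ zero f _ = z≤n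
  half-≤ (suc k) f (s≤s h) = ≤-trans (≤-trans (s≤s (m≤m+n k (k + 0))) (≤-reflexive (sym (+-suc k (k + 0))))) h

  σ-fuel-≡ : ∀ f g n → n ≤ f → n ≤ g → σ-fuel f n ≡ σ-fuel g n
  σ-fuel-0 : ∀ g → σ-fuel g 0 ≡ 0
  σ-fuel-0 zero = refl
  σ-fuel-0 (suc g) = σ-fuel-0 g
  σ-fuel-≡ zero g zero _ _ = sym (σ-fuel-0 g)
  σ-fuel-≡ (suc f) zero zero _ _ = σ-fuel-0 f
  σ-fuel-≡ (suc f) (suc g) n p q with even⊎odd n
  ... | inj₁ (k , refl) = σ-fuel-≡ f g k (half-≤ k f p) (half-≤ k g q)
  ... | inj₂ (k , refl) = cong suc (σ-fuel-≡ f g k (≤-trans (m≤m+n k (k + 0)) (≤-pred p)) (≤-trans (m≤m+n k (k + 0)) (≤-pred q)))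

  2*-injective : ∀ {k l} → 2 * k ≡ 2 * l → k ≡ l
  2*-injective {k} {l} = *-cancelˡ-≡ k l 2


abstract
  -- The number of ones in the binary expansion. Opaque from here on, so that it is determined by
  -- `σ-0`, `σ-even` and `σ-odd` and no longer by the recursion on fuel.
  σ : ℕ → ℕ
  σ n = σ-fuel n n

  σ-0 : σ 0 ≡ 0
  σ-0 = refl

  σ-even : ∀ k → σ (2 * k) ≡ σ k
  σ-even zero = refl
  σ-even k@(suc k′) with even⊎odd (2 * k)
  ... | inj₁ (l , e) with 2*-injective {k} {l} e
  ...   | refl = σ-fuel-≡ _ _ k (≤-trans (s≤s (m≤m+n k′ (k′ + 0))) (≤-reflexive (sym (+-suc k′ (k′ + 0))))) ≤-refl
  σ-even k@(suc _) | inj₂ (l , e) = contradiction e (even≢odd k l)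

  σ-odd : ∀ k → σ (suc (2 * k)) ≡ suc (σ k)
  σ-odd k with even⊎odd (suc (2 * k))
  ... | inj₁ (l , e) = contradiction (sym e) (even≢odd l k)
  ... | inj₂ (l , e) with 2*-injective {k} {l} (suc-injective e)
  ...   | refl = cong suc (σ-fuel-≡ _ _ k (m≤m+n k (k + 0)) ≤-refl)

private
  half-< : ∀ {k} → k ≢ 0 → k < 2 * k
  half-< {zero} h = ⊥-elim (h refl)
  half-< {suc k} _ = s≤s (≤-trans (s≤s (m≤m+n k (k + 0))) (≤-reflexive (sym (+-suc k (k + 0)))))

σ>0 : ∀ n → 0 < n → 0 < σ n
σ>0 = <-rec _ go
  where
  go : ∀ n → (∀ {m} → m < n → 0 < m → 0 < σ m) → 0 < n → 0 < σ n
  go n rec 0<n with even⊎odd n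
  ... | inj₂ (k , refl) = subst (0 <_) (sym (σ-odd k)) z<s
  ... | inj₁ (zero , refl) = contradiction 0<n (<-irrefl refl)
  ... | inj₁ (k@(suc _) , refl) = subst (0 <_) (sym (σ-even k)) (rec (half-< {k} (λ ())) z<s)

σ-suc : ∀ n → σ (suc n) ≤ suc (σ n)
σ-suc = <-rec _ go
  where
  go : ∀ n → (∀ {m} → m < n → σ (suc m) ≤ suc (σ m)) → σ (suc n) ≤ suc (σ n)
  go n rec with even⊎odd n
  ... | inj₁ (k , refl) = ≤-reflexive (trans (σ-odd k) (cong suc (sym (σ-even k))))
  ... | inj₂ (k , refl) = subst₂ _≤_ (trans (sym (σ-even (suc k))) (cong σ (l k))) (cong suc (sym (σ-odd k)))
                            (m≤n⇒m≤1+n (rec {k} (s≤s (m≤m+n k (k + 0)))))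
    where
    l : ∀ k → 2 * suc k ≡ suc (suc (2 * k))
    l = solve-∀

σ-+-≤ : ∀ a b → σ (a + b) ≤ σ a + σ b
σ-+-≤ = <-rec _ go
  where
  go : ∀ a → (∀ {a′} → a′ < a → ∀ b → σ (a′ + b) ≤ σ a′ + σ b) → ∀ b → σ (a + b) ≤ σ a + σ b
  go a rec b with even⊎odd a | even⊎odd b
  ... | inj₁ (zero , refl) | _ = ≤-reflexive (cong (_+ σ b) (sym σ-0))
  ... | inj₁ (k@(suc _) , refl) | inj₁ (l , refl) = begin
    σ (2 * k + 2 * l) ≡⟨ cong σ (sym (*-distribˡ-+ 2 k l)) ⟩
    σ (2 * (k + l))   ≡⟨ σ-even (k + l) ⟩
    σ (k + l)         ≤⟨ rec (half-< {k} (λ ())) l ⟩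
    σ k + σ l         ≡⟨ cong₂ _+_ (sym (σ-even k)) (sym (σ-even l)) ⟩
    σ (2 * k) + σ (2 * l) ∎
    where open ≤-Reasoning
  ... | inj₁ (k@(suc _) , refl) | inj₂ (l , refl) = begin
    σ (2 * k + suc (2 * l)) ≡⟨ cong σ (e k l) ⟩
    σ (suc (2 * (k + l)))   ≡⟨ σ-odd (k + l) ⟩
    suc (σ (k + l))         ≤⟨ s≤s (rec (half-< {k} (λ ())) l) ⟩
    suc (σ k + σ l)         ≡⟨ sym (+-suc (σ k) (σ l)) ⟩
    σ k + suc (σ l)         ≡⟨ cong₂ _+_ (sym (σ-even k)) (sym (σ-odd l)) ⟩
    σ (2 * k) + σ (suc (2 * l)) ∎
    where
    open ≤-Reasoning
    e : ∀ k l → 2 * k + suc (2 * l) ≡ suc (2 * (k + l))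
    e = solve-∀
  ... | inj₂ (k , refl) | inj₁ (l , refl) = begin
    σ (suc (2 * k) + 2 * l) ≡⟨ cong σ (cong suc (sym (*-distribˡ-+ 2 k l))) ⟩
    σ (suc (2 * (k + l)))   ≡⟨ σ-odd (k + l) ⟩
    suc (σ (k + l))         ≤⟨ s≤s (rec (s≤s (m≤m+n k (k + 0))) l) ⟩
    suc (σ k) + σ l         ≡⟨ cong₂ _+_ (sym (σ-odd k)) (sym (σ-even l)) ⟩
    σ (suc (2 * k)) + σ (2 * l) ∎
    where open ≤-Reasoning
  ... | inj₂ (k , refl) | inj₂ (l , refl) = begin
    σ (suc (2 * k) + suc (2 * l)) ≡⟨ cong σ (e k l) ⟩
    σ (2 * suc (k + l))     ≡⟨ σ-even (suc (k + l)) ⟩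
    σ (suc (k + l))         ≤⟨ σ-suc (k + l) ⟩
    suc (σ (k + l))         ≤⟨ s≤s (rec (s≤s (m≤m+n k (k + 0))) l) ⟩
    suc (σ k + σ l)         ≤⟨ s≤s (+-monoʳ-≤ (σ k) (n≤1+n (σ l))) ⟩
    suc (σ k) + suc (σ l)   ≡⟨ cong₂ _+_ (sym (σ-odd k)) (sym (σ-odd l)) ⟩
    σ (suc (2 * k)) + σ (suc (2 * l)) ∎
    where
    open ≤-Reasoning
    e : ∀ k l → suc (2 * k) + suc (2 * l) ≡ 2 * suc (k + l)
    e = solve-∀

2*-cancel-< : ∀ {a b} → 2 * a < 2 * b → a < b
2*-cancel-< {a} {b} = *-cancelˡ-< 2 a b

σ-block : ∀ e {a} b → a < 2 ^ e → σ (a + 2 ^ e * b) ≡ σ a + σ b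
σ-block zero {zero} b _ = trans (cong σ (+-identityʳ b)) (cong (_+ σ b) (sym σ-0))
σ-block zero {suc a} b (s≤s ())
σ-block (suc e) {a} b h with even⊎odd a
... | inj₁ (k , refl) = trans (cong σ (l k (2 ^ e) b)) (trans (σ-even (k + 2 ^ e * b))
                          (trans (σ-block e b (2*-cancel-< h)) (cong (_+ σ b) (sym (σ-even k)))))
  where
  l : ∀ k p b → 2 * k + 2 * p * b ≡ 2 * (k + p * b)
  l = solve-∀
... | inj₂ (k , refl) = trans (cong σ (l k (2 ^ e) b)) (trans (σ-odd (k + 2 ^ e * b))
                          (trans (cong suc (σ-block e b (2*-cancel-< (<-trans (n<1+n _) h)))) (cong (_+ σ b) (sym (σ-odd k)))))
  where
  l : ∀ k p b → suc (2 * k) + 2 * p * b ≡ suc (2 * (k + p * b))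
  l = solve-∀

σ-complement : ∀ e a a′ → suc (a + a′) ≡ 2 ^ e → σ a + σ a′ ≡ e
σ-complement zero zero zero _ = cong₂ _+_ σ-0 σ-0
σ-complement (suc e) a a′ h with even⊎odd a | even⊎odd a′
... | inj₁ (k , refl) | inj₁ (l , refl) = contradiction (trans (sym h) (cong suc (sym (*-distribˡ-+ 2 k l)))) (even≢odd (2 ^ e) (k + l))
... | inj₂ (k , refl) | inj₂ (l , refl) = contradiction (trans (sym h) (s k l)) (even≢odd (2 ^ e) (suc (k + l)))
  where
  s : ∀ k l → suc (suc (2 * k) + suc (2 * l)) ≡ suc (2 * suc (k + l))
  s = solve-∀
... | inj₁ (k , refl) | inj₂ (l , refl) = trans (cong₂ _+_ (σ-even k) (σ-odd l))
  (trans (+-suc (σ k) (σ l)) (cong suc (σ-complement e k l (2*-injective (trans (s k l) h)))))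
  where
  s : ∀ k l → 2 * suc (k + l) ≡ suc (2 * k + suc (2 * l))
  s = solve-∀
... | inj₂ (k , refl) | inj₁ (l , refl) = trans (cong₂ _+_ (σ-odd k) (σ-even l))
  (cong suc (σ-complement e k l (2*-injective (trans (s k l) h))))
  where
  s : ∀ k l → 2 * suc (k + l) ≡ suc (suc (2 * k) + 2 * l)
  s = solve-∀

-- Every carry lowers the digit sum of s + t by one against σ s + σ t. As σ is subadditive, this
-- inequality is an equality and means that no carry occurs.
NoCarry : ℕ → ℕ → Set
NoCarry s t = σ s + σ t ≤ σ (s + t)

split-2^ : ∀ e n → ∃₂ λ r q → r < 2 ^ e × n ≡ r + 2 ^ e * q
split-2^ e n = n % (2 ^ e) , n / (2 ^ e) , m%n<n n (2 ^ e) , trans (m≡m%n+[m/n]*n n (2 ^ e)) (cong (n % (2 ^ e) ℕ.+_) (*-comm (n / (2 ^ e)) (2 ^ e)))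
  where
  instance
    nz : NonZero (2 ^ e)
    nz = m^n≢0 2 e

-- Subadditivity on the lower and on the upper block, together with the absorption of the carry c
-- between them, bounds the total defect. As that total is zero, each block has defect zero.
noCarry-split : ∀ e {s₀ t₀} s t → s₀ < 2 ^ e → t₀ < 2 ^ e → NoCarry (s₀ + 2 ^ e * s) (t₀ + 2 ^ e * t) → NoCarry s₀ t₀ × NoCarry s t
noCarry-split e {s₀} {t₀} s t s₀< t₀< h with split-2^ e (s₀ + t₀)
... | r , c , r< , eq = +-cancelʳ-≤ (σ s + σ t) _ _ (≤-trans total (+-monoʳ-≤ (σ (s₀ + t₀)) (σ-+-≤ s t)))
                      , +-cancelˡ-≤ (σ s₀ + σ t₀) _ _ (≤-trans total (+-monoˡ-≤ (σ (s + t)) (σ-+-≤ s₀ t₀)))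
  where
  open ≤-Reasoning
  P = 2 ^ e
  l₁ : ∀ a b c d → a + b + (c + d) ≡ (a + c) + (b + d)
  l₁ = solve-∀
  l₂ : ∀ s₀ t₀ s t p → (s₀ + p * s) + (t₀ + p * t) ≡ (s₀ + t₀) + p * (s + t)
  l₂ = solve-∀
  l₃ : ∀ r p c u → r + p * c + p * u ≡ r + p * (c + u)
  l₃ = solve-∀
  total : σ s₀ + σ t₀ + (σ s + σ t) ≤ σ (s₀ + t₀) + σ (s + t)
  total = begin
    σ s₀ + σ t₀ + (σ s + σ t)       ≡⟨ l₁ (σ s₀) (σ t₀) (σ s) (σ t) ⟩
    (σ s₀ + σ s) + (σ t₀ + σ t)     ≡⟨ sym (cong₂ _+_ (σ-block e s s₀<) (σ-block e t t₀<)) ⟩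
    σ (s₀ + P * s) + σ (t₀ + P * t) ≤⟨ h ⟩
    σ ((s₀ + P * s) + (t₀ + P * t)) ≡⟨ cong σ (trans (l₂ s₀ t₀ s t P) (trans (cong (_+ P * (s + t)) eq) (l₃ r P c (s + t)))) ⟩
    σ (r + P * (c + (s + t)))       ≡⟨ σ-block e _ r< ⟩
    σ r + σ (c + (s + t))           ≤⟨ +-monoʳ-≤ (σ r) (σ-+-≤ c (s + t)) ⟩
    σ r + (σ c + σ (s + t))         ≡⟨ sym (+-assoc (σ r) (σ c) _) ⟩
    σ r + σ c + σ (s + t)           ≡⟨ cong (_+ σ (s + t)) (sym (trans (cong σ eq) (σ-block e c r<))) ⟩
    σ (s₀ + t₀) + σ (s + t)         ∎

noCarry-join : ∀ e {s₀ t₀} s t → s₀ + t₀ < 2 ^ e → NoCarry s₀ t₀ → NoCarry s t → NoCarry (s₀ + 2 ^ e * s) (t₀ + 2 ^ e * t)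
noCarry-join e {s₀} {t₀} s t lt p q = begin
  σ (s₀ + P * s) + σ (t₀ + P * t) ≡⟨ cong₂ _+_ (σ-block e s (≤-<-trans (m≤m+n s₀ t₀) lt)) (σ-block e t (≤-<-trans (m≤n+m t₀ s₀) lt)) ⟩
  (σ s₀ + σ s) + (σ t₀ + σ t)     ≡⟨ l₁ (σ s₀) (σ t₀) (σ s) (σ t) ⟩
  σ s₀ + σ t₀ + (σ s + σ t)       ≤⟨ +-mono-≤ p q ⟩
  σ (s₀ + t₀) + σ (s + t)         ≡⟨ sym (σ-block e (s + t) lt) ⟩
  σ (s₀ + t₀ + P * (s + t))       ≡⟨ cong σ (l₂ s₀ t₀ s t P) ⟩
  σ ((s₀ + P * s) + (t₀ + P * t)) ∎
  where
  open ≤-Reasoning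
  P = 2 ^ e
  l₁ : ∀ a b c d → (a + c) + (b + d) ≡ a + b + (c + d)
  l₁ = solve-∀
  l₂ : ∀ s₀ t₀ s t p → (s₀ + t₀) + p * (s + t) ≡ (s₀ + p * s) + (t₀ + p * t)
  l₂ = solve-∀

noCarry-0ˡ : ∀ t → NoCarry 0 t
noCarry-0ˡ t = ≤-reflexive (cong (_+ σ t) σ-0)

noCarry-0ʳ : ∀ s → NoCarry s 0
noCarry-0ʳ s = ≤-reflexive (trans (trans (cong (σ s ℕ.+_) σ-0) (+-identityʳ (σ s))) (cong σ (sym (+-identityʳ s))))

-- If s consists of e ones, then s + (t + 1) = 2ᵉ + t has digit sum only σ t + 1. But σ s = e is at
-- least σ t + 1, since the complement of t is nonzero, and σ (t + 1) is positive.
noCarry-ones : ∀ e {s t} → suc s ≡ 2 ^ e → t < 2 ^ e → NoCarry s t → t ≡ 0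
noCarry-ones e {s} {zero} es t< h = refl
noCarry-ones e {s} {suc t} es t< h with m≤n⇒∃[o]m+o≡n t<
... | r , er = contradiction (+-cancelˡ-≤ (σ t + 1) _ _ bad) (<⇒≱ (σ>0 (suc t) z<s))
  where
  open ≤-Reasoning
  σs : σ s ≡ e
  σs = trans (sym (trans (cong (σ s ℕ.+_) σ-0) (+-identityʳ (σ s)))) (σ-complement e s 0 (trans (cong suc (+-identityʳ s)) es))
  σt : σ t + σ (suc r) ≡ e
  σt = σ-complement e t (suc r) (trans (cong suc (+-suc t r)) er)
  bad : σ t + 1 + σ (suc t) ≤ σ t + 1 + 0
  bad = begin
    σ t + 1 + σ (suc t)         ≤⟨ +-monoˡ-≤ _ (+-monoʳ-≤ (σ t) (σ>0 (suc r) z<s)) ⟩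
    σ t + σ (suc r) + σ (suc t) ≡⟨ cong (_+ σ (suc t)) (trans σt (sym σs)) ⟩
    σ s + σ (suc t)             ≤⟨ h ⟩
    σ (s + suc t)               ≡⟨ cong σ (trans (+-suc s t) (trans (cong (_+ t) es) (trans (+-comm (2 ^ e) t) (cong (t ℕ.+_) (sym (*-identityʳ (2 ^ e))))))) ⟩
    σ (t + 2 ^ e * 1)           ≡⟨ trans (σ-block e 1 (<-trans (n<1+n t) t<)) (cong (σ t ℕ.+_) (trans (σ-odd 0) (cong suc σ-0))) ⟩
    σ t + 1                     ≡⟨ sym (+-identityʳ _) ⟩
    σ t + 1 + 0                 ∎

private
  mask-shift : ∀ f g {s} → s + 2 ^ f ≡ 2 ^ (f + g) → ∃ λ s′ → suc s′ ≡ 2 ^ g × s ≡ 0 + 2 ^ f * s′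
  mask-shift f g {s} es with m≤n⇒∃[o]m+o≡n (m^n>0 2 g)
  ... | s′ , e′ = s′ , e′ , +-cancelʳ-≡ (2 ^ f) _ _ (trans es (trans (^-distribˡ-+-* 2 f g)
                    (trans (cong (2 ^ f *_) (sym e′)) (trans (*-suc (2 ^ f) s′) (+-comm (2 ^ f) _)))))

-- The mask s has g ones above f zeros, so it forbids the upper g bits of t.
noCarry-mask⇒< : ∀ f g {s t} → s + 2 ^ f ≡ 2 ^ (f + g) → t < 2 ^ (f + g) → NoCarry s t → t < 2 ^ f
noCarry-mask⇒< f g {s} {t} es t< h with mask-shift f g es | split-2^ f t
... | s′ , e′ , refl | t₀ , t₁ , t₀< , refl
  with noCarry-ones g {s′} {t₁} e′ t₁< (proj₂ (noCarry-split f {0} {t₀} s′ t₁ (m^n>0 2 f) t₀< h))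
  where
  t₁< : t₁ < 2 ^ g
  t₁< = *-cancelˡ-< (2 ^ f) t₁ (2 ^ g) (≤-<-trans (m≤n+m _ t₀) (<-≤-trans t< (≤-reflexive (^-distribˡ-+-* 2 f g))))
... | refl = subst (_< 2 ^ f) (sym (trans (cong (t₀ ℕ.+_) (*-zeroʳ (2 ^ f))) (+-identityʳ t₀))) t₀<

<⇒noCarry-mask : ∀ f g {s t} → s + 2 ^ f ≡ 2 ^ (f + g) → t < 2 ^ f → NoCarry s t
<⇒noCarry-mask f g {s} {t} es t< with mask-shift f g es
... | s′ , e′ , refl = subst (NoCarry (2 ^ f * s′)) (trans (cong (t ℕ.+_) (*-zeroʳ (2 ^ f))) (+-identityʳ t))
                         (noCarry-join f {0} {t} s′ 0 t< (noCarry-0ˡ t) (noCarry-0ʳ s′))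

-- The power of two in a central binomial coefficient

binom : ℕ → ℕ → ℕ
binom n zero = 1
binom zero (suc k) = 0
binom (suc n) (suc k) = binom n k + binom n (suc k)

n<k⇒binom≡0 : ∀ {n k} → n < k → binom n k ≡ 0
n<k⇒binom≡0 {zero} {suc k} _ = refl
n<k⇒binom≡0 {suc n} {suc k} (s≤s h) = cong₂ _+_ (n<k⇒binom≡0 h) (n<k⇒binom≡0 (m≤n⇒m≤1+n h))

binom-! : ∀ m n → binom (m + n) m * (m ! * n !) ≡ (m + n) !
binom-! zero n = trans (+-identityʳ _) (+-identityʳ _)
binom-! (suc m) zero = trans (cong (λ z → (binom (m + 0) m + z) * (suc m ! * 1)) (n<k⇒binom≡0 (s≤s (≤-reflexive (+-identityʳ m)))))
  (trans (l (binom (m + 0) m) m (m !)) (trans (cong (suc m *_) (binom-! m zero)) (cong (λ z → suc z * (m + 0) !) (sym (+-identityʳ m)))))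
  where
  l : ∀ b m f → (b + 0) * (suc m * f * 1) ≡ suc m * (b * (f * 1))
  l = solve-∀
binom-! (suc m) (suc n) = begin
  (b₁ + b₂) * (suc m * m ! * (suc n * n !)) ≡⟨ l b₁ b₂ m n (m !) (n !) ⟩
  suc m * (b₁ * (m ! * (suc n * n !))) + suc n * (b₂ * (suc m * m ! * n !))
    ≡⟨ cong₂ (λ u v → suc m * u + suc n * v) (binom-! m (suc n)) (subst (λ z → binom z (suc m) * (suc m * m ! * n !) ≡ z !) (sym (+-suc m n)) (binom-! (suc m) n)) ⟩
  suc m * (m + suc n) ! + suc n * (m + suc n) ! ≡⟨ sym (*-distribʳ-+ ((m + suc n) !) (suc m) (suc n)) ⟩
  (suc m + suc n) * (m + suc n) ! ∎
  where
  open ≡-Reasoning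
  b₁ = binom (m + suc n) m
  b₂ = binom (m + suc n) (suc m)
  l : ∀ b c m n f g → (b + c) * (suc m * f * (suc n * g)) ≡ suc m * (b * (f * (suc n * g))) + suc n * (c * (suc m * f * g))
  l = solve-∀

-- The even factors of (2n)! give 2ⁿ n!, and o is the product of the first n odd numbers.
2n!-odd-part : ∀ n → ∃ λ o → Odd o × (2 * n) ! ≡ 2 ^ n * n ! * o
2n!-odd-part zero = 1 , (0 , refl) , refl
2n!-odd-part (suc n) with 2n!-odd-part n
... | o , oo , e = suc (2 * n) * o , odd-* (n , refl) oo ,
  trans (cong _! (l₀ n)) (trans (cong (λ z → suc (suc (2 * n)) * (suc (2 * n) * z)) e) (l n (2 ^ n) (n !) o))
  where
  l₀ : ∀ n → 2 * suc n ≡ suc (suc (2 * n))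
  l₀ = solve-∀
  l : ∀ n p f o → suc (suc (2 * n)) * (suc (2 * n) * (p * f * o)) ≡ 2 * p * (suc n * f) * (suc (2 * n) * o)
  l = solve-∀

-- Legendre's formula: the exponent of 2 in n! is n - σ n, put multiplicatively to avoid the
-- subtraction. Halving n costs n! only the factor described by `2n!-odd-part`.
legendre : ∀ n → ∃ λ o → Odd o × n ! * 2 ^ σ n ≡ 2 ^ n * o
legendre = <-rec _ go
  where
  go : ∀ n → (∀ {m} → m < n → ∃ λ o → Odd o × m ! * 2 ^ σ m ≡ 2 ^ m * o) → ∃ λ o → Odd o × n ! * 2 ^ σ n ≡ 2 ^ n * o
  go n rec with even⊎odd n
  ... | inj₁ (zero , refl) = 1 , (0 , refl) , cong (λ z → 1 * 2 ^ z) σ-0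
  ... | inj₁ (k@(suc _) , refl) with rec (half-< {k} (λ ())) | 2n!-odd-part k
  ...   | o , oo , e | o′ , oo′ , e′ = o * o′ , odd-* oo oo′ ,
    trans (cong₂ (λ u v → u * 2 ^ v) e′ (σ-even k)) (trans (l₁ (2 ^ k) (k !) o′ (2 ^ σ k)) (trans (cong (λ z → 2 ^ k * z * o′) e)
      (trans (l₂ (2 ^ k) o o′) (cong (_* (o * o′)) (sym (trans (cong (2 ^_) (cong (k ℕ.+_) (+-identityʳ k))) (^-distribˡ-+-* 2 k k)))))))
    where
    l₁ : ∀ p f o s → p * f * o * s ≡ p * (f * s) * o
    l₁ = solve-∀
    l₂ : ∀ p o o′ → p * (p * o) * o′ ≡ p * p * (o * o′)
    l₂ = solve-∀
  go n rec | inj₂ (k , refl) with rec {k} (s≤s (m≤m+n k (k + 0))) | 2n!-odd-part k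
  ...   | o , oo , e | o′ , oo′ , e′ = suc (2 * k) * (o * o′) , odd-* (k , refl) (odd-* oo oo′) ,
    trans (cong₂ (λ u v → suc (2 * k) * u * 2 ^ v) e′ (σ-odd k)) (trans (l₁ k (2 ^ k) (k !) o′ (2 ^ σ k)) (trans (cong (λ z → suc (2 * k) * 2 * (2 ^ k * z * o′)) e)
      (trans (l₂ k (2 ^ k) o o′) (cong (λ z → 2 * z * (suc (2 * k) * (o * o′))) (sym (trans (cong (2 ^_) (cong (k ℕ.+_) (+-identityʳ k))) (^-distribˡ-+-* 2 k k)))))))
    where
    l₁ : ∀ k p f o s → suc (2 * k) * (p * f * o) * (2 * s) ≡ suc (2 * k) * 2 * (p * (f * s) * o)
    l₁ = solve-∀
    l₂ : ∀ k p o o′ → suc (2 * k) * 2 * (p * (p * o) * o′) ≡ 2 * (p * p) * (suc (2 * k) * (o * o′))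
    l₂ = solve-∀

-- The exponent of 2 is that of (2n)!/n!, which is n, minus that of n!, which is n - σ n.
central-binom : ∀ n → ∃₂ λ o o′ → Odd o × Odd o′ × binom (n + n) n * o ≡ o′ * 2 ^ σ n
central-binom n with legendre n | 2n!-odd-part n
... | o , oo , e | o′ , oo′ , e′ = o , o′ , oo , oo′ , *-cancelˡ-≡ _ _ (2 ^ n) ⦃ m^n≢0 2 n ⦄ (begin
    2 ^ n * (c * o)             ≡⟨ l₁ (2 ^ n) c o ⟩
    c * (2 ^ n * o)             ≡⟨ cong (c *_) (sym e) ⟩
    c * (n ! * 2 ^ σ n)         ≡⟨ sym (*-assoc c (n !) _) ⟩
    c * n ! * 2 ^ σ n           ≡⟨ cong (_* 2 ^ σ n) cn! ⟩
    2 ^ n * o′ * 2 ^ σ n        ≡⟨ *-assoc (2 ^ n) o′ _ ⟩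
    2 ^ n * (o′ * 2 ^ σ n)      ∎)
  where
  open ≡-Reasoning
  c = binom (n + n) n
  l₁ : ∀ p c o → p * (c * o) ≡ c * (p * o)
  l₁ = solve-∀
  l₂ : ∀ p f o → p * f * o ≡ p * o * f
  l₂ = solve-∀
  cn! : c * n ! ≡ 2 ^ n * o′
  cn! = *-cancelʳ-≡ _ _ (n !) ⦃ n !≢0 ⦄ (trans (*-assoc c (n !) (n !)) (trans (binom-! n n)
          (trans (cong _! (cong (n ℕ.+_) (sym (+-identityʳ n)))) (trans e′ (l₂ (2 ^ n) (n !) o′)))))

odd⇒¬2∣ : ∀ {o} → Odd o → ¬ (2 ∣ o)
odd⇒¬2∣ (k , refl) (divides q e) = even≢odd q k (trans (*-comm 2 q) (sym e))

2^∣central-binom⇒≤σ : ∀ j n → 2 ^ j ∣ binom (n + n) n → j ≤ σ n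
2^∣central-binom⇒≤σ j n h with j ≤? σ n | central-binom n
... | yes p | _ = p
... | no ¬p | o , o′ , oo , oo′ , e with m≤n⇒∃[o]m+o≡n (≰⇒> ¬p)
...   | k , refl = contradiction 2∣o′ (odd⇒¬2∣ oo′)
  where
  instance
    nz : NonZero (2 ^ σ n)
    nz = m^n≢0 2 (σ n)
  d : 2 * 2 ^ σ n ∣ o′ * 2 ^ σ n
  d = ∣-trans (divides (2 ^ k) (trans (^-distribˡ-+-* 2 (suc (σ n)) k) (*-comm (2 ^ suc (σ n)) (2 ^ k)))) (subst (2 ^ (suc (σ n) + k) ∣_) e (∣m⇒∣m*n o h))
  2∣o′ : 2 ∣ o′
  2∣o′ = *-cancelʳ-∣ (2 ^ σ n) d

central-binom-odd-part : ∀ n → ∃ λ q → Odd q × binom (n + n) n ≡ 2 ^ σ n * q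
central-binom-odd-part n with central-binom n
... | o , o′ , (k , refl) , oo′ , e = q , odd-q , trans eq (*-comm q _)
  where
  instance
    nz : NonZero (2 ^ σ n)
    nz = m^n≢0 2 (σ n)
  d : 2 ^ σ n ∣ binom (n + n) n
  d = coprime-divisor (Coprime.sym (coprime-^ʳ (σ n) (Coprime.sym (∣-suc⇒coprime {t = k} refl)))) (divides o′ (trans (*-comm (suc (2 * k)) _) e))
  q = quotient d
  eq : binom (n + n) n ≡ q * 2 ^ σ n
  eq = m∣n⇒n≡quotient*m d
  qo : q * suc (2 * k) ≡ o′
  qo = *-cancelʳ-≡ _ _ (2 ^ σ n) (trans (l q (suc (2 * k)) (2 ^ σ n)) (trans (cong (_* suc (2 * k)) (sym eq)) e))
    where
    l : ∀ q o p → q * o * p ≡ q * p * o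
    l = solve-∀
  odd-q : Odd q
  odd-q with even⊎odd q
  ... | inj₂ p = p
  ... | inj₁ (r , er) = contradiction (subst (2 ∣_) qo (∣m⇒∣m*n _ (divides r (trans er (*-comm 2 r))))) (odd⇒¬2∣ oo′)

-- The quotient of Pell solutions

module Expansion (V : ℕ) where

  partial-sum : ℕ → ℕ → ℕ
  partial-sum m zero = 0
  partial-sum m (suc j) = partial-sum m j + binom m j * V ^ j

  partial-sum-suc : ∀ m j → partial-sum (suc m) (suc j) ≡ partial-sum m (suc j) + V * partial-sum m j
  partial-sum-suc m zero = sym (trans (cong (λ z → 1 + z) (*-zeroʳ V)) refl)
  partial-sum-suc m (suc j) = trans (cong (_+ (binom m j + binom m (suc j)) * (V * V ^ j)) (partial-sum-suc m j))
    (l (partial-sum m j) V (binom m j) (binom m (suc j)) (V ^ j))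
    where
    l : ∀ s v b c p → s + b * p + v * s + (b + c) * (v * p) ≡ s + b * p + c * (v * p) + v * (s + b * p)
    l = solve-∀

  binomial-theorem : ∀ m → suc V ^ m ≡ partial-sum m (suc m)
  binomial-theorem zero = refl
  binomial-theorem (suc m) = trans (cong (suc V *_) (binomial-theorem m))
    (sym (trans (partial-sum-suc m (suc m)) (cong (_+ V * partial-sum m (suc m))
      (trans (cong (λ z → partial-sum m (suc m) + z * V ^ suc m) (n<k⇒binom≡0 (n<1+n m))) (+-identityʳ _)))))

  partial-sum-tail : ∀ m j i → ∃ λ t → partial-sum m (j + i) ≡ partial-sum m j + V ^ j * t
  partial-sum-tail m j zero = 0 , trans (cong (partial-sum m) (+-identityʳ j)) (sym (trans (cong (partial-sum m j ℕ.+_) (*-zeroʳ (V ^ j))) (+-identityʳ _)))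
  partial-sum-tail m j (suc i) with partial-sum-tail m j i
  ... | t , e = t + binom m (j + i) * V ^ i , trans (cong (partial-sum m) (+-suc j i))
    (trans (cong₂ _+_ e (cong (binom m (j + i) *_) (^-distribˡ-+-* V j i))) (l (partial-sum m j) (V ^ j) t (binom m (j + i)) (V ^ i)))
    where
    l : ∀ s p t b q → s + p * t + b * (p * q) ≡ s + p * (t + b * q)
    l = solve-∀

  partial-sum-≤ : 1 ≤ V → ∀ m j → partial-sum m (suc j) ≤ 2 ^ m * V ^ j
  partial-sum-≤ 1≤V zero zero = ≤-refl
  partial-sum-≤ 1≤V zero (suc j) = ≤-trans (≤-reflexive (+-identityʳ _)) (≤-trans (partial-sum-≤ 1≤V zero j) (*-monoʳ-≤ 1 (m≤n*m (V ^ j) V ⦃ >-nonZero 1≤V ⦄)))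
  partial-sum-≤ 1≤V (suc m) zero = ≤-trans (m^n>0 2 (suc m)) (≤-reflexive (sym (*-identityʳ _)))
  partial-sum-≤ 1≤V (suc m) (suc j) = begin
    partial-sum (suc m) (2 + j) ≡⟨ partial-sum-suc m (suc j) ⟩
    partial-sum m (2 + j) + V * partial-sum m (suc j)
      ≤⟨ +-mono-≤ (partial-sum-≤ 1≤V m (suc j)) (*-monoʳ-≤ V (partial-sum-≤ 1≤V m j)) ⟩
    2 ^ m * (V * V ^ j) + V * (2 ^ m * V ^ j) ≡⟨ l (2 ^ m) V (V ^ j) ⟩
    2 * 2 ^ m * (V * V ^ j) ∎
    where
    open ≤-Reasoning
    l : ∀ p v q → p * (v * q) + v * (p * q) ≡ 2 * p * (v * q)
    l = solve-∀

  -- The binomial sum is cut at exponent n. The part divisible by Vⁿ has a quotient congruent to the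
  -- central coefficient modulo V, and r collects the lower terms; it is small against Vⁿ once V is
  -- large against 2²ⁿ.
  central-expansion : ∀ n → 1 ≤ n → 1 ≤ V → ∃₂ λ r t →
    suc V ^ (n + n) ≡ V ^ n * (binom (n + n) n + V * t) + r × r * V ≤ 2 ^ (n + n) * V ^ n
  central-expansion n@(suc n′) _ 1≤V with partial-sum-tail (n + n) (suc n) n
  ... | t , e = partial-sum (n + n) n , t
    , trans (binomial-theorem (n + n)) (trans e (l (partial-sum (n + n) n) (binom (n + n) n) (V ^ n) V t))
    , ≤-trans (*-monoˡ-≤ V (partial-sum-≤ 1≤V (n + n) n′)) (≤-reflexive (l₂ (2 ^ (n + n)) (V ^ n′) V))
    where
    l : ∀ s b p v t → s + b * p + v * p * t ≡ p * (b + v * t) + s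
    l = solve-∀
    l₂ : ∀ q p v → q * p * v ≡ q * (v * p)
    l₂ = solve-∀

-- (t + 1)ᵐ ≤ tᵐ + m (t + 1)ᵐ⁻¹, multiplied by t + 1.
bernoulli : ∀ t m → suc t * suc t ^ m ≤ suc t * t ^ m + m * suc t ^ m
bernoulli t zero = m≤m+n _ _
bernoulli t (suc m) = begin
  suc t * (suc t * suc t ^ m)                         ≤⟨ *-monoʳ-≤ (suc t) (bernoulli t m) ⟩
  suc t * (suc t * t ^ m + m * suc t ^ m)             ≡⟨ l t (t ^ m) m (suc t ^ m) ⟩
  suc t * t ^ m + (suc t * (t * t ^ m) + m * (suc t * suc t ^ m))
    ≤⟨ +-monoˡ-≤ _ (*-monoʳ-≤ (suc t) (^-monoˡ-≤ m (n≤1+n t))) ⟩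
  suc t * suc t ^ m + (suc t * (t * t ^ m) + m * (suc t * suc t ^ m)) ≡⟨ l₂ (suc t * suc t ^ m) (suc t * (t * t ^ m)) m ⟩
  suc t * (t * t ^ m) + suc m * (suc t * suc t ^ m) ∎
  where
  open ≤-Reasoning
  l : ∀ t p m q → suc t * (suc t * p + m * q) ≡ suc t * p + (suc t * (t * p) + m * (suc t * q))
  l = solve-∀
  l₂ : ∀ x y m → x + (y + m * x) ≡ y + suc m * x
  l₂ = solve-∀

*-^ : ∀ a b n → (a * b) ^ n ≡ a ^ n * b ^ n
*-^ a b zero = refl
*-^ a b (suc n) = trans (cong (a * b *_) (*-^ a b n)) (l a b (a ^ n) (b ^ n))
  where
  l : ∀ a b p q → a * b * (p * q) ≡ a * p * (b * q)
  l = solve-∀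

-- Y a (2n + 1) lies between (2α - 1)²ⁿ and (2α)²ⁿ, where α = 1 + a. By Bernoulli's inequality it
-- falls short of the upper bound by a relative error of at most n / α.
Y-bounds : ∀ a n → suc a * (2 * suc a) ^ (n + n) ≤ suc a * Y a (suc (n + n)) + n * (2 * suc a) ^ (n + n)
Y-bounds a n = *-cancelˡ-≤ 2 (begin
  2 * (suc a * s ^ m)                   ≡⟨ sym (*-assoc 2 (suc a) _) ⟩
  s * s ^ m                             ≡⟨ cong (λ z → z * z ^ m) (es a) ⟩
  suc t * suc t ^ m                     ≤⟨ bernoulli t m ⟩
  suc t * t ^ m + m * suc t ^ m         ≤⟨ +-monoˡ-≤ _ (*-monoʳ-≤ (suc t) (Y-lower a m)) ⟩
  suc t * Y a (suc m) + m * suc t ^ m   ≡⟨ cong (λ z → z * Y a (suc m) + m * z ^ m) (sym (es a)) ⟩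
  s * Y a (suc m) + m * s ^ m           ≡⟨ l a (Y a (suc m)) n (s ^ m) ⟩
  2 * (suc a * Y a (suc m) + n * s ^ m) ∎)
  where
  open ≤-Reasoning
  m = n + n
  s = 2 * suc a
  t = suc (2 * a)
  es : ∀ a → 2 * suc a ≡ suc (suc (2 * a))
  es = solve-∀
  l : ∀ a y n p → 2 * suc a * y + (n + n) * p ≡ 2 * (suc a * y + n * p)
  l = solve-∀

Y-bounds′ : ∀ a n → 2 * suc a * (2 * suc a) ^ n ≤ 2 * suc a * Y a (suc n) + n * (2 * suc a) ^ n
Y-bounds′ a n = begin
  s * s ^ n                             ≡⟨ cong (λ z → z * z ^ n) (es a) ⟩
  suc t * suc t ^ n                     ≤⟨ bernoulli t n ⟩
  suc t * t ^ n + n * suc t ^ n         ≤⟨ +-monoˡ-≤ _ (*-monoʳ-≤ (suc t) (Y-lower a n)) ⟩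
  suc t * Y a (suc n) + n * suc t ^ n   ≡⟨ cong (λ z → z * Y a (suc n) + n * z ^ n) (sym (es a)) ⟩
  s * Y a (suc n) + n * s ^ n           ∎
  where
  open ≤-Reasoning
  s = 2 * suc a
  t = suc (2 * a)
  es : ∀ a → 2 * suc a ≡ suc (suc (2 * a))
  es = solve-∀

-- With α = 1 + a = U (V + 1) and κ = 1 + k = 2 U² V, the quotient Y a (2n + 1) / Y k (n + 1)
-- approximates (V + 1)²ⁿ / Vⁿ.
module Approximation (n V U L a k : ℕ) (1≤n : 1 ≤ n) (1≤V : 1 ≤ V) (1≤L : 1 ≤ L) (U≥ : 64 * (n * L) ≤ U)
                     (ea : suc a ≡ U * suc V) (ek : suc k ≡ 2 * (U * U * V)) where

  -- α and κ are chosen so that the leading powers (2α)²ⁿ = u P₁ and (2κ)ⁿ = u P₂ have the same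
  -- factor u, which cancels in C / K.
  α κ C K P₁ P₂ u : ℕ
  α = suc a
  κ = suc k
  C = Y a (suc (n + n))
  K = Y k (suc n)
  P₁ = suc V ^ (n + n)
  P₂ = V ^ n
  u = (2 * U) ^ (n + n)

  private
    instance
      nzV : NonZero V
      nzV = >-nonZero 1≤V
      nzU : NonZero U
      nzU = >-nonZero (≤-trans (*-mono-≤ {x = 1} {y = 64} (s≤s z≤n) (*-mono-≤ 1≤n 1≤L)) U≥)
      nzu : NonZero u
      nzu = m^n≢0 (2 * U) (n + n) ⦃ m*n≢0 2 U ⦄
      nzP₂ : NonZero P₂
      nzP₂ = m^n≢0 V n

    α≥ : 64 * (n * L) ≤ α
    α≥ = ≤-trans U≥ (≤-trans (m≤m*n U (suc V)) (≤-reflexive (sym ea)))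
    κ≥ : 64 * (n * L) ≤ κ
    κ≥ = ≤-trans U≥ (≤-trans (m≤m*n U (2 * U * V) ⦃ m*n≢0 (2 * U) V ⦃ m*n≢0 2 U ⦄ ⦄) (≤-reflexive (trans (l U V) (sym ek))))
      where
      l : ∀ U V → U * (2 * U * V) ≡ 2 * (U * U * V)
      l = solve-∀
    uP₁ : (2 * α) ^ (n + n) ≡ u * P₁
    uP₁ = trans (cong (λ z → (2 * z) ^ (n + n)) ea) (trans (cong (_^ (n + n)) (sym (*-assoc 2 U (suc V)))) (*-^ (2 * U) (suc V) (n + n)))
    uP₂ : (2 * κ) ^ n ≡ u * P₂
    uP₂ = trans (cong (λ z → (2 * z) ^ n) ek) (trans (cong (_^ n) (l U V)) (trans (*-^ (2 * U * (2 * U)) V n)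
            (cong (_* V ^ n) (trans (*-^ (2 * U) (2 * U) n) (sym (^-distribˡ-+-* (2 * U) n n))))))
      where
      l : ∀ U V → 2 * (2 * (U * U * V)) ≡ 2 * U * (2 * U) * V
      l = solve-∀
    C≥ : α * (u * P₁) ≤ α * C + n * (u * P₁)
    C≥ = subst (λ z → α * z ≤ α * C + n * z) uP₁ (Y-bounds a n)
    C≤ : C ≤ u * P₁
    C≤ = ≤-trans (Y-upper a (n + n)) (≤-reflexive uP₁)
    K≥ : 2 * κ * (u * P₂) ≤ 2 * κ * K + n * (u * P₂)
    K≥ = subst (λ z → 2 * κ * z ≤ 2 * κ * K + n * z) uP₂ (Y-bounds′ k n)
    K≤ : K ≤ u * P₂
    K≤ = ≤-trans (Y-upper k n) (≤-reflexive uP₂)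

  -- The hypothesis gives P₁ / P₂ < L + 1/4 up to the relative error n / α of C. Since α ≥ 64 n L,
  -- and P₁ < 2 L P₂ by the crude estimate `s₂`, that error costs at most 1/32.
  close⇒upper : 4 * C < 4 * (K * L) + K → 32 * P₁ < (32 * L + 9) * P₂
  close⇒upper h = *-cancelˡ-< α _ _ (begin-strict
      α * (32 * P₁)                              ≡⟨ l₁ α P₁ ⟩
      8 * (4 * (α * P₁))                         <⟨ *-monoʳ-< 8 s₁ ⟩
      8 * (α * ((4 * L + 1) * P₂) + 4 * (n * P₁)) ≡⟨ l₂ α L P₂ n P₁ ⟩
      α * ((32 * L + 8) * P₂) + 32 * (n * P₁)    ≤⟨ +-monoʳ-≤ (α * ((32 * L + 8) * P₂)) (≤-trans (*-monoʳ-≤ 32 (*-monoʳ-≤ n (<⇒≤ s₂))) (≤-trans (≤-reflexive (l₄ n L P₂)) (*-monoˡ-≤ P₂ α≥))) ⟩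
      α * ((32 * L + 8) * P₂) + α * P₂           ≡⟨ l₃ α L P₂ ⟩
      α * ((32 * L + 9) * P₂)                    ∎)
    where
    open ≤-Reasoning
    l₁ : ∀ α p → α * (32 * p) ≡ 8 * (4 * (α * p))
    l₁ = solve-∀
    l₂ : ∀ α L q n p → 8 * (α * ((4 * L + 1) * q) + 4 * (n * p)) ≡ α * ((32 * L + 8) * q) + 32 * (n * p)
    l₂ = solve-∀
    l₃ : ∀ α L q → α * ((32 * L + 8) * q) + α * q ≡ α * ((32 * L + 9) * q)
    l₃ = solve-∀
    l₄ : ∀ n L q → 32 * (n * (2 * (L * q))) ≡ 64 * (n * L) * q
    l₄ = solve-∀
    s₁ : 4 * (α * P₁) < α * ((4 * L + 1) * P₂) + 4 * (n * P₁)
    s₁ = *-cancelˡ-< u _ _ (begin-strict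
      u * (4 * (α * P₁))                     ≡⟨ m₁ u α P₁ ⟩
      4 * (α * (u * P₁))                     ≤⟨ *-monoʳ-≤ 4 C≥ ⟩
      4 * (α * C + n * (u * P₁))             ≡⟨ m₂ α C n (u * P₁) ⟩
      α * (4 * C) + 4 * (n * (u * P₁))       <⟨ +-monoˡ-< _ (*-monoʳ-< α h) ⟩
      α * (4 * (K * L) + K) + 4 * (n * (u * P₁)) ≡⟨ m₃ α K L (4 * (n * (u * P₁))) ⟩
      α * ((4 * L + 1) * K) + 4 * (n * (u * P₁)) ≤⟨ +-monoˡ-≤ _ (*-monoʳ-≤ α (*-monoʳ-≤ (4 * L + 1) K≤)) ⟩
      α * ((4 * L + 1) * (u * P₂)) + 4 * (n * (u * P₁)) ≡⟨ m₄ α L u P₂ n P₁ ⟩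
      u * (α * ((4 * L + 1) * P₂) + 4 * (n * P₁)) ∎)
      where
      m₁ : ∀ u α p → u * (4 * (α * p)) ≡ 4 * (α * (u * p))
      m₁ = solve-∀
      m₂ : ∀ α c n z → 4 * (α * c + n * z) ≡ α * (4 * c) + 4 * (n * z)
      m₂ = solve-∀
      m₃ : ∀ α K L z → α * (4 * (K * L) + K) + z ≡ α * ((4 * L + 1) * K) + z
      m₃ = solve-∀
      m₄ : ∀ α L u q n p → α * ((4 * L + 1) * (u * q)) + 4 * (n * (u * p)) ≡ u * (α * ((4 * L + 1) * q) + 4 * (n * p))
      m₄ = solve-∀
    n≤α : 8 * n ≤ α
    n≤α = ≤-trans (*-mono-≤ {x = 8} {y = 64} (≤-of-+ 56 refl) (m≤m*n n L ⦃ >-nonZero 1≤L ⦄)) α≥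
    s₂ : P₁ < 2 * (L * P₂)
    s₂ = *-cancelˡ-< (7 * α) _ _ (+-cancelʳ-< (α * P₁) _ _ (begin-strict
      7 * α * P₁ + α * P₁                       ≡⟨ m₁ α P₁ ⟩
      2 * (4 * (α * P₁))                        <⟨ *-monoʳ-< 2 s₁ ⟩
      2 * (α * ((4 * L + 1) * P₂) + 4 * (n * P₁)) ≡⟨ m₂ α L P₂ n P₁ ⟩
      α * ((8 * L + 2 * 1) * P₂) + 8 * n * P₁   ≤⟨ +-mono-≤ (*-monoʳ-≤ α (*-monoˡ-≤ P₂ (+-monoʳ-≤ (8 * L) (*-mono-≤ {x = 2} {y = 6} (s≤s (s≤s z≤n)) 1≤L)))) (*-monoˡ-≤ P₁ n≤α) ⟩
      α * ((8 * L + 6 * L) * P₂) + α * P₁       ≡⟨ m₃ α L P₂ (α * P₁) ⟩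
      7 * α * (2 * (L * P₂)) + α * P₁           ∎))
      where
      m₁ : ∀ α p → 7 * α * p + α * p ≡ 2 * (4 * (α * p))
      m₁ = solve-∀
      m₂ : ∀ α L q n p → 2 * (α * ((4 * L + 1) * q) + 4 * (n * p)) ≡ α * ((8 * L + 2 * 1) * q) + 8 * n * p
      m₂ = solve-∀
      m₃ : ∀ α L q z → α * ((8 * L + 6 * L) * q) + z ≡ 7 * α * (2 * (L * q)) + z
      m₃ = solve-∀

  -- The same in the other direction: L < P₁ / P₂ + 1/4 + 1/64, where the last term comes from the
  -- relative error n / (2κ) of K.
  close⇒lower : 4 * (K * L) < 4 * C + K → 64 * (L * P₂) < 64 * P₁ + 17 * P₂
  close⇒lower h = *-cancelˡ-< (2 * κ) _ _ (begin-strict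
      2 * κ * (64 * (L * P₂))                              ≡⟨ l₁ κ L P₂ ⟩
      16 * (8 * (κ * (L * P₂)))                            <⟨ *-monoʳ-< 16 s₁ ⟩
      16 * (2 * (κ * (4 * P₁ + P₂)) + 4 * (n * (L * P₂)))  ≡⟨ l₂ κ P₁ P₂ n L ⟩
      2 * κ * (64 * P₁ + 16 * P₂) + 64 * (n * L) * P₂      ≤⟨ +-monoʳ-≤ _ (*-monoˡ-≤ P₂ (≤-trans κ≥ (m≤m+n κ (κ + 0)))) ⟩
      2 * κ * (64 * P₁ + 16 * P₂) + 2 * κ * P₂             ≡⟨ l₃ κ P₁ P₂ ⟩
      2 * κ * (64 * P₁ + 17 * P₂)                          ∎)
    where
    open ≤-Reasoning
    l₁ : ∀ κ L q → 2 * κ * (64 * (L * q)) ≡ 16 * (8 * (κ * (L * q)))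
    l₁ = solve-∀
    l₂ : ∀ κ p q n L → 16 * (2 * (κ * (4 * p + q)) + 4 * (n * (L * q))) ≡ 2 * κ * (64 * p + 16 * q) + 64 * (n * L) * q
    l₂ = solve-∀
    l₃ : ∀ κ p q → 2 * κ * (64 * p + 16 * q) + 2 * κ * q ≡ 2 * κ * (64 * p + 17 * q)
    l₃ = solve-∀
    s₁ : 8 * (κ * (L * P₂)) < 2 * (κ * (4 * P₁ + P₂)) + 4 * (n * (L * P₂))
    s₁ = *-cancelˡ-< u _ _ (begin-strict
      u * (8 * (κ * (L * P₂)))                      ≡⟨ m₁ u κ L P₂ ⟩
      4 * L * (2 * κ * (u * P₂))                    ≤⟨ *-monoʳ-≤ (4 * L) K≥ ⟩
      4 * L * (2 * κ * K + n * (u * P₂))            ≡⟨ m₂ L κ K n (u * P₂) ⟩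
      2 * κ * (4 * (K * L)) + 4 * (n * (L * (u * P₂))) <⟨ +-monoˡ-< _ (*-monoʳ-< (2 * κ) h) ⟩
      2 * κ * (4 * C + K) + 4 * (n * (L * (u * P₂))) ≤⟨ +-monoˡ-≤ _ (*-monoʳ-≤ (2 * κ) (+-mono-≤ (*-monoʳ-≤ 4 C≤) K≤)) ⟩
      2 * κ * (4 * (u * P₁) + u * P₂) + 4 * (n * (L * (u * P₂))) ≡⟨ m₃ κ u P₁ P₂ n L ⟩
      u * (2 * (κ * (4 * P₁ + P₂)) + 4 * (n * (L * P₂))) ∎)
      where
      m₁ : ∀ u κ L q → u * (8 * (κ * (L * q))) ≡ 4 * L * (2 * κ * (u * q))
      m₁ = solve-∀
      m₂ : ∀ L κ K n z → 4 * L * (2 * κ * K + n * z) ≡ 2 * κ * (4 * (K * L)) + 4 * (n * (L * z))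
      m₂ = solve-∀
      m₃ : ∀ κ u p q n L → 2 * κ * (4 * (u * p) + u * q) + 4 * (n * (L * (u * q))) ≡ u * (2 * (κ * (4 * p + q)) + 4 * (n * (L * q)))
      m₃ = solve-∀

  -- From (V + 1)² ≥ (V + 2) V follows P₁ / P₂ ≥ (V + 2)ⁿ, whatever the size of V against 2ⁿ. This
  -- is the lower bound for L that is available before anything is known about w.
  close⇒≥ : 4 * C < 4 * (K * L) + K → (2 + V) ^ n ≤ L
  close⇒≥ h = ≤-pred (*-cancelˡ-< 32 _ _ (<-≤-trans (*-cancelʳ-< P₂ _ _ s) (≤-trans (+-monoʳ-≤ (32 * L) (≤-of-+ {9} {32} 23 refl)) (≤-reflexive (l L)))))
    where
    open ≤-Reasoning
    l : ∀ L → 32 * L + 32 ≡ 32 * suc L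
    l = solve-∀
    l₂ : ∀ V → suc V * suc V ≡ (2 + V) * V + 1
    l₂ = solve-∀
    s : 32 * (2 + V) ^ n * P₂ < (32 * L + 9) * P₂
    s = begin-strict
      32 * (2 + V) ^ n * P₂     ≡⟨ *-assoc 32 ((2 + V) ^ n) P₂ ⟩
      32 * ((2 + V) ^ n * P₂)   ≡⟨ cong (32 *_) (sym (*-^ (2 + V) V n)) ⟩
      32 * ((2 + V) * V) ^ n    ≤⟨ *-monoʳ-≤ 32 (^-monoˡ-≤ n (≤-of-+ 1 (l₂ V))) ⟩
      32 * (suc V * suc V) ^ n  ≡⟨ cong (32 *_) (trans (*-^ (suc V) (suc V) n) (sym (^-distribˡ-+-* (suc V) n n))) ⟩
      32 * P₁                   <⟨ close⇒upper h ⟩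
      (32 * L + 9) * P₂         ∎

  -- With P₁ / P₂ between ρ and ρ + 1/32, the two estimates give L < ρ + 19/64 and ρ < L + 9/32, so
  -- the integers agree.
  close⇒≡ : ∀ {ρ r} → P₁ ≡ P₂ * ρ + r → 32 * r ≤ P₂ → 4 * C < 4 * (K * L) + K → 4 * (K * L) < 4 * C + K → L ≡ ρ
  close⇒≡ {ρ} {r} e r≤ h h′ = ≤-antisym
    (≤-pred (*-cancelˡ-< 64 _ _ (<-≤-trans (*-cancelʳ-< P₂ _ _ lt) (≤-trans (+-monoʳ-≤ (64 * ρ) (≤-of-+ {19} {64} 45 refl)) (≤-reflexive (l ρ))))))
    (≤-pred (*-cancelˡ-< 32 _ _ (<-≤-trans (*-cancelʳ-< P₂ _ _ lt′) (≤-trans (+-monoʳ-≤ (32 * L) (≤-of-+ {9} {32} 23 refl)) (≤-reflexive (l′ L))))))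
    where
    open ≤-Reasoning
    l : ∀ L → 64 * L + 64 ≡ 64 * suc L
    l = solve-∀
    l′ : ∀ L → 32 * L + 32 ≡ 32 * suc L
    l′ = solve-∀
    lt′ : 32 * ρ * P₂ < (32 * L + 9) * P₂
    lt′ = begin-strict
      32 * ρ * P₂       ≡⟨ m₁ ρ P₂ ⟩
      32 * (P₂ * ρ)     ≤⟨ *-monoʳ-≤ 32 (≤-of-+ r e) ⟩
      32 * P₁           <⟨ close⇒upper h ⟩
      (32 * L + 9) * P₂ ∎
      where
      m₁ : ∀ ρ q → 32 * ρ * q ≡ 32 * (q * ρ)
      m₁ = solve-∀
    lt : 64 * L * P₂ < (64 * ρ + 19) * P₂
    lt = begin-strict
      64 * L * P₂                     ≡⟨ *-assoc 64 L P₂ ⟩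
      64 * (L * P₂)                   <⟨ close⇒lower h′ ⟩
      64 * P₁ + 17 * P₂               ≡⟨ trans (cong (λ z → 64 * z + 17 * P₂) e) (m₁ P₂ ρ r) ⟩
      (64 * ρ + 17) * P₂ + 2 * (32 * r) ≤⟨ +-monoʳ-≤ ((64 * ρ + 17) * P₂) (*-monoʳ-≤ 2 r≤) ⟩
      (64 * ρ + 17) * P₂ + 2 * P₂     ≡⟨ m₂ P₂ ρ ⟩
      (64 * ρ + 19) * P₂              ∎
      where
      m₁ : ∀ q ρ r → 64 * (q * ρ + r) + 17 * q ≡ (64 * ρ + 17) * q + 2 * (32 * r)
      m₁ = solve-∀
      m₂ : ∀ q ρ → (64 * ρ + 17) * q + 2 * q ≡ (64 * ρ + 19) * q
      m₂ = solve-∀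

  -- The distance |C - K L| is at most K / 8 here, while soundness asks only for less than K / 4.
  -- The gap is the slack that R > 0 consumes.
  ≡⇒close : ∀ {r} → P₁ ≡ P₂ * L + r → 32 * r ≤ P₂ → 8 * C ≤ 8 * (K * L) + K × 8 * (K * L) ≤ 8 * C + K
  ≡⇒close {r} e r≤ = upper , lower
    where
    open ≤-Reasoning
    upper : 8 * C ≤ 8 * (K * L) + K
    upper = *-cancelˡ-≤ (8 * κ) (+-cancelʳ-≤ (4 * ((8 * L + 1) * (n * (u * P₂)))) _ _ (begin
      8 * κ * (8 * C) + 4 * ((8 * L + 1) * (n * (u * P₂)))
        ≤⟨ +-mono-≤ (*-monoʳ-≤ (8 * κ) (*-monoʳ-≤ 8 (≤-trans C≤ (≤-reflexive (cong (u *_) e)))))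
                    (*-monoʳ-≤ 4 (*-monoˡ-≤ (n * (u * P₂)) (+-monoʳ-≤ (8 * L) (≤-trans 1≤L (m≤n*m L 8))))) ⟩
      8 * κ * (8 * (u * (P₂ * L + r))) + 4 * ((8 * L + 8 * L) * (n * (u * P₂)))
        ≡⟨ m₁ κ u P₂ L r n ⟩
      κ * (64 * (u * (P₂ * L))) + (2 * κ * u * (32 * r) + 64 * (n * L) * (u * P₂))
        ≤⟨ +-monoʳ-≤ (κ * (64 * (u * (P₂ * L)))) (+-mono-≤ (*-monoʳ-≤ (2 * κ * u) r≤) (*-monoˡ-≤ (u * P₂) κ≥)) ⟩
      κ * (64 * (u * (P₂ * L))) + (2 * κ * u * P₂ + κ * (u * P₂))
        ≤⟨ ≤-of-+ (5 * (κ * (u * P₂))) (m₂ κ u P₂ L) ⟩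
      (8 * L + 1) * (4 * (2 * κ * (u * P₂)))
        ≤⟨ *-monoʳ-≤ (8 * L + 1) (*-monoʳ-≤ 4 K≥) ⟩
      (8 * L + 1) * (4 * (2 * κ * K + n * (u * P₂)))
        ≡⟨ m₃ L κ K (n * (u * P₂)) ⟩
      8 * κ * (8 * (K * L) + K) + 4 * ((8 * L + 1) * (n * (u * P₂))) ∎))
      where
      m₁ : ∀ κ u q L r n → 8 * κ * (8 * (u * (q * L + r))) + 4 * ((8 * L + 8 * L) * (n * (u * q)))
         ≡ κ * (64 * (u * (q * L))) + (2 * κ * u * (32 * r) + 64 * (n * L) * (u * q))
      m₁ = solve-∀
      m₂ : ∀ κ u q L → (8 * L + 1) * (4 * (2 * κ * (u * q))) ≡ κ * (64 * (u * (q * L))) + (2 * κ * u * q + κ * (u * q)) + 5 * (κ * (u * q))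
      m₂ = solve-∀
      m₃ : ∀ L κ K z → (8 * L + 1) * (4 * (2 * κ * K + z)) ≡ 8 * κ * (8 * (K * L) + K) + 4 * ((8 * L + 1) * z)
      m₃ = solve-∀
    uP₂≤ : u * P₂ ≤ 2 * K
    uP₂≤ = *-cancelˡ-≤ κ (+-cancelʳ-≤ (κ * (u * P₂)) _ _ (begin
      κ * (u * P₂) + κ * (u * P₂) ≡⟨ m₁ κ (u * P₂) ⟩
      2 * κ * (u * P₂)            ≤⟨ K≥ ⟩
      2 * κ * K + n * (u * P₂)    ≤⟨ +-mono-≤ (≤-reflexive (m₂ κ K)) (*-monoˡ-≤ (u * P₂) (≤-trans (≤-trans (m≤m*n n L ⦃ >-nonZero 1≤L ⦄) (m≤n*m (n * L) 64)) κ≥)) ⟩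
      κ * (2 * K) + κ * (u * P₂)  ∎))
      where
      m₁ : ∀ κ z → κ * z + κ * z ≡ 2 * κ * z
      m₁ = solve-∀
      m₂ : ∀ κ K → 2 * κ * K ≡ κ * (2 * K)
      m₂ = solve-∀
    P₁≤ : P₁ ≤ 2 * (L * P₂)
    P₁≤ = begin
      P₁                 ≡⟨ e ⟩
      P₂ * L + r         ≤⟨ +-monoʳ-≤ (P₂ * L) (≤-trans (≤-trans (m≤n*m r 32) r≤) (m≤m*n P₂ L ⦃ >-nonZero 1≤L ⦄)) ⟩
      P₂ * L + P₂ * L    ≡⟨ m₁ P₂ L ⟩
      2 * (L * P₂)       ∎
      where
      m₁ : ∀ q L → q * L + q * L ≡ 2 * (L * q)
      m₁ = solve-∀
    lower : 8 * (K * L) ≤ 8 * C + K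
    lower = *-cancelˡ-≤ α (begin
      α * (8 * (K * L))               ≤⟨ *-monoʳ-≤ α (*-monoʳ-≤ 8 (*-monoˡ-≤ L K≤)) ⟩
      α * (8 * (u * P₂ * L))          ≤⟨ *-monoʳ-≤ α (*-monoʳ-≤ 8 (≤-trans (≤-reflexive (*-assoc u P₂ L)) (*-monoʳ-≤ u (≤-of-+ r e)))) ⟩
      α * (8 * (u * P₁))              ≡⟨ m₁ α (u * P₁) ⟩
      8 * (α * (u * P₁))              ≤⟨ *-monoʳ-≤ 8 C≥ ⟩
      8 * (α * C + n * (u * P₁))      ≤⟨ *-monoʳ-≤ 8 (+-monoʳ-≤ (α * C) (*-monoʳ-≤ n (*-monoʳ-≤ u P₁≤))) ⟩
      8 * (α * C + n * (u * (2 * (L * P₂)))) ≡⟨ m₂ α C n u L P₂ ⟩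
      α * (8 * C) + 16 * (n * L) * (u * P₂)  ≤⟨ +-monoʳ-≤ _ (*-monoʳ-≤ (16 * (n * L)) uP₂≤) ⟩
      α * (8 * C) + 16 * (n * L) * (2 * K)   ≤⟨ +-monoʳ-≤ _ (≤-trans (≤-of-+ (32 * (n * L) * K) (m₃ (n * L) K)) (*-monoˡ-≤ K α≥)) ⟩
      α * (8 * C) + α * K             ≡⟨ sym (*-distribˡ-+ α (8 * C) K) ⟩
      α * (8 * C + K)                 ∎)
      where
      m₁ : ∀ α z → α * (8 * z) ≡ 8 * (α * z)
      m₁ = solve-∀
      m₂ : ∀ α C n u L q → 8 * (α * C + n * (u * (2 * (L * q)))) ≡ α * (8 * C) + 16 * (n * L) * (u * q)
      m₂ = solve-∀
      m₃ : ∀ z K → 64 * z * K ≡ 16 * z * (2 * K) + 32 * z * K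
      m₃ = solve-∀

-- Congruences characterising powers of two

4^≡2^*2^ : ∀ n → 4 ^ n ≡ 2 ^ n * 2 ^ n
4^≡2^*2^ n = *-^ 2 2 n

-- (w − p)(p w + 1) ≡ 0 and 0 ≤ … < m, respectively (w + p)(p w − 1) ≡ 0.
power-of-two-unique : ∀ {m w p C} → 2 ≤ p → 2 * p * (w * w) + 2 * w * (p * p) + (2 * p + 2 * w) < m
  → Cong m (3 * (p * C) + 2) (2 * (p * p))
  → Cong m (3 * (w * C) + 2) (2 * (w * w)) ⊎ Cong m (3 * (w * C) + 2 * (w * w)) 2 → w ≡ p
power-of-two-unique {m} {w} {p} {C} 2≤p bound hp (inj₁ hw) =
  *-cancelʳ-≡ w p (suc (p * w)) (*-cancelˡ-≡ _ _ 2 (trans (l₁ w p) (trans eq (l₂ w p))))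
  where
  l₁ : ∀ w p → 2 * (w * suc (p * w)) ≡ p * (2 * (w * w)) + 2 * w
  l₁ = solve-∀
  l₂ : ∀ w p → w * (2 * (p * p)) + 2 * p ≡ 2 * (p * suc (p * w))
  l₂ = solve-∀
  l₃ : ∀ w p C → p * (3 * (w * C) + 2) + 2 * w ≡ w * (3 * (p * C) + 2) + 2 * p
  l₃ = solve-∀
  b₁ : ∀ w p → 2 * p * (w * w) + 2 * w * (p * p) + (2 * p + 2 * w) ≡ p * (2 * (w * w)) + 2 * w + (2 * w * (p * p) + 2 * p)
  b₁ = solve-∀
  b₂ : ∀ w p → 2 * p * (w * w) + 2 * w * (p * p) + (2 * p + 2 * w) ≡ w * (2 * (p * p)) + 2 * p + (2 * p * (w * w) + 2 * w)
  b₂ = solve-∀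
  eq : p * (2 * (w * w)) + 2 * w ≡ w * (2 * (p * p)) + 2 * p
  eq = cong-small (cong-trans (cong-+ (cong-*ˡ p (cong-sym hw)) (cong-refl {a = 2 * w}))
                    (cong-trans (cong-reflexive (l₃ w p C)) (cong-+ (cong-*ˡ w hp) (cong-refl {a = 2 * p}))))
         (≤-<-trans (≤-of-+ _ (b₁ w p)) bound) (≤-<-trans (≤-of-+ _ (b₂ w p)) bound)
power-of-two-unique {m} {w} {p} {C} 2≤p bound hp (inj₂ hw) = contradiction (m*n≡1⇒m≡1 p w pw≡1) (λ { refl → <-irrefl refl 2≤p })
  where
  l₃ : ∀ w p C → p * (3 * (w * C) + 2 * (w * w)) + w * (2 * (p * p)) ≡ 2 * p * (w * w) + 2 * w * (p * p) + 3 * (w * (p * C))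
  l₃ = solve-∀
  l₄ : ∀ w p C → p * 2 + w * (3 * (p * C) + 2) ≡ 2 * p + 2 * w + 3 * (w * (p * C))
  l₄ = solve-∀
  eq : 2 * p * (w * w) + 2 * w * (p * p) ≡ 2 * p + 2 * w
  eq = cong-small (cong-+-cancelʳ (subst₂ (Cong m) (l₃ w p C) (l₄ w p C) (cong-+ (cong-*ˡ p hw) (cong-*ˡ w (cong-sym hp)))) cong-refl)
         (≤-<-trans (m≤m+n _ _) bound) (≤-<-trans (m≤n+m (2 * p + 2 * w) (2 * p * (w * w) + 2 * w * (p * p))) bound)
  pw≡1 : p * w ≡ 1
  pw≡1 = *-cancelʳ-≡ (p * w) 1 (2 * (w + p)) ⦃ m*n≢0 2 (w + p) ⦃ _ ⦄ ⦃ >-nonZero (≤-trans (≤-trans (s≤s z≤n) 2≤p) (m≤n+m p w)) ⦄ ⦄ (trans (s₁ p w) (trans eq (s₂ p w)))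
    where
    s₁ : ∀ p w → p * w * (2 * (w + p)) ≡ 2 * p * (w * w) + 2 * w * (p * p)
    s₁ = solve-∀
    s₂ : ∀ p w → 2 * p + 2 * w ≡ 1 * (2 * (w + p))
    s₂ = solve-∀

-- Each factor of V has a task. As y divides V, divisibility of L by y passes to the binomial
-- coefficient. The factor 16 (1 + w²) enters the lower bound for L, which makes the modulus large
-- enough to identify w; with w identified, it makes V large enough for the integer part.
module Bridge (n y w L U a k : ℕ) (1≤n : 1 ≤ n) (1≤y : 1 ≤ y) (1≤L : 1 ≤ L) (U≥ : 64 * (n * L) ≤ U)
              (ea : suc a ≡ U * suc (16 * (y * suc (w * w)))) (ek : suc k ≡ 2 * (U * U * (16 * (y * suc (w * w))))) where

  V : ℕ
  V = 16 * (y * suc (w * w))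

  private
    instance
      nzy : NonZero y
      nzy = >-nonZero 1≤y
      nzL : NonZero L
      nzL = >-nonZero 1≤L

  16ww≤V : 16 * suc (w * w) ≤ V
  16ww≤V = *-monoʳ-≤ 16 (m≤n*m (suc (w * w)) y)

  1≤V : 1 ≤ V
  1≤V = ≤-trans (s≤s z≤n) 16ww≤V

  open Approximation n V U L a k 1≤n 1≤V 1≤L U≥ ea ek public

  private
    64≤U : 64 ≤ U
    64≤U = ≤-trans (*-mono-≤ {x = 64} {y = 64} ≤-refl (*-mono-≤ 1≤n 1≤L)) U≥
    U≤α : U ≤ α
    U≤α = ≤-trans (m≤m*n U (suc V)) (≤-reflexive (sym ea))
    2α≤κ : 2 * α ≤ κ
    2α≤κ = begin
      2 * α             ≡⟨ cong (2 *_) ea ⟩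
      2 * (U * suc V)   ≤⟨ *-monoʳ-≤ 2 (*-monoʳ-≤ U (+-monoˡ-≤ V 1≤V)) ⟩
      2 * (U * (V + V)) ≡⟨ l U V ⟩
      2 * (U * 2 * V)   ≤⟨ *-monoʳ-≤ 2 (*-monoˡ-≤ V (*-monoʳ-≤ U (≤-trans (s≤s (s≤s z≤n)) 64≤U))) ⟩
      2 * (U * U * V)   ≡⟨ sym ek ⟩
      κ                 ∎
      where
      open ≤-Reasoning
      l : ∀ U V → 2 * (U * (V + V)) ≡ 2 * (U * 2 * V)
      l = solve-∀

  64nL≤α : 64 * (n * L) ≤ α
  64nL≤α = ≤-trans U≥ U≤α

  64nL≤κ : 64 * (n * L) ≤ κ
  64nL≤κ = ≤-trans 64nL≤α (≤-trans (m≤m+n α (α + 0)) 2α≤κ)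

  -- Y k N ≡ N modulo k, so the hypothesis fixes N only up to sign modulo k. Since k is large, any N
  -- other than n + 1 is at least 2n + 2; then Y k N ≥ 2C, and already 4C + Y k N ≤ 4 Y k N L.
  index-unique : ∀ N → Cong± k (Y k N) (suc n) → 4 * (Y k N * L) < 4 * C + Y k N → N ≡ suc n
  index-unique N h close with N + suc n <? k
  ... | yes lt = cong±-small (cong±-trans (inj₁ (cong-sym (Y-mod k N))) h) lt
  ... | no ¬lt = contradiction close (≤⇒≯ (begin
      4 * C + Y k N             ≤⟨ +-monoˡ-≤ (Y k N) (≤-trans (≤-reflexive (l₁ C)) (*-monoʳ-≤ 2 2C≤)) ⟩
      2 * Y k N + Y k N         ≤⟨ ≤-of-+ (Y k N) (l₂ (Y k N)) ⟩
      4 * Y k N                 ≤⟨ *-monoʳ-≤ 4 (m≤m*n (Y k N) L) ⟩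
      4 * (Y k N * L)           ∎))
    where
    open ≤-Reasoning
    l₁ : ∀ c → 4 * c ≡ 2 * (2 * c)
    l₁ = solve-∀
    l₂ : ∀ c → 4 * c ≡ 2 * c + c + c
    l₂ = solve-∀
    N≥ : 2 + (n + n) ≤ N
    N≥ = +-cancelʳ-≤ (suc n) _ _ (≤-trans (≤-pred (begin
        suc (2 + (n + n) + suc n) ≡⟨ l n ⟩
        4 * 1 + 3 * n             ≤⟨ +-monoˡ-≤ (3 * n) (*-monoʳ-≤ 4 1≤n) ⟩
        4 * n + 3 * n             ≤⟨ ≤-of-+ (57 * n) (l′ n) ⟩
        64 * n                    ≤⟨ *-monoʳ-≤ 64 (m≤m*n n L) ⟩
        64 * (n * L)              ≤⟨ 64nL≤κ ⟩
        suc k                     ∎)) (≮⇒≥ ¬lt))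
      where
      l : ∀ n → suc (2 + (n + n) + suc n) ≡ 4 * 1 + 3 * n
      l = solve-∀
      l′ : ∀ n → 64 * n ≡ 4 * n + 3 * n + 57 * n
      l′ = solve-∀
    2α≤ : 2 * α ≤ suc (2 * k)
    2α≤ = ≤-trans 2α≤κ (s≤s (m≤m+n k (k + 0)))
    2C≤ : 2 * C ≤ Y k N
    2C≤ = begin
      2 * C                         ≤⟨ *-mono-≤ {x = 2} {y = 2 * α} (*-monoʳ-≤ 2 (s≤s z≤n)) (Y-upper a (n + n)) ⟩
      (2 * α) ^ suc (n + n)         ≤⟨ ^-monoˡ-≤ (suc (n + n)) 2α≤ ⟩
      suc (2 * k) ^ suc (n + n)     ≤⟨ Y-lower k (suc (n + n)) ⟩
      Y k (2 + (n + n))             ≤⟨ Y-mono-≤ k N≥ ⟩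
      Y k N                         ∎

  sound : ∀ {N m} → Cong± k (Y k N) (suc n)
    → 4 * C < 4 * (Y k N * L) + Y k N → 4 * (Y k N * L) < 4 * C + Y k N
    → 4 * a ≡ suc m → Cong m (3 * (w * C) + 2) (2 * (w * w)) ⊎ Cong m (3 * (w * C) + 2 * (w * w)) 2
    → y ∣ L → w ≡ 2 ^ suc (n + n) × y ∣ binom (n + n) n
  sound {N} {m} hN c₁ c₂ em hw y∣L with index-unique N hN c₂
  ... | refl = w≡p , y∣b
    where
    open ≤-Reasoning
    p = 2 ^ suc (n + n)
    16^ : 16 ^ n ≡ 2 ^ (n + n) * 2 ^ (n + n)
    16^ = trans (*-^ 4 4 n) (cong₂ _*_ e e)
      where
      e : 4 ^ n ≡ 2 ^ (n + n)
      e = trans (*-^ 2 2 n) (sym (^-distribˡ-+-* 2 n n))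
    -- This holds for the unknown w as it stands. Because p² = 4 · 16ⁿ, it makes m exceed all terms
    -- of the congruences for w and p.
    bigL : 16 ^ n * suc (w * w) ≤ L
    bigL = begin
      16 ^ n * suc (w * w)      ≤⟨ *-monoʳ-≤ (16 ^ n) (≤-trans (≤-reflexive (sym (*-identityʳ (suc (w * w))))) (^-monoʳ-≤ (suc (w * w)) 1≤n)) ⟩
      16 ^ n * suc (w * w) ^ n  ≡⟨ sym (*-^ 16 (suc (w * w)) n) ⟩
      (16 * suc (w * w)) ^ n    ≤⟨ ^-monoˡ-≤ n (≤-trans 16ww≤V (m≤n+m V 2)) ⟩
      (2 + V) ^ n               ≤⟨ close⇒≥ c₁ ⟩
      L                         ∎
    1≤p : 1 ≤ p
    1≤p = m^n>0 2 (suc (n + n))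
    bound : 2 * p * (w * w) + 2 * w * (p * p) + (2 * p + 2 * w) < m
    bound = ≤-pred (begin
      suc (suc (2 * p * (w * w) + 2 * w * (p * p) + (2 * p + 2 * w)))
        ≤⟨ s≤s (s≤s (+-mono-≤ (+-monoˡ-≤ (2 * w * (p * p)) (*-monoˡ-≤ (w * w) (*-monoʳ-≤ 2 p≤pp))) (+-mono-≤ (*-monoʳ-≤ 2 p≤pp) (*-monoʳ-≤ 2 (m≤m*n w (p * p) ⦃ m*n≢0 p p ⦃ >-nonZero 1≤p ⦄ ⦃ >-nonZero 1≤p ⦄ ⦄))))) ⟩
      suc (suc (2 * (p * p) * (w * w) + 2 * w * (p * p) + (2 * (p * p) + 2 * (w * (p * p)))))
        ≡⟨ cong (2 ℕ.+_) (s₁ w (p * p)) ⟩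
      2 + 2 * (p * p) * (w * w + 2 * w + 1)
        ≤⟨ +-monoʳ-≤ 2 (*-monoʳ-≤ (2 * (p * p)) w-bound) ⟩
      2 + 2 * (p * p) * (2 * suc (w * w))
        ≡⟨ cong (2 ℕ.+_) (trans (s₂ (2 ^ (n + n)) (suc (w * w))) (cong (λ z → 16 * (z * suc (w * w))) (sym 16^))) ⟩
      2 + 16 * (16 ^ n * suc (w * w))
        ≤⟨ +-monoʳ-≤ 2 (*-monoʳ-≤ 16 bigL) ⟩
      2 + 16 * L
        ≤⟨ +-cancelʳ-≤ 4 _ _ final ⟩
      4 * a ≡⟨ em ⟩
      suc m ∎)
      where
      p≤pp : p ≤ p * p
      p≤pp = m≤m*n p p ⦃ >-nonZero 1≤p ⦄
      s₁ : ∀ w q → 2 * q * (w * w) + 2 * w * q + (2 * q + 2 * (w * q)) ≡ 2 * q * (w * w + 2 * w + 1)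
      s₁ = solve-∀
      s₂ : ∀ q s → 2 * (2 * q * (2 * q)) * (2 * s) ≡ 16 * (q * q * s)
      s₂ = solve-∀
      w-bound : w * w + 2 * w + 1 ≤ 2 * suc (w * w)
      w-bound = go w
        where
        g : ∀ v → 2 * suc (suc v * suc v) ≡ suc v * suc v + 2 * suc v + 1 + v * v
        g = solve-∀
        go : ∀ w → w * w + 2 * w + 1 ≤ 2 * suc (w * w)
        go zero = s≤s z≤n
        go (suc v) = ≤-of-+ (v * v) (g v)
      final : 2 + 16 * L + 4 ≤ 4 * a + 4
      final = begin
        2 + 16 * L + 4     ≤⟨ +-monoˡ-≤ 4 (+-monoˡ-≤ (16 * L) (*-mono-≤ {x = 2} {y = 2} ≤-refl 1≤L)) ⟩
        2 * L + 16 * L + 4 * 1 ≤⟨ +-monoʳ-≤ (2 * L + 16 * L) (*-monoʳ-≤ 4 1≤L) ⟩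
        2 * L + 16 * L + 4 * L ≤⟨ ≤-of-+ (42 * L) (t₁ L) ⟩
        64 * L             ≤⟨ *-monoʳ-≤ 64 (m≤n*m L n ⦃ >-nonZero 1≤n ⦄) ⟩
        64 * (n * L)       ≤⟨ 64nL≤α ⟩
        suc a              ≤⟨ m≤m+n (suc a) (3 * suc a) ⟩
        4 * suc a          ≡⟨ t₂ a ⟩
        4 * a + 4          ∎
        where
        t₁ : ∀ L → 64 * L ≡ 2 * L + 16 * L + 4 * L + 42 * L
        t₁ = solve-∀
        t₂ : ∀ a → 4 * suc a ≡ 4 * a + 4
        t₂ = solve-∀
    w≡p : w ≡ p
    w≡p = power-of-two-unique {C = C} (*-mono-≤ {x = 2} {y = 2} ≤-refl (m^n>0 2 (n + n))) bound
            (subst (Cong m (3 * (p * C) + 2)) (cong (2 *_) (4^≡2^*2^ (suc (n + n)))) (2^-Y-cong a m em (suc (n + n)))) hw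
    y∣b : y ∣ binom (n + n) n
    y∣b with Expansion.central-expansion V n 1≤n 1≤V
    -- Once w = p, V is at least 32 · 2²ⁿ, so the remainder is at most Vⁿ / 32 and L is the integer
    -- part, that is, the binomial coefficient plus V t. Both L and V are divisible by y.
    ... | r , t , e , r≤ = ∣m+n∣m⇒∣n (subst (y ∣_) (trans (close⇒≡ e 32r≤ c₁ c₂) (+-comm (binom (n + n) n) (V * t))) y∣L)
                             (∣m⇒∣m*n t (∣n⇒∣m*n 16 (m∣m*n (suc (w * w)))))
      where
      32r≤ : 32 * r ≤ V ^ n
      32r≤ = *-cancelˡ-≤ (2 ^ (n + n)) ⦃ m^n≢0 2 (n + n) ⦄ (begin
        2 ^ (n + n) * (32 * r)  ≡⟨ u₁ (2 ^ (n + n)) r ⟩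
        r * (16 * (1 * (2 * 2 ^ (n + n))))  ≤⟨ *-monoʳ-≤ r (*-monoʳ-≤ 16 (*-monoˡ-≤ p 1≤p)) ⟩
        r * (16 * (p * p))      ≡⟨ cong (λ z → r * (16 * (z * z))) (sym w≡p) ⟩
        r * (16 * (w * w))      ≤⟨ *-monoʳ-≤ r (≤-trans (*-monoʳ-≤ 16 (n≤1+n (w * w))) 16ww≤V) ⟩
        r * V                   ≤⟨ r≤ ⟩
        2 ^ (n + n) * V ^ n     ∎)
        where
        u₁ : ∀ q r → q * (32 * r) ≡ r * (16 * (1 * (2 * q)))
        u₁ = solve-∀

-- Adding V t, a multiple of 16 y, to y q with q odd leaves an odd multiple of y. So L may be sought
-- in the form y (2l + 1), which is nonzero for every integer l. L is fixed before U, a and k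
-- because those depend on it.
bridge-complete : ∀ n y → 1 ≤ n → 1 ≤ y → ∀ {q} → Odd q → binom (n + n) n ≡ y * q →
  let w = 2 ^ suc (n + n) in ∃ λ l → let L = y * suc (2 * l) in
  ∀ U a k → 64 * (n * L) ≤ U → suc a ≡ U * suc (16 * (y * suc (w * w))) → suc k ≡ 2 * (U * U * (16 * (y * suc (w * w)))) →
  8 * Y a (suc (n + n)) ≤ 8 * (Y k (suc n) * L) + Y k (suc n) × 8 * (Y k (suc n) * L) ≤ 8 * Y a (suc (n + n)) + Y k (suc n)
bridge-complete n y 1≤n 1≤y {q} (l₀ , refl) eb
  with Expansion.central-expansion (16 * (y * suc (2 ^ suc (n + n) * 2 ^ suc (n + n)))) n 1≤n
         (≤-trans (m≤m*n 1 16) (*-monoʳ-≤ 16 (*-mono-≤ {x = 1} {u = 1} 1≤y (s≤s z≤n))))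
... | r , t , e , r≤ = l , concl
  where
  w = 2 ^ suc (n + n)
  V = 16 * (y * suc (w * w))
  l = l₀ + 8 * (suc (w * w) * t)
  L = y * suc (2 * l)
  L≡ : binom (n + n) n + V * t ≡ L
  L≡ = trans (cong (_+ V * t) eb) (s y l₀ (suc (w * w)) t)
    where
    s : ∀ y l₀ z t → y * suc (2 * l₀) + 16 * (y * z) * t ≡ y * suc (2 * (l₀ + 8 * (z * t)))
    s = solve-∀
  1≤w : 1 ≤ w
  1≤w = m^n>0 2 (suc (n + n))
  32r≤ : 32 * r ≤ V ^ n
  32r≤ = *-cancelˡ-≤ (2 ^ (n + n)) ⦃ m^n≢0 2 (n + n) ⦄ (begin
        2 ^ (n + n) * (32 * r)  ≡⟨ u₁ (2 ^ (n + n)) r ⟩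
        r * (16 * (1 * (2 * 2 ^ (n + n))))  ≤⟨ *-monoʳ-≤ r (*-monoʳ-≤ 16 (*-monoˡ-≤ w 1≤w)) ⟩
        r * (16 * (w * w))      ≤⟨ *-monoʳ-≤ r (*-monoʳ-≤ 16 (≤-trans (n≤1+n (w * w)) (m≤n*m (suc (w * w)) y ⦃ >-nonZero 1≤y ⦄))) ⟩
        r * V                   ≤⟨ r≤ ⟩
        2 ^ (n + n) * V ^ n     ∎)
        where
        open ≤-Reasoning
        u₁ : ∀ q r → q * (32 * r) ≡ r * (16 * (1 * (2 * q)))
        u₁ = solve-∀
  concl : ∀ U a k → 64 * (n * L) ≤ U → suc a ≡ U * suc V → suc k ≡ 2 * (U * U * V) →
    8 * Y a (suc (n + n)) ≤ 8 * (Y k (suc n) * L) + Y k (suc n) × 8 * (Y k (suc n) * L) ≤ 8 * Y a (suc (n + n)) + Y k (suc n)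
  concl U a k U≥ ea ek = Bridge.≡⇒close n y w L U a k 1≤n 1≤y (*-mono-≤ {x = 1} {u = 1} 1≤y (s≤s z≤n)) U≥ ea ek
    (trans e (cong (λ z → V ^ n * z + r) L≡)) 32r≤

-- Coding a polynomial equation by digits

pos-^ : ∀ m n → + (m ^ n) ≡ (+ m) ℤ.^ n
pos-^ m zero = refl
pos-^ m (suc n) = trans (ℤ.pos-* m (m ^ n)) (cong (+ m ℤ.*_) (pos-^ m n))

Σℤ : ∀ {A : Set} → (A → ℤ) → List A → ℤ
Σℤ f [] = + 0
Σℤ f (x ∷ xs) = f x ℤ.+ Σℤ f xs

Σℕ : ∀ {A : Set} → (A → ℕ) → List A → ℕ
Σℕ f [] = 0
Σℕ f (x ∷ xs) = f x + Σℕ f xs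

module _ {A : Set} where

  Σℤ-++ : ∀ (f : A → ℤ) xs ys → Σℤ f (xs ++ ys) ≡ Σℤ f xs ℤ.+ Σℤ f ys
  Σℤ-++ f [] ys = sym (ℤ.+-identityˡ _)
  Σℤ-++ f (x ∷ xs) ys = trans (cong (ℤ._+_ (f x)) (Σℤ-++ f xs ys)) (sym (ℤ.+-assoc (f x) _ _))

  Σℤ-map : ∀ {B : Set} (f : B → ℤ) (h : A → B) xs → Σℤ f (List.map h xs) ≡ Σℤ (f ∘ h) xs
  Σℤ-map f h [] = refl
  Σℤ-map f h (x ∷ xs) = cong (ℤ._+_ (f (h x))) (Σℤ-map f h xs)

  Σℤ-*ˡ : ∀ c (f : A → ℤ) xs → Σℤ (λ x → c ℤ.* f x) xs ≡ c ℤ.* Σℤ f xs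
  Σℤ-*ˡ c f [] = sym (ℤ.*-zeroʳ c)
  Σℤ-*ˡ c f (x ∷ xs) = trans (cong (ℤ._+_ (c ℤ.* f x)) (Σℤ-*ˡ c f xs)) (sym (ℤ.*-distribˡ-+ c (f x) _))

  Σℤ-cong : ∀ {f h : A → ℤ} → (∀ x → f x ≡ h x) → ∀ xs → Σℤ f xs ≡ Σℤ h xs
  Σℤ-cong e [] = refl
  Σℤ-cong e (x ∷ xs) = cong₂ ℤ._+_ (e x) (Σℤ-cong e xs)

vsum : ∀ {n} → Vec ℤ n → ℤ
vsum [] = + 0
vsum (x ∷ xs) = x ℤ.+ vsum xs

-- The exponent vectors of (1 + X₀ + … )ᵈ, listed with multiplicity.
bumps : ∀ {n} → Vec ℕ n → List (Vec ℕ n)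
bumps [] = []
bumps (e ∷ es) = (suc e ∷ es) ∷ List.map (e ∷_) (bumps es)

zeros : ∀ n → Vec ℕ n
zeros zero = []
zeros (suc n) = 0 ∷ zeros n

grow : ∀ {n} → List (Vec ℕ n) → List (Vec ℕ n)
grow [] = []
grow (e ∷ es) = (e ∷ bumps e) ++ grow es

powers : ∀ n → ℕ → List (Vec ℕ n)
powers n zero = zeros n ∷ []
powers n (suc d) = grow (powers n d)

bumps-sum : ∀ {n} (e : Vec ℕ n) v → Σℤ (λ e′ → monVal e′ v) (bumps e) ≡ vsum v ℤ.* monVal e v
bumps-sum [] [] = refl
bumps-sum (e ∷ es) (x ∷ xs) = trans (cong (ℤ._+_ (x ℤ.* x ℤ.^ e ℤ.* monVal es xs))
  (trans (Σℤ-map (λ e′ → monVal e′ (x ∷ xs)) (e ∷_) (bumps es)) (trans (Σℤ-*ˡ (x ℤ.^ e) (λ e′ → monVal e′ xs) (bumps es)) (cong (x ℤ.^ e ℤ.*_) (bumps-sum es xs)))))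
  (l x (x ℤ.^ e) (monVal es xs) (vsum xs))
  where
  l : ∀ x p m s → x ℤ.* p ℤ.* m ℤ.+ p ℤ.* (s ℤ.* m) ≡ (x ℤ.+ s) ℤ.* (p ℤ.* m)
  l = ℤ-Solver.solve-∀

grow-sum : ∀ {n} (es : List (Vec ℕ n)) v → Σℤ (λ e → monVal e v) (grow es) ≡ (+ 1 ℤ.+ vsum v) ℤ.* Σℤ (λ e → monVal e v) es
grow-sum [] v = sym (ℤ.*-zeroʳ (+ 1 ℤ.+ vsum v))
grow-sum (e ∷ es) v = trans (Σℤ-++ (λ e → monVal e v) (e ∷ bumps e) (grow es))
  (trans (cong₂ (λ p q → monVal e v ℤ.+ p ℤ.+ q) (bumps-sum e v) (grow-sum es v))
    (l (vsum v) (monVal e v) (Σℤ (λ e → monVal e v) es)))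
  where
  l : ∀ s m t → m ℤ.+ s ℤ.* m ℤ.+ (+ 1 ℤ.+ s) ℤ.* t ≡ (+ 1 ℤ.+ s) ℤ.* (m ℤ.+ t)
  l = ℤ-Solver.solve-∀

monVal-zeros : ∀ {n} (v : Vec ℤ n) → monVal (zeros n) v ≡ + 1
monVal-zeros [] = refl
monVal-zeros (x ∷ xs) = trans (ℤ.*-identityˡ _) (monVal-zeros xs)

powers-sum : ∀ n d (v : Vec ℤ n) → Σℤ (λ e → monVal e v) (powers n d) ≡ (+ 1 ℤ.+ vsum v) ℤ.^ d
powers-sum n zero v = trans (ℤ.+-identityʳ _) (monVal-zeros v)
powers-sum n (suc d) v = trans (grow-sum (powers n d) v) (cong ((+ 1 ℤ.+ vsum v) ℤ.*_) (powers-sum n d v))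

bumps-deg : ∀ {n} (e : Vec ℕ n) → All (λ e′ → expDeg e′ ≡ suc (expDeg e)) (bumps e)
bumps-deg [] = []
bumps-deg (e ∷ es) = refl ∷ All.map⁺ (All.map (λ p → trans (cong (e ℕ.+_) p) (+-suc e _)) (bumps-deg es))
  where import Data.List.Relation.Unary.All.Properties as All

grow-deg : ∀ {n d} {es : List (Vec ℕ n)} → All (λ e → expDeg e ≤ d) es → All (λ e → expDeg e ≤ suc d) (grow es)
grow-deg [] = []
grow-deg (_∷_ {x = e} p ps) = All.++⁺ (m≤n⇒m≤1+n p ∷ All.map (λ q → ≤-trans (≤-reflexive q) (s≤s p)) (bumps-deg e)) (grow-deg ps)
  where import Data.List.Relation.Unary.All.Properties as All

powers-deg : ∀ n d → All (λ e → expDeg e ≤ d) (powers n d)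
powers-deg n zero = ≤-reflexive (z n) ∷ []
  where
  z : ∀ n → expDeg (zeros n) ≡ 0
  z zero = refl
  z (suc n) = z n
powers-deg n (suc d) = grow-deg (powers-deg n d)

unbump : ∀ {n d} (e : Vec ℕ n) → expDeg e ≡ suc d → ∃ λ e′ → expDeg e′ ≡ d × e ∈ bumps e′
unbump (zero ∷ es) p with unbump es p
... | e′ , q , m = 0 ∷ e′ , q , there (∈-map⁺ (0 ∷_) m)
unbump (suc e ∷ es) p = e ∷ es , suc-injective p , here refl

grow-∈ : ∀ {n} {e e′ : Vec ℕ n} {es} → e′ ∈ es → e ∈ (e′ ∷ bumps e′) → e ∈ grow es
grow-∈ {es = x ∷ es} (here refl) q = ∈-++⁺ˡ q
grow-∈ {es = x ∷ es} (there p) q = ∈-++⁺ʳ (x ∷ bumps x) (grow-∈ p q)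

expDeg≡0⇒zeros : ∀ {n} (e : Vec ℕ n) → expDeg e ≡ 0 → e ≡ zeros n
expDeg≡0⇒zeros [] _ = refl
expDeg≡0⇒zeros (zero ∷ es) p = cong (0 ∷_) (expDeg≡0⇒zeros es p)

∈-powers : ∀ {n} d (e : Vec ℕ n) → expDeg e ≤ d → e ∈ powers n d
∈-powers zero e p = here (expDeg≡0⇒zeros e (n≤0⇒n≡0 p))
∈-powers (suc d) e p with m≤n⇒m<n∨m≡n p
... | inj₁ (s≤s q) = grow-∈ (∈-powers d e q) (here refl)
... | inj₂ q with unbump e q
...   | e′ , r , m = grow-∈ (∈-powers d e′ (≤-reflexive r)) (there m)

ind : ℕ → ℕ → ℕ
ind m n with m ≟ n
... | yes _ = 1
... | no _ = 0

ind-refl : ∀ m → ind m m ≡ 1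
ind-refl m with m ≟ m
... | yes _ = refl
... | no p = contradiction refl p

module Coefficients (n δ : ℕ) where

  β : ℕ
  β = suc δ

  -- The exponents as digits in base δ + 1: monomials of degree at most δ get distinct codes.
  enc : ∀ {n} → Vec ℕ n → ℕ
  enc [] = 0
  enc (e ∷ es) = e + β * enc es

  expansion : List (Vec ℕ n)
  expansion = powers n δ

  enc-< : ∀ {n} (e : Vec ℕ n) → expDeg e ≤ δ → enc e < β ^ n
  enc-< [] p = s≤s z≤n
  enc-< {suc n} (e ∷ es) p = begin-strict
    e + β * enc es  ≤⟨ +-monoˡ-≤ _ (≤-trans (m≤m+n e _) p) ⟩
    δ + β * enc es  <⟨ n<1+n _ ⟩
    β + β * enc es  ≡⟨ sym (*-suc β (enc es)) ⟩
    β * suc (enc es) ≤⟨ *-monoʳ-≤ β (enc-< es (≤-trans (m≤n+m _ e) p)) ⟩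
    β * β ^ n ∎
    where open ≤-Reasoning

  enc-injective : ∀ {n} (e e′ : Vec ℕ n) → expDeg e ≤ δ → expDeg e′ ≤ δ → enc e ≡ enc e′ → e ≡ e′
  enc-injective [] [] _ _ _ = refl
  enc-injective (e ∷ es) (e′ ∷ es′) p p′ h
    with cong-small {β} {e} {e′} (enc es , enc es′ , trans (cong (e ℕ.+_) (*-comm (enc es) β)) (trans h (cong (e′ ℕ.+_) (*-comm β (enc es′)))))
           (s≤s (≤-trans (m≤m+n e _) p)) (s≤s (≤-trans (m≤m+n e′ _) p′))
  ... | refl = cong (e ∷_) (enc-injective es es′ (≤-trans (m≤n+m _ e) p) (≤-trans (m≤n+m _ e) p′)
                 (*-cancelˡ-≡ _ _ β (+-cancelˡ-≡ e _ _ h)))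

  -- The multinomial coefficient of the monomial in the δ-th power of 1 plus the sum of the
  -- variables, obtained by counting instead of by factorials.
  multiplicity : Vec ℕ n → ℕ
  multiplicity e₀ = Σℕ (λ e → ind (enc e) (enc e₀)) expansion

  multiplicity>0 : ∀ e₀ → expDeg e₀ ≤ δ → 0 < multiplicity e₀
  multiplicity>0 e₀ p = go (∈-powers δ e₀ p)
    where
    go : ∀ {es} → e₀ ∈ es → 0 < Σℕ (λ e → ind (enc e) (enc e₀)) es
    go (here refl) = ≤-trans (≤-reflexive (sym (ind-refl (enc e₀)))) (m≤m+n _ _)
    go (there m) = ≤-trans (go m) (m≤n+m _ _)

  multiplicity-sum : ∀ e₀ → expDeg e₀ ≤ δ → ∀ d x →
    Σℤ (λ e → + ind (enc e) (enc e₀) ℤ.* (d ℤ.* monVal e x)) expansion ≡ d ℤ.* (+ multiplicity e₀) ℤ.* monVal e₀ x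
  multiplicity-sum e₀ p d x = go (powers-deg n δ)
    where
    l : ∀ i j d m → i ℤ.* (d ℤ.* m) ℤ.+ d ℤ.* j ℤ.* m ≡ d ℤ.* (i ℤ.+ j) ℤ.* m
    l = ℤ-Solver.solve-∀
    eq : ∀ e → expDeg e ≤ δ → + ind (enc e) (enc e₀) ℤ.* (d ℤ.* monVal e x) ≡ + ind (enc e) (enc e₀) ℤ.* (d ℤ.* monVal e₀ x)
    eq e q with enc e ≟ enc e₀
    ... | yes h = cong (λ z → + 1 ℤ.* (d ℤ.* monVal z x)) (enc-injective e e₀ q p h)
    ... | no _ = refl
    go : ∀ {es} → All (λ e → expDeg e ≤ δ) es →
      Σℤ (λ e → + ind (enc e) (enc e₀) ℤ.* (d ℤ.* monVal e x)) es ≡ d ℤ.* (+ Σℕ (λ e → ind (enc e) (enc e₀)) es) ℤ.* monVal e₀ x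
    go [] = sym (trans (cong (ℤ._* monVal e₀ x) (ℤ.*-zeroʳ d)) refl)
    go (_∷_ {x = e} {xs = es} q qs) = trans (cong₂ ℤ._+_ (eq e q) (go qs))
      (trans (l (+ ind (enc e) (enc e₀)) (+ Σℕ (λ e → ind (enc e) (enc e₀)) es) d (monVal e₀ x))
        (cong (λ z → d ℤ.* z ℤ.* monVal e₀ x) (sym (ℤ.pos-+ (ind (enc e) (enc e₀)) _))))

  -- Coefficients d with Σ d · multiplicity e · Xᵉ = scale · P; the factor 4 separates digits.
  scaled : Poly n → ℕ × Poly n
  scaled [] = 4 , []
  scaled ((c , e) ∷ ms) = let s , ds = scaled ms ; k = multiplicity e in
    k * s , (c ℤ.* + s , e) ∷ List.map (λ (d , e′) → + k ℤ.* d , e′) ds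

  scale>0 : ∀ P → All (λ m → expDeg (proj₂ m) ≤ δ) P → 0 < proj₁ (scaled P)
  scale>0 [] [] = z<s
  scale>0 ((c , e) ∷ ms) (p ∷ ps) = *-mono-≤ {x = 1} {u = 1} (multiplicity>0 e p) (scale>0 ms ps)

  4∣scale : ∀ P → 4 ∣ proj₁ (scaled P)
  4∣scale [] = ∣-refl
  4∣scale ((c , e) ∷ ms) = ∣n⇒∣m*n (multiplicity e) (4∣scale ms)

  scaled-deg : ∀ P → All (λ m → expDeg (proj₂ m) ≤ δ) P → All (λ m → expDeg (proj₂ m) ≤ δ) (proj₂ (scaled P))
  scaled-deg [] [] = []
  scaled-deg ((c , e) ∷ ms) (p ∷ ps) = p ∷ All.map⁺ (scaled-deg ms ps)
    where import Data.List.Relation.Unary.All.Properties as All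

  scaled-sum : ∀ P x → Σℤ (λ (d , e) → d ℤ.* (+ multiplicity e) ℤ.* monVal e x) (proj₂ (scaled P)) ≡ + proj₁ (scaled P) ℤ.* eval P x
  scaled-sum [] x = refl
  scaled-sum ((c , e) ∷ ms) x = trans (cong (ℤ._+_ (c ℤ.* + s ℤ.* + k ℤ.* monVal e x))
      (trans (Σℤ-map _ (λ (d , e′) → + k ℤ.* d , e′) ds)
        (trans (Σℤ-cong (λ (d , e′) → l₁ (+ k) d (+ multiplicity e′) (monVal e′ x)) ds)
          (trans (Σℤ-*ˡ (+ k) _ ds) (cong (+ k ℤ.*_) (scaled-sum ms x))))))
    (trans (l₂ c (+ s) (+ k) (monVal e x) (eval ms x)) (cong (ℤ._* (c ℤ.* monVal e x ℤ.+ eval ms x)) (sym (ℤ.pos-* k s))))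
    where
    s = proj₁ (scaled ms)
    ds = proj₂ (scaled ms)
    k = multiplicity e
    l₁ : ∀ k d c m → k ℤ.* d ℤ.* c ℤ.* m ≡ k ℤ.* (d ℤ.* c ℤ.* m)
    l₁ = ℤ-Solver.solve-∀
    l₂ : ∀ c s k m r → c ℤ.* s ℤ.* k ℤ.* m ℤ.+ k ℤ.* (s ℤ.* r) ≡ k ℤ.* s ℤ.* (c ℤ.* m ℤ.+ r)
    l₂ = ℤ-Solver.solve-∀

int-cong : ∀ b c m q → + b ℤ.+ + m ℤ.* q ≡ + c → Cong m b c
int-cong b c m (+ k) e = k , 0 , trans (ℤ.+-injective (trans (ℤ.pos-+ b (k * m)) (trans (cong (ℤ._+_ (+ b)) (trans (cong +_ (*-comm k m)) (ℤ.pos-* m k))) e))) (sym (+-identityʳ c))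
int-cong b c m -[1+ k ] e = 0 , suc k , trans (+-identityʳ b) (ℤ.+-injective
  (trans (l (+ b) (+ m) (+ suc k)) (trans (cong₂ ℤ._+_ e (trans (sym (ℤ.pos-* m (suc k))) (cong +_ (*-comm m (suc k))))) (sym (ℤ.pos-+ c (suc k * m))))))
  where
  l : ∀ b m k → b ≡ b ℤ.+ m ℤ.* (ℤ.- k) ℤ.+ m ℤ.* k
  l = ℤ-Solver.solve-∀

ℤ-*-^ : ∀ x y n → (x ℤ.* y) ℤ.^ n ≡ x ℤ.^ n ℤ.* y ℤ.^ n
ℤ-*-^ x y zero = refl
ℤ-*-^ x y (suc n) = trans (cong (x ℤ.* y ℤ.*_) (ℤ-*-^ x y n)) (l x y (x ℤ.^ n) (y ℤ.^ n))
  where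
  l : ∀ x y p q → x ℤ.* y ℤ.* (p ℤ.* q) ≡ x ℤ.* p ℤ.* (y ℤ.* q)
  l = ℤ-Solver.solve-∀

∣^∣ : ∀ x n → ∣ x ℤ.^ n ∣ ≡ ∣ x ∣ ^ n
∣^∣ x zero = refl
∣^∣ x (suc n) = trans (ℤ.abs-* x (x ℤ.^ n)) (cong (∣ x ∣ *_) (∣^∣ x n))

ind-≢ : ∀ {m n} → m ≢ n → ind m n ≡ 0
ind-≢ {m} {n} h with m ≟ n
... | yes e = contradiction e h
... | no _ = refl

∣monVal∣ : ∀ {n b} (e : Vec ℕ n) (x : Vec ℤ n) → VAll.All (λ i → ∣ i ∣ ≤ b) x → ∣ monVal e x ∣ ≤ b ^ expDeg e
∣monVal∣ [] [] [] = ≤-refl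
∣monVal∣ {b = b} (e ∷ es) (x ∷ xs) (p ∷ ps) = begin
  ∣ x ℤ.^ e ℤ.* monVal es xs ∣      ≡⟨ ℤ.abs-* (x ℤ.^ e) (monVal es xs) ⟩
  ∣ x ℤ.^ e ∣ * ∣ monVal es xs ∣    ≤⟨ *-mono-≤ (≤-trans (≤-reflexive (∣^∣ x e)) (^-monoˡ-≤ e p)) (∣monVal∣ es xs ps) ⟩
  b ^ e * b ^ expDeg es             ≡⟨ sym (^-distribˡ-+-* b e (expDeg es)) ⟩
  b ^ (e + expDeg es)               ∎
  where open ≤-Reasoning

Σℕ-≤ : ∀ {A : Set} {Q : A → Set} {f : A → ℕ} {c} → (∀ {x} → Q x → f x ≤ c) → ∀ {xs} → All Q xs → Σℕ f xs ≤ List.length xs * c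
Σℕ-≤ h [] = z≤n
Σℕ-≤ h (p ∷ ps) = +-mono-≤ (h p) (Σℕ-≤ h ps)

-- Numbers written as hi ℬᵐ⁺¹ + c ℬᵐ + lo with m = suc m′ and small c and lo.
module Digits (n δ ℬ m′ : ℕ) (0<ℬ : 0 < ℬ) (em : suc m′ ≡ suc δ ^ n) where

  open Coefficients n δ

  m : ℕ
  m = suc m′

  B^ : ℕ → ℤ
  B^ k = + (ℬ ^ k)

  B^-+ : ∀ i j → B^ (i + j) ≡ B^ i ℤ.* B^ j
  B^-+ i j = trans (cong +_ (^-distribˡ-+-* ℬ i j)) (ℤ.pos-* (ℬ ^ i) (ℬ ^ j))

  private
    instance
      nzℬ : NonZero ℬ
      nzℬ = >-nonZero 0<ℬ

  -- The variables receive the weights ℬ^w, ℬ^(wβ), ℬ^(wβ²), ..., so for w = 1 the monomial with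
  -- exponent vector e is multiplied by ℬ^(enc e).
  weigh : ∀ {k} → ℕ → Vec ℤ k → Vec ℤ k
  weigh w [] = []
  weigh w (x ∷ xs) = x ℤ.* B^ w ∷ weigh (w * β) xs

  monVal-weigh : ∀ {k} w (e : Vec ℕ k) x → monVal e (weigh w x) ≡ monVal e x ℤ.* B^ (w * enc e)
  monVal-weigh w [] [] = cong (λ z → + 1 ℤ.* B^ z) (sym (*-zeroʳ w))
  monVal-weigh w (e ∷ es) (x ∷ xs) = begin
    (x ℤ.* B^ w) ℤ.^ e ℤ.* monVal es (weigh (w * β) xs)
      ≡⟨ cong₂ ℤ._*_ (trans (ℤ-*-^ x (B^ w) e) (cong (x ℤ.^ e ℤ.*_) (trans (sym (pos-^ (ℬ ^ w) e)) (cong +_ (^-*-assoc ℬ w e))))) (monVal-weigh (w * β) es xs) ⟩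
    (x ℤ.^ e ℤ.* B^ (w * e)) ℤ.* (monVal es xs ℤ.* B^ (w * β * enc es))
      ≡⟨ l (x ℤ.^ e) (B^ (w * e)) (monVal es xs) (B^ (w * β * enc es)) ⟩
    x ℤ.^ e ℤ.* monVal es xs ℤ.* (B^ (w * e) ℤ.* B^ (w * β * enc es))
      ≡⟨ cong (x ℤ.^ e ℤ.* monVal es xs ℤ.*_) (trans (sym (B^-+ (w * e) (w * β * enc es))) (cong B^ (l₂ w e β (enc es)))) ⟩
    x ℤ.^ e ℤ.* monVal es xs ℤ.* B^ (w * (e + β * enc es)) ∎
    where
    open ≡-Reasoning
    l : ∀ a b c d → (a ℤ.* b) ℤ.* (c ℤ.* d) ≡ a ℤ.* c ℤ.* (b ℤ.* d)
    l = ℤ-Solver.solve-∀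
    l₂ : ∀ w e β c → w * e + w * β * c ≡ w * (e + β * c)
    l₂ = solve-∀

  Dec : ℤ → ℤ → ℕ → Set
  Dec Q c s = ∃₂ λ hi lo → Q ≡ hi ℤ.* B^ (suc m) ℤ.+ c ℤ.* B^ m ℤ.+ lo × ∣ lo ∣ ≤ s * ℬ ^ m′ × ∣ c ∣ ≤ s

  dec-+ : ∀ {Q c s Q′ c′ s′} → Dec Q c s → Dec Q′ c′ s′ → Dec (Q ℤ.+ Q′) (c ℤ.+ c′) (s + s′)
  dec-+ {c = c} {s} {c′ = c′} {s′} (hi , lo , e , p , q) (hi′ , lo′ , e′ , p′ , q′) = hi ℤ.+ hi′ , lo ℤ.+ lo′
    , trans (cong₂ ℤ._+_ e e′) (l hi hi′ (B^ (suc m)) c c′ (B^ m) lo lo′)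
    , ≤-trans (ℤ.∣i+j∣≤∣i∣+∣j∣ lo lo′) (≤-trans (+-mono-≤ p p′) (≤-reflexive (sym (*-distribʳ-+ (ℬ ^ m′) s s′))))
    , ≤-trans (ℤ.∣i+j∣≤∣i∣+∣j∣ c c′) (+-mono-≤ q q′)
    where
    l : ∀ h h′ P c c′ R o o′ → (h ℤ.* P ℤ.+ c ℤ.* R ℤ.+ o) ℤ.+ (h′ ℤ.* P ℤ.+ c′ ℤ.* R ℤ.+ o′) ≡ (h ℤ.+ h′) ℤ.* P ℤ.+ (c ℤ.+ c′) ℤ.* R ℤ.+ (o ℤ.+ o′)
    l = ℤ-Solver.solve-∀

  dec-Σ : ∀ {A : Set} {R : A → Set} {f c : A → ℤ} {s : A → ℕ} → (∀ {x} → R x → Dec (f x) (c x) (s x)) →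
          ∀ {xs} → All R xs → Dec (Σℤ f xs) (Σℤ c xs) (Σℕ s xs)
  dec-Σ h [] = + 0 , + 0 , refl , z≤n , z≤n
  dec-Σ {c = c} h (_∷_ {x = x} {xs = xs} p ps) = dec-+ {c = c x} {c′ = Σℤ c xs} (h p) (dec-Σ {c = c} h ps)

  dec-term : ∀ d M i j → j ≤ m → Dec (M ℤ.* B^ i ℤ.* (d ℤ.* B^ (m ∸ j))) (+ ind i j ℤ.* (d ℤ.* M)) ∣ d ℤ.* M ∣
  dec-term d M i j j≤m with <-cmp i j
  ... | tri≈ _ refl _ rewrite ind-refl i = + 0 , + 0
    , trans (l M (B^ i) d (B^ (m ∸ i))) (trans (cong ((d ℤ.* M) ℤ.*_) (trans (sym (B^-+ i (m ∸ i))) (cong B^ (m+[n∸m]≡n j≤m)))) (l₂ (d ℤ.* M) (B^ m) (B^ (suc m))))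
    , z≤n , ≤-reflexive (cong ∣_∣ (ℤ.*-identityˡ (d ℤ.* M)))
    where
    l : ∀ M b d c → M ℤ.* b ℤ.* (d ℤ.* c) ≡ d ℤ.* M ℤ.* (b ℤ.* c)
    l = ℤ-Solver.solve-∀
    l₂ : ∀ t b b′ → t ℤ.* b ≡ + 0 ℤ.* b′ ℤ.+ + 1 ℤ.* t ℤ.* b ℤ.+ + 0
    l₂ = ℤ-Solver.solve-∀
  ... | tri> _ i≢j j<i rewrite ind-≢ i≢j with m≤n⇒∃[o]m+o≡n j<i
  ...   | t , refl = d ℤ.* M ℤ.* B^ t , + 0
    , trans (l M (B^ i) d (B^ (m ∸ j))) (trans (cong ((d ℤ.* M) ℤ.*_) (trans (sym (B^-+ i (m ∸ j))) (trans (cong B^ exps) (B^-+ t (suc m))))) (l₂ (d ℤ.* M) (B^ t) (B^ (suc m)) (B^ m)))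
    , z≤n , z≤n
    where
    l : ∀ M b d c → M ℤ.* b ℤ.* (d ℤ.* c) ≡ d ℤ.* M ℤ.* (b ℤ.* c)
    l = ℤ-Solver.solve-∀
    l₂ : ∀ x t b b′ → x ℤ.* (t ℤ.* b) ≡ x ℤ.* t ℤ.* b ℤ.+ + 0 ℤ.* b′ ℤ.+ + 0
    l₂ = ℤ-Solver.solve-∀
    exps : suc j + t + (m ∸ j) ≡ t + suc m
    exps = trans (s j t (m ∸ j)) (cong (λ z → t + suc z) (m+[n∸m]≡n j≤m))
      where
      s : ∀ j t r → suc j + t + r ≡ t + suc (j + r)
      s = solve-∀
  dec-term d M i j j≤m | tri< i<j i≢j _ rewrite ind-≢ i≢j with m≤n⇒∃[o]m+o≡n i<j
  ...   | t , refl = + 0 , M ℤ.* B^ i ℤ.* (d ℤ.* B^ (m ∸ j))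
    , l₂ (M ℤ.* B^ i ℤ.* (d ℤ.* B^ (m ∸ j))) (B^ (suc m)) (B^ m)
    , ≤-trans (≤-reflexive (trans (cong ∣_∣ (trans (l M (B^ i) d (B^ (m ∸ j))) (cong ((d ℤ.* M) ℤ.*_) (sym (B^-+ i (m ∸ j)))))) (ℤ.abs-* (d ℤ.* M) _)))
        (*-monoʳ-≤ ∣ d ℤ.* M ∣ (^-monoʳ-≤ ℬ exps))
    , z≤n
    where
    l : ∀ M b d c → M ℤ.* b ℤ.* (d ℤ.* c) ≡ d ℤ.* M ℤ.* (b ℤ.* c)
    l = ℤ-Solver.solve-∀
    l₂ : ∀ x b b′ → x ≡ + 0 ℤ.* b ℤ.+ + 0 ℤ.* b′ ℤ.+ x
    l₂ = ℤ-Solver.solve-∀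
    exps : i + (m ∸ (suc i + t)) ≤ m′
    exps = +-cancelʳ-≤ (suc t) _ _ (≤-trans (≤-reflexive (trans (s i t (m ∸ (suc i + t))) (m+[n∸m]≡n j≤m))) (≤-trans (s≤s (m≤m+n m′ t)) (≤-reflexive (sym (+-suc m′ t)))))
      where
      s : ∀ i t r → i + r + suc t ≡ suc i + t + r
      s = solve-∀

  Dval : Poly n → ℤ
  Dval D = Σℤ (λ (d , e) → d ℤ.* B^ (m ∸ enc e)) D

  enc≤m : ∀ {k} (e : Vec ℕ k) → k ≡ n → expDeg e ≤ δ → enc e ≤ m
  enc≤m e refl p = ≤-trans (<⇒≤ (enc-< e p)) (≤-reflexive (sym em))

  Dsize : Poly n → ℕ
  Dsize D = Σℕ (λ (d , _) → ∣ d ∣) D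

  module _ (P : Poly n) (degP : All (λ mon → expDeg (proj₂ mon) ≤ δ) P) where

    D : Poly n
    D = proj₂ (scaled P)

    scale : ℕ
    scale = proj₁ (scaled P)

    -- The power contributes each monomial at position `enc e` with its multiplicity, and `Dval`
    -- puts the matching coefficient at position m - `enc e`. In the product only equal codes meet
    -- at position m, where the scaled value of P appears.
    dec-product : ∀ x → Dec ((+ 1 ℤ.+ vsum (weigh 1 x)) ℤ.^ δ ℤ.* Dval D) (+ scale ℤ.* eval P x)
                            (Σℕ (λ (d , _) → Σℕ (λ e → ∣ d ℤ.* monVal e x ∣) expansion) D)
    dec-product x = subst₂ (λ Q c → Dec Q c (Σℕ (λ (d , _) → Σℕ (λ e → ∣ d ℤ.* monVal e x ∣) expansion) D)) Q≡ (scaled-sum P x)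
      (dec-Σ (λ {(d , e₀)} p → subst (λ c → Dec (Σℤ (λ e → monVal e x ℤ.* B^ (enc e) ℤ.* (d ℤ.* B^ (m ∸ enc e₀))) expansion) c (Σℕ (λ e → ∣ d ℤ.* monVal e x ∣) expansion))
                                       (multiplicity-sum e₀ p d x)
                                       (dec-Σ {R = λ e → expDeg e ≤ δ} (λ {e} _ → dec-term d (monVal e x) (enc e) (enc e₀) (enc≤m e₀ refl p)) (powers-deg n δ)))
             (scaled-deg P degP))
      where
      Z = + 1 ℤ.+ vsum (weigh 1 x)
      pull : ∀ u es → Σℤ (λ e → monVal e x ℤ.* B^ (enc e) ℤ.* u) es ≡ u ℤ.* Σℤ (λ e → monVal e (weigh 1 x)) es
      pull u es = trans (Σℤ-cong (λ e → trans (ℤ.*-comm _ u) (cong (u ℤ.*_) (sym (trans (monVal-weigh 1 e x) (cong (λ z → monVal e x ℤ.* B^ z) (+-identityʳ (enc e))))))) es)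
                    (Σℤ-*ˡ u _ es)
      Q≡ : Σℤ (λ (d , e₀) → Σℤ (λ e → monVal e x ℤ.* B^ (enc e) ℤ.* (d ℤ.* B^ (m ∸ enc e₀))) expansion) D ≡ Z ℤ.^ δ ℤ.* Dval D
      Q≡ = trans (Σℤ-cong (λ (d , e₀) → trans (pull (d ℤ.* B^ (m ∸ enc e₀)) expansion) (trans (cong ((d ℤ.* B^ (m ∸ enc e₀)) ℤ.*_) (powers-sum n δ (weigh 1 x))) (ℤ.*-comm _ (Z ℤ.^ δ)))) D)
             (Σℤ-*ˡ (Z ℤ.^ δ) _ D)

    dec-size : ∀ {b} x → 1 ≤ b → VAll.All (λ i → ∣ i ∣ ≤ b) x →
      Σℕ (λ (d , _) → Σℕ (λ e → ∣ d ℤ.* monVal e x ∣) expansion) D ≤ Dsize D * (List.length expansion * b ^ δ)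
    dec-size {b} x 1≤b px = go D
      where
      go : ∀ D → Σℕ (λ (d , _) → Σℕ (λ e → ∣ d ℤ.* monVal e x ∣) expansion) D ≤ Dsize D * (List.length expansion * b ^ δ)
      go [] = z≤n
      go ((d , e₀) ∷ D) = ≤-trans (+-mono-≤ (≤-trans (Σℕ-≤ {Q = λ e → expDeg e ≤ δ} {f = λ e → ∣ d ℤ.* monVal e x ∣} (λ {e} → one {e}) (powers-deg n δ)) (≤-reflexive (s (List.length expansion) ∣ d ∣ (b ^ δ)))) (go D)) (≤-reflexive (sym (*-distribʳ-+ _ ∣ d ∣ (Dsize D))))
        where
        s : ∀ l d c → l * (d * c) ≡ d * (l * c)
        s = solve-∀
        one : ∀ {e} → expDeg e ≤ δ → ∣ d ℤ.* monVal e x ∣ ≤ ∣ d ∣ * b ^ δ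
        one {e} p = ≤-trans (≤-reflexive (ℤ.abs-* d _)) (*-monoʳ-≤ ∣ d ∣ (≤-trans (∣monVal∣ e x px) (^-monoʳ-≤ b ⦃ >-nonZero 1≤b ⦄ p)))

  ∣Dval∣ : ∀ D → ∣ Dval D ∣ ≤ Dsize D * ℬ ^ m
  ∣Dval∣ [] = z≤n
  ∣Dval∣ ((d , e) ∷ D) = begin
    ∣ d ℤ.* B^ (m ∸ enc e) ℤ.+ Dval D ∣ ≤⟨ ℤ.∣i+j∣≤∣i∣+∣j∣ (d ℤ.* B^ (m ∸ enc e)) (Dval D) ⟩
    ∣ d ℤ.* B^ (m ∸ enc e) ∣ + ∣ Dval D ∣ ≤⟨ +-mono-≤ (≤-trans (≤-reflexive (ℤ.abs-* d _)) (*-monoʳ-≤ ∣ d ∣ (^-monoʳ-≤ ℬ (m∸n≤m m (enc e))))) (∣Dval∣ D) ⟩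
    ∣ d ∣ * ℬ ^ m + Dsize D * ℬ ^ m ≡⟨ sym (*-distribʳ-+ (ℬ ^ m) ∣ d ∣ (Dsize D)) ⟩
    (∣ d ∣ + Dsize D) * ℬ ^ m ∎
    where open ≤-Reasoning

  private
    +∣lo+ℬᵐ∣ : ∀ lo s → ∣ lo ∣ ≤ s * ℬ ^ m′ → s < ℬ → ∃ λ r → lo ℤ.+ B^ m ≡ + r × r < 2 * ℬ ^ m
    +∣lo+ℬᵐ∣ lo s p s<ℬ = go lo (≤-<-trans p (*-monoˡ-< (ℬ ^ m′) ⦃ m^n≢0 ℬ m′ ⦄ s<ℬ))
      where
      go : ∀ lo → ∣ lo ∣ < ℬ ^ m → ∃ λ r → lo ℤ.+ B^ m ≡ + r × r < 2 * ℬ ^ m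
      go (+ k) h = k + ℬ ^ m , sym (ℤ.pos-+ k (ℬ ^ m)) , <-≤-trans (+-monoˡ-< (ℬ ^ m) h) (≤-reflexive (cong (ℬ ^ m ℕ.+_) (sym (+-identityʳ _))))
      go -[1+ k ] h = ℬ ^ m ∸ suc k , trans (ℤ.⊖-≥ (<⇒≤ h)) refl , <-≤-trans (s≤s (m∸n≤m (ℬ ^ m) (suc k))) (≤-trans (≤-reflexive (+-comm 1 (ℬ ^ m))) (+-monoʳ-≤ (ℬ ^ m) (≤-trans (m^n>0 ℬ m) (≤-reflexive (sym (+-identityʳ _))))))

    split-half : ∀ r P → r < 2 * P → ∃₂ λ r₀ ε → r ≡ r₀ + P * ε × r₀ < P × ε < 2
    split-half r P h with r <? P
    ... | yes p = r , 0 , sym (trans (cong (r ℕ.+_) (*-zeroʳ P)) (+-identityʳ r)) , p , s≤s z≤n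
    ... | no ¬p with m≤n⇒∃[o]m+o≡n (≮⇒≥ ¬p)
    ...   | k , refl = k , 1 , trans (+-comm P k) (cong (k ℕ.+_) (sym (*-identityʳ P))) , +-cancelˡ-< P _ _ (<-≤-trans h (≤-reflexive (cong (P ℕ.+_) (+-identityʳ P)))) , s≤s (s≤s z≤n)

  -- The part below position m may be negative. The added ℬᵐ makes it positive and less than 2ℬᵐ, so
  -- over a vanishing digit it leaves 0 or 1.
  zero⇒digit : ∀ {Q s q big} → Dec Q (+ 0) s → s < ℬ → 2 ≤ ℬ → Q ℤ.+ B^ m ℤ.+ B^ (suc m) ℤ.* big ≡ + q →
    ∃ λ r₀ → ∃₂ λ ε h → q ≡ r₀ + ℬ ^ m * (ε + ℬ * h) × r₀ < ℬ ^ m × ε < 2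
  zero⇒digit {Q} {s} {q} {big} (hi , lo , e , p , _) s<ℬ 2≤ℬ eq with +∣lo+ℬᵐ∣ lo s p s<ℬ
  ... | r , er , r< with split-half r (ℬ ^ m) r<
  ...   | r₀ , ε , refl , r₀< , ε< = go (hi ℤ.+ big) refl
    where
    P = ℬ ^ m
    eq′ : B^ (suc m) ℤ.* (hi ℤ.+ big) ℤ.+ + (r₀ + P * ε) ≡ + q
    eq′ = trans (cong (ℤ._+_ (B^ (suc m) ℤ.* (hi ℤ.+ big))) (sym er))
            (trans (l (B^ (suc m)) hi big lo (B^ m)) (trans (cong (λ z → z ℤ.+ B^ m ℤ.+ B^ (suc m) ℤ.* big) (sym e)) eq))
      where
      l : ∀ b hi big lo c → b ℤ.* (hi ℤ.+ big) ℤ.+ (lo ℤ.+ c) ≡ (hi ℤ.* b ℤ.+ + 0 ℤ.* c ℤ.+ lo) ℤ.+ c ℤ.+ b ℤ.* big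
      l = ℤ-Solver.solve-∀
    r<ℬ^ : r₀ + P * ε < ℬ ^ suc m
    r<ℬ^ = <-≤-trans r< (*-monoˡ-≤ P 2≤ℬ)
    go : ∀ t → t ≡ hi ℤ.+ big → ∃ λ r₀ → ∃₂ λ ε h → q ≡ r₀ + P * (ε + ℬ * h) × r₀ < P × ε < 2
    go (+ h) et = r₀ , ε , h , ℤ.+-injective (trans (sym eq′) (trans (cong (λ z → B^ (suc m) ℤ.* z ℤ.+ + (r₀ + P * ε)) (sym et))
                    (trans (cong (ℤ._+ + (r₀ + P * ε)) (sym (ℤ.pos-* (ℬ ^ suc m) h))) (trans (sym (ℤ.pos-+ (ℬ ^ suc m * h) (r₀ + P * ε))) (cong +_ (l ℬ P h r₀ ε)))))) , r₀< , ε<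
      where
      l : ∀ b p h r ε → b * p * h + (r + p * ε) ≡ r + p * (ε + b * h)
      l = solve-∀
    go -[1+ h ] et = contradiction (≤-trans (m≤m+n (ℬ ^ suc m) (ℬ ^ suc m * h + q)) (≤-reflexive (trans (l (ℬ ^ suc m) h q) (sym eq″)))) (<⇒≱ r<ℬ^)
      where
      l : ∀ b h q → b + (b * h + q) ≡ b * suc h + q
      l = solve-∀
      eq″ : r₀ + P * ε ≡ ℬ ^ suc m * suc h + q
      eq″ = ℤ.+-injective (trans (l₂ (B^ (suc m)) (+ suc h) (+ (r₀ + P * ε)))
        (trans (cong (ℤ._+_ (B^ (suc m) ℤ.* + suc h)) (trans (cong (λ z → B^ (suc m) ℤ.* z ℤ.+ + (r₀ + P * ε)) et) eq′))
          (trans (cong (ℤ._+ + q) (sym (ℤ.pos-* (ℬ ^ suc m) (suc h)))) (sym (ℤ.pos-+ (ℬ ^ suc m * suc h) q)))))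
        where
        l₂ : ∀ b k r → r ≡ b ℤ.* k ℤ.+ (b ℤ.* (ℤ.- k) ℤ.+ r)
        l₂ = ℤ-Solver.solve-∀

  -- The lower part contributes η, which is 0 or 1, to position m, so c + η ≡ ε modulo ℬ. Both c and
  -- ℬ are multiples of 4, hence η = ε; then ℬ divides c, and |c| < ℬ.
  digit⇒zero : ∀ {Q c s big r₀ ε h} → Dec Q c s → s < ℬ → 4 ∣ ℬ → (∃ λ c′ → c ≡ + 4 ℤ.* c′) →
    Q ℤ.+ B^ m ℤ.+ B^ (suc m) ℤ.* big ≡ + (r₀ + ℬ ^ m * (ε + ℬ * h)) → r₀ < ℬ ^ m → ε < 2 → c ≡ + 0
  digit⇒zero {Q} {c} {s} {big} {r₀} {ε} {h} (hi , lo , e , p , c≤s) s<ℬ (divides ℬ/4 eℬ) (c′ , ec) eq r₀< ε< with +∣lo+ℬᵐ∣ lo s p s<ℬ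
  ... | r , er , r< with split-half r (ℬ ^ m) r<
  ...   | r₁ , η , refl , r₁< , η< = c≡0
    where
    P = ℬ ^ m
    instance
      nzP : NonZero P
      nzP = m^n≢0 ℬ m
    z : ℤ
    z = + h ℤ.- hi ℤ.- big
    cast : ∀ a b → + (a + P * b) ≡ + a ℤ.+ + P ℤ.* + b
    cast a b = trans (ℤ.pos-+ a (P * b)) (cong (ℤ._+_ (+ a)) (ℤ.pos-* P b))
    main : + P ℤ.* (c ℤ.+ + ℬ ℤ.* (hi ℤ.+ big)) ℤ.+ (+ r₁ ℤ.+ + P ℤ.* + η) ≡ + r₀ ℤ.+ + P ℤ.* (+ ε ℤ.+ + ℬ ℤ.* + h)
    main = trans (cong (ℤ._+_ (+ P ℤ.* (c ℤ.+ + ℬ ℤ.* (hi ℤ.+ big)))) (trans (sym (cast r₁ η)) (sym er)))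
      (trans (l (+ P) c (+ ℬ) hi big lo)
        (trans (cong (λ b → (hi ℤ.* b ℤ.+ c ℤ.* + P ℤ.+ lo) ℤ.+ + P ℤ.+ b ℤ.* big) (sym (ℤ.pos-* ℬ P)))
          (trans (cong (λ w → w ℤ.+ + P ℤ.+ B^ (suc m) ℤ.* big) (sym e))
            (trans eq (trans (cast r₀ (ε + ℬ * h)) (cong (λ w → + r₀ ℤ.+ + P ℤ.* w) (trans (ℤ.pos-+ ε (ℬ * h)) (cong (ℤ._+_ (+ ε)) (ℤ.pos-* ℬ h)))))))))
      where
      l : ∀ P c b hi big lo → P ℤ.* (c ℤ.+ b ℤ.* (hi ℤ.+ big)) ℤ.+ (lo ℤ.+ P) ≡ (hi ℤ.* (b ℤ.* P) ℤ.+ c ℤ.* P ℤ.+ lo) ℤ.+ P ℤ.+ b ℤ.* P ℤ.* big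
      l = ℤ-Solver.solve-∀
    r₁≡r₀ : r₁ ≡ r₀
    r₁≡r₀ = cong-small (int-cong r₁ r₀ P (c ℤ.+ + ℬ ℤ.* (hi ℤ.+ big) ℤ.+ + η ℤ.- (+ ε ℤ.+ + ℬ ℤ.* + h))
      (trans (l (+ r₁) (+ P) (c ℤ.+ + ℬ ℤ.* (hi ℤ.+ big)) (+ η) (+ ε ℤ.+ + ℬ ℤ.* + h)) (trans (cong (ℤ._- + P ℤ.* (+ ε ℤ.+ + ℬ ℤ.* + h)) main) (l₂ (+ r₀) (+ P ℤ.* (+ ε ℤ.+ + ℬ ℤ.* + h)))))) r₁< r₀<
      where
      l : ∀ r P u η v → r ℤ.+ P ℤ.* (u ℤ.+ η ℤ.- v) ≡ (P ℤ.* u ℤ.+ (r ℤ.+ P ℤ.* η)) ℤ.- P ℤ.* v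
      l = ℤ-Solver.solve-∀
      l₂ : ∀ r v → r ℤ.+ v ℤ.- v ≡ r
      l₂ = ℤ-Solver.solve-∀
    digit : c ℤ.+ + ℬ ℤ.* (hi ℤ.+ big) ℤ.+ + η ≡ + ε ℤ.+ + ℬ ℤ.* + h
    digit = ℤ.*-cancelˡ-≡ (+ P) _ _ ⦃ nz P ⦄ (trans (l₁ (+ P) (c ℤ.+ + ℬ ℤ.* (hi ℤ.+ big)) (+ η) (+ r₁)) (trans (cong (ℤ._- + r₁) main) (trans (cong (λ w → + r₀ ℤ.+ + P ℤ.* (+ ε ℤ.+ + ℬ ℤ.* + h) ℤ.- + w) r₁≡r₀) (l₂ (+ r₀) _))))
      where
      nz : ∀ P → .⦃ NonZero P ⦄ → ℤ.NonZero (+ P)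
      nz (suc _) = _
      l₁ : ∀ P u η r → P ℤ.* (u ℤ.+ η) ≡ (P ℤ.* u ℤ.+ (r ℤ.+ P ℤ.* η)) ℤ.- r
      l₁ = ℤ-Solver.solve-∀
      l₂ : ∀ r v → r ℤ.+ v ℤ.- r ≡ v
      l₂ = ℤ-Solver.solve-∀
    η≡ε : η ≡ ε
    η≡ε = cong-small (int-cong η ε 4 (c′ ℤ.- + ℬ/4 ℤ.* z)
      (trans (l (+ η) c′ (+ ℬ/4) (+ h) hi big) (trans (cong₂ (λ u v → u ℤ.+ v ℤ.* (hi ℤ.+ big) ℤ.+ + η ℤ.- v ℤ.* + h) (sym ec) (trans (sym (ℤ.pos-* ℬ/4 4)) (cong +_ (sym eℬ))))
        (trans (cong (ℤ._- + ℬ ℤ.* + h) digit) (l₂ (+ ε) (+ ℬ ℤ.* + h)))))) (<-≤-trans η< (s≤s (s≤s z≤n))) (<-≤-trans ε< (s≤s (s≤s z≤n)))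
      where
      l : ∀ η c q h hi big → η ℤ.+ + 4 ℤ.* (c ℤ.- q ℤ.* (h ℤ.- hi ℤ.- big)) ≡ + 4 ℤ.* c ℤ.+ q ℤ.* + 4 ℤ.* (hi ℤ.+ big) ℤ.+ η ℤ.- q ℤ.* + 4 ℤ.* h
      l = ℤ-Solver.solve-∀
      l₂ : ∀ r v → r ℤ.+ v ℤ.- v ≡ r
      l₂ = ℤ-Solver.solve-∀
    c≡ℬz : c ≡ + ℬ ℤ.* z
    c≡ℬz = trans (l c (+ ℬ) hi big (+ η)) (trans (cong (λ w → w ℤ.- + η ℤ.- + ℬ ℤ.* (hi ℤ.+ big)) (trans digit (cong (λ w → + w ℤ.+ + ℬ ℤ.* + h) (sym η≡ε)))) (l₂ (+ η) (+ ℬ) (+ h) hi big))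
      where
      l : ∀ c b hi big η → c ≡ (c ℤ.+ b ℤ.* (hi ℤ.+ big) ℤ.+ η) ℤ.- η ℤ.- b ℤ.* (hi ℤ.+ big)
      l = ℤ-Solver.solve-∀
      l₂ : ∀ η b h hi big → (η ℤ.+ b ℤ.* h) ℤ.- η ℤ.- b ℤ.* (hi ℤ.+ big) ≡ b ℤ.* (h ℤ.- hi ℤ.- big)
      l₂ = ℤ-Solver.solve-∀
    c≡0 : c ≡ + 0
    c≡0 = ℤ.∣i∣≡0⇒i≡0 (∣-small (divides ∣ z ∣ (trans (cong ∣_∣ c≡ℬz) (trans (ℤ.abs-* (+ ℬ) z) (*-comm ℬ ∣ z ∣)))) (≤-<-trans c≤s s<ℬ))

-- Masks: restrictions on digits as the absence of carries

IsPow2 : ℕ → Set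
IsPow2 P = ∃ λ e → P ≡ 2 ^ e

pow2-* : ∀ {P Q} → IsPow2 P → IsPow2 Q → IsPow2 (P * Q)
pow2-* (e , refl) (f , refl) = e + f , sym (^-distribˡ-+-* 2 e f)

pow2-^ : ∀ {P} n → IsPow2 P → IsPow2 (P ^ n)
pow2-^ n (e , refl) = e * n , ^-*-assoc 2 e n

pow2>0 : ∀ {P} → IsPow2 P → 0 < P
pow2>0 (e , refl) = m^n>0 2 e

pow2-split : ∀ {P} → IsPow2 P → ∀ n → ∃₂ λ r q → r < P × n ≡ r + P * q
pow2-split (e , refl) = split-2^ e

noCarry-split′ : ∀ {P} → IsPow2 P → ∀ {s₀ t₀} s t → s₀ < P → t₀ < P → NoCarry (s₀ + P * s) (t₀ + P * t) → NoCarry s₀ t₀ × NoCarry s t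
noCarry-split′ (e , refl) = noCarry-split e

noCarry-join′ : ∀ {P} → IsPow2 P → ∀ {s₀ t₀} s t → s₀ + t₀ < P → NoCarry s₀ t₀ → NoCarry s t → NoCarry (s₀ + P * s) (t₀ + P * t)
noCarry-join′ (e , refl) = noCarry-join e

private
  pow2-quotient : ∀ f e → 2 ^ f ≤ 2 ^ e → ∃ λ g → e ≡ f + g
  pow2-quotient f e h with f ≤? e
  ... | yes p = e ∸ f , sym (m+[n∸m]≡n p)
  ... | no ¬p = contradiction h (<⇒≱ (^-monoʳ-< 2 (s≤s (s≤s z≤n)) (≰⇒> ¬p)))

mask⇒< : ∀ {P Q} → IsPow2 P → IsPow2 Q → Q ≤ P → ∀ {t} → t < P → NoCarry (P ∸ Q) t → t < Q
mask⇒< (e , refl) (f , refl) h t< with pow2-quotient f e h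
... | g , refl = noCarry-mask⇒< f g (m∸n+n≡m h) t<

<⇒mask : ∀ {P Q} → IsPow2 P → IsPow2 Q → Q ≤ P → ∀ {t} → t < Q → NoCarry (P ∸ Q) t
<⇒mask (e , refl) (f , refl) h with pow2-quotient f e h
... | g , refl = <⇒noCarry-mask f g (m∸n+n≡m h)

-- S + T has at most σ S + σ T ones; complementing S and T turns the equality into a lower bound.
kummer-blocks : ∀ {N S T S′ T′} → IsPow2 N → S + T < N → suc (S + S′) ≡ N → suc (T + T′) ≡ N →
  let X = S + T + N * (S′ + N * T′) in
  (N * N ∣ binom (X + X) X → NoCarry S T) × (NoCarry S T → ∃ λ q → Odd q × binom (X + X) X ≡ N * N * q)
kummer-blocks {N} {S} {T} {S′} {T′} (μ , refl) lt es et = ⇒ , ⇐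
  where
  open ≤-Reasoning
  X₀ = S + T + N * (S′ + N * T′)
  σX : σ X₀ ≡ σ (S + T) + (σ S′ + σ T′)
  σX = trans (σ-block μ (S′ + N * T′) lt) (cong (σ (S + T) ℕ.+_) (σ-block μ T′ (≤-trans (s≤s (m≤n+m S′ S)) (≤-reflexive es))))
  σS = σ-complement μ S S′ es
  σT = σ-complement μ T T′ et
  NN : N * N ≡ 2 ^ (μ + μ)
  NN = sym (^-distribˡ-+-* 2 μ μ)
  l : ∀ a b c d → a + b + (c + d) ≡ a + c + (b + d)
  l = solve-∀
  μμ : σ S + σ T + (σ S′ + σ T′) ≡ μ + μ
  μμ = trans (l (σ S) (σ T) (σ S′) (σ T′)) (cong₂ _+_ σS σT)
  ⇒ : N * N ∣ binom (X₀ + X₀) X₀ → NoCarry S T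
  ⇒ h = +-cancelʳ-≤ (σ S′ + σ T′) _ _ (≤-trans (≤-reflexive μμ) (≤-trans (2^∣central-binom⇒≤σ (μ + μ) X₀ (subst (_∣ binom (X₀ + X₀) X₀) NN h)) (≤-reflexive σX)))
  ⇐ : NoCarry S T → ∃ λ q → Odd q × binom (X₀ + X₀) X₀ ≡ N * N * q
  ⇐ h with central-binom-odd-part X₀
  ... | q , oq , e = q , oq , trans e (cong (_* q) (trans (cong (2 ^_) σX≡) (sym NN)))
    where
    σX≡ : σ X₀ ≡ μ + μ
    σX≡ = trans σX (trans (cong (_+ (σ S′ + σ T′)) (≤-antisym (σ-+-≤ S T) h)) μμ)

module Layout (δ : ℕ) where

  β : ℕ
  β = suc δ

  -- The distance from position w to position w βᵏ. Consecutive positions w and w β are w δ apart.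
  len : ℕ → ℕ → ℕ
  len w zero = 0
  len w (suc k) = w * δ + len (w * β) k

  len-≡ : ∀ w k → w + len w k ≡ w * β ^ k
  len-≡ w zero = trans (+-identityʳ w) (sym (*-identityʳ w))
  len-≡ w (suc k) = trans (sym (+-assoc w (w * δ) _)) (trans (cong (_+ len (w * β) k) (sym (*-suc w δ)))
                      (trans (len-≡ (w * β) k) (*-assoc w β (β ^ k))))

module MaskDefs (ℬ bb δ : ℕ) (1≤δ : 1 ≤ δ) (1≤bb : 1 ≤ bb) (4bb≤ℬ : 4 * bb ≤ ℬ) where

  private
    instance
      nzℬ : NonZero ℬ
      nzℬ = >-nonZero (≤-trans 1≤bb (≤-trans (m≤n*m bb 4) 4bb≤ℬ))
    nz^ : ∀ n → NonZero (ℬ ^ n)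
    nz^ n = m^n≢0 ℬ n

  open Layout δ public

  code : ∀ {k} → ℕ → Vec ℕ k → ℕ
  code w [] = 0
  code w (z ∷ zs) = z + ℬ ^ (w * δ) * code (w * β) zs

  -- The blocks ℬ^(wδ) - bb admit exactly entries below bb. The last block 2 bb - 1 faces the part
  -- of Γ from ℬᵐ upwards, where Γ is g shifted by 2 bb ℬᵐ; it serves to recover that shift exactly.
  mask : ℕ → ℕ → ℕ
  mask w zero = 2 * bb ∸ 1
  mask w (suc k) = (ℬ ^ (w * δ) ∸ bb) + ℬ ^ (w * δ) * mask (w * β) k

  bb≤ℬ^ : ∀ {w} → 0 < w → bb ≤ ℬ ^ (w * δ)
  bb≤ℬ^ {w} 0<w = ≤-trans (≤-trans (m≤n*m bb 4) 4bb≤ℬ) (≤-trans (≤-reflexive (sym (*-identityʳ ℬ))) (^-monoʳ-≤ ℬ (*-mono-≤ {x = 1} {u = 1} 0<w 1≤δ)))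

  ∸-< : ∀ {P Q} → 0 < Q → Q ≤ P → P ∸ Q < P
  ∸-< {P} {Q} 0<Q h = ∸-monoʳ-< {P} {Q} {0} 0<Q h

  1≤2bb : 1 ≤ 2 * bb
  1≤2bb = ≤-trans 1≤bb (m≤n*m bb 2)

  0<w*β : ∀ {w} → 0 < w → 0 < w * β
  0<w*β {w} p = *-mono-≤ {x = 1} {u = 1} p (s≤s z≤n)

  mask-< : ∀ w k → 0 < w → mask w k < ℬ ^ len w k * (2 * bb)
  mask-< w zero _ = <-≤-trans (∸-< {2 * bb} {1} (s≤s z≤n) 1≤2bb) (≤-reflexive (sym (*-identityˡ _)))
  mask-< w (suc k) 0<w = begin-strict
    (P ∸ bb) + P * mask (w * β) k  <⟨ +-monoˡ-< _ (∸-< {P} {bb} 1≤bb (bb≤ℬ^ {w} 0<w)) ⟩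
    P + P * mask (w * β) k         ≡⟨ sym (*-suc P _) ⟩
    P * suc (mask (w * β) k)       ≤⟨ *-monoʳ-≤ P (mask-< (w * β) k (0<w*β {w} 0<w)) ⟩
    P * (ℬ ^ len (w * β) k * (2 * bb)) ≡⟨ sym (*-assoc P _ _) ⟩
    P * ℬ ^ len (w * β) k * (2 * bb)   ≡⟨ cong (_* (2 * bb)) (sym (^-distribˡ-+-* ℬ (w * δ) (len (w * β) k))) ⟩
    ℬ ^ len w (suc k) * (2 * bb)   ∎
    where
    open ≤-Reasoning
    P = ℬ ^ (w * δ)

  code-< : ∀ w {k} (z : Vec ℕ k) → 0 < w → VAll.All (_< bb) z → code w z < ℬ ^ len w k
  code-< w [] _ [] = s≤s z≤n
  code-< w {suc k} (z ∷ zs) 0<w (p ∷ ps) = begin-strict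
    z + Q * code (w * β) zs <⟨ +-monoˡ-< _ (<-≤-trans p (bb≤ℬ^ {w} 0<w)) ⟩
    Q + Q * code (w * β) zs ≡⟨ sym (*-suc Q _) ⟩
    Q * suc (code (w * β) zs) ≤⟨ *-monoʳ-≤ Q (code-< (w * β) zs (0<w*β {w} 0<w) ps) ⟩
    Q * ℬ ^ len (w * β) k   ≡⟨ sym (^-distribˡ-+-* ℬ (w * δ) _) ⟩
    ℬ ^ len w (suc k)       ∎
    where
    open ≤-Reasoning
    Q = ℬ ^ (w * δ)

  module _ (k m : ℕ) (em : m ≡ β ^ suc k) where

    private
      P = ℬ ^ β
      R = ℬ ^ len β k
      1≤P : 1 ≤ P
      1≤P = m^n>0 ℬ β

    ℬ^m : ℬ ^ m ≡ P * R
    ℬ^m = trans (cong (ℬ ^_) (trans em (sym (len-≡ β k)))) (^-distribˡ-+-* ℬ β (len β k))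

    -- The additional lowest block of ones clears the positions below β, which belong to the
    -- constant 1 and the parameter a.
    fullMask : ℕ
    fullMask = (ℬ ^ β ∸ 1) + ℬ ^ β * mask β k

    fullMask-< : fullMask < ℬ ^ m * (2 * bb)
    fullMask-< = begin-strict
      (P ∸ 1) + P * mask β k <⟨ +-monoˡ-< _ (∸-< {P} {1} (s≤s z≤n) 1≤P) ⟩
      P + P * mask β k       ≡⟨ sym (*-suc P _) ⟩
      P * suc (mask β k)     ≤⟨ *-monoʳ-≤ P (mask-< β k z<s) ⟩
      P * (R * (2 * bb))     ≡⟨ sym (*-assoc P R _) ⟩
      P * R * (2 * bb)       ≡⟨ cong (_* (2 * bb)) (sym ℬ^m) ⟩
      ℬ ^ m * (2 * bb)       ∎
      where open ≤-Reasoning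

    code-full-< : ∀ (z : Vec ℕ k) → VAll.All (_< bb) z → ℬ ^ β * code β z < ℬ ^ m
    code-full-< z pz = <-≤-trans (*-monoʳ-< P ⦃ nz^ β ⦄ (code-< β z z<s pz)) (≤-reflexive (sym ℬ^m))

module Mask (ℬ bb δ : ℕ) (1≤δ : 1 ≤ δ) (1≤bb : 1 ≤ bb) (4bb≤ℬ : 4 * bb ≤ ℬ) (powℬ : IsPow2 ℬ) (powbb : IsPow2 bb) where

  open MaskDefs ℬ bb δ 1≤δ 1≤bb 4bb≤ℬ

  private
    instance
      nzℬ : NonZero ℬ
      nzℬ = >-nonZero (pow2>0 powℬ)
    nz^ : ∀ n → NonZero (ℬ ^ n)
    nz^ n = m^n≢0 ℬ n

  pow2-2bb : IsPow2 (2 * bb)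
  pow2-2bb = pow2-* (1 , refl) powbb

  decode : ∀ w k {Γ} → 0 < w → NoCarry (mask w k) Γ → ℬ ^ len w k * bb ≤ Γ → Γ < ℬ ^ len w k * (3 * bb) →
    ∃ λ (z : Vec ℕ k) → VAll.All (_< bb) z × Γ ≡ code w z + ℬ ^ len w k * (2 * bb)
  decode w zero {Γ} 0<w h lo hi with pow2-split pow2-2bb Γ
  ... | t₀ , t₁ , t₀< , refl = [] , [] , trans (cong₂ (λ u v → u + 2 * bb * v) t₀≡0 t₁≡1) (s bb)
    where
    s : ∀ b → 0 + 2 * b * 1 ≡ 0 + 1 * (2 * b)
    s = solve-∀
    h′ : NoCarry (2 * bb ∸ 1) t₀ × NoCarry 0 t₁
    h′ = noCarry-split′ pow2-2bb 0 t₁ (∸-< {2 * bb} {1} (s≤s z≤n) 1≤2bb) t₀< (subst (λ z → NoCarry z (t₀ + 2 * bb * t₁)) (sym (trans (cong (2 * bb ∸ 1 ℕ.+_) (*-zeroʳ (2 * bb))) (+-identityʳ _))) h)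
    t₀≡0 : t₀ ≡ 0
    t₀≡0 = n<1⇒n≡0 (mask⇒< pow2-2bb (0 , refl) 1≤2bb t₀< (proj₁ h′))
    -- In the window from bb to 3 bb the only multiple of 2 bb is 2 bb itself. So the shift is
    -- recovered exactly, and g, which could have been negative, is the code.
    t₁≡1 : t₁ ≡ 1
    t₁≡1 = ≤-antisym (≤-pred (*-cancelˡ-< (2 * bb) t₁ 2 (≤-<-trans (m≤n+m _ t₀) (<-≤-trans hi (≤-of-+ bb (s₁ bb))))))
             (n≢0⇒n>0 (λ { refl → contradiction (subst (1 * bb ≤_) (trans (cong₂ _+_ t₀≡0 (*-zeroʳ (2 * bb))) refl) lo) (<⇒≱ (≤-trans 1≤bb (≤-reflexive (sym (*-identityˡ bb))))) }))
      where
      s₁ : ∀ b → 2 * b * 2 ≡ 1 * (3 * b) + b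
      s₁ = solve-∀
  decode w (suc k) {Γ} 0<w h lo hi with pow2-split (pow2-^ (w * δ) powℬ) Γ
  ... | t₀ , t₁ , t₀< , refl with noCarry-split′ (pow2-^ (w * δ) powℬ) (mask (w * β) k) t₁ (∸-< {ℬ ^ (w * δ)} {bb} 1≤bb (bb≤ℬ^ {w} 0<w)) t₀< h
  ...   | h₀ , h₁ with decode (w * β) k {t₁} (0<w*β {w} 0<w) h₁ lo₁ hi₁
    where
    P = ℬ ^ (w * δ)
    R = ℬ ^ len (w * β) k
    PR : ∀ c → ℬ ^ len w (suc k) * c ≡ P * (R * c)
    PR c = trans (cong (_* c) (^-distribˡ-+-* ℬ (w * δ) (len (w * β) k))) (*-assoc P R c)
    lo₁ : R * bb ≤ t₁
    lo₁ = ≤-pred (*-cancelˡ-< P (R * bb) (suc t₁) (≤-<-trans (≤-reflexive (sym (PR bb))) (≤-<-trans lo (<-≤-trans (+-monoˡ-< (P * t₁) t₀<) (≤-reflexive (sym (*-suc P t₁)))))))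
    hi₁ : t₁ < R * (3 * bb)
    hi₁ = *-cancelˡ-< P t₁ _ (≤-<-trans (m≤n+m _ t₀) (<-≤-trans hi (≤-reflexive (PR (3 * bb)))))
  ...     | zs , pz , refl = t₀ ∷ zs , mask⇒< (pow2-^ (w * δ) powℬ) powbb (bb≤ℬ^ {w} 0<w) t₀< h₀ ∷ pz
      , trans (s t₀ (ℬ ^ (w * δ)) (code (w * β) zs) (ℬ ^ len (w * β) k) (2 * bb))
          (cong (λ u → t₀ + ℬ ^ (w * δ) * code (w * β) zs + u * (2 * bb)) (sym (^-distribˡ-+-* ℬ (w * δ) (len (w * β) k))))
    where
    s : ∀ t p c r b → t + p * (c + r * b) ≡ t + p * c + p * r * b
    s = solve-∀

  encode : ∀ w {k} (z : Vec ℕ k) → 0 < w → VAll.All (_< bb) z → NoCarry (mask w k) (code w z + ℬ ^ len w k * (2 * bb))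
  encode w [] _ [] = subst₂ NoCarry (trans (cong (2 * bb ∸ 1 ℕ.+_) (*-zeroʳ (2 * bb))) (+-identityʳ _)) (s bb)
    (noCarry-join′ pow2-2bb {2 * bb ∸ 1} {0} 0 1 (≤-<-trans (≤-reflexive (+-identityʳ _)) (∸-< {2 * bb} {1} (s≤s z≤n) 1≤2bb)) (noCarry-0ʳ _) (noCarry-0ˡ 1))
    where
    s : ∀ b → 0 + 2 * b * 1 ≡ 0 + 1 * (2 * b)
    s = solve-∀
  encode w {suc k} (z ∷ zs) 0<w (p ∷ ps) = subst (NoCarry (mask w (suc k)))
    (trans (s z (ℬ ^ (w * δ)) (code (w * β) zs) (ℬ ^ len (w * β) k) (2 * bb))
          (cong (λ u → z + ℬ ^ (w * δ) * code (w * β) zs + u * (2 * bb)) (sym (^-distribˡ-+-* ℬ (w * δ) (len (w * β) k)))))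
    (noCarry-join′ (pow2-^ (w * δ) powℬ) {P ∸ bb} {z} (mask (w * β) k) _ (<-≤-trans (+-monoʳ-< (P ∸ bb) p) (≤-reflexive (m∸n+n≡m (bb≤ℬ^ {w} 0<w))))
      (<⇒mask (pow2-^ (w * δ) powℬ) powbb (bb≤ℬ^ {w} 0<w) p) (encode (w * β) zs (0<w*β {w} 0<w) ps))
    where
    P = ℬ ^ (w * δ)
    s : ∀ t p c r b → t + p * (c + r * b) ≡ t + p * c + p * r * b
    s = solve-∀

  module _ (k m : ℕ) (em : m ≡ β ^ suc k) where

    private
      P = ℬ ^ β
      R = ℬ ^ len β k
      powP : IsPow2 P
      powP = pow2-^ β powℬ
      1≤P : 1 ≤ P
      1≤P = m^n>0 ℬ β

    decode-full : ∀ {Γ} → NoCarry (fullMask k m em) Γ → ℬ ^ m * bb ≤ Γ → Γ < ℬ ^ m * (3 * bb) →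
      ∃ λ (z : Vec ℕ k) → VAll.All (_< bb) z × Γ ≡ ℬ ^ β * code β z + ℬ ^ m * (2 * bb)
    decode-full {Γ} h lo hi with pow2-split powP Γ
    ... | t₀ , t₁ , t₀< , refl with noCarry-split′ powP (mask β k) t₁ (∸-< {P} {1} (s≤s z≤n) 1≤P) t₀< h
    ...   | h₀ , h₁ with n<1⇒n≡0 (mask⇒< powP (0 , refl) 1≤P t₀< h₀)
    ...     | refl with decode β k {t₁} z<s h₁ lo₁ hi₁
      where
      PR : ∀ c → ℬ ^ m * c ≡ P * (R * c)
      PR c = trans (cong (_* c) (ℬ^m k m em)) (*-assoc P R c)
      lo₁ : R * bb ≤ t₁
      lo₁ = *-cancelˡ-≤ P ⦃ nz^ β ⦄ (≤-trans (≤-reflexive (sym (PR bb))) lo)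
      hi₁ : t₁ < R * (3 * bb)
      hi₁ = *-cancelˡ-< P t₁ _ (<-≤-trans hi (≤-reflexive (PR (3 * bb))))
    ...       | z , pz , refl = z , pz , trans (*-distribˡ-+ P (code β z) (R * (2 * bb))) (cong (P * code β z ℕ.+_) (trans (sym (*-assoc P R _)) (cong (_* (2 * bb)) (sym (ℬ^m k m em)))))

    encode-full : ∀ (z : Vec ℕ k) → VAll.All (_< bb) z → NoCarry (fullMask k m em) (ℬ ^ β * code β z + ℬ ^ m * (2 * bb))
    encode-full z pz = subst (NoCarry (fullMask k m em))
      (trans (*-distribˡ-+ P (code β z) (R * (2 * bb))) (cong (P * code β z ℕ.+_) (trans (sym (*-assoc P R _)) (cong (_* (2 * bb)) (sym (ℬ^m k m em))))))
      (noCarry-join′ powP {P ∸ 1} {0} (mask β k) (code β z + R * (2 * bb)) (≤-<-trans (≤-reflexive (+-identityʳ _)) (∸-< {P} {1} (s≤s z≤n) 1≤P)) (noCarry-0ʳ _) (encode β z z<s pz))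

    private
      2≤ℬ : 2 ≤ ℬ
      2≤ℬ = ≤-trans (*-mono-≤ {x = 2} {y = 4} (s≤s (s≤s z≤n)) 1≤bb) 4bb≤ℬ
      shape : ∀ a b c → a * b ≡ 0 + a * (b + c * 0)
      shape = solve-∀

    -- As ℬ is a power of two, ℬ - 2 has all bits except the lowest: without a carry the digit at
    -- position m is 0 or 1.
    digit-decode : ∀ {q} → NoCarry (ℬ ^ m * (ℬ ∸ 2)) q → ∃ λ r₀ → ∃₂ λ ε h → q ≡ r₀ + ℬ ^ m * (ε + ℬ * h) × r₀ < ℬ ^ m × ε < 2
    digit-decode {q} h with pow2-split (pow2-^ m powℬ) q
    ... | r₀ , q₁ , r₀< , refl with pow2-split powℬ q₁
    ...   | ε , h₁ , ε< , refl with noCarry-split′ (pow2-^ m powℬ) {0} {r₀} (ℬ ∸ 2 + ℬ * 0) (ε + ℬ * h₁) (m^n>0 ℬ m) r₀< (subst (λ z → NoCarry z (r₀ + ℬ ^ m * (ε + ℬ * h₁))) (shape (ℬ ^ m) (ℬ ∸ 2) ℬ) h)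
    ...     | _ , h₂ = r₀ , ε , h₁ , refl , r₀< , mask⇒< powℬ (1 , refl) 2≤ℬ ε< (proj₁ (noCarry-split′ powℬ 0 h₁ (∸-< {ℬ} {2} (s≤s z≤n) 2≤ℬ) ε< h₂))

    digit-encode : ∀ {r₀ ε h} → r₀ < ℬ ^ m → ε < 2 → NoCarry (ℬ ^ m * (ℬ ∸ 2)) (r₀ + ℬ ^ m * (ε + ℬ * h))
    digit-encode {r₀} {ε} {h} r₀< ε< = subst (λ z → NoCarry z (r₀ + ℬ ^ m * (ε + ℬ * h))) (sym (shape (ℬ ^ m) (ℬ ∸ 2) ℬ))
      (noCarry-join′ (pow2-^ m powℬ) {0} {r₀} (ℬ ∸ 2 + ℬ * 0) (ε + ℬ * h) r₀< (noCarry-0ˡ r₀)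
        (noCarry-join′ powℬ {ℬ ∸ 2} {ε} 0 h (<-≤-trans (+-monoʳ-< (ℬ ∸ 2) ε<) (≤-reflexive (m∸n+n≡m 2≤ℬ))) (<⇒mask powℬ (1 , refl) 2≤ℬ ε<) (noCarry-0ˡ h)))

-- The numbers S, T, N and X of the coding

n<2^n : ∀ n → n < 2 ^ n
n<2^n zero = s≤s z≤n
n<2^n (suc n) = ≤-trans (s≤s (n<2^n n)) (≤-trans (+-monoˡ-≤ (2 ^ n) (m^n>0 2 n)) (≤-reflexive (cong (2 ^ n ℕ.+_) (sym (+-identityʳ (2 ^ n))))))

shift-nonneg : ∀ i H → ∣ i ∣ ≤ H → ∃ λ r → i ℤ.+ + H ≡ + r × r ≤ 2 * H
shift-nonneg (+ k) H h = k + H , sym (ℤ.pos-+ k H) , ≤-trans (+-monoˡ-≤ H h) (≤-reflexive (cong (H ℕ.+_) (sym (+-identityʳ H))))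
shift-nonneg -[1+ k ] H h = H ∸ suc k , ℤ.⊖-≥ h , ≤-trans (m∸n≤m H (suc k)) (m≤m+n H (H + 0))

shift-window : ∀ g M → ∣ g ∣ < M → ∃ λ Γ → + (2 * M) ℤ.+ g ≡ + Γ × M ≤ Γ × Γ < 3 * M
shift-window (+ k) M h = 2 * M + k , sym (ℤ.pos-+ (2 * M) k) , ≤-trans (m≤m+n M (M + 0)) (m≤m+n _ k) , <-≤-trans (+-monoʳ-< (2 * M) h) (≤-reflexive (l M))
  where
  l : ∀ M → 2 * M + M ≡ 3 * M
  l = solve-∀
shift-window -[1+ k ] M h with m≤n⇒∃[o]m+o≡n h
... | o , refl = M + suc o , eq , m≤m+n M (suc o) , <-≤-trans (+-monoʳ-< M (s≤s (s≤s (m≤n+m o k)))) (≤-of-+ M (l₃ M))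
  where
  l₂ : ∀ M o k → 2 * M + suc o ≡ M + suc o + M
  l₂ = solve-∀
  l₃ : ∀ M → 3 * M ≡ M + M + M
  l₃ = solve-∀
  eq : + (2 * M) ℤ.+ -[1+ k ] ≡ + (M + suc o)
  eq = trans (ℤ.⊖-≥ (≤-trans (≤-trans (n≤1+n (suc k)) h) (m≤m+n M (M + 0))))
    (cong +_ (trans (cong (_∸ suc k) (l₄ k o)) (m+n∸n≡m (M + suc o) (suc k))))
    where
    l₄ : ∀ k o → 2 * (suc (suc k) + o) ≡ suc (suc k) + o + suc o + suc k
    l₄ = solve-∀

module Coding (k δ : ℕ) (1≤δ : 1 ≤ δ) (P : Poly (suc k)) (degP : All (λ mon → expDeg (proj₂ mon) ≤ δ) P) where

  open Coefficients (suc k) δ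

  coeffs : Poly (suc k)
  coeffs = proj₂ (scaled P)

  csize : ℕ
  csize = Σℕ (λ (d , _) → ∣ d ∣) coeffs

  c₀ : ℕ
  c₀ = csize + csize * List.length expansion

  abstract

    -- A power of two above `c₀`, so that no coefficient of the expansion reaches the base as long
    -- as a and the unknowns are below bb. The additional factor 8 makes the base divisible by 4 and
    -- gives the window of width 3 bb room.
    c : ℕ
    c = 2 ^ (3 + c₀)

    c₀<c : c₀ < c
    c₀<c = <-trans (n<2^n c₀) (^-monoʳ-< 2 (s≤s (s≤s z≤n)) (m<n+m c₀ {3} z<s))

    8≤c : 8 ≤ c
    8≤c = ^-monoʳ-≤ 2 {3} {3 + c₀} (m≤m+n 3 c₀)

    pow2-c : IsPow2 c
    pow2-c = 3 + c₀ , refl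

    4∣c : 4 ∣ c
    4∣c = divides (2 ^ suc c₀) (l (2 ^ c₀))
      where
      l : ∀ p → 2 * (2 * (2 * p)) ≡ 2 * p * 4
      l = solve-∀

  m′ m : ℕ
  m′ = pred (β ^ suc k)
  m = suc m′

  abstract

    -- Both S and T stay below ℬ to the exponent (m + 1)(δ + 2) + 1, so one more power of ℬ exceeds
    -- their sum.
    t : ℕ
    t = suc m * (2 + δ) + 2

    t-def : t ≡ suc m * (2 + δ) + 2
    t-def = refl

  em : m ≡ β ^ suc k
  em = suc-pred (β ^ suc k) ⦃ m^n≢0 β (suc k) ⦄

  module At (bb : ℕ) (1≤bb : 1 ≤ bb) where

    ℬ N M₀ M : ℕ
    ℬ = c * bb ^ suc δ
    N = ℬ ^ t
    M₀ = ℬ ^ m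
    M = bb * M₀

    private
      instance
        nzbb : NonZero bb
        nzbb = >-nonZero 1≤bb

    8bb≤ℬ : 8 * bb ≤ ℬ
    8bb≤ℬ = *-mono-≤ 8≤c (≤-trans (≤-reflexive (sym (*-identityʳ bb))) (^-monoʳ-≤ bb {1} {suc δ} (s≤s z≤n)))

    4bb≤ℬ : 4 * bb ≤ ℬ
    4bb≤ℬ = ≤-trans (*-monoˡ-≤ bb (≤-of-+ {4} {8} 4 refl)) 8bb≤ℬ

    8≤ℬ : 8 ≤ ℬ
    8≤ℬ = ≤-trans (*-monoʳ-≤ 8 1≤bb) 8bb≤ℬ

    0<ℬ : 0 < ℬ
    0<ℬ = ≤-trans (s≤s z≤n) 8≤ℬ

    private
      instance
        nzℬ : NonZero ℬ
        nzℬ = >-nonZero 0<ℬ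

    c₀bb^δ<ℬ : c₀ * bb ^ δ < ℬ
    c₀bb^δ<ℬ = <-≤-trans (*-monoˡ-< (bb ^ δ) ⦃ m^n≢0 bb δ ⦄ c₀<c) (*-monoʳ-≤ c (^-monoʳ-≤ bb (n≤1+n δ)))

    csize≤ℬ : csize ≤ ℬ
    csize≤ℬ = ≤-trans (≤-trans (m≤m+n csize _) (<⇒≤ c₀<c)) (m≤m*n c (bb ^ suc δ) ⦃ m^n≢0 bb (suc δ) ⦄)

    open Digits (suc k) δ ℬ m′ 0<ℬ em hiding (m)
    open MaskDefs ℬ bb δ 1≤δ 1≤bb 4bb≤ℬ hiding (β)

    -- Two tests in one number: the lower part demands that g is a code, the upper part that the
    -- polynomial vanishes at the coded point. T carries Γ and q in the same two places.
    S : ℕ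
    S = fullMask k m em + ℬ ^ suc m * (ℬ ^ m * (ℬ ∸ 2))

    1≤M : 1 ≤ M
    1≤M = *-mono-≤ {x = 1} {u = 1} 1≤bb (m^n>0 ℬ m)

    -- Since |Z| and |`Dval`| are at most ℬᵐ⁺¹, adding ℬᵐ⁺¹ H makes Q positive for every g of the
    -- window, code or not, and it does not touch position m.
    H : ℕ
    H = ℬ ^ (suc m * δ)

    Zℤ : ℕ → ℤ → ℤ
    Zℤ a g = + 1 ℤ.+ + a ℤ.* + ℬ ℤ.+ g

    abstract

      Qℤ Tℤ Xℤ : ℕ → ℤ → ℤ
      Qℤ a g = Zℤ a g ℤ.^ δ ℤ.* Dval coeffs ℤ.+ B^ m ℤ.+ B^ (suc m) ℤ.* + H
      Tℤ a g = + (2 * M) ℤ.+ g ℤ.+ B^ (suc m) ℤ.* Qℤ a g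
      Xℤ a g = + S ℤ.+ Tℤ a g ℤ.+ + N ℤ.* ((+ N ℤ.- + 1 ℤ.- + S) ℤ.+ + N ℤ.* (+ N ℤ.- + 1 ℤ.- Tℤ a g))

      Qℤ-def : ∀ a g → Qℤ a g ≡ Zℤ a g ℤ.^ δ ℤ.* Dval coeffs ℤ.+ B^ m ℤ.+ B^ (suc m) ℤ.* + H
      Qℤ-def a g = refl
      Tℤ-def : ∀ a g → Tℤ a g ≡ + (2 * M) ℤ.+ g ℤ.+ B^ (suc m) ℤ.* Qℤ a g
      Tℤ-def a g = refl
      Xℤ-def : ∀ a g → Xℤ a g ≡ + S ℤ.+ Tℤ a g ℤ.+ + N ℤ.* ((+ N ℤ.- + 1 ℤ.- + S) ℤ.+ + N ℤ.* (+ N ℤ.- + 1 ℤ.- Tℤ a g))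
      Xℤ-def a g = refl

    -- The values as natural numbers. They are obtained from a < bb and |g| < M alone, without bb
    -- being a power of two, because soundness needs X natural, and at least M, before it can show
    -- that.
    record Range (a : ℕ) (g : ℤ) : Set where
      field
        Γ q S′ T′ X₀ : ℕ
        Γ≡ : + (2 * M) ℤ.+ g ≡ + Γ
        Γ≥ : M ≤ Γ
        Γ< : Γ < 3 * M
        q≡ : Qℤ a g ≡ + q
        S+T< : S + (Γ + ℬ ^ suc m * q) < N
        S′≡ : suc (S + S′) ≡ N
        T′≡ : suc (Γ + ℬ ^ suc m * q + T′) ≡ N
        X≡ : X₀ ≡ S + (Γ + ℬ ^ suc m * q) + N * (S′ + N * T′)
        Xℤ≡ : Xℤ a g ≡ + X₀
        X≥ : M ≤ X₀

    3M≤ : 3 * M ≤ ℬ ^ suc m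
    3M≤ = ≤-trans (≤-reflexive (sym (*-assoc 3 bb M₀))) (*-monoˡ-≤ M₀ (≤-trans (*-monoˡ-≤ bb (≤-of-+ {3} {8} 5 refl)) 8bb≤ℬ))

    fullMask<ℬ^ : fullMask k m em < ℬ ^ suc m
    fullMask<ℬ^ = <-≤-trans (fullMask-< k m em) (≤-trans (≤-reflexive (*-comm M₀ (2 * bb))) (*-monoˡ-≤ M₀ (≤-trans (*-monoˡ-≤ bb (≤-of-+ {2} {8} 6 refl)) 8bb≤ℬ)))

    range : ∀ a g → a < bb → ∣ g ∣ < M → Range a g
    range a g a<bb g<M = record
      { Γ = Γ ; q = q ; S′ = S′ ; T′ = T′ ; X₀ = X₀
      ; Γ≡ = eΓ ; Γ≥ = Γ≥ ; Γ< = Γ< ; q≡ = eq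
      ; S+T< = S+T< ; S′≡ = m+[n∸m]≡n (≤-trans (s≤s (m≤m+n S T)) S+T<) ; T′≡ = m+[n∸m]≡n (≤-trans (s≤s (m≤n+m T S)) S+T<)
      ; X≡ = refl
      ; Xℤ≡ = Xℤ≡
      ; X≥ = ≤-trans Γ≥ (≤-trans (m≤m+n Γ _) (≤-trans (m≤n+m T S) (m≤m+n (S + T) _))) }
      where
      open ≤-Reasoning
      ∣Z∣ : ∣ Zℤ a g ∣ ≤ ℬ ^ suc m
      ∣Z∣ = begin
        ∣ + 1 ℤ.+ + a ℤ.* + ℬ ℤ.+ g ∣   ≤⟨ ℤ.∣i+j∣≤∣i∣+∣j∣ (+ 1 ℤ.+ + a ℤ.* + ℬ) g ⟩
        ∣ + 1 ℤ.+ + a ℤ.* + ℬ ∣ + ∣ g ∣ ≡⟨ cong (λ z → ∣ + 1 ℤ.+ z ∣ + ∣ g ∣) (sym (ℤ.pos-* a ℬ)) ⟩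
        suc (a * ℬ) + ∣ g ∣             ≤⟨ +-mono-≤ (s≤s (*-monoʳ-≤ a ℬ≤)) (<⇒≤ g<M) ⟩
        suc (a * M₀) + M                ≤⟨ +-monoˡ-≤ M (≤-trans (+-monoˡ-≤ (a * M₀) (m^n>0 ℬ m)) (*-monoˡ-≤ M₀ a<bb)) ⟩
        M + M                           ≤⟨ ≤-of-+ M (l M) ⟩
        3 * M                           ≤⟨ 3M≤ ⟩
        ℬ ^ suc m                       ∎
        where
        ℬ≤ : ℬ ≤ M₀
        ℬ≤ = m≤m*n ℬ (ℬ ^ m′) ⦃ m^n≢0 ℬ m′ ⦄
        l : ∀ M → 3 * M ≡ M + M + M
        l = solve-∀
      ∣ZD∣ : ∣ Zℤ a g ℤ.^ δ ℤ.* Dval coeffs ∣ ≤ ℬ ^ suc m * H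
      ∣ZD∣ = begin
        ∣ Zℤ a g ℤ.^ δ ℤ.* Dval coeffs ∣       ≡⟨ trans (ℤ.abs-* (Zℤ a g ℤ.^ δ) (Dval coeffs)) (cong (_* ∣ Dval coeffs ∣) (∣^∣ (Zℤ a g) δ)) ⟩
        ∣ Zℤ a g ∣ ^ δ * ∣ Dval coeffs ∣       ≤⟨ *-mono-≤ (^-monoˡ-≤ δ ∣Z∣) (≤-trans (∣Dval∣ coeffs) (*-monoˡ-≤ (ℬ ^ m) csize≤ℬ)) ⟩
        (ℬ ^ suc m) ^ δ * ℬ ^ suc m            ≡⟨ trans (cong (_* ℬ ^ suc m) (^-*-assoc ℬ (suc m) δ)) (*-comm H _) ⟩
        ℬ ^ suc m * H                          ∎
      window = shift-window g M g<M
      Γ = proj₁ window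
      eΓ = proj₁ (proj₂ window)
      Γ≥ = proj₁ (proj₂ (proj₂ window))
      Γ< = proj₂ (proj₂ (proj₂ window))
      shifted = shift-nonneg (Zℤ a g ℤ.^ δ ℤ.* Dval coeffs) (ℬ ^ suc m * H) ∣ZD∣
      r = proj₁ shifted
      er = proj₁ (proj₂ shifted)
      r≤ = proj₂ (proj₂ shifted)
      q = r + ℬ ^ m
      T = Γ + ℬ ^ suc m * q
      S′ = N ∸ suc S
      T′ = N ∸ suc T
      X₀ = S + T + N * (S′ + N * T′)
      eq : Qℤ a g ≡ + q
      eq = trans (Qℤ-def a g) $ trans (cong (ℤ._+_ (Zℤ a g ℤ.^ δ ℤ.* Dval coeffs ℤ.+ B^ m)) (sym (ℤ.pos-* (ℬ ^ suc m) H)))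
             (trans (l (Zℤ a g ℤ.^ δ ℤ.* Dval coeffs) (B^ m) (+ (ℬ ^ suc m * H))) (trans (cong (ℤ._+ B^ m) er) (sym (ℤ.pos-+ r (ℬ ^ m)))))
        where
        l : ∀ x y z → x ℤ.+ y ℤ.+ z ≡ x ℤ.+ z ℤ.+ y
        l = ℤ-Solver.solve-∀
      eT : Tℤ a g ≡ + T
      eT = trans (Tℤ-def a g) $ trans (cong₂ (λ u v → u ℤ.+ B^ (suc m) ℤ.* v) eΓ eq) (sym (trans (ℤ.pos-+ Γ (ℬ ^ suc m * q)) (cong (ℤ._+_ (+ Γ)) (ℤ.pos-* (ℬ ^ suc m) q))))
      G = ℬ ^ (suc m * suc δ)
      G≡ : G ≡ ℬ ^ suc m * H
      G≡ = trans (cong (ℬ ^_) (*-suc (suc m) δ)) (^-distribˡ-+-* ℬ (suc m) (suc m * δ))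
      q< : suc q ≤ ℬ * G
      q< = begin
        suc (r + ℬ ^ m)               ≤⟨ s≤s (+-mono-≤ (≤-trans r≤ (≤-reflexive (cong (2 *_) (sym G≡)))) (^-monoʳ-≤ ℬ (≤-trans (n≤1+n m) (m≤m*n (suc m) (suc δ))))) ⟩
        suc (2 * G + G)               ≤⟨ +-monoˡ-≤ (2 * G + G) (m^n>0 ℬ (suc m * suc δ)) ⟩
        G + (2 * G + G)               ≤⟨ ≤-of-+ (4 * G) (l G) ⟩
        8 * G                         ≤⟨ *-monoˡ-≤ G 8≤ℬ ⟩
        ℬ * G                         ∎
        where
        l : ∀ G → 8 * G ≡ G + (2 * G + G) + 4 * G
        l = solve-∀
      F = ℬ ^ suc m * (ℬ * G)
      T< : T < F
      T< = begin-strict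
        Γ + ℬ ^ suc m * q             <⟨ +-monoˡ-< _ (<-≤-trans Γ< 3M≤) ⟩
        ℬ ^ suc m + ℬ ^ suc m * q     ≡⟨ sym (*-suc (ℬ ^ suc m) q) ⟩
        ℬ ^ suc m * suc q             ≤⟨ *-monoʳ-≤ (ℬ ^ suc m) q< ⟩
        F                             ∎
      S< : S < F
      S< = begin-strict
        fullMask k m em + ℬ ^ suc m * (ℬ ^ m * (ℬ ∸ 2)) <⟨ +-monoˡ-< _ fullMask<ℬ^ ⟩
        ℬ ^ suc m + ℬ ^ suc m * (ℬ ^ m * (ℬ ∸ 2)) ≡⟨ sym (*-suc (ℬ ^ suc m) _) ⟩
        ℬ ^ suc m * suc (ℬ ^ m * (ℬ ∸ 2))         ≤⟨ *-monoʳ-≤ (ℬ ^ suc m) (≤-trans one (≤-trans (*-comm-≤ (ℬ ^ m) ℬ) (*-monoʳ-≤ ℬ (^-monoʳ-≤ ℬ (≤-trans (n≤1+n m) (m≤m*n (suc m) (suc δ))))))) ⟩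
        F ∎
        where
        *-comm-≤ : ∀ x y → x * y ≤ y * x
        *-comm-≤ x y = ≤-reflexive (*-comm x y)
        one : suc (ℬ ^ m * (ℬ ∸ 2)) ≤ ℬ ^ m * ℬ
        one = *-monoʳ-< (ℬ ^ m) ⦃ m^n≢0 ℬ m ⦄ (∸-< {ℬ} {2} (s≤s z≤n) (≤-trans (≤-of-+ {2} {8} 6 refl) 8≤ℬ))
      N≡ : ℬ * F ≡ N
      N≡ = trans (l ℬ (ℬ ^ suc m) G) (sym (trans (trans (cong (ℬ ^_) t-def) (^-distribˡ-+-* ℬ (suc m * (2 + δ)) 2)) (cong₂ _*_ (trans (cong (ℬ ^_) (*-suc (suc m) (suc δ))) (^-distribˡ-+-* ℬ (suc m) (suc m * suc δ))) (cong (ℬ *_) (*-identityʳ ℬ)))))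
        where
        l : ∀ b x g → b * (x * (b * g)) ≡ x * g * (b * b)
        l = solve-∀
      S+T< : S + T < N
      S+T< = begin-strict
        S + T   <⟨ +-mono-< S< T< ⟩
        F + F   ≤⟨ ≤-of-+ (6 * F) (l F) ⟩
        8 * F   ≤⟨ *-monoˡ-≤ F 8≤ℬ ⟩
        ℬ * F   ≡⟨ N≡ ⟩
        N       ∎
        where
        l : ∀ F → 8 * F ≡ F + F + 6 * F
        l = solve-∀
      comp : ∀ s s′ → suc (s + s′) ≡ N → + N ℤ.- + 1 ℤ.- + s ≡ + s′
      comp s s′ e = trans (cong (λ z → + z ℤ.- + 1 ℤ.- + s) (sym e)) (trans (cong (λ z → + 1 ℤ.+ z ℤ.- + 1 ℤ.- + s) (ℤ.pos-+ s s′)) (l (+ s) (+ s′)))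
        where
        l : ∀ s s′ → + 1 ℤ.+ (s ℤ.+ s′) ℤ.- + 1 ℤ.- s ≡ s′
        l = ℤ-Solver.solve-∀
      Xℤ≡ : Xℤ a g ≡ + X₀
      Xℤ≡ = trans (Xℤ-def a g) $ trans (cong (λ z → + S ℤ.+ z ℤ.+ + N ℤ.* ((+ N ℤ.- + 1 ℤ.- + S) ℤ.+ + N ℤ.* (+ N ℤ.- + 1 ℤ.- z))) eT)
        (trans (cong₂ (λ u v → + S ℤ.+ + T ℤ.+ + N ℤ.* (u ℤ.+ + N ℤ.* v)) (comp S S′ (m+[n∸m]≡n (≤-trans (s≤s (m≤m+n S T)) S+T<))) (comp T T′ (m+[n∸m]≡n (≤-trans (s≤s (m≤n+m T S)) S+T<))))
          (sym (trans (ℤ.pos-+ (S + T) (N * (S′ + N * T′))) (cong₂ ℤ._+_ (ℤ.pos-+ S T) (trans (ℤ.pos-* N (S′ + N * T′)) (cong (+ N ℤ.*_) (trans (ℤ.pos-+ S′ (N * T′)) (cong (ℤ._+_ (+ S′)) (ℤ.pos-* N T′)))))))))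

    vsum-weigh : ∀ {j} w (z : Vec ℕ j) → vsum (weigh w (Vec.map +_ z)) ≡ + (ℬ ^ w * code w z)
    vsum-weigh w [] = cong +_ (sym (*-zeroʳ (ℬ ^ w)))
    vsum-weigh w (z ∷ zs) = trans (cong₂ ℤ._+_ (sym (ℤ.pos-* z (ℬ ^ w))) (vsum-weigh (w * β) zs))
      (trans (sym (ℤ.pos-+ (z * ℬ ^ w) _)) (cong +_ (trans (cong (λ u → z * ℬ ^ w + u * code (w * β) zs) (trans (cong (ℬ ^_) (*-suc w δ)) (^-distribˡ-+-* ℬ w (w * δ)))) (l z (ℬ ^ w) (ℬ ^ (w * δ)) (code (w * β) zs)))))
      where
      l : ∀ z p r c → z * p + p * r * c ≡ p * (z + r * c)
      l = solve-∀

    Z≡ : ∀ a (z : Vec ℕ k) → Zℤ a (+ (ℬ ^ β * code β z)) ≡ + 1 ℤ.+ vsum (weigh 1 (+ a ∷ Vec.map +_ z))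
    Z≡ a z = trans (ℤ.+-assoc (+ 1) (+ a ℤ.* + ℬ) _) (cong (ℤ._+_ (+ 1)) (cong₂ ℤ._+_ (cong (λ u → + a ℤ.* + u) (sym (*-identityʳ ℬ)))
               (sym (subst (λ w → vsum (weigh w (Vec.map +_ z)) ≡ + (ℬ ^ β * code β z)) (sym (+-identityʳ β)) (vsum-weigh β z)))))

    small-size : ∀ a (z : Vec ℕ k) → a < bb → VAll.All (_< bb) z →
      Σℕ (λ (d , _) → Σℕ (λ e → ∣ d ℤ.* monVal e (+ a ∷ Vec.map +_ z) ∣) expansion) coeffs < ℬ
    small-size a z a<bb pz = ≤-<-trans (dec-size P degP (+ a ∷ Vec.map +_ z) 1≤bb (<⇒≤ a<bb ∷ lift pz))
      (≤-<-trans (≤-trans (≤-reflexive (sym (*-assoc csize _ (bb ^ δ)))) (*-monoˡ-≤ (bb ^ δ) (m≤n+m _ csize))) c₀bb^δ<ℬ)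
      where
      lift : ∀ {j} {z : Vec ℕ j} → VAll.All (_< bb) z → VAll.All (λ i → ∣ i ∣ ≤ bb) (Vec.map +_ z)
      lift [] = []
      lift (p ∷ ps) = <⇒≤ p ∷ lift ps

    private
      Mask-Γ : ∀ x → x * M ≡ ℬ ^ m * (x * bb)
      Mask-Γ x = l x bb M₀
        where
        l : ∀ x b c → x * (b * c) ≡ c * (x * b)
        l = solve-∀

    module _ (powbb : IsPow2 bb) where

      powℬ : IsPow2 ℬ
      powℬ = pow2-* pow2-c (pow2-^ (suc δ) powbb)

      open Mask ℬ bb δ 1≤δ 1≤bb 4bb≤ℬ powℬ powbb

      -- Divisibility by N² means that S and T add without carry. Splitting at ℬᵐ⁺¹, the lower half
      -- decodes g into a point and the upper half says that the digit belonging to this point is 0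
      -- or 1.
      coding-sound : ∀ {a g} (R : Range a g) → a < bb → let open Range R in
        N * N ∣ binom (X₀ + X₀) X₀ → ∃ λ (z : Vec ℕ k) → eval P (+ a ∷ Vec.map +_ z) ≡ + 0
      coding-sound {a} {g} R a<bb h = finish (proj₁ decoded) (proj₁ (proj₂ decoded)) (proj₂ (proj₂ decoded)) (digit-decode k m em (proj₂ halves))
        where
        open Range R
        halves : NoCarry (fullMask k m em) Γ × NoCarry (ℬ ^ m * (ℬ ∸ 2)) q
        halves = noCarry-split′ (pow2-^ (suc m) powℬ) (ℬ ^ m * (ℬ ∸ 2)) q fullMask<ℬ^ (<-≤-trans Γ< 3M≤)
                   (proj₁ (kummer-blocks {S′ = S′} {T′ = T′} (pow2-^ t powℬ) S+T< S′≡ T′≡) (subst (λ x → N * N ∣ binom (x + x) x) X≡ h))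
        decoded = decode-full k m em (proj₁ halves) (≤-trans (≤-reflexive (*-comm M₀ bb)) Γ≥) (<-≤-trans Γ< (≤-reflexive (Mask-Γ 3)))
        finish : (z : Vec ℕ k) → VAll.All (_< bb) z → Γ ≡ ℬ ^ β * code β z + ℬ ^ m * (2 * bb) →
          (∃ λ r₀ → ∃₂ λ ε h → q ≡ r₀ + ℬ ^ m * (ε + ℬ * h) × r₀ < ℬ ^ m × ε < 2) →
          ∃ λ (z : Vec ℕ k) → eval P (+ a ∷ Vec.map +_ z) ≡ + 0
        finish z pz eΓ (r₀ , ε , h′ , eq , r₀< , ε<) = z , zero-factor (digit⇒zero {Zx ℤ.^ δ ℤ.* Dval coeffs} {+ proj₁ (scaled P) ℤ.* eval P x} {size} {+ H} {r₀} {ε} {h′} (dec-product P degP x) (small-size a z a<bb pz) 4∣ℬ four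
                (trans (cong (λ u → u ℤ.^ δ ℤ.* Dval coeffs ℤ.+ B^ m ℤ.+ B^ (suc m) ℤ.* + H) (trans (sym (Z≡ a z)) (cong (Zℤ a) (sym g≡)))) (trans (sym (Qℤ-def a g)) (trans q≡ (cong +_ eq)))) r₀< ε<)
          where
          x = + a ∷ Vec.map +_ z
          Zx = + 1 ℤ.+ vsum (weigh 1 x)
          size = Σℕ (λ (d , _) → Σℕ (λ e → ∣ d ℤ.* monVal e x ∣) expansion) coeffs
          g≡ : g ≡ + (ℬ ^ β * code β z)
          g≡ = trans (l₁ (+ (2 * M)) g) (trans (cong (ℤ._- + (2 * M)) (trans Γ≡ (trans (cong +_ (trans eΓ (cong (ℬ ^ β * code β z ℕ.+_) (sym (Mask-Γ 2))))) (ℤ.pos-+ (ℬ ^ β * code β z) (2 * M))))) (l₂ (+ (ℬ ^ β * code β z)) (+ (2 * M))))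
            where
            l₁ : ∀ m g → g ≡ m ℤ.+ g ℤ.- m
            l₁ = ℤ-Solver.solve-∀
            l₂ : ∀ c m → c ℤ.+ m ℤ.- m ≡ c
            l₂ = ℤ-Solver.solve-∀
          4∣ℬ : 4 ∣ ℬ
          4∣ℬ = ∣m⇒∣m*n (bb ^ suc δ) 4∣c
          four : ∃ λ c′ → + proj₁ (scaled P) ℤ.* eval P x ≡ + 4 ℤ.* c′
          four with 4∣scale P
          ... | divides s e = + s ℤ.* eval P x , trans (cong (λ u → + u ℤ.* eval P x) (trans e (*-comm s 4))) (trans (cong (ℤ._* eval P x) (ℤ.pos-* 4 s)) (ℤ.*-assoc (+ 4) (+ s) (eval P x)))
          zero-factor : + proj₁ (scaled P) ℤ.* eval P x ≡ + 0 → eval P x ≡ + 0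
          zero-factor e with ℤ.i*j≡0⇒i≡0∨j≡0 (+ proj₁ (scaled P)) e
          ... | inj₂ p = p
          ... | inj₁ p = contradiction (ℤ.+-injective p) (λ q → <-irrefl (sym q) (scale>0 P degP))

      coding-complete : ∀ {a} (z : Vec ℕ k) → a < bb → VAll.All (_< bb) z → eval P (+ a ∷ Vec.map +_ z) ≡ + 0 →
        let g = ℬ ^ β * code β z in g < M₀ × ((R : Range a (+ g)) → let open Range R in ∃ λ o → Odd o × binom (X₀ + X₀) X₀ ≡ N * N * o)
      coding-complete {a} z a<bb pz root = code-full-< k m em z pz , λ R → go R
        where
        x = + a ∷ Vec.map +_ z
        g = ℬ ^ β * code β z
        go : (R : Range a (+ g)) → let open Range R in ∃ λ o → Odd o × binom (X₀ + X₀) X₀ ≡ N * N * o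
        go R = subst (λ x → ∃ λ o → Odd o × binom (x + x) x ≡ N * N * o) (sym X≡)
              (proj₂ (kummer-blocks {S′ = S′} {T′ = T′} (pow2-^ t powℬ) S+T< S′≡ T′≡)
                (noCarry-join′ (pow2-^ (suc m) powℬ) (ℬ ^ m * (ℬ ∸ 2)) q sum< nc₁ (nc₂ digit)))
          where
          open Range R
          digit : ∃ λ r₀ → ∃₂ λ ε h → q ≡ r₀ + ℬ ^ m * (ε + ℬ * h) × r₀ < ℬ ^ m × ε < 2
          digit = zero⇒digit {(+ 1 ℤ.+ vsum (weigh 1 x)) ℤ.^ δ ℤ.* Dval coeffs} {Σℕ (λ (d , _) → Σℕ (λ e → ∣ d ℤ.* monVal e x ∣) expansion) coeffs} {q} {+ H} (subst (λ u → Dec ((+ 1 ℤ.+ vsum (weigh 1 x)) ℤ.^ δ ℤ.* Dval coeffs) u (Σℕ (λ (d , _) → Σℕ (λ e → ∣ d ℤ.* monVal e x ∣) expansion) coeffs))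
                       (trans (cong (+ proj₁ (scaled P) ℤ.*_) root) (ℤ.*-zeroʳ (+ proj₁ (scaled P)))) (dec-product P degP x))
                    (small-size a z a<bb pz) (≤-trans (≤-of-+ {2} {8} 6 refl) 8≤ℬ)
                    (trans (cong (λ u → u ℤ.^ δ ℤ.* Dval coeffs ℤ.+ B^ m ℤ.+ B^ (suc m) ℤ.* + H) (sym (Z≡ a z))) (trans (sym (Qℤ-def a (+ g))) q≡))
          nc₂ : (∃ λ r₀ → ∃₂ λ ε h → q ≡ r₀ + ℬ ^ m * (ε + ℬ * h) × r₀ < ℬ ^ m × ε < 2) → NoCarry (ℬ ^ m * (ℬ ∸ 2)) q
          nc₂ (r₀ , ε , h , eq , r₀< , ε<) = subst (NoCarry (ℬ ^ m * (ℬ ∸ 2))) (sym eq) (digit-encode k m em {h = h} r₀< ε<)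
          Γ≡′ : Γ ≡ g + ℬ ^ m * (2 * bb)
          Γ≡′ = trans (ℤ.+-injective (trans (sym Γ≡) (sym (ℤ.pos-+ (2 * M) g)))) (trans (+-comm (2 * M) g) (cong (g ℕ.+_) (Mask-Γ 2)))
          nc₁ : NoCarry (fullMask k m em) Γ
          nc₁ = subst (NoCarry (fullMask k m em)) (sym Γ≡′) (encode-full k m em z pz)
          sum< : fullMask k m em + Γ < ℬ ^ suc m
          sum< = begin-strict
            fullMask k m em + Γ          <⟨ +-mono-< (fullMask-< k m em) Γ< ⟩
            ℬ ^ m * (2 * bb) + 3 * M     ≡⟨ cong (_+ 3 * M) (sym (Mask-Γ 2)) ⟩
            2 * M + 3 * M                ≤⟨ ≤-of-+ (3 * M) (l M) ⟩
            8 * M                        ≡⟨ sym (*-assoc 8 bb M₀) ⟩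
            8 * bb * M₀                  ≤⟨ *-monoˡ-≤ M₀ 8bb≤ℬ ⟩
            ℬ ^ suc m                    ∎
            where
            open ≤-Reasoning
            l : ∀ M → 8 * M ≡ 2 * M + 3 * M + 3 * M
            l = solve-∀

-- Squares and positivity over ℤ

∣∣-sq : ∀ i → + (∣ i ∣ * ∣ i ∣) ≡ i ℤ.* i
∣∣-sq i = sym (i*i≡+∣i∣*∣i∣ i)

signed : ∀ i → ∃ λ ε → (ε ≡ + 1 ⊎ ε ≡ ℤ.- + 1) × i ≡ + ∣ i ∣ ℤ.* ε
signed (+ n) = + 1 , inj₁ refl , sym (ℤ.*-identityʳ (+ n))
signed -[1+ n ] = ℤ.- + 1 , inj₂ refl , trans (sym (ℤ.-1*i≡-i (+ suc n))) (ℤ.*-comm (ℤ.- + 1) (+ suc n))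

int-cong± : ∀ {m} A B z → A ≡ B ℤ.+ + m ℤ.* z → Cong± m ∣ A ∣ ∣ B ∣
int-cong± {m} A B z e with signed A | signed B
... | ε , sε , eA | ε′ , sε′ , eB = go sε sε′
  where
  a = ∣ A ∣
  b = ∣ B ∣
  e′ : + a ℤ.* ε ≡ + b ℤ.* ε′ ℤ.+ + m ℤ.* z
  e′ = trans (sym eA) (trans e (cong (ℤ._+ + m ℤ.* z) eB))
  go : ε ≡ + 1 ⊎ ε ≡ ℤ.- + 1 → ε′ ≡ + 1 ⊎ ε′ ≡ ℤ.- + 1 → Cong± m a b
  go (inj₁ refl) (inj₁ refl) = inj₁ (cong-sym (int-cong b a m z (trans (l (+ b) (+ m) z) (trans (sym e′) (ℤ.*-identityʳ (+ a))))))
    where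
    l : ∀ b m z → b ℤ.+ m ℤ.* z ≡ b ℤ.* + 1 ℤ.+ m ℤ.* z
    l = ℤ-Solver.solve-∀
  go (inj₂ refl) (inj₂ refl) = inj₁ (int-cong a b m z (trans (l (+ a) (+ m) z) (trans (cong (λ u → + m ℤ.* z ℤ.- u) e′) (l₂ (+ b) (+ m) z))))
    where
    l : ∀ a m z → a ℤ.+ m ℤ.* z ≡ m ℤ.* z ℤ.- a ℤ.* (ℤ.- + 1)
    l = ℤ-Solver.solve-∀
    l₂ : ∀ b m z → m ℤ.* z ℤ.- (b ℤ.* (ℤ.- + 1) ℤ.+ m ℤ.* z) ≡ b
    l₂ = ℤ-Solver.solve-∀
  go (inj₁ refl) (inj₂ refl) = inj₂ (cong-0⇒∣ (cong-sym (int-cong 0 (a + b) m z (trans (l (+ b) (+ m) z) (trans (cong (ℤ._+ + b) (sym e′)) (trans (l₂ (+ a) (+ b)) (sym (ℤ.pos-+ a b))))))))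
    where
    l : ∀ b m z → + 0 ℤ.+ m ℤ.* z ≡ b ℤ.* (ℤ.- + 1) ℤ.+ m ℤ.* z ℤ.+ b
    l = ℤ-Solver.solve-∀
    l₂ : ∀ a b → a ℤ.* + 1 ℤ.+ b ≡ a ℤ.+ b
    l₂ = ℤ-Solver.solve-∀
  go (inj₂ refl) (inj₁ refl) = inj₂ (cong-0⇒∣ (int-cong (a + b) 0 m z (trans (cong (ℤ._+ + m ℤ.* z) (ℤ.pos-+ a b)) (trans (l (+ a) (+ b) (+ m) z) (trans (cong (ℤ._+_ (+ a)) (sym e′)) (l₂ (+ a)))))))
    where
    l : ∀ a b m z → a ℤ.+ b ℤ.+ m ℤ.* z ≡ a ℤ.+ (b ℤ.* + 1 ℤ.+ m ℤ.* z)
    l = ℤ-Solver.solve-∀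
    l₂ : ∀ a → a ℤ.+ a ℤ.* (ℤ.- + 1) ≡ + 0
    l₂ = ℤ-Solver.solve-∀

cong⇒int : ∀ {m a b} → Cong m a b → ∃ λ z → + a ≡ + b ℤ.+ + m ℤ.* z
cong⇒int {m} {a} {b} (k , l , e) = + l ℤ.- + k , trans (s (+ a) (+ k) (+ m)) (trans (cong (ℤ._- + k ℤ.* + m) e′) (s₂ (+ b) (+ k) (+ l) (+ m)))
  where
  cast : ∀ x y → + (x + y * m) ≡ + x ℤ.+ + y ℤ.* + m
  cast x y = trans (ℤ.pos-+ x (y * m)) (cong (ℤ._+_ (+ x)) (ℤ.pos-* y m))
  e′ : + a ℤ.+ + k ℤ.* + m ≡ + b ℤ.+ + l ℤ.* + m
  e′ = trans (sym (cast a k)) (trans (cong +_ e) (cast b l))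
  s : ∀ a k m → a ≡ (a ℤ.+ k ℤ.* m) ℤ.- k ℤ.* m
  s = ℤ-Solver.solve-∀
  s₂ : ∀ b k l m → (b ℤ.+ l ℤ.* m) ℤ.- k ℤ.* m ≡ b ℤ.+ m ℤ.* (l ℤ.- k)
  s₂ = ℤ-Solver.solve-∀

-- S² divides (S n + T)², so S divides S n + T and therefore T; division by S² then shows that Q is
-- a square.
square∧divides-sound : ∀ {S T Q} n → S ≢ + 0 → (S ℤ.* n ℤ.+ T) ℤ.* (S ℤ.* n ℤ.+ T) ℤ.- S ℤ.* S ℤ.* Q ≡ + 0 →
  (∃ λ t → T ≡ S ℤ.* t) × (∃ λ q → Q ≡ + (q * q))
square∧divides-sound {S} {T} {Q} n S≢0 e = (proj₁ divisor , proj₂ divisor) , root Q e₁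
  where
  A = S ℤ.* n ℤ.+ T
  s = ∣ S ∣
  r = ∣ A ∣
  0<s : 0 < s
  0<s = n≢0⇒n>0 (λ p → S≢0 (ℤ.∣i∣≡0⇒i≡0 p))
  instance
    nzs : NonZero s
    nzs = >-nonZero 0<s
  e₁ : + (r * r) ≡ + (s * s) ℤ.* Q
  e₁ = trans (∣∣-sq A) (trans (ℤ.i-j≡0⇒i≡j (A ℤ.* A) (S ℤ.* S ℤ.* Q) e) (cong (ℤ._* Q) (sym (∣∣-sq S))))
  r² : r * r ≡ s * s * ∣ Q ∣
  r² = trans (cong ∣_∣ e₁) (ℤ.abs-* (+ (s * s)) Q)
  s∣r : s ∣ r
  s∣r = sq-∣⇒∣ (divides ∣ Q ∣ (trans r² (*-comm (s * s) ∣ Q ∣)))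
  q = quotient s∣r
  er : r ≡ q * s
  er = m∣n⇒n≡quotient*m s∣r
  root : ∀ Q → + (r * r) ≡ + (s * s) ℤ.* Q → ∃ λ q → Q ≡ + (q * q)
  root (+ c) h = q , cong +_ c≡
    where
    r²′ : r * r ≡ s * s * c
    r²′ = ℤ.+-injective (trans h (sym (ℤ.pos-* (s * s) c)))
    c≡ : c ≡ q * q
    c≡ = *-cancelˡ-≡ c (q * q) (s * s) ⦃ m*n≢0 s s ⦄ (trans (sym r²′) (trans (cong₂ _*_ er er) (l q s)))
      where
      l : ∀ q s → q * s * (q * s) ≡ s * s * (q * q)
      l = solve-∀
  root -[1+ c ] h = contradiction h (pos≢neg (s * s) ⦃ m*n≢0 s s ⦄)
    where
    pos≢neg : ∀ x → .⦃ NonZero x ⦄ → + (r * r) ≢ + x ℤ.* -[1+ c ]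
    pos≢neg (suc x) ()
  divisor : ∃ λ t → T ≡ S ℤ.* t
  divisor with signed A | signed S
  ... | ε , _ , eA | ε′ , sε′ , eS = + q ℤ.* ε ℤ.* ε′ ℤ.- n , trans (l₁ S n T) (trans (cong (ℤ._- S ℤ.* n) eq) (l₃ S n (+ q ℤ.* ε ℤ.* ε′)))
    where
    l₁ : ∀ S n T → T ≡ S ℤ.* n ℤ.+ T ℤ.- S ℤ.* n
    l₁ = ℤ-Solver.solve-∀
    l₃ : ∀ S n t → S ℤ.* t ℤ.- S ℤ.* n ≡ S ℤ.* (t ℤ.- n)
    l₃ = ℤ-Solver.solve-∀
    εε : ∀ {ε} → ε ≡ + 1 ⊎ ε ≡ ℤ.- + 1 → ε ℤ.* ε ≡ + 1
    εε (inj₁ refl) = refl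
    εε (inj₂ refl) = refl
    l₂ : ∀ q s ε ε′ → q ℤ.* s ℤ.* ε ℤ.* (ε′ ℤ.* ε′) ≡ s ℤ.* ε′ ℤ.* (q ℤ.* ε ℤ.* ε′)
    l₂ = ℤ-Solver.solve-∀
    eq : A ≡ S ℤ.* (+ q ℤ.* ε ℤ.* ε′)
    eq = trans eA (trans (cong (ℤ._* ε) (trans (cong +_ er) (ℤ.pos-* q s))) (trans (sym (ℤ.*-identityʳ _))
           (trans (cong (+ q ℤ.* + s ℤ.* ε ℤ.*_) (sym (εε sε′))) (trans (l₂ (+ q) (+ s) ε ε′) (cong (ℤ._* (+ q ℤ.* ε ℤ.* ε′)) (sym eS))))))

square∧divides-complete : ∀ S t q → (S ℤ.* (q ℤ.- t) ℤ.+ S ℤ.* t) ℤ.* (S ℤ.* (q ℤ.- t) ℤ.+ S ℤ.* t) ℤ.- S ℤ.* S ℤ.* (q ℤ.* q) ≡ + 0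
square∧divides-complete = ℤ-Solver.solve-∀

sign-split : ∀ i → (∃ λ n → i ≡ + suc n) ⊎ (∃ λ n → i ≡ ℤ.- + n)
sign-split (+ zero) = inj₂ (0 , refl)
sign-split (+ suc n) = inj₁ (n , refl)
sign-split -[1+ n ] = inj₂ (suc n , refl)

1+2-≢0 : ∀ v → + 2 ℤ.* v ℤ.+ + 1 ≢ + 0
1+2-≢0 v e = case cong±-small (int-cong± {2} (+ 1) (+ 0) (ℤ.- v) (trans (l v) (trans (cong (ℤ._- + 2 ℤ.* v) e) (l₂ v)))) (s≤s (s≤s z≤n)) of λ ()
  where
  l : ∀ u → + 1 ≡ (+ 2 ℤ.* u ℤ.+ + 1) ℤ.- + 2 ℤ.* u
  l = ℤ-Solver.solve-∀
  l₂ : ∀ u → + 0 ℤ.- + 2 ℤ.* u ≡ + 0 ℤ.+ + 2 ℤ.* (ℤ.- u)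
  l₂ = ℤ-Solver.solve-∀

1+3-≢0 : ∀ v → + 3 ℤ.* v ℤ.+ + 1 ≢ + 0
1+3-≢0 v e = case cong±-small (int-cong± {3} (+ 1) (+ 0) (ℤ.- v) (trans (l v) (trans (cong (ℤ._- + 3 ℤ.* v) e) (l₂ v)))) (s≤s (s≤s z≤n)) of λ ()
  where
  l : ∀ u → + 1 ≡ (+ 3 ℤ.* u ℤ.+ + 1) ℤ.- + 3 ℤ.* u
  l = ℤ-Solver.solve-∀
  l₂ : ∀ u → + 0 ℤ.- + 3 ℤ.* u ≡ + 0 ℤ.+ + 3 ℤ.* (ℤ.- u)
  l₂ = ℤ-Solver.solve-∀

-- (-2)ʲ ≡ 1 modulo 3. Allowing the sign is essential, since 2ʲ itself is 1 modulo 3 only for even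
-- j.
power-of-two-mod-3 : ∀ j → ∃ λ v → ∣ + 3 ℤ.* v ℤ.+ + 1 ∣ ≡ 2 ^ j
power-of-two-mod-3 zero = + 0 , refl
power-of-two-mod-3 (suc j) with power-of-two-mod-3 j
... | v , e = ℤ.- (+ 2 ℤ.* v ℤ.+ + 1) , trans (cong ∣_∣ (l v)) (trans (ℤ.abs-* (ℤ.- + 2) (+ 3 ℤ.* v ℤ.+ + 1)) (cong (2 *_) e))
  where
  l : ∀ v → + 3 ℤ.* (ℤ.- (+ 2 ℤ.* v ℤ.+ + 1)) ℤ.+ + 1 ≡ (ℤ.- + 2) ℤ.* (+ 3 ℤ.* v ℤ.+ + 1)
  l = ℤ-Solver.solve-∀

two-adic : ∀ n → 0 < n → ∃₂ λ i k → n ≡ 2 ^ i * suc (2 * k)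
two-adic = <-rec _ go
  where
  go : ∀ n → (∀ {m} → m < n → 0 < m → ∃₂ λ i k → m ≡ 2 ^ i * suc (2 * k)) → 0 < n → ∃₂ λ i k → n ≡ 2 ^ i * suc (2 * k)
  go n rec 0<n with even⊎odd n
  ... | inj₂ (k , refl) = 0 , k , sym (+-identityʳ _)
  ... | inj₁ (zero , refl) = contradiction 0<n (<-irrefl refl)
  ... | inj₁ (suc k , refl) with rec {suc k} (s≤s (≤-trans (s≤s (m≤m+n k (k + 0))) (≤-reflexive (sym (+-suc k (k + 0)))))) z<s
  ...   | i , l , e = suc i , l , trans (cong (2 *_) e) (sym (*-assoc 2 (2 ^ i) (suc (2 * l))))

-- Every nonzero integer is, up to sign, (2 u + 1)(3 v + 1): an odd number times a power of two.
nonzero-param : ∀ y → 0 < y → ∃₂ λ u v → ∣ (+ 2 ℤ.* u ℤ.+ + 1) ℤ.* (+ 3 ℤ.* v ℤ.+ + 1) ∣ ≡ y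
nonzero-param y 0<y with two-adic y 0<y
... | i , k , e with power-of-two-mod-3 i
...   | v , ev = + k , v , trans (ℤ.abs-* (+ 2 ℤ.* + k ℤ.+ + 1) (+ 3 ℤ.* v ℤ.+ + 1)) (trans (cong₂ _*_ (cong ∣_∣ l) ev) (trans (*-comm (suc (2 * k)) (2 ^ i)) (sym e)))
  where
  l : + 2 ℤ.* + k ℤ.+ + 1 ≡ + suc (2 * k)
  l = trans (cong (ℤ._+ + 1) (sym (ℤ.pos-* 2 k))) (trans (sym (ℤ.pos-+ (2 * k) 1)) (cong +_ (+-comm (2 * k) 1)))

-- For R ≤ 0 the second factor is negative as soon as J > 0 and y ≠ 0, so the product is no square.
-- For R > 0 it is 1 modulo J, hence coprime to J. If J = s² and R = r + 1, the Pell coefficient is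
-- (4r + 2) s², never a square, so a suitable y exists.
Positivity : ℤ → ℤ → ℤ → ℤ
Positivity J R y = J ℤ.* ((+ 4 ℤ.* R ℤ.- + 2) ℤ.* J ℤ.* (y ℤ.* y) ℤ.+ + 1)

private
  nonNeg-factor : ∀ {j P q} → 0 < j → + j ℤ.* P ≡ + q → ∃ λ p → P ≡ + p
  nonNeg-factor {suc j} {+ p} _ _ = p , refl
  nonNeg-factor {suc j} { -[1+ p ]} _ ()

positivity-sound : ∀ {j R y q} → 0 < j → y ≢ + 0 → Positivity (+ j) R y ≡ + (q * q) → (∃ λ r → R ≡ + suc r) × IsSquare j
positivity-sound {j} {R} {y} {q} 0<j y≢0 e with nonNeg-factor {j} 0<j e
... | p , ep with sign-split R
...   | inj₂ (ρ , refl) = contradiction absurd (<⇒≱ (s≤s (s≤s z≤n)))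
  where
  y₂ = ∣ y ∣ * ∣ y ∣
  0<y₂ : 0 < y₂
  0<y₂ = *-mono-≤ {x = 1} {u = 1} 0<y 0<y
    where
    0<y : 0 < ∣ y ∣
    0<y = n≢0⇒n>0 (λ h → y≢0 (ℤ.∣i∣≡0⇒i≡0 h))
  l : ∀ ρ j y → (+ 4 ℤ.* (ℤ.- ρ) ℤ.- + 2) ℤ.* j ℤ.* y ℤ.+ + 1 ℤ.+ (+ 4 ℤ.* ρ ℤ.+ + 2) ℤ.* j ℤ.* y ≡ + 1
  l = ℤ-Solver.solve-∀
  cast : + ((4 * ρ + 2) * j * y₂) ≡ (+ 4 ℤ.* + ρ ℤ.+ + 2) ℤ.* + j ℤ.* + y₂
  cast = trans (ℤ.pos-* ((4 * ρ + 2) * j) y₂) (cong (ℤ._* + y₂) (trans (ℤ.pos-* (4 * ρ + 2) j) (cong (ℤ._* + j) (trans (ℤ.pos-+ (4 * ρ) 2) (cong (ℤ._+ + 2) (ℤ.pos-* 4 ρ))))))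
  sum : p + (4 * ρ + 2) * j * y₂ ≡ 1
  sum = ℤ.+-injective (trans (ℤ.pos-+ p _) (trans (cong₂ ℤ._+_ (trans (sym ep) (cong (λ z → (+ 4 ℤ.* (ℤ.- + ρ) ℤ.- + 2) ℤ.* + j ℤ.* z ℤ.+ + 1) (sym (∣∣-sq y)))) cast) (l (+ ρ) (+ j) (+ y₂))))
  absurd : 2 ≤ 1
  absurd = ≤-trans (*-mono-≤ {x = 2} {u = 1} (*-mono-≤ {x = 2} {u = 1} (m≤n+m 2 (4 * ρ)) 0<j) 0<y₂) (≤-trans (m≤n+m _ p) (≤-reflexive sum))
...   | inj₁ (r , refl) = (r , refl) , proj₁ (coprime-product-square 0<j 0<p cop (q , jp))
  where
  y₂ = ∣ y ∣ * ∣ y ∣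
  l : ∀ r j y → (+ 4 ℤ.* (+ 1 ℤ.+ r) ℤ.- + 2) ℤ.* j ℤ.* y ℤ.+ + 1 ≡ + 1 ℤ.+ j ℤ.* ((+ 4 ℤ.* r ℤ.+ + 2) ℤ.* y)
  l = ℤ-Solver.solve-∀
  p≡ : p ≡ suc (j * ((4 * r + 2) * y₂))
  p≡ = ℤ.+-injective (trans (sym ep) (trans (cong (λ z → (+ 4 ℤ.* + suc r ℤ.- + 2) ℤ.* + j ℤ.* z ℤ.+ + 1) (sym (∣∣-sq y)))
    (trans (l (+ r) (+ j) (+ y₂)) (cong (ℤ._+_ (+ 1)) (sym (trans (ℤ.pos-* j ((4 * r + 2) * y₂)) (cong (+ j ℤ.*_) (trans (ℤ.pos-* (4 * r + 2) y₂) (cong (ℤ._* + y₂) (trans (ℤ.pos-+ (4 * r) 2) (cong (ℤ._+ + 2) (ℤ.pos-* 4 r))))))))))))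
  0<p : 0 < p
  0<p = ≤-trans z<s (≤-reflexive (sym p≡))
  cop : Coprime j p
  cop = ∣-suc⇒coprime p≡
  jp : j * p ≡ q * q
  jp = ℤ.+-injective (trans (ℤ.pos-* j p) (trans (cong (+ j ℤ.*_) (sym ep)) e))

positivity-complete : ∀ s r → 0 < s → ∃₂ λ u v → ∃ λ q → Positivity (+ (s * s)) (+ suc r) ((+ 2 ℤ.* u ℤ.+ + 1) ℤ.* (+ 3 ℤ.* v ℤ.+ + 1)) ≡ q ℤ.* q
positivity-complete s r 0<s with pell-exists ((2 + 4 * r) * (s * s)) nonsquare
  where
  nonsquare : ¬ IsSquare ((2 + 4 * r) * (s * s))
  nonsquare (t , e) = ¬≡2-mod-4-square r q (*-cancelʳ-≡ (2 + 4 * r) (q * q) (s * s) ⦃ m*n≢0 s s ⦄ (trans e (trans (cong₂ _*_ et et) (l q s))))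
    where
    instance
      nzs : NonZero s
      nzs = >-nonZero 0<s
    s∣t : s ∣ t
    s∣t = sq-∣⇒∣ (divides (2 + 4 * r) (sym e))
    q = quotient s∣t
    et : t ≡ q * s
    et = m∣n⇒n≡quotient*m s∣t
    l : ∀ q s → q * s * (q * s) ≡ q * q * (s * s)
    l = solve-∀
... | x , y , 0<y , e with nonzero-param y 0<y
...   | u , v , ey = u , v , + s ℤ.* + x , (begin
    + (s * s) ℤ.* ((+ 4 ℤ.* + suc r ℤ.- + 2) ℤ.* + (s * s) ℤ.* (z ℤ.* z) ℤ.+ + 1)
      ≡⟨ cong (λ w → + (s * s) ℤ.* ((+ 4 ℤ.* + suc r ℤ.- + 2) ℤ.* + (s * s) ℤ.* w ℤ.+ + 1)) (trans (sym (∣∣-sq z)) (trans (cong (λ w → + (w * w)) ey) (ℤ.pos-* y y))) ⟩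
    + (s * s) ℤ.* ((+ 4 ℤ.* + suc r ℤ.- + 2) ℤ.* + (s * s) ℤ.* (+ y ℤ.* + y) ℤ.+ + 1)
      ≡⟨ l₁ (+ (s * s)) (+ r) (+ y) ⟩
    + (s * s) ℤ.* (+ 1 ℤ.+ (+ 2 ℤ.+ + 4 ℤ.* + r) ℤ.* + (s * s) ℤ.* (+ y ℤ.* + y))
      ≡⟨ cong₂ ℤ._*_ (ℤ.pos-* s s) (sym pell) ⟩
    + s ℤ.* + s ℤ.* (+ x ℤ.* + x)
      ≡⟨ l₂ (+ s) (+ x) ⟩
    + s ℤ.* + x ℤ.* (+ s ℤ.* + x) ∎)
  where
  open ≡-Reasoning
  z = (+ 2 ℤ.* u ℤ.+ + 1) ℤ.* (+ 3 ℤ.* v ℤ.+ + 1)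
  l₁ : ∀ j r y → j ℤ.* ((+ 4 ℤ.* (+ 1 ℤ.+ r) ℤ.- + 2) ℤ.* j ℤ.* (y ℤ.* y) ℤ.+ + 1) ≡ j ℤ.* (+ 1 ℤ.+ (+ 2 ℤ.+ + 4 ℤ.* r) ℤ.* j ℤ.* (y ℤ.* y))
  l₁ = ℤ-Solver.solve-∀
  l₂ : ∀ s x → s ℤ.* s ℤ.* (x ℤ.* x) ≡ s ℤ.* x ℤ.* (s ℤ.* x)
  l₂ = ℤ-Solver.solve-∀
  pell : + x ℤ.* + x ≡ + 1 ℤ.+ (+ 2 ℤ.+ + 4 ℤ.* + r) ℤ.* + (s * s) ℤ.* (+ y ℤ.* + y)
  pell = trans (sym (ℤ.pos-* x x)) (trans (cong +_ e) (cong (ℤ._+_ (+ 1)) (trans (ℤ.pos-* ((2 + 4 * r) * (s * s)) (y * y))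
           (cong₂ ℤ._*_ (trans (ℤ.pos-* (2 + 4 * r) (s * s)) (cong (ℤ._* + (s * s)) (trans (ℤ.pos-+ 2 (4 * r)) (cong (ℤ._+_ (+ 2)) (ℤ.pos-* 4 r))))) (ℤ.pos-* y y)))))

-- The three coprime squares S₂, F and I

pellForm : ℤ → ℤ → ℤ
pellForm α z = (α ℤ.* α ℤ.- + 1) ℤ.* (z ℤ.* z) ℤ.+ + 1

pellForm-pos : ∀ a z → pellForm (+ suc a) z ≡ + suc (a * (2 + a) * (∣ z ∣ * ∣ z ∣))
pellForm-pos a z = trans (cong (λ w → (+ suc a ℤ.* + suc a ℤ.- + 1) ℤ.* w ℤ.+ + 1) (sym (∣∣-sq z)))
  (trans (l (+ a) (+ (∣ z ∣ * ∣ z ∣))) (cong (ℤ._+_ (+ 1)) (sym (trans (ℤ.pos-* (a * (2 + a)) (∣ z ∣ * ∣ z ∣)) (cong (ℤ._* + (∣ z ∣ * ∣ z ∣)) (trans (ℤ.pos-* a (2 + a)) (cong (+ a ℤ.*_) (ℤ.pos-+ 2 a))))))))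
  where
  l : ∀ a z → ((+ 1 ℤ.+ a) ℤ.* (+ 1 ℤ.+ a) ℤ.- + 1) ℤ.* z ℤ.+ + 1 ≡ + 1 ℤ.+ a ℤ.* (+ 2 ℤ.+ a) ℤ.* z
  l = ℤ-Solver.solve-∀

*-pos : ∀ {m n} → 0 < m → 0 < n → 0 < m * n
*-pos {m} {n} p q = *-mono-≤ {1} {m} {1} {n} p q

-- G = α + F (F − α) is suc G′: either F = 1 or F ≥ a, so the truncated subtraction does no harm.
module Core (a k : ℕ) (B C K x y : ℤ) where

  c e φ f G′ h i s₂ d : ℕ
  c = ∣ C ∣
  s₂ = suc (k * (2 + k) * (∣ K ∣ * ∣ K ∣))
  d = suc (a * (2 + a) * (c * c))
  e = 2 * (c * c) * d * s₂ * ∣ x ∣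
  φ = a * (2 + a) * (e * e)
  f = suc φ
  G′ = φ * (suc φ ∸ a)
  Hℤ : ℤ
  Hℤ = C ℤ.+ + f ℤ.* (B ℤ.+ (+ 2 ℤ.* y ℤ.- + 1) ℤ.* C)
  h = ∣ Hℤ ∣
  i = suc (G′ * (2 + G′) * (h * h))

  0<s₂ : 0 < s₂
  0<s₂ = z<s

  0<d : 0 < d
  0<d = z<s

  0<f : 0 < f
  0<f = z<s

  0<i : 0 < i
  0<i = z<s

  E≡ : ∣ + 2 ℤ.* (C ℤ.* C) ℤ.* + d ℤ.* + s₂ ℤ.* x ∣ ≡ e
  E≡ = trans (ℤ.abs-* (+ 2 ℤ.* (C ℤ.* C) ℤ.* + d ℤ.* + s₂) x) (cong (_* ∣ x ∣) (trans (ℤ.abs-* (+ 2 ℤ.* (C ℤ.* C) ℤ.* + d) (+ s₂)) (cong (_* s₂)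
         (trans (ℤ.abs-* (+ 2 ℤ.* (C ℤ.* C)) (+ d)) (cong (_* d) (trans (ℤ.abs-* (+ 2) (C ℤ.* C)) (cong (2 *_) (ℤ.abs-* C C))))))))

  F≡ : pellForm (+ suc a) (+ 2 ℤ.* (C ℤ.* C) ℤ.* + d ℤ.* + s₂ ℤ.* x) ≡ + f
  F≡ = trans (pellForm-pos a (+ 2 ℤ.* (C ℤ.* C) ℤ.* + d ℤ.* + s₂ ℤ.* x)) (cong (λ z → + suc (a * (2 + a) * (z * z))) E≡)

  φ-cases : φ ≡ 0 ⊎ a ≤ suc φ
  φ-cases with e in eq
  ... | zero = inj₁ (*-zeroʳ (a * (2 + a)))
  ... | suc e′ = inj₂ (m≤n⇒m≤1+n (≤-trans (m≤m*n a (2 + a)) (m≤m*n (a * (2 + a)) (suc e′ * suc e′))))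

  -- The left side shows G ≡ α modulo F. The right side is G = 1 + (F - 1)(F + 1 - α), which shows G
  -- ≡ 1 modulo F - 1 and hence modulo 2C.
  G≡ : + suc a ℤ.+ + f ℤ.* (+ f ℤ.- + suc a) ≡ + suc G′
  G≡ with φ-cases
  ... | inj₁ p = trans (cong (λ z → + suc a ℤ.+ + suc z ℤ.* (+ suc z ℤ.- + suc a)) p) (trans (l (+ a)) (cong (λ z → + suc (z * (suc z ∸ a))) (sym p)))
    where
    l : ∀ a → (+ 1 ℤ.+ a) ℤ.+ + 1 ℤ.* (+ 1 ℤ.- (+ 1 ℤ.+ a)) ≡ + 1
    l = ℤ-Solver.solve-∀
  ... | inj₂ q = trans (l (+ a) (+ φ)) (cong (ℤ._+_ (+ 1)) (trans (cong (+ φ ℤ.*_) (trans (ℤ.m-n≡m⊖n (suc φ) a) (ℤ.⊖-≥ q))) (sym (ℤ.pos-* φ (suc φ ∸ a)))))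
    where
    l : ∀ a φ → (+ 1 ℤ.+ a) ℤ.+ (+ 1 ℤ.+ φ) ℤ.* ((+ 1 ℤ.+ φ) ℤ.- (+ 1 ℤ.+ a)) ≡ + 1 ℤ.+ φ ℤ.* ((+ 1 ℤ.+ φ) ℤ.- a)
    l = ℤ-Solver.solve-∀

  I≡ : pellForm (+ suc a ℤ.+ + f ℤ.* (+ f ℤ.- + suc a)) Hℤ ≡ + i
  I≡ = trans (cong (λ z → pellForm z Hℤ) G≡) (pellForm-pos G′ Hℤ)

  G≡α : Cong f G′ a
  G≡α = cong-sym (int-cong a G′ f (+ f ℤ.- + suc a) (trans (l (+ a) (+ f ℤ.* (+ f ℤ.- + suc a))) (trans (cong (ℤ._- + 1) G≡) (l₂ (+ G′)))))
    where
    l : ∀ a z → a ℤ.+ z ≡ (+ 1 ℤ.+ a) ℤ.+ z ℤ.- + 1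
    l = ℤ-Solver.solve-∀
    l₂ : ∀ g → + 1 ℤ.+ g ℤ.- + 1 ≡ g
    l₂ = ℤ-Solver.solve-∀

  private
    d∣e : d ∣ e
    d∣e = ∣m⇒∣m*n ∣ x ∣ (∣m⇒∣m*n s₂ (n∣m*n (2 * (c * c))))
    s₂∣e : s₂ ∣ e
    s₂∣e = ∣m⇒∣m*n ∣ x ∣ (n∣m*n (2 * (c * c) * d))
    2cc∣e : 2 * (c * c) ∣ e
    2cc∣e = ∣m⇒∣m*n ∣ x ∣ (∣m⇒∣m*n s₂ (m∣m*n d))
    e∣φ : e ∣ φ
    e∣φ = ∣n⇒∣m*n (a * (2 + a)) (m∣m*n e)

  cc∣e : c * c ∣ e
  cc∣e = ∣-trans (n∣m*n 2) 2cc∣e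

  2c∣φ : 2 * c ∣ φ
  2c∣φ = ∣-trans (∣-trans (*-monoʳ-∣ 2 (m∣m*n {c} c)) 2cc∣e) e∣φ

  φ∣G′ : φ ∣ G′
  φ∣G′ = m∣m*n (suc φ ∸ a)

  G≡1 : 2 * c ∣ G′
  G≡1 = ∣-trans 2c∣φ φ∣G′

  H≡C : Cong± f h c
  H≡C = int-cong± Hℤ C _ refl

  -- F ≡ 1 modulo 2C, so H ≡ C + B + (2y - 1) C = B + 2yC.
  H≡B : Cong± (2 * c) h ∣ B ∣
  H≡B with 2c∣φ | signed C
  ... | divides q eφ | ε , _ , eC = int-cong± Hℤ B (+ q ℤ.* t ℤ.+ ε ℤ.* y)
    (trans (cong (λ z → C ℤ.+ z ℤ.* t) (trans (cong (λ z → + suc z) eφ) (cong (ℤ._+_ (+ 1)) (ℤ.pos-* q (2 * c)))))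
      (trans (l C (+ q) (+ (2 * c)) B y)
        (trans (cong (λ z → B ℤ.+ z ℤ.* y ℤ.+ + q ℤ.* + (2 * c) ℤ.* t) (trans (cong (λ z → + 2 ℤ.* z) eC) (trans (sym (ℤ.*-assoc (+ 2) (+ c) ε)) (cong (ℤ._* ε) (sym (ℤ.pos-* 2 c))))))
          (l₂ B (+ (2 * c)) ε y (+ q) t))))
    where
    t = B ℤ.+ (+ 2 ℤ.* y ℤ.- + 1) ℤ.* C
    l : ∀ C q m B y → C ℤ.+ (+ 1 ℤ.+ q ℤ.* m) ℤ.* (B ℤ.+ (+ 2 ℤ.* y ℤ.- + 1) ℤ.* C) ≡ B ℤ.+ + 2 ℤ.* C ℤ.* y ℤ.+ q ℤ.* m ℤ.* (B ℤ.+ (+ 2 ℤ.* y ℤ.- + 1) ℤ.* C)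
    l = ℤ-Solver.solve-∀
    l₂ : ∀ B m ε y q t → B ℤ.+ m ℤ.* ε ℤ.* y ℤ.+ q ℤ.* m ℤ.* t ≡ B ℤ.+ m ℤ.* (q ℤ.* t ℤ.+ ε ℤ.* y)
    l₂ = ℤ-Solver.solve-∀

  private
    cong-α : Cong± f h c → Cong f (a * (2 + a) * (c * c)) (G′ * (2 + G′) * (h * h))
    cong-α hc = cong-* (cong-sym (cong-* G≡α (cong-+ (cong-refl {a = 2}) G≡α))) (cong-sym (sq hc))
      where
      sq : Cong± f h c → Cong f (h * h) (c * c)
      sq (inj₁ p) = cong-* p p
      sq (inj₂ p) = cong-+-cancelʳ {c = h * c} {d = h * c} (cong-trans (∣⇒cong-0 (subst (f ∣_) (*-distribˡ-+ h h c) (∣n⇒∣m*n h p)))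
                      (cong-sym (∣⇒cong-0 (subst (f ∣_) (l h c) (∣m⇒∣m*n c p))))) cong-refl
        where
        l : ∀ h c → (h + c) * c ≡ c * c + h * c
        l = solve-∀

  -- Modulo F one has G ≡ α and H ≡ ±C, hence I ≡ D. But D divides E, and F ≡ 1 modulo E.
  coprime-f-i : Coprime f i
  coprime-f-i {t} (t∣f , t∣i) = ∣1⇒≡1 (∣m+n∣m⇒∣n (subst (t ∣_) (+-comm 1 φ) t∣f) (∣-trans t∣d (∣-trans d∣e e∣φ)))
    where
    t∣d : t ∣ d
    t∣d = cong-∣-resp (cong-∣ t∣f (cong-+ (cong-refl {a = 1}) (cong-α H≡C))) t∣i

  -- S₂ is a factor of E, so it divides F - 1 and with it G - 1. Both F and I are therefore 1 modulo
  -- S₂.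
  coprime-s₂-fi : Coprime s₂ (f * i)
  coprime-s₂-fi = coprime-*ʳ (cop s₂∣φ) (cop (∣m⇒∣m*n (h * h) (∣m⇒∣m*n (2 + G′) (∣-trans s₂∣φ φ∣G′))))
    where
    s₂∣φ : s₂ ∣ φ
    s₂∣φ = ∣-trans s₂∣e e∣φ
    cop : ∀ {n} → s₂ ∣ n → Coprime s₂ (suc n)
    cop (divides q refl) = ∣-suc⇒coprime {t = q} (cong suc (*-comm q s₂))

  j : ℕ
  j = s₂ * (f * i)

  0<j : 0 < j
  0<j = *-pos 0<s₂ (*-pos 0<f 0<i)

  squares : IsSquare j → IsSquare s₂ × IsSquare f × IsSquare i
  squares h with coprime-product-square {s₂} {f * i} 0<s₂ (*-pos 0<f 0<i) coprime-s₂-fi h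
  ... | p , q = p , coprime-product-square {f} {i} 0<f 0<i coprime-f-i q

  criterion : 2 ≤ a → 0 < ∣ B ∣ → ∣ B ∣ ≤ c → 0 < ∣ x ∣ → IsSquare f → IsSquare i → c ≡ Y a ∣ B ∣
  criterion 2≤a 0<B B≤c 0<x (r , er) (r′ , er′) =
    Y-criterion {a} {c} {∣ B ∣} {e} {r} {G′} {h} {r′} 2≤a 0<B B≤c 0<e cc∣e (sym er) (sym er′)
      (cong-∣ (divides r er) G≡α) G≡1 (cong±-∣ (divides r er) H≡C) H≡B
    where
    0<c : 0 < c
    0<c = <-≤-trans 0<B B≤c
    0<e : 0 < e
    0<e = *-pos (*-pos (*-pos (*-pos {2} z<s (*-pos 0<c 0<c)) 0<d) 0<s₂) 0<x

-- x is the only free factor of E, so F is a square when x solves the Pell equation with coefficient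
-- (α² - 1) e₀². For I the number H is made equal to Y G′ B, and S₂ is a square since K is a Pell
-- solution.
core-complete : ∀ a k B N → 1 ≤ a → 0 < B →
  ∃₂ λ x y → 0 < ∣ x ∣ × ∃ λ s → 0 < s × Core.j a k (+ B) (+ Y a B) (+ Y k N) x y ≡ s * s
core-complete a k B N 1≤a 0<B = result (pell-exists (a * (2 + a) * (e₀ * e₀)) nonsquare)
  where
  C = Y a B
  instance
    nzC : NonZero C
    nzC = >-nonZero (≤-trans 0<B (n≤Y a B))
  s₂ = suc (k * (2 + k) * (Y k N * Y k N))
  d = suc (a * (2 + a) * (C * C))
  e₀ = 2 * (C * C) * d * s₂
  instance
    nze : NonZero e₀
    nze = m*n≢0 (2 * (C * C) * d) s₂ ⦃ m*n≢0 (2 * (C * C)) d ⦃ m*n≢0 2 (C * C) ⦃ _ ⦄ ⦃ m*n≢0 C C ⦄ ⦄ ⦄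
  nonsquare : ¬ IsSquare (a * (2 + a) * (e₀ * e₀))
  -- After division by e₀² a root q would satisfy a² < q² < (a + 1)².
  nonsquare (t , e) = contradiction (sq-cancel-< {a} {q} (subst (a * a <_) aq lower)) (≤⇒≯ (≤-pred (sq-cancel-< {q} {suc a} (subst (_< suc a * suc a) aq upper))))
    where
    e₀∣t : e₀ ∣ t
    e₀∣t = sq-∣⇒∣ (divides (a * (2 + a)) (sym e))
    q = quotient e₀∣t
    et : t ≡ q * e₀
    et = m∣n⇒n≡quotient*m e₀∣t
    aq : a * (2 + a) ≡ q * q
    aq = *-cancelʳ-≡ (a * (2 + a)) (q * q) (e₀ * e₀) ⦃ m*n≢0 e₀ e₀ ⦄ (trans e (trans (cong₂ _*_ et et) (l q e₀)))
      where
      l : ∀ q s → q * s * (q * s) ≡ q * q * (s * s)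
      l = solve-∀
    lower : a * a < a * (2 + a)
    lower = *-monoʳ-< a ⦃ >-nonZero 1≤a ⦄ (s≤s (n≤1+n a))
    upper : a * (2 + a) < suc a * suc a
    upper = ≤-reflexive (l a)
      where
      l : ∀ a → suc (a * (2 + a)) ≡ suc a * suc a
      l = solve-∀
  result : (∃₂ λ r x → 0 < x × r * r ≡ suc (a * (2 + a) * (e₀ * e₀) * (x * x))) →
    ∃₂ λ x y → 0 < ∣ x ∣ × ∃ λ s → 0 < s × Core.j a k (+ B) (+ C) (+ Y k N) x y ≡ s * s
  result (r , x , 0<x , er) = + x , y , 0<x , s , 0<s , j≡
    where
    -- f, φ and G′ are independent of y; the value 0 stands in until y can be computed from them.
    module C₀ = Core a k (+ B) (+ C) (+ Y k N) (+ x) (+ 0)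
    f = C₀.f
    φ = C₀.φ
    G′ = C₀.G′
    H₀ = Y G′ B
    fint : ∃ λ z → + H₀ ≡ + C ℤ.+ + f ℤ.* z
    fint = cong⇒int (proj₂ (XY-cong C₀.G≡α B))
    bint : ∃ λ z → + H₀ ≡ + B ℤ.+ + (2 * C) ℤ.* z
    bint = cong⇒int (cong-∣ C₀.G≡1 (Y-mod G′ B))
    z = proj₁ fint
    z′ = proj₁ bint
    q = quotient C₀.2c∣φ
    -- H₀ = C + F z = B + 2C z′ and F = 1 + 2C q give z = B - C + 2C (z′ - q z). So every H with
    -- both congruences has the prescribed form.
    y = z′ ℤ.- + q ℤ.* z
    z≡ : z ≡ + B ℤ.+ (+ 2 ℤ.* y ℤ.- + 1) ℤ.* + C
    z≡ = trans (l₁ z (+ C) (+ φ)) (trans (cong (λ w → w ℤ.- + C ℤ.- + φ ℤ.* z) (trans (sym (proj₂ fint)) (proj₂ bint)))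
           (trans (cong₂ (λ u w → + B ℤ.+ u ℤ.* z′ ℤ.- + C ℤ.- w ℤ.* z) (ℤ.pos-* 2 C) (trans (cong +_ (m∣n⇒n≡quotient*m C₀.2c∣φ)) (trans (ℤ.pos-* q (2 * C)) (cong (+ q ℤ.*_) (ℤ.pos-* 2 C)))))
             (l₂ (+ B) (+ C) z′ (+ q) z)))
      where
      l₁ : ∀ z C φ → z ≡ (C ℤ.+ (+ 1 ℤ.+ φ) ℤ.* z) ℤ.- C ℤ.- φ ℤ.* z
      l₁ = ℤ-Solver.solve-∀
      l₂ : ∀ B C z′ q z → B ℤ.+ + 2 ℤ.* C ℤ.* z′ ℤ.- C ℤ.- q ℤ.* (+ 2 ℤ.* C) ℤ.* z ≡ B ℤ.+ (+ 2 ℤ.* (z′ ℤ.- q ℤ.* z) ℤ.- + 1) ℤ.* C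
      l₂ = ℤ-Solver.solve-∀
    module C₁ = Core a k (+ B) (+ C) (+ Y k N) (+ x) y
    h≡ : C₁.h ≡ H₀
    h≡ = cong ∣_∣ (trans (cong (λ w → + C ℤ.+ + f ℤ.* w) (sym z≡)) (sym (proj₂ fint)))
    s = X k N * (r * X G′ B)
    f≡ : f ≡ r * r
    f≡ = sym (trans er (cong suc (l (a * (2 + a)) e₀ x)))
      where
      l : ∀ a e x → a * (e * e) * (x * x) ≡ a * (e * x * (e * x))
      l = solve-∀
    i≡ : C₁.i ≡ X G′ B * X G′ B
    i≡ = trans (cong (λ w → suc (G′ * (2 + G′) * (w * w))) h≡) (sym (pell-XY G′ B))
    j≡ : C₁.j ≡ s * s
    j≡ = trans (cong₂ _*_ (sym (pell-XY k N)) (cong₂ _*_ f≡ i≡)) (l (X k N) r (X G′ B))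
      where
      l : ∀ p r q → p * p * (r * r * (q * q)) ≡ p * (r * q) * (p * (r * q))
      l = solve-∀
    0<r : 0 < r
    0<r = n≢0⇒n>0 (λ { refl → case er of λ () })
    0<s : 0 < s
    0<s = *-pos (X>0 k N) (*-pos 0<r (X>0 G′ B))

-- The equation in eleven unknowns

-- X, Y, bb and M₀ stand for the values at (a , b , g) of the polynomials of the coding, and b̂ = 3 b + 1.
record Vars : Set where
  constructor vars
  field
    Xᵛ Yᵛ bbᵛ M₀ᵛ aᵛ b̂ᵛ gᵛ hᵛ kᵛ lᵛ wᵛ xᵛ yᵛ uᵛ vᵛ nᵛ : ℤ

open Vars

module Sys where

  abstract

    W V L U α κ B C K S₂ D E F G H I J M R S₀ T₀ yy Q equation : Vars → ℤ
    W s = b̂ᵛ s ℤ.* wᵛ s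
    V s = + 16 ℤ.* (Yᵛ s ℤ.* (+ 1 ℤ.+ W s ℤ.* W s))
    L s = Yᵛ s ℤ.* (+ 2 ℤ.* lᵛ s ℤ.+ + 1)
    -- One plus a square exceeds |X L| whatever the signs, and it is positive even when nothing is
    -- known about X and L.
    U s = + 64 ℤ.* (+ 1 ℤ.+ Xᵛ s ℤ.* Xᵛ s ℤ.* (L s ℤ.* L s))
    α s = U s ℤ.* (+ 1 ℤ.+ V s)
    κ s = + 2 ℤ.* (U s ℤ.* U s ℤ.* V s)
    B s = + 1 ℤ.+ (Xᵛ s ℤ.+ Xᵛ s)
    C s = B s ℤ.+ (α s ℤ.- + 1) ℤ.* hᵛ s
    K s = + 1 ℤ.+ Xᵛ s ℤ.+ (κ s ℤ.- + 1) ℤ.* kᵛ s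
    S₂ s = pellForm (κ s) (K s)
    D s = pellForm (α s) (C s)
    E s = + 2 ℤ.* (C s ℤ.* C s) ℤ.* D s ℤ.* S₂ s ℤ.* xᵛ s
    F s = pellForm (α s) (E s)
    G s = α s ℤ.+ F s ℤ.* (F s ℤ.- α s)
    H s = C s ℤ.+ F s ℤ.* (B s ℤ.+ (+ 2 ℤ.* yᵛ s ℤ.- + 1) ℤ.* C s)
    I s = pellForm (G s) (H s)
    J s = S₂ s ℤ.* (F s ℤ.* I s)
    M s = bbᵛ s ℤ.* M₀ᵛ s
    -- Positivity yields x ≠ 0, g² + a² M₀² < M² and 16 (C - K L)² < K², that is, all inequalities
    -- of the system in one.
    R s = xᵛ s ℤ.* xᵛ s ℤ.* (K s ℤ.* K s ℤ.* (M s ℤ.* M s ℤ.- (gᵛ s ℤ.* gᵛ s ℤ.+ aᵛ s ℤ.* aᵛ s ℤ.* (M₀ᵛ s ℤ.* M₀ᵛ s))) ℤ.- + 16 ℤ.* (M s ℤ.* M s) ℤ.* ((C s ℤ.- K s ℤ.* L s) ℤ.* (C s ℤ.- K s ℤ.* L s)))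
    -- The modulus for which the Pell recurrence has the roots 2 and 1/2. `T₀` is the congruence
    -- satisfied by W = 2ᴮ together with C = Y (α - 1) B.
    S₀ s = + 4 ℤ.* α s ℤ.- + 5
    T₀ s = + 3 ℤ.* (W s ℤ.* C s) ℤ.- + 2 ℤ.* (W s ℤ.* W s ℤ.- + 1)
    yy s = (+ 2 ℤ.* uᵛ s ℤ.+ + 1) ℤ.* (+ 3 ℤ.* vᵛ s ℤ.+ + 1)
    Q s = Positivity (J s) (R s) (yy s)
    equation s = (S₀ s ℤ.* nᵛ s ℤ.+ T₀ s) ℤ.* (S₀ s ℤ.* nᵛ s ℤ.+ T₀ s) ℤ.- S₀ s ℤ.* S₀ s ℤ.* Q s

    W-def : ∀ s → W s ≡ b̂ᵛ s ℤ.* wᵛ s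
    W-def s = refl
    V-def : ∀ s → V s ≡ + 16 ℤ.* (Yᵛ s ℤ.* (+ 1 ℤ.+ W s ℤ.* W s))
    V-def s = refl
    L-def : ∀ s → L s ≡ Yᵛ s ℤ.* (+ 2 ℤ.* lᵛ s ℤ.+ + 1)
    L-def s = refl
    U-def : ∀ s → U s ≡ + 64 ℤ.* (+ 1 ℤ.+ Xᵛ s ℤ.* Xᵛ s ℤ.* (L s ℤ.* L s))
    U-def s = refl
    α-def : ∀ s → α s ≡ U s ℤ.* (+ 1 ℤ.+ V s)
    α-def s = refl
    κ-def : ∀ s → κ s ≡ + 2 ℤ.* (U s ℤ.* U s ℤ.* V s)
    κ-def s = refl
    B-def : ∀ s → B s ≡ + 1 ℤ.+ (Xᵛ s ℤ.+ Xᵛ s)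
    B-def s = refl
    C-def : ∀ s → C s ≡ B s ℤ.+ (α s ℤ.- + 1) ℤ.* hᵛ s
    C-def s = refl
    K-def : ∀ s → K s ≡ + 1 ℤ.+ Xᵛ s ℤ.+ (κ s ℤ.- + 1) ℤ.* kᵛ s
    K-def s = refl
    S₂-def : ∀ s → S₂ s ≡ pellForm (κ s) (K s)
    S₂-def s = refl
    D-def : ∀ s → D s ≡ pellForm (α s) (C s)
    D-def s = refl
    E-def : ∀ s → E s ≡ + 2 ℤ.* (C s ℤ.* C s) ℤ.* D s ℤ.* S₂ s ℤ.* xᵛ s
    E-def s = refl
    F-def : ∀ s → F s ≡ pellForm (α s) (E s)
    F-def s = refl
    G-def : ∀ s → G s ≡ α s ℤ.+ F s ℤ.* (F s ℤ.- α s)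
    G-def s = refl
    H-def : ∀ s → H s ≡ C s ℤ.+ F s ℤ.* (B s ℤ.+ (+ 2 ℤ.* yᵛ s ℤ.- + 1) ℤ.* C s)
    H-def s = refl
    I-def : ∀ s → I s ≡ pellForm (G s) (H s)
    I-def s = refl
    J-def : ∀ s → J s ≡ S₂ s ℤ.* (F s ℤ.* I s)
    J-def s = refl
    M-def : ∀ s → M s ≡ bbᵛ s ℤ.* M₀ᵛ s
    M-def s = refl
    R-def : ∀ s → R s ≡ xᵛ s ℤ.* xᵛ s ℤ.* (K s ℤ.* K s ℤ.* (M s ℤ.* M s ℤ.- (gᵛ s ℤ.* gᵛ s ℤ.+ aᵛ s ℤ.* aᵛ s ℤ.* (M₀ᵛ s ℤ.* M₀ᵛ s))) ℤ.- + 16 ℤ.* (M s ℤ.* M s) ℤ.* ((C s ℤ.- K s ℤ.* L s) ℤ.* (C s ℤ.- K s ℤ.* L s)))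
    R-def s = refl
    S₀-def : ∀ s → S₀ s ≡ + 4 ℤ.* α s ℤ.- + 5
    S₀-def s = refl
    T₀-def : ∀ s → T₀ s ≡ + 3 ℤ.* (W s ℤ.* C s) ℤ.- + 2 ℤ.* (W s ℤ.* W s ℤ.- + 1)
    T₀-def s = refl
    yy-def : ∀ s → yy s ≡ (+ 2 ℤ.* uᵛ s ℤ.+ + 1) ℤ.* (+ 3 ℤ.* vᵛ s ℤ.+ + 1)
    yy-def s = refl
    Q-def : ∀ s → Q s ≡ Positivity (J s) (R s) (yy s)
    Q-def s = refl
    equation-def : ∀ s → equation s ≡ (S₀ s ℤ.* nᵛ s ℤ.+ T₀ s) ℤ.* (S₀ s ℤ.* nᵛ s ℤ.+ T₀ s) ℤ.- S₀ s ℤ.* S₀ s ℤ.* Q s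
    equation-def s = refl

-- Here α = 1 + a₀ and κ = 1 + k₀.
module Values (X₀ L₀ W₀ y₀ : ℕ) (0<y₀ : 0 < y₀) where

  V₀ U₀ a₀ k₀ : ℕ
  V₀ = 16 * (y₀ * suc (W₀ * W₀))
  U₀ = 64 * suc (X₀ * X₀ * (L₀ * L₀))
  a₀ = pred (U₀ * suc V₀)
  k₀ = pred (2 * (U₀ * U₀ * V₀))

  0<U₀ : 0 < U₀
  0<U₀ = *-pos {64} z<s z<s

  0<V₀ : 0 < V₀
  0<V₀ = *-pos {16} z<s (*-pos 0<y₀ z<s)

  ea : suc a₀ ≡ U₀ * suc V₀
  ea = suc-pred (U₀ * suc V₀) ⦃ >-nonZero (*-pos 0<U₀ z<s) ⦄

  ek : suc k₀ ≡ 2 * (U₀ * U₀ * V₀)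
  ek = suc-pred (2 * (U₀ * U₀ * V₀)) ⦃ >-nonZero (*-pos {2} z<s (*-pos (*-pos 0<U₀ 0<U₀) 0<V₀)) ⦄

  U₀≥ : 64 * (X₀ * L₀) ≤ U₀
  U₀≥ = *-monoʳ-≤ 64 (≤-trans (n≤1+n² (X₀ * L₀)) (≤-reflexive (cong suc (l X₀ L₀))))
    where
    n≤1+n² : ∀ n → n ≤ suc (n * n)
    n≤1+n² zero = z≤n
    n≤1+n² (suc n) = m≤n⇒m≤1+n (m≤m*n (suc n) (suc n))
    l : ∀ x y → x * y * (x * y) ≡ x * x * (y * y)
    l = solve-∀

  a₀≥ : 64 * (X₀ * L₀) + 63 ≤ a₀
  a₀≥ = ≤-pred (begin
    suc (64 * (X₀ * L₀) + 63) ≡⟨ l (X₀ * L₀) ⟩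
    64 * suc (X₀ * L₀)        ≤⟨ *-monoʳ-≤ 64 (s≤s XL≤) ⟩
    U₀                        ≤⟨ m≤m*n U₀ (suc V₀) ⟩
    U₀ * suc V₀               ≡⟨ sym ea ⟩
    suc a₀                    ∎)
    where
    open ≤-Reasoning
    l : ∀ z → suc (64 * z + 63) ≡ 64 * suc z
    l = solve-∀
    n≤n² : ∀ n → n ≤ n * n
    n≤n² zero = z≤n
    n≤n² (suc n) = m≤m*n (suc n) (suc n)
    XL≤ : X₀ * L₀ ≤ X₀ * X₀ * (L₀ * L₀)
    XL≤ = *-mono-≤ (n≤n² X₀) (n≤n² L₀)

  module _ {X L W : ℤ} (eX : ∣ X ∣ ≡ X₀) (eL : ∣ L ∣ ≡ L₀) (eW : ∣ W ∣ ≡ W₀) where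

    private
      sq-cast : ∀ {i n} → ∣ i ∣ ≡ n → i ℤ.* i ≡ + (n * n)
      sq-cast {i} refl = sym (∣∣-sq i)

    V≡ : + 16 ℤ.* (+ y₀ ℤ.* (+ 1 ℤ.+ W ℤ.* W)) ≡ + V₀
    V≡ = trans (cong (λ z → + 16 ℤ.* (+ y₀ ℤ.* (+ 1 ℤ.+ z))) (sq-cast {W} eW)) (sym (trans (ℤ.pos-* 16 (y₀ * suc (W₀ * W₀))) (cong (+ 16 ℤ.*_) (ℤ.pos-* y₀ (suc (W₀ * W₀))))))

    U≡ : + 64 ℤ.* (+ 1 ℤ.+ X ℤ.* X ℤ.* (L ℤ.* L)) ≡ + U₀
    U≡ = trans (cong₂ (λ z z′ → + 64 ℤ.* (+ 1 ℤ.+ z ℤ.* z′)) (sq-cast {X} eX) (sq-cast {L} eL))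
           (sym (trans (ℤ.pos-* 64 (suc (X₀ * X₀ * (L₀ * L₀)))) (cong (λ z → + 64 ℤ.* (+ 1 ℤ.+ z)) (ℤ.pos-* (X₀ * X₀) (L₀ * L₀)))))

  α≡ : + U₀ ℤ.* (+ 1 ℤ.+ + V₀) ≡ + suc a₀
  α≡ = trans (sym (ℤ.pos-* U₀ (suc V₀))) (cong +_ (sym ea))

  κ≡ : + 2 ℤ.* (+ U₀ ℤ.* + U₀ ℤ.* + V₀) ≡ + suc k₀
  κ≡ = sym (trans (cong +_ ek) (trans (ℤ.pos-* 2 (U₀ * U₀ * V₀)) (cong (+ 2 ℤ.*_) (trans (ℤ.pos-* (U₀ * U₀) V₀) (cong (ℤ._* + V₀) (ℤ.pos-* U₀ U₀))))))


product-cast : ∀ a k B C K x y {S₂ D F I} → let open Core a k B C K x y using (j) in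
  S₂ ≡ pellForm (+ suc k) K → D ≡ pellForm (+ suc a) C → F ≡ pellForm (+ suc a) (+ 2 ℤ.* (C ℤ.* C) ℤ.* D ℤ.* S₂ ℤ.* x) →
  I ≡ pellForm (+ suc a ℤ.+ F ℤ.* (F ℤ.- + suc a)) (C ℤ.+ F ℤ.* (B ℤ.+ (+ 2 ℤ.* y ℤ.- + 1) ℤ.* C)) → S₂ ℤ.* (F ℤ.* I) ≡ + j
product-cast a k B C K x y eS eD = step₁ (trans eS (pellForm-pos k K)) (trans eD (pellForm-pos a C))
  where
  open Core a k B C K x y
  step₃ : ∀ {I} → I ≡ + i → + s₂ ℤ.* (+ f ℤ.* I) ≡ + j
  step₃ refl = sym (trans (ℤ.pos-* s₂ (f * i)) (cong (+ s₂ ℤ.*_) (ℤ.pos-* f i)))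
  step₂ : ∀ {F I} → F ≡ + f → I ≡ pellForm (+ suc a ℤ.+ F ℤ.* (F ℤ.- + suc a)) (C ℤ.+ F ℤ.* (B ℤ.+ (+ 2 ℤ.* y ℤ.- + 1) ℤ.* C)) → + s₂ ℤ.* (F ℤ.* I) ≡ + j
  step₂ refl eI = step₃ (trans eI I≡)
  step₁ : ∀ {S₂ D F I} → S₂ ≡ + s₂ → D ≡ + d → F ≡ pellForm (+ suc a) (+ 2 ℤ.* (C ℤ.* C) ℤ.* D ℤ.* S₂ ℤ.* x) →
    I ≡ pellForm (+ suc a ℤ.+ F ℤ.* (F ℤ.- + suc a)) (C ℤ.+ F ℤ.* (B ℤ.+ (+ 2 ℤ.* y ℤ.- + 1) ℤ.* C)) → S₂ ℤ.* (F ℤ.* I) ≡ + j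
  step₁ refl refl eF = step₂ (trans eF F≡)

modulus-cast : ∀ a → 2 ≤ a → + 4 ℤ.* + suc a ℤ.- + 5 ≡ + pred (4 * a) × 4 * a ≡ suc (pred (4 * a))
modulus-cast a@(suc a′) _ = trans (l (+ a′)) (trans (cong (λ z → + 3 ℤ.+ z) (sym (ℤ.pos-* 4 a′))) (cong +_ (l₂ a′))) , refl
  where
  l : ∀ a → + 4 ℤ.* (+ 2 ℤ.+ a) ℤ.- + 5 ≡ + 3 ℤ.+ + 4 ℤ.* a
  l = ℤ-Solver.solve-∀
  l₂ : ∀ a → 3 + 4 * a ≡ a + 3 * suc a
  l₂ = solve-∀

-- Only the absolute values of W and C are known later. The two alternatives are the two possible
-- signs of W C.
ratio-cong : ∀ {m} W C t → + 3 ℤ.* (W ℤ.* C) ℤ.- + 2 ℤ.* (W ℤ.* W ℤ.- + 1) ≡ + m ℤ.* t →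
  Cong m (3 * (∣ W ∣ * ∣ C ∣) + 2) (2 * (∣ W ∣ * ∣ W ∣)) ⊎ Cong m (3 * (∣ W ∣ * ∣ C ∣) + 2 * (∣ W ∣ * ∣ W ∣)) 2
ratio-cong {m} W C t e with signed (W ℤ.* C)
... | ε , sε , eε = go sε
  where
  p = ∣ W ∣ * ∣ C ∣
  s = ∣ W ∣ * ∣ W ∣
  e′ : + 3 ℤ.* (+ p ℤ.* ε) ℤ.- + 2 ℤ.* (+ s ℤ.- + 1) ≡ + m ℤ.* t
  e′ = trans (cong₂ (λ u v → + 3 ℤ.* u ℤ.- + 2 ℤ.* (v ℤ.- + 1)) (sym (trans eε (cong (λ z → + z ℤ.* ε) (ℤ.abs-* W C)))) (∣∣-sq W)) e
  go : ε ≡ + 1 ⊎ ε ≡ ℤ.- + 1 → Cong m (3 * p + 2) (2 * s) ⊎ Cong m (3 * p + 2 * s) 2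
  go (inj₁ refl) = inj₁ (cong-sym (int-cong (2 * s) (3 * p + 2) m t (trans (cong₂ ℤ._+_ (ℤ.pos-* 2 s) (sym e′)) (trans (l (+ p) (+ s)) (sym (trans (ℤ.pos-+ (3 * p) 2) (cong (ℤ._+ + 2) (ℤ.pos-* 3 p))))))))
    where
    l : ∀ p s → + 2 ℤ.* s ℤ.+ (+ 3 ℤ.* (p ℤ.* + 1) ℤ.- + 2 ℤ.* (s ℤ.- + 1)) ≡ + 3 ℤ.* p ℤ.+ + 2
    l = ℤ-Solver.solve-∀
  go (inj₂ refl) = inj₂ (int-cong (3 * p + 2 * s) 2 m t (trans (cong₂ ℤ._+_ (trans (ℤ.pos-+ (3 * p) (2 * s)) (cong₂ ℤ._+_ (ℤ.pos-* 3 p) (ℤ.pos-* 2 s))) (sym e′)) (l (+ p) (+ s))))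
    where
    l : ∀ p s → + 3 ℤ.* p ℤ.+ + 2 ℤ.* s ℤ.+ (+ 3 ℤ.* (p ℤ.* (ℤ.- + 1)) ℤ.- + 2 ℤ.* (s ℤ.- + 1)) ≡ + 2
    l = ℤ-Solver.solve-∀

-pos≢suc : ∀ t r → ℤ.- + t ≢ + suc r
-pos≢suc zero r ()
-pos≢suc (suc t) r ()

product>0 : ∀ {x A B r} → + x ℤ.* (+ A ℤ.- + B) ≡ + suc r → 0 < x × B < A
product>0 {x} {A} {B} {r} e = n≢0⇒n>0 (λ { refl → case trans (sym (ℤ.*-zeroˡ (+ A ℤ.- + B))) e of λ () }) , ≰⇒> A≰B
  where
  A≰B : ¬ (A ≤ B)
  A≰B h = -pos≢suc (x * (B ∸ A)) r (trans (cong ℤ.-_ (ℤ.pos-* x (B ∸ A))) (trans (ℤ.neg-distribʳ-* (+ x) (+ (B ∸ A))) (trans (cong (+ x ℤ.*_) (sym (trans (ℤ.m-n≡m⊖n A B) (ℤ.⊖-≤ h)))) e)))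

-- A natural number stands for each square in R = x² (K² (M² − g² − a²M₀²) − 16 M² r²).
R-cast : ∀ x K M g am r → + x ℤ.* (+ K ℤ.* (+ M ℤ.- (+ g ℤ.+ + am)) ℤ.- + 16 ℤ.* + M ℤ.* + r) ≡ + x ℤ.* (+ (K * M) ℤ.- + (K * (g + am) + 16 * M * r))
R-cast x K M g am r = cong (+ x ℤ.*_) (trans (l (+ K) (+ M) (+ g) (+ am) (+ r)) (cong₂ ℤ._-_ (sym (ℤ.pos-* K M))
  (sym (trans (ℤ.pos-+ (K * (g + am)) (16 * M * r)) (cong₂ ℤ._+_ (trans (ℤ.pos-* K (g + am)) (cong (+ K ℤ.*_) (ℤ.pos-+ g am))) (trans (ℤ.pos-* (16 * M) r) (cong (ℤ._* + r) (ℤ.pos-* 16 M))))))))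
  where
  l : ∀ K M g am r → K ℤ.* (M ℤ.- (g ℤ.+ am)) ℤ.- + 16 ℤ.* M ℤ.* r ≡ K ℤ.* M ℤ.- (K ℤ.* (g ℤ.+ am) ℤ.+ + 16 ℤ.* M ℤ.* r)
  l = ℤ-Solver.solve-∀

R≡ : ∀ bb M₀ a g C K L x →
  x ℤ.* x ℤ.* (K ℤ.* K ℤ.* (+ bb ℤ.* + M₀ ℤ.* (+ bb ℤ.* + M₀) ℤ.- (g ℤ.* g ℤ.+ + a ℤ.* + a ℤ.* (+ M₀ ℤ.* + M₀)))
    ℤ.- + 16 ℤ.* (+ bb ℤ.* + M₀ ℤ.* (+ bb ℤ.* + M₀)) ℤ.* ((C ℤ.- K ℤ.* L) ℤ.* (C ℤ.- K ℤ.* L)))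
  ≡ + (∣ x ∣ * ∣ x ∣) ℤ.* (+ (∣ K ∣ * ∣ K ∣ * (bb * M₀ * (bb * M₀))) ℤ.- + (∣ K ∣ * ∣ K ∣ * (∣ g ∣ * ∣ g ∣ + a * M₀ * (a * M₀)) + 16 * (bb * M₀ * (bb * M₀)) * (∣ C ℤ.- K ℤ.* L ∣ * ∣ C ℤ.- K ℤ.* L ∣)))
R≡ bb M₀ a g C K L x = trans
  (sq₃ (sym (∣∣-sq x)) (sym (∣∣-sq K)) MM (sym (∣∣-sq g)) am (sym (∣∣-sq (C ℤ.- K ℤ.* L))))
  (R-cast (∣ x ∣ * ∣ x ∣) (∣ K ∣ * ∣ K ∣) (bb * M₀ * (bb * M₀)) (∣ g ∣ * ∣ g ∣) (a * M₀ * (a * M₀)) (∣ C ℤ.- K ℤ.* L ∣ * ∣ C ℤ.- K ℤ.* L ∣))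
  where
  MM : + bb ℤ.* + M₀ ℤ.* (+ bb ℤ.* + M₀) ≡ + (bb * M₀ * (bb * M₀))
  MM = sym (trans (ℤ.pos-* (bb * M₀) (bb * M₀)) (cong₂ ℤ._*_ (ℤ.pos-* bb M₀) (ℤ.pos-* bb M₀)))
  am : + a ℤ.* + a ℤ.* (+ M₀ ℤ.* + M₀) ≡ + (a * M₀ * (a * M₀))
  am = trans (l (+ a) (+ M₀)) (sym (trans (ℤ.pos-* (a * M₀) (a * M₀)) (cong₂ ℤ._*_ (ℤ.pos-* a M₀) (ℤ.pos-* a M₀))))
    where
    l : ∀ a m → a ℤ.* a ℤ.* (m ℤ.* m) ≡ a ℤ.* m ℤ.* (a ℤ.* m)
    l = ℤ-Solver.solve-∀
  sq₃ : ∀ {p p′ q q′ m m′ s s′ t t′ r r′ : ℤ} → p ≡ p′ → q ≡ q′ → m ≡ m′ → s ≡ s′ → t ≡ t′ → r ≡ r′ →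
    p ℤ.* (q ℤ.* (m ℤ.- (s ℤ.+ t)) ℤ.- + 16 ℤ.* m ℤ.* r) ≡ p′ ℤ.* (q′ ℤ.* (m′ ℤ.- (s′ ℤ.+ t′)) ℤ.- + 16 ℤ.* m′ ℤ.* r′)
  sq₃ refl refl refl refl refl refl = refl

inequalities-sound : ∀ {K M g am r} → K * (g + am) + 16 * M * r < K * M → g + am < M × 16 * r < K
inequalities-sound {K} {M} {g} {am} {r} h =
    *-cancelˡ-< K _ _ (≤-<-trans (m≤m+n _ _) h)
  , *-cancelˡ-< M _ _ (≤-<-trans (≤-trans (≤-reflexive (l M r)) (m≤n+m _ (K * (g + am)))) (<-≤-trans h (≤-reflexive (*-comm K M))))
  where
  l : ∀ M r → M * (16 * r) ≡ 16 * M * r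
  l = solve-∀

close-abs : ∀ C K L → 16 * (∣ C ℤ.- K ℤ.* L ∣ * ∣ C ℤ.- K ℤ.* L ∣) < ∣ K ∣ * ∣ K ∣ →
  4 * ∣ C ∣ < 4 * (∣ K ∣ * ∣ L ∣) + ∣ K ∣ × 4 * (∣ K ∣ * ∣ L ∣) < 4 * ∣ C ∣ + ∣ K ∣
close-abs C K L h = tri₁ , tri₂
  where
  open ≤-Reasoning
  r = ∣ C ℤ.- K ℤ.* L ∣
  4r<K : 4 * r < ∣ K ∣
  4r<K = sq-cancel-< (≤-<-trans (≤-reflexive (l r)) h)
    where
    l : ∀ r → 4 * r * (4 * r) ≡ 16 * (r * r)
    l = solve-∀
  C≤ : ∣ C ∣ ≤ r + ∣ K ∣ * ∣ L ∣
  C≤ = begin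
    ∣ C ∣                              ≡⟨ cong ∣_∣ (l C (K ℤ.* L)) ⟩
    ∣ (C ℤ.- K ℤ.* L) ℤ.+ K ℤ.* L ∣    ≤⟨ ℤ.∣i+j∣≤∣i∣+∣j∣ (C ℤ.- K ℤ.* L) (K ℤ.* L) ⟩
    r + ∣ K ℤ.* L ∣                    ≡⟨ cong (r ℕ.+_) (ℤ.abs-* K L) ⟩
    r + ∣ K ∣ * ∣ L ∣                  ∎
    where
    l : ∀ c d → c ≡ (c ℤ.- d) ℤ.+ d
    l = ℤ-Solver.solve-∀
  KL≤ : ∣ K ∣ * ∣ L ∣ ≤ ∣ C ∣ + r
  KL≤ = begin
    ∣ K ∣ * ∣ L ∣                      ≡⟨ sym (ℤ.abs-* K L) ⟩
    ∣ K ℤ.* L ∣                        ≡⟨ cong ∣_∣ (l C (K ℤ.* L)) ⟩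
    ∣ C ℤ.- (C ℤ.- K ℤ.* L) ∣          ≤⟨ ℤ.∣i-j∣≤∣i∣+∣j∣ C (C ℤ.- K ℤ.* L) ⟩
    ∣ C ∣ + r                          ∎
    where
    l : ∀ c d → d ≡ c ℤ.- (c ℤ.- d)
    l = ℤ-Solver.solve-∀
  tri₁ : 4 * ∣ C ∣ < 4 * (∣ K ∣ * ∣ L ∣) + ∣ K ∣
  tri₁ = begin-strict
    4 * ∣ C ∣                      ≤⟨ *-monoʳ-≤ 4 C≤ ⟩
    4 * (r + ∣ K ∣ * ∣ L ∣)        ≡⟨ l r (∣ K ∣ * ∣ L ∣) ⟩
    4 * (∣ K ∣ * ∣ L ∣) + 4 * r    <⟨ +-monoʳ-< (4 * (∣ K ∣ * ∣ L ∣)) 4r<K ⟩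
    4 * (∣ K ∣ * ∣ L ∣) + ∣ K ∣    ∎
    where
    l : ∀ r k → 4 * (r + k) ≡ 4 * k + 4 * r
    l = solve-∀
  tri₂ : 4 * (∣ K ∣ * ∣ L ∣) < 4 * ∣ C ∣ + ∣ K ∣
  tri₂ = begin-strict
    4 * (∣ K ∣ * ∣ L ∣)            ≤⟨ *-monoʳ-≤ 4 KL≤ ⟩
    4 * (∣ C ∣ + r)                ≡⟨ *-distribˡ-+ 4 ∣ C ∣ r ⟩
    4 * ∣ C ∣ + 4 * r              <⟨ +-monoʳ-< (4 * ∣ C ∣) 4r<K ⟩
    4 * ∣ C ∣ + ∣ K ∣              ∎

-- The Pell criterion needs B ≤ |C| for an arbitrary integer h: a nonzero multiple of a moves B by
-- at least 2B.
abs-lower : ∀ {a B} C h → C ≡ + B ℤ.+ + a ℤ.* h → 2 * B ≤ a → B ≤ ∣ C ∣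
abs-lower {a} {B} C (+ n) e _ = ≤-trans (m≤m+n B (a * n)) (≤-reflexive (sym (cong ∣_∣ (trans e (trans (cong (ℤ._+_ (+ B)) (sym (ℤ.pos-* a n))) (sym (ℤ.pos-+ B (a * n))))))))
abs-lower {a} {B} C -[1+ n ] e 2B≤a = ≤-trans (m+n≤o⇒m≤o∸n B (≤-trans (≤-reflexive (cong (B ℕ.+_) (sym (+-identityʳ B)))) (≤-trans 2B≤a (m≤m*n a (suc n)))))
  (≤-reflexive (sym (trans (cong ∣_∣ (trans e (trans (cong (ℤ._+_ (+ B)) (trans (sym (ℤ.neg-distribʳ-* (+ a) (+ suc n))) (cong ℤ.-_ (sym (ℤ.pos-* a (suc n)))))) (ℤ.m-n≡m⊖n B (a * suc n)))))
    (ℤ.∣⊖∣-≤ (≤-trans (≤-trans (m≤m+n B (B + 0)) 2B≤a) (m≤m*n a (suc n)))))))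

nonzero-param-≢0 : ∀ u v → (+ 2 ℤ.* u ℤ.+ + 1) ℤ.* (+ 3 ℤ.* v ℤ.+ + 1) ≢ + 0
nonzero-param-≢0 u v e with ℤ.i*j≡0⇒i≡0∨j≡0 (+ 2 ℤ.* u ℤ.+ + 1) e
... | inj₁ p = 1+2-≢0 u p
... | inj₂ p = 1+3-≢0 v p

∣i∣>0 : ∀ {i} → i ≢ + 0 → 0 < ∣ i ∣
∣i∣>0 h = n≢0⇒n>0 (λ p → h (ℤ.∣i∣≡0⇒i≡0 p))

sq>0⇒>0 : ∀ {n} → 0 < n * n → 0 < n
sq>0⇒>0 {suc n} _ = z<s

R-value : ∀ s {bb M₀ a} → bbᵛ s ≡ + bb → M₀ᵛ s ≡ + M₀ → aᵛ s ≡ + a → Sys.R s ≡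
  xᵛ s ℤ.* xᵛ s ℤ.* (Sys.K s ℤ.* Sys.K s ℤ.* (+ bb ℤ.* + M₀ ℤ.* (+ bb ℤ.* + M₀) ℤ.- (gᵛ s ℤ.* gᵛ s ℤ.+ + a ℤ.* + a ℤ.* (+ M₀ ℤ.* + M₀)))
    ℤ.- + 16 ℤ.* (+ bb ℤ.* + M₀ ℤ.* (+ bb ℤ.* + M₀)) ℤ.* ((Sys.C s ℤ.- Sys.K s ℤ.* Sys.L s) ℤ.* (Sys.C s ℤ.- Sys.K s ℤ.* Sys.L s)))
R-value s ebb eM₀ ea = trans (Sys.R-def s) (subst₃ (trans (Sys.M-def s) (cong₂ ℤ._*_ ebb eM₀)) ea eM₀)
  where
  subst₃ : ∀ {m m′ a a′ μ μ′ : ℤ} → m ≡ m′ → a ≡ a′ → μ ≡ μ′ →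
    xᵛ s ℤ.* xᵛ s ℤ.* (Sys.K s ℤ.* Sys.K s ℤ.* (m ℤ.* m ℤ.- (gᵛ s ℤ.* gᵛ s ℤ.+ a ℤ.* a ℤ.* (μ ℤ.* μ))) ℤ.- + 16 ℤ.* (m ℤ.* m) ℤ.* ((Sys.C s ℤ.- Sys.K s ℤ.* Sys.L s) ℤ.* (Sys.C s ℤ.- Sys.K s ℤ.* Sys.L s)))
    ≡ xᵛ s ℤ.* xᵛ s ℤ.* (Sys.K s ℤ.* Sys.K s ℤ.* (m′ ℤ.* m′ ℤ.- (gᵛ s ℤ.* gᵛ s ℤ.+ a′ ℤ.* a′ ℤ.* (μ′ ℤ.* μ′))) ℤ.- + 16 ℤ.* (m′ ℤ.* m′) ℤ.* ((Sys.C s ℤ.- Sys.K s ℤ.* Sys.L s) ℤ.* (Sys.C s ℤ.- Sys.K s ℤ.* Sys.L s)))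
  subst₃ refl refl refl = refl

-- The bounds `∣g∣<M` and `a<bb` are drawn while X is still an arbitrary integer. They are what
-- proves it natural, so only `conclusion` takes it in the form n₀ ≥ 1.
module SystemSound (y₀ bb M₀ a : ℕ) (0<y₀ : 0 < y₀) (s : Vars)
  (eY : Yᵛ s ≡ + y₀) (ebb : bbᵛ s ≡ + bb) (eM₀ : M₀ᵛ s ≡ + M₀) (ea′ : aᵛ s ≡ + a) (root : Sys.equation s ≡ + 0) where

  private
    W L B C K R yy : ℤ
    W = Sys.W s
    L = Sys.L s
    B = Sys.B s
    C = Sys.C s
    K = Sys.K s
    R = Sys.R s
    yy = Sys.yy s

    open Values (∣ Xᵛ s ∣) (∣ L ∣) (∣ W ∣) y₀ 0<y₀

    eL : L ≡ + y₀ ℤ.* (+ 2 ℤ.* lᵛ s ℤ.+ + 1)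
    eL = trans (Sys.L-def s) (cong (ℤ._* (+ 2 ℤ.* lᵛ s ℤ.+ + 1)) eY)

    ∣L∣ : ∣ L ∣ ≡ y₀ * ∣ + 2 ℤ.* lᵛ s ℤ.+ + 1 ∣
    ∣L∣ = trans (cong ∣_∣ eL) (ℤ.abs-* (+ y₀) (+ 2 ℤ.* lᵛ s ℤ.+ + 1))

    1≤L : 1 ≤ ∣ L ∣
    1≤L = ≤-trans (*-pos 0<y₀ (∣i∣>0 (1+2-≢0 (lᵛ s)))) (≤-reflexive (sym ∣L∣))

    eV : Sys.V s ≡ + V₀
    eV = trans (trans (Sys.V-def s) (cong (λ z → + 16 ℤ.* (z ℤ.* (+ 1 ℤ.+ W ℤ.* W))) eY)) (V≡ {Xᵛ s} {L} {W} refl refl refl)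
    eU : Sys.U s ≡ + U₀
    eU = trans (Sys.U-def s) (U≡ {Xᵛ s} {L} {W} refl refl refl)
    eα : Sys.α s ≡ + suc a₀
    eα = trans (Sys.α-def s) (trans (cong₂ (λ p q → p ℤ.* (+ 1 ℤ.+ q)) eU eV) α≡)
    eκ : Sys.κ s ≡ + suc k₀
    eκ = trans (Sys.κ-def s) (trans (cong₂ (λ p q → + 2 ℤ.* (p ℤ.* p ℤ.* q)) eU eV) κ≡)
    eC : C ≡ B ℤ.+ + a₀ ℤ.* hᵛ s
    eC = trans (Sys.C-def s) (cong (λ z → B ℤ.+ (z ℤ.- + 1) ℤ.* hᵛ s) eα)
    eK : K ≡ + 1 ℤ.+ Xᵛ s ℤ.+ + k₀ ℤ.* kᵛ s
    eK = trans (Sys.K-def s) (cong (λ z → + 1 ℤ.+ Xᵛ s ℤ.+ (z ℤ.- + 1) ℤ.* kᵛ s) eκ)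

    2≤a₀ : 2 ≤ a₀
    2≤a₀ = ≤-trans (≤-trans (≤-of-+ {2} {63} 61 refl) (m≤n+m 63 _)) a₀≥

    module Cr = Core a₀ k₀ B C K (xᵛ s) (yᵛ s)

    eJ : Sys.J s ≡ + Cr.j
    eJ = trans (Sys.J-def s) (product-cast a₀ k₀ B C K (xᵛ s) (yᵛ s) {Sys.S₂ s} {Sys.D s} {Sys.F s} {Sys.I s}
      (trans (Sys.S₂-def s) (cong (λ z → pellForm z K) eκ)) (trans (Sys.D-def s) (cong (λ z → pellForm z C) eα))
      (trans (Sys.F-def s) (cong₂ pellForm eα (Sys.E-def s)))
      (trans (Sys.I-def s) (cong₂ pellForm (trans (Sys.G-def s) (cong (λ z → z ℤ.+ Sys.F s ℤ.* (Sys.F s ℤ.- z)) eα)) (Sys.H-def s))))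

    m₀ : ℕ
    m₀ = pred (4 * a₀)
    em₀ : 4 * a₀ ≡ suc m₀
    em₀ = proj₂ (modulus-cast a₀ 2≤a₀)
    eS₀ : Sys.S₀ s ≡ + m₀
    eS₀ = trans (Sys.S₀-def s) (trans (cong (λ z → + 4 ℤ.* z ℤ.- + 5) eα) (proj₁ (modulus-cast a₀ 2≤a₀)))

    S₀≢0 : Sys.S₀ s ≢ + 0
    S₀≢0 e = contradiction (≤-trans (*-mono-≤ {x = 4} {y = 4} {u = 2} ≤-refl 2≤a₀) (≤-reflexive (trans em₀ (cong suc (ℤ.+-injective (trans (sym eS₀) e)))))) (λ { (s≤s ()) })

    yy≢0 : yy ≢ + 0
    yy≢0 e = nonzero-param-≢0 (uᵛ s) (vᵛ s) (trans (sym (Sys.yy-def s)) e)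

    split : (∃ λ t → Sys.T₀ s ≡ Sys.S₀ s ℤ.* t) × (∃ λ q → Sys.Q s ≡ + (q * q))
    split = square∧divides-sound {Sys.S₀ s} {Sys.T₀ s} {Sys.Q s} (nᵛ s) S₀≢0 (trans (sym (Sys.equation-def s)) root)

    positive : (∃ λ r → R ≡ + suc r) × IsSquare Cr.j
    positive = positivity-sound {Cr.j} {R} {yy} {proj₁ (proj₂ split)} Cr.0<j yy≢0
      (trans (cong (λ z → Positivity z R yy) (sym eJ)) (trans (sym (Sys.Q-def s)) (proj₂ (proj₂ split))))

    r₀ : ℕ
    r₀ = ∣ C ℤ.- K ℤ.* L ∣

    eR : R ≡ + (∣ xᵛ s ∣ * ∣ xᵛ s ∣) ℤ.* (+ (∣ K ∣ * ∣ K ∣ * (bb * M₀ * (bb * M₀))) ℤ.- + (∣ K ∣ * ∣ K ∣ * (∣ gᵛ s ∣ * ∣ gᵛ s ∣ + a * M₀ * (a * M₀)) + 16 * (bb * M₀ * (bb * M₀)) * (r₀ * r₀)))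
    eR = trans (R-value s ebb eM₀ ea′) (R≡ bb M₀ a (gᵛ s) C K L (xᵛ s))

    diff : 0 < ∣ xᵛ s ∣ * ∣ xᵛ s ∣ × ∣ K ∣ * ∣ K ∣ * (∣ gᵛ s ∣ * ∣ gᵛ s ∣ + a * M₀ * (a * M₀)) + 16 * (bb * M₀ * (bb * M₀)) * (r₀ * r₀) < ∣ K ∣ * ∣ K ∣ * (bb * M₀ * (bb * M₀))
    diff = product>0 {r = proj₁ (proj₁ positive)} (trans (sym eR) (proj₂ (proj₁ positive)))

    ineqs : ∣ gᵛ s ∣ * ∣ gᵛ s ∣ + a * M₀ * (a * M₀) < bb * M₀ * (bb * M₀) × 16 * (r₀ * r₀) < ∣ K ∣ * ∣ K ∣
    ineqs = inequalities-sound {g = ∣ gᵛ s ∣ * ∣ gᵛ s ∣} {a * M₀ * (a * M₀)} (proj₂ diff)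

    closeness : 4 * ∣ C ∣ < 4 * (∣ K ∣ * ∣ L ∣) + ∣ K ∣ × 4 * (∣ K ∣ * ∣ L ∣) < 4 * ∣ C ∣ + ∣ K ∣
    closeness = close-abs C K L (proj₂ ineqs)

    sqs : IsSquare Cr.s₂ × IsSquare Cr.f × IsSquare Cr.i
    sqs = Cr.squares (proj₂ positive)

    ratio : Cong m₀ (3 * (∣ W ∣ * ∣ C ∣) + 2) (2 * (∣ W ∣ * ∣ W ∣)) ⊎ Cong m₀ (3 * (∣ W ∣ * ∣ C ∣) + 2 * (∣ W ∣ * ∣ W ∣)) 2
    ratio = ratio-cong W C (proj₁ (proj₁ split)) (trans (sym (Sys.T₀-def s)) (trans (proj₂ (proj₁ split)) (cong (ℤ._* proj₁ (proj₁ split)) eS₀)))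

  ∣g∣<M : ∣ gᵛ s ∣ < bb * M₀
  ∣g∣<M = sq-cancel-< (≤-<-trans (m≤m+n _ _) (proj₁ ineqs))

  a<bb : a < bb
  a<bb = *-cancelʳ-< M₀ a bb (sq-cancel-< (≤-<-trans (m≤n+m (a * M₀ * (a * M₀)) (∣ gᵛ s ∣ * ∣ gᵛ s ∣)) (proj₁ ineqs)))

  conclusion : ∀ n₀ → 1 ≤ n₀ → Xᵛ s ≡ + n₀ → (∣ b̂ᵛ s ∣ ∣ 2 ^ suc (n₀ + n₀)) × (y₀ ∣ binom (n₀ + n₀) n₀)
  conclusion n₀ 1≤n₀ eX = finish (pell-classify k₀ (∣ K ∣) (proj₁ (proj₁ sqs)) (sym (proj₂ (proj₁ sqs))))
    where
    eB : B ≡ + suc (n₀ + n₀)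
    eB = trans (Sys.B-def s) (cong (λ z → + 1 ℤ.+ (z ℤ.+ z)) eX)
    ∣B∣ : ∣ B ∣ ≡ suc (n₀ + n₀)
    ∣B∣ = cong ∣_∣ eB
    ∣X∣ : ∣ Xᵛ s ∣ ≡ n₀
    ∣X∣ = cong ∣_∣ eX
    2B≤a₀ : 2 * suc (n₀ + n₀) ≤ a₀
    2B≤a₀ = begin
      2 * suc (n₀ + n₀)          ≡⟨ twice n₀ ⟩
      4 * n₀ + 2                 ≤⟨ +-mono-≤ (*-mono-≤ {x = 4} {y = 64} (≤-of-+ 60 refl) (≤-trans (m≤m*n n₀ (∣ L ∣) ⦃ >-nonZero 1≤L ⦄) (≤-reflexive (cong (_* ∣ L ∣) (sym ∣X∣))))) (≤-of-+ {2} {63} 61 refl) ⟩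
      64 * (∣ Xᵛ s ∣ * ∣ L ∣) + 63 ≤⟨ a₀≥ ⟩
      a₀                         ∎
      where
      open ≤-Reasoning
      twice : ∀ n → 2 * suc (n + n) ≡ 4 * n + 2
      twice = solve-∀
    B≤C : suc (n₀ + n₀) ≤ ∣ C ∣
    B≤C = abs-lower {a₀} C (hᵛ s) (trans eC (cong (ℤ._+ + a₀ ℤ.* hᵛ s) eB)) 2B≤a₀
    C≡ : ∣ C ∣ ≡ Y a₀ (suc (n₀ + n₀))
    C≡ = trans (Cr.criterion 2≤a₀ (subst (0 <_) (sym ∣B∣) z<s) (≤-trans (≤-reflexive ∣B∣) B≤C) (sq>0⇒>0 (proj₁ diff)) (proj₁ (proj₂ sqs)) (proj₂ (proj₂ sqs))) (cong (Y a₀) ∣B∣)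
    K± : Cong± k₀ (∣ K ∣) (suc n₀)
    K± = int-cong± K (+ suc n₀) (kᵛ s) (trans eK (cong (λ z → + 1 ℤ.+ z ℤ.+ + k₀ ℤ.* kᵛ s) eX))
    finish : (∃ λ N → ∣ K ∣ ≡ Y k₀ N × proj₁ (proj₁ sqs) ≡ X k₀ N) → (∣ b̂ᵛ s ∣ ∣ 2 ^ suc (n₀ + n₀)) × (y₀ ∣ binom (n₀ + n₀) n₀)
    finish (N , K≡ , _) = subst (λ z → (∣ b̂ᵛ s ∣) ∣ z) (proj₁ result) (subst (λ z → (∣ b̂ᵛ s ∣) ∣ z) (sym (trans (cong ∣_∣ (Sys.W-def s)) (ℤ.abs-* (b̂ᵛ s) (wᵛ s)))) (m∣m*n ∣ wᵛ s ∣)) , proj₂ result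
      where
      module Br = Bridge n₀ y₀ (∣ W ∣) (∣ L ∣) U₀ a₀ k₀ 1≤n₀ 0<y₀ 1≤L (subst (λ z → 64 * (z * ∣ L ∣) ≤ U₀) ∣X∣ U₀≥) ea ek
      result : ∣ W ∣ ≡ 2 ^ suc (n₀ + n₀) × (y₀ ∣ binom (n₀ + n₀) n₀)
      result = Br.sound {N} {m₀} (subst (λ z → Cong± k₀ z (suc n₀)) K≡ K±)
        (subst₂ (λ c κ → 4 * c < 4 * (κ * ∣ L ∣) + κ) C≡ K≡ (proj₁ closeness))
        (subst₂ (λ c κ → 4 * (κ * ∣ L ∣) < 4 * c + κ) C≡ K≡ (proj₂ closeness))
        em₀ (subst (λ c → Cong m₀ (3 * (∣ W ∣ * c) + 2) (2 * (∣ W ∣ * ∣ W ∣)) ⊎ Cong m₀ (3 * (∣ W ∣ * c) + 2 * (∣ W ∣ * ∣ W ∣)) 2) C≡ ratio)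
        (divides ∣ + 2 ℤ.* lᵛ s ℤ.+ + 1 ∣ (trans ∣L∣ (*-comm y₀ _)))

-- With |C − K L| ≤ K / 8, |g| ≤ M / 2 and a M₀ ≤ M / 2 the inequality R > 0 has room to spare.
inequalities-complete : ∀ {K M g am r} → 0 < K → 0 < M → 4 * g ≤ M → 4 * am ≤ M → 64 * r ≤ K → K * (g + am) + 16 * M * r < K * M
inequalities-complete {K} {M} {g} {am} {r} 0<K 0<M hg ham hr = *-cancelˡ-< 4 _ _ (begin-strict
    4 * (K * (g + am) + 16 * M * r)               ≡⟨ l K g am M r ⟩
    K * (4 * g + 4 * am) + M * (64 * r)           ≤⟨ +-mono-≤ (*-monoʳ-≤ K (+-mono-≤ hg ham)) (*-monoʳ-≤ M hr) ⟩
    K * (M + M) + M * K                           <⟨ m<m+n _ (*-pos 0<K 0<M) ⟩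
    K * (M + M) + M * K + K * M                   ≡⟨ l₂ K M ⟩
    4 * (K * M)                                   ∎)
  where
  open ≤-Reasoning
  l : ∀ K g am M r → 4 * (K * (g + am) + 16 * M * r) ≡ K * (4 * g + 4 * am) + M * (64 * r)
  l = solve-∀
  l₂ : ∀ K M → K * (M + M) + M * K + K * M ≡ 4 * (K * M)
  l₂ = solve-∀

product>0-complete : ∀ {x A B} → 0 < x → B < A → ∃ λ r → + x ℤ.* (+ A ℤ.- + B) ≡ + suc r
product>0-complete {x} {A} {B} 0<x B<A = pred (x * (A ∸ B)) , trans (cong (+ x ℤ.*_) (trans (ℤ.m-n≡m⊖n A B) (ℤ.⊖-≥ (<⇒≤ B<A))))
  (trans (sym (ℤ.pos-* x (A ∸ B))) (cong +_ (sym (suc-pred (x * (A ∸ B)) ⦃ >-nonZero (*-pos 0<x (m<n⇒0<n∸m B<A)) ⦄))))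

abs-difference : ∀ C K L → 8 * C ≤ 8 * (K * L) + K → 8 * (K * L) ≤ 8 * C + K → 8 * ∣ + C ℤ.- + K ℤ.* + L ∣ ≤ K
abs-difference C K L h₁ h₂ = subst (λ z → 8 * ∣ z ∣ ≤ K) (sym e) (bound (≤-total (K * L) C))
  where
  e : + C ℤ.- + K ℤ.* + L ≡ C ℤ.⊖ (K * L)
  e = trans (cong (ℤ._-_ (+ C)) (sym (ℤ.pos-* K L))) (ℤ.m-n≡m⊖n C (K * L))
  one : ∀ {m n} → m ≤ n → 8 * n ≤ 8 * m + K → 8 * (n ∸ m) ≤ K
  one {m} {n} m≤n h = ≤-trans (≤-reflexive (*-distribˡ-∸ 8 n m)) (m≤n+o⇒m∸n≤o (8 * n) (8 * m) h)
  bound : K * L ≤ C ⊎ C ≤ K * L → 8 * ∣ C ℤ.⊖ (K * L) ∣ ≤ K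
  bound (inj₁ p) = subst (λ z → 8 * ∣ z ∣ ≤ K) (sym (ℤ.⊖-≥ p)) (one p h₁)
  bound (inj₂ p) = subst (λ z → 8 * z ≤ K) (sym (ℤ.∣⊖∣-≤ p)) (one p h₂)

ratio-complete : ∀ m p C → Cong m (3 * (p * C) + 2) (2 * (p * p)) → ∃ λ t → + 3 ℤ.* (+ p ℤ.* + C) ℤ.- + 2 ℤ.* (+ p ℤ.* + p ℤ.- + 1) ≡ + m ℤ.* t
ratio-complete m p C h with cong⇒int h
... | t , e = t , trans (l (+ p) (+ C)) (trans (cong (ℤ._- + 2 ℤ.* (+ p ℤ.* + p)) (trans (sym cast) (trans e (cong (ℤ._+ + m ℤ.* t) (trans (ℤ.pos-* 2 (p * p)) (cong (+ 2 ℤ.*_) (ℤ.pos-* p p))))))) (l₂ (+ 2 ℤ.* (+ p ℤ.* + p)) (+ m ℤ.* t)))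
  where
  cast : + (3 * (p * C) + 2) ≡ + 3 ℤ.* (+ p ℤ.* + C) ℤ.+ + 2
  cast = trans (ℤ.pos-+ (3 * (p * C)) 2) (cong (ℤ._+ + 2) (trans (ℤ.pos-* 3 (p * C)) (cong (+ 3 ℤ.*_) (ℤ.pos-* p C))))
  l : ∀ p c → + 3 ℤ.* (p ℤ.* c) ℤ.- + 2 ℤ.* (p ℤ.* p ℤ.- + 1) ≡ + 3 ℤ.* (p ℤ.* c) ℤ.+ + 2 ℤ.- + 2 ℤ.* (p ℤ.* p)
  l = ℤ-Solver.solve-∀
  l₂ : ∀ x y → x ℤ.+ y ℤ.- x ≡ y
  l₂ = ℤ-Solver.solve-∀

module SystemComplete (n₀ y₀ bb M₀ a j : ℕ) (b̂ g : ℤ) (1≤n₀ : 1 ≤ n₀) (0<y₀ : 0 < y₀) (0<M : 0 < bb * M₀)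
  (eb̂ : ∣ b̂ ∣ ≡ 2 ^ j) (j≤ : j ≤ suc (n₀ + n₀)) (2g≤M : 2 * ∣ g ∣ ≤ bb * M₀) (2a≤bb : 2 * a ≤ bb)
  {o : ℕ} (odd-o : Odd o) (eo : binom (n₀ + n₀) n₀ ≡ y₀ * o) where

  private
    B₀ p : ℕ
    B₀ = suc (n₀ + n₀)
    p = 2 ^ B₀
    bridge = bridge-complete n₀ y₀ 1≤n₀ 0<y₀ odd-o eo
    l₀ L₀ : ℕ
    l₀ = proj₁ bridge
    L₀ = y₀ * suc (2 * l₀)

    open Values n₀ L₀ p y₀ 0<y₀

    C₀ K₀ : ℕ
    C₀ = Y a₀ B₀
    K₀ = Y k₀ (suc n₀)

    closeness : 8 * C₀ ≤ 8 * (K₀ * L₀) + K₀ × 8 * (K₀ * L₀) ≤ 8 * C₀ + K₀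
    closeness = proj₂ bridge U₀ a₀ k₀ U₀≥ ea ek

    -- W is to be 2 to the exponent 2 n₀ + 1. The number b̂ = ±2ʲ divides it because of `j≤`, and w
    -- takes over the sign.
    w-exists : ∃ λ w → b̂ ℤ.* w ≡ + p
    w-exists with signed b̂
    ... | ε , sε , e = + (2 ^ (B₀ ∸ j)) ℤ.* ε , trans (cong (ℤ._* (+ (2 ^ (B₀ ∸ j)) ℤ.* ε)) (trans e (cong (λ z → + z ℤ.* ε) eb̂)))
        (trans (l (+ (2 ^ j)) ε (+ (2 ^ (B₀ ∸ j)))) (trans (cong₂ ℤ._*_ (trans (sym (ℤ.pos-* (2 ^ j) (2 ^ (B₀ ∸ j)))) (cong +_ (trans (sym (^-distribˡ-+-* 2 j (B₀ ∸ j))) (cong (2 ^_) (m+[n∸m]≡n j≤))))) (εε sε)) (ℤ.*-identityʳ (+ p))))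
      where
      l : ∀ q ε r → q ℤ.* ε ℤ.* (r ℤ.* ε) ≡ q ℤ.* r ℤ.* (ε ℤ.* ε)
      l = ℤ-Solver.solve-∀
      εε : ∀ {ε} → ε ≡ + 1 ⊎ ε ≡ ℤ.- + 1 → ε ℤ.* ε ≡ + 1
      εε (inj₁ refl) = refl
      εε (inj₂ refl) = refl

    hh : ∃ λ h → + C₀ ≡ + B₀ ℤ.+ + a₀ ℤ.* h
    hh = cong⇒int (Y-mod a₀ B₀)

    kk : ∃ λ k → + K₀ ≡ + suc n₀ ℤ.+ + k₀ ℤ.* k
    kk = cong⇒int (Y-mod k₀ (suc n₀))

    1≤a₀ : 1 ≤ a₀
    1≤a₀ = ≤-trans (≤-trans (≤-of-+ {1} {63} 62 refl) (m≤n+m 63 _)) a₀≥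
    2≤a₀ : 2 ≤ a₀
    2≤a₀ = ≤-trans (≤-trans (≤-of-+ {2} {63} 61 refl) (m≤n+m 63 _)) a₀≥

    0<K₀ : 0 < K₀
    0<K₀ = ≤-trans z<s (n≤Y k₀ (suc n₀))

  solution : ∃ λ s → Xᵛ s ≡ + n₀ × Yᵛ s ≡ + y₀ × bbᵛ s ≡ + bb × M₀ᵛ s ≡ + M₀ × aᵛ s ≡ + a × b̂ᵛ s ≡ b̂ × gᵛ s ≡ g × Sys.equation s ≡ + 0
  solution = choose w-exists hh kk (core-complete a₀ k₀ B₀ (suc n₀) 1≤a₀ z<s)
    where
    choose : (∃ λ w → b̂ ℤ.* w ≡ + p) → (∃ λ h → + C₀ ≡ + B₀ ℤ.+ + a₀ ℤ.* h) → (∃ λ k → + K₀ ≡ + suc n₀ ℤ.+ + k₀ ℤ.* k) →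
      (∃₂ λ x y → 0 < ∣ x ∣ × ∃ λ s → 0 < s × Core.j a₀ k₀ (+ B₀) (+ C₀) (+ K₀) x y ≡ s * s) →
      ∃ λ s → Xᵛ s ≡ + n₀ × Yᵛ s ≡ + y₀ × bbᵛ s ≡ + bb × M₀ᵛ s ≡ + M₀ × aᵛ s ≡ + a × b̂ᵛ s ≡ b̂ × gᵛ s ≡ g × Sys.equation s ≡ + 0
    choose (w , eW) (h , eh) (k , ek′) (x , y , 0<x , t , 0<t , ej) = result
      where
      point : ℤ → ℤ → ℤ → Vars
      point u v n = vars (+ n₀) (+ y₀) (+ bb) (+ M₀) (+ a) b̂ g h k (+ l₀) w x y u v n

      module Point (u v n : ℤ) where
        s : Vars
        s = point u v n
        eW′ : Sys.W s ≡ + p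
        eW′ = trans (Sys.W-def s) eW
        eL : Sys.L s ≡ + L₀
        eL = trans (Sys.L-def s) (trans (cong (+ y₀ ℤ.*_) (trans (cong (ℤ._+ + 1) (sym (ℤ.pos-* 2 l₀))) (trans (sym (ℤ.pos-+ (2 * l₀) 1)) (cong +_ (+-comm (2 * l₀) 1))))) (sym (ℤ.pos-* y₀ (suc (2 * l₀)))))
        eV : Sys.V s ≡ + V₀
        eV = trans (Sys.V-def s) (V≡ {+ n₀} {Sys.L s} {Sys.W s} refl (cong ∣_∣ eL) (cong ∣_∣ eW′))
        eU : Sys.U s ≡ + U₀
        eU = trans (Sys.U-def s) (U≡ {+ n₀} {Sys.L s} {Sys.W s} refl (cong ∣_∣ eL) (cong ∣_∣ eW′))
        eα : Sys.α s ≡ + suc a₀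
        eα = trans (Sys.α-def s) (trans (cong₂ (λ p q → p ℤ.* (+ 1 ℤ.+ q)) eU eV) α≡)
        eκ : Sys.κ s ≡ + suc k₀
        eκ = trans (Sys.κ-def s) (trans (cong₂ (λ p q → + 2 ℤ.* (p ℤ.* p ℤ.* q)) eU eV) κ≡)
        eB : Sys.B s ≡ + B₀
        eB = Sys.B-def s
        eC : Sys.C s ≡ + C₀
        eC = trans (Sys.C-def s) (trans (cong₂ (λ B z → B ℤ.+ (z ℤ.- + 1) ℤ.* h) eB eα) (sym eh))
        eK : Sys.K s ≡ + K₀
        eK = trans (Sys.K-def s) (trans (cong (λ z → + 1 ℤ.+ + n₀ ℤ.+ (z ℤ.- + 1) ℤ.* k) eκ) (sym ek′))
        eJ : Sys.J s ≡ + (t * t)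
        eJ = trans (Sys.J-def s) (trans (product-cast a₀ k₀ (+ B₀) (+ C₀) (+ K₀) x y {Sys.S₂ s} {Sys.D s} {Sys.F s} {Sys.I s}
          (trans (Sys.S₂-def s) (cong₂ pellForm eκ eK)) (trans (Sys.D-def s) (cong₂ pellForm eα eC))
          (trans (Sys.F-def s) (cong₂ pellForm eα (trans (Sys.E-def s) (cong (λ c → + 2 ℤ.* (c ℤ.* c) ℤ.* Sys.D s ℤ.* Sys.S₂ s ℤ.* x) eC))))
          (trans (Sys.I-def s) (cong₂ pellForm (trans (Sys.G-def s) (cong (λ z → z ℤ.+ Sys.F s ℤ.* (Sys.F s ℤ.- z)) eα))
            (trans (Sys.H-def s) (cong₂ (λ c B → c ℤ.+ Sys.F s ℤ.* (B ℤ.+ (+ 2 ℤ.* y ℤ.- + 1) ℤ.* c)) eC eB))))) (cong +_ ej))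
        eS₀ : Sys.S₀ s ≡ + pred (4 * a₀)
        eS₀ = trans (Sys.S₀-def s) (trans (cong (λ z → + 4 ℤ.* z ℤ.- + 5) eα) (proj₁ (modulus-cast a₀ 2≤a₀)))
        eT₀ : Sys.T₀ s ≡ + 3 ℤ.* (+ p ℤ.* + C₀) ℤ.- + 2 ℤ.* (+ p ℤ.* + p ℤ.- + 1)
        eT₀ = trans (Sys.T₀-def s) (cong₂ (λ W C → + 3 ℤ.* (W ℤ.* C) ℤ.- + 2 ℤ.* (W ℤ.* W ℤ.- + 1)) eW′ eC)
        eR : Sys.R s ≡ + (∣ x ∣ * ∣ x ∣) ℤ.* (+ (K₀ * K₀ * (bb * M₀ * (bb * M₀))) ℤ.- + (K₀ * K₀ * (∣ g ∣ * ∣ g ∣ + a * M₀ * (a * M₀)) + 16 * (bb * M₀ * (bb * M₀)) * (∣ + C₀ ℤ.- + K₀ ℤ.* + L₀ ∣ * ∣ + C₀ ℤ.- + K₀ ℤ.* + L₀ ∣)))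
        eR = trans (R-value s refl refl refl) (trans (R≡ bb M₀ a g (Sys.C s) (Sys.K s) (Sys.L s) x) (cast eC eK eL))
          where
          cast : ∀ {C K L} → C ≡ + C₀ → K ≡ + K₀ → L ≡ + L₀ →
            + (∣ x ∣ * ∣ x ∣) ℤ.* (+ (∣ K ∣ * ∣ K ∣ * (bb * M₀ * (bb * M₀))) ℤ.- + (∣ K ∣ * ∣ K ∣ * (∣ g ∣ * ∣ g ∣ + a * M₀ * (a * M₀)) + 16 * (bb * M₀ * (bb * M₀)) * (∣ C ℤ.- K ℤ.* L ∣ * ∣ C ℤ.- K ℤ.* L ∣)))
            ≡ + (∣ x ∣ * ∣ x ∣) ℤ.* (+ (K₀ * K₀ * (bb * M₀ * (bb * M₀))) ℤ.- + (K₀ * K₀ * (∣ g ∣ * ∣ g ∣ + a * M₀ * (a * M₀)) + 16 * (bb * M₀ * (bb * M₀)) * (∣ + C₀ ℤ.- + K₀ ℤ.* + L₀ ∣ * ∣ + C₀ ℤ.- + K₀ ℤ.* + L₀ ∣)))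
          cast refl refl refl = refl

      r₀ : ℕ
      r₀ = ∣ + C₀ ℤ.- + K₀ ℤ.* + L₀ ∣
      quarter : ∀ {z M} → 2 * z ≤ M → 4 * (z * z) ≤ M * M
      quarter {z} h = ≤-trans (≤-reflexive (q z)) (sq-mono-≤ h)
        where
        q : ∀ z → 4 * (z * z) ≡ 2 * z * (2 * z)
        q = solve-∀
      sixtyfourth : 64 * (r₀ * r₀) ≤ K₀ * K₀
      sixtyfourth = ≤-trans (≤-reflexive (q r₀)) (sq-mono-≤ (abs-difference C₀ K₀ L₀ (proj₁ closeness) (proj₂ closeness)))
        where
        q : ∀ z → 64 * (z * z) ≡ 8 * z * (8 * z)
        q = solve-∀
      positiveR : ∃ λ r → + (∣ x ∣ * ∣ x ∣) ℤ.* (+ (K₀ * K₀ * (bb * M₀ * (bb * M₀))) ℤ.- + (K₀ * K₀ * (∣ g ∣ * ∣ g ∣ + a * M₀ * (a * M₀)) + 16 * (bb * M₀ * (bb * M₀)) * (r₀ * r₀))) ≡ + suc r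
      positiveR = product>0-complete (*-pos 0<x 0<x) (inequalities-complete {K₀ * K₀} {bb * M₀ * (bb * M₀)} {∣ g ∣ * ∣ g ∣} {a * M₀ * (a * M₀)} {r₀ * r₀}
          (*-pos 0<K₀ 0<K₀) (*-pos 0<M 0<M) (quarter {∣ g ∣} 2g≤M) (quarter {a * M₀} (≤-trans (≤-reflexive (sym (*-assoc 2 a M₀))) (*-monoˡ-≤ M₀ 2a≤bb))) sixtyfourth)
      t-exists : ∃ λ t → + 3 ℤ.* (+ p ℤ.* + C₀) ℤ.- + 2 ℤ.* (+ p ℤ.* + p ℤ.- + 1) ≡ + pred (4 * a₀) ℤ.* t
      t-exists = ratio-complete (pred (4 * a₀)) p C₀ (subst (Cong (pred (4 * a₀)) (3 * (p * C₀) + 2)) (cong (2 *_) (4^≡2^*2^ B₀)) (2^-Y-cong a₀ (pred (4 * a₀)) (proj₂ (modulus-cast a₀ 2≤a₀)) B₀))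
      assemble : ∀ r → + (∣ x ∣ * ∣ x ∣) ℤ.* (+ (K₀ * K₀ * (bb * M₀ * (bb * M₀))) ℤ.- + (K₀ * K₀ * (∣ g ∣ * ∣ g ∣ + a * M₀ * (a * M₀)) + 16 * (bb * M₀ * (bb * M₀)) * (r₀ * r₀))) ≡ + suc r →
        ∀ z → + 3 ℤ.* (+ p ℤ.* + C₀) ℤ.- + 2 ℤ.* (+ p ℤ.* + p ℤ.- + 1) ≡ + pred (4 * a₀) ℤ.* z →
        (∃₂ λ u v → ∃ λ q → Positivity (+ (t * t)) (+ suc r) ((+ 2 ℤ.* u ℤ.+ + 1) ℤ.* (+ 3 ℤ.* v ℤ.+ + 1)) ≡ q ℤ.* q) →
        ∃ λ s → Xᵛ s ≡ + n₀ × Yᵛ s ≡ + y₀ × bbᵛ s ≡ + bb × M₀ᵛ s ≡ + M₀ × aᵛ s ≡ + a × b̂ᵛ s ≡ b̂ × gᵛ s ≡ g × Sys.equation s ≡ + 0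
      assemble r er z ez (u , v , q , eQ) = Pt.s , refl , refl , refl , refl , refl , refl , refl ,
        trans (Sys.equation-def Pt.s) (trans (cong₂ (λ T Q → (Sys.S₀ Pt.s ℤ.* (q ℤ.- z) ℤ.+ T) ℤ.* (Sys.S₀ Pt.s ℤ.* (q ℤ.- z) ℤ.+ T) ℤ.- Sys.S₀ Pt.s ℤ.* Sys.S₀ Pt.s ℤ.* Q) eT eQ′)
          (square∧divides-complete (Sys.S₀ Pt.s) z q))
        where
        module Pt = Point u v (q ℤ.- z)
        eT : Sys.T₀ Pt.s ≡ Sys.S₀ Pt.s ℤ.* z
        eT = trans Pt.eT₀ (trans ez (cong (ℤ._* z) (sym Pt.eS₀)))
        eQ′ : Sys.Q Pt.s ≡ q ℤ.* q
        eQ′ = trans (Sys.Q-def Pt.s) (trans (cong₂ (λ J R → Positivity J R (Sys.yy Pt.s)) Pt.eJ (trans Pt.eR er)) (trans (cong (Positivity (+ (t * t)) (+ suc r)) (Sys.yy-def Pt.s)) eQ))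
      result = assemble (proj₁ positiveR) (proj₂ positiveR) (proj₁ t-exists) (proj₂ t-exists) (positivity-complete t (proj₁ positiveR) 0<t)

-- Degrees

deg≤ : ∀ {n} → ℕ → Poly n → Set
deg≤ d P = All (λ m → expDeg (proj₂ m) ≤ d) P

IsPoly : ∀ {n} → ℕ → (Vec ℤ n → ℤ) → Set
IsPoly {n} d f = Σ (Poly n) λ P → deg≤ d P × (∀ xs → eval P xs ≡ f xs)

eval-++ : ∀ {n} (P Q : Poly n) xs → eval (P ++ Q) xs ≡ eval P xs ℤ.+ eval Q xs
eval-++ [] Q xs = sym (ℤ.+-identityˡ _)
eval-++ ((c , e) ∷ P) Q xs = trans (cong (ℤ._+_ (c ℤ.* monVal e xs)) (eval-++ P Q xs)) (sym (ℤ.+-assoc (c ℤ.* monVal e xs) _ _))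

_⊕ᵉ_ : ∀ {n} → Vec ℕ n → Vec ℕ n → Vec ℕ n
[] ⊕ᵉ [] = []
(e ∷ es) ⊕ᵉ (f ∷ fs) = (e + f) ∷ (es ⊕ᵉ fs)

expDeg-⊕ᵉ : ∀ {n} (e f : Vec ℕ n) → expDeg (e ⊕ᵉ f) ≡ expDeg e + expDeg f
expDeg-⊕ᵉ [] [] = refl
expDeg-⊕ᵉ (e ∷ es) (f ∷ fs) = trans (cong (e + f ℕ.+_) (expDeg-⊕ᵉ es fs)) (l e f (expDeg es) (expDeg fs))
  where
  l : ∀ a b c d → a + b + (c + d) ≡ a + c + (b + d)
  l = solve-∀

monVal-⊕ᵉ : ∀ {n} (e f : Vec ℕ n) xs → monVal (e ⊕ᵉ f) xs ≡ monVal e xs ℤ.* monVal f xs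
monVal-⊕ᵉ [] [] [] = refl
monVal-⊕ᵉ (e ∷ es) (f ∷ fs) (x ∷ xs) = trans (cong₂ ℤ._*_ (ℤ.^-distribˡ-+-* x e f) (monVal-⊕ᵉ es fs xs)) (l (x ℤ.^ e) (x ℤ.^ f) (monVal es xs) (monVal fs xs))
  where
  l : ∀ a b c d → a ℤ.* b ℤ.* (c ℤ.* d) ≡ a ℤ.* c ℤ.* (b ℤ.* d)
  l = ℤ-Solver.solve-∀

mulMonomial : ∀ {n} → Monomial n → Poly n → Poly n
mulMonomial (c , e) [] = []
mulMonomial (c , e) ((d , f) ∷ P) = (c ℤ.* d , e ⊕ᵉ f) ∷ mulMonomial (c , e) P

eval-mulMonomial : ∀ {n} c (e : Vec ℕ n) P xs → eval (mulMonomial (c , e) P) xs ≡ c ℤ.* monVal e xs ℤ.* eval P xs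
eval-mulMonomial c e [] xs = sym (ℤ.*-zeroʳ (c ℤ.* monVal e xs))
eval-mulMonomial c e ((d , f) ∷ P) xs = trans (cong₂ (λ u v → c ℤ.* d ℤ.* u ℤ.+ v) (monVal-⊕ᵉ e f xs) (eval-mulMonomial c e P xs))
  (l c d (monVal e xs) (monVal f xs) (eval P xs))
  where
  l : ∀ c d m m′ p → c ℤ.* d ℤ.* (m ℤ.* m′) ℤ.+ c ℤ.* m ℤ.* p ≡ c ℤ.* m ℤ.* (d ℤ.* m′ ℤ.+ p)
  l = ℤ-Solver.solve-∀

deg-mulMonomial : ∀ {n d d′} c (e : Vec ℕ n) {P} → expDeg e ≤ d → deg≤ d′ P → deg≤ (d + d′) (mulMonomial (c , e) P)
deg-mulMonomial c e p [] = []
deg-mulMonomial c e {(_ , f) ∷ _} p (q ∷ qs) = ≤-trans (≤-reflexive (expDeg-⊕ᵉ e f)) (+-mono-≤ p q) ∷ deg-mulMonomial c e p qs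

mulPoly : ∀ {n} → Poly n → Poly n → Poly n
mulPoly [] Q = []
mulPoly (m ∷ P) Q = mulMonomial m Q ++ mulPoly P Q

eval-mulPoly : ∀ {n} (P Q : Poly n) xs → eval (mulPoly P Q) xs ≡ eval P xs ℤ.* eval Q xs
eval-mulPoly [] Q xs = refl
eval-mulPoly ((c , e) ∷ P) Q xs = trans (eval-++ (mulMonomial (c , e) Q) (mulPoly P Q) xs)
  (trans (cong₂ ℤ._+_ (eval-mulMonomial c e Q xs) (eval-mulPoly P Q xs)) (sym (ℤ.*-distribʳ-+ (eval Q xs) (c ℤ.* monVal e xs) (eval P xs))))

deg-mulPoly : ∀ {n d d′} {P Q : Poly n} → deg≤ d P → deg≤ d′ Q → deg≤ (d + d′) (mulPoly P Q)
deg-mulPoly [] q = []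
deg-mulPoly {P = (c , e) ∷ _} (p ∷ ps) q = All.++⁺ (deg-mulMonomial c e p q) (deg-mulPoly ps q)
  where import Data.List.Relation.Unary.All.Properties as All

expDeg-zeros : ∀ n → expDeg (zeros n) ≡ 0
expDeg-zeros zero = refl
expDeg-zeros (suc n) = expDeg-zeros n

unit : ∀ {n} → Fin n → Vec ℕ n
unit {suc n} Fin.zero = 1 ∷ zeros n
unit (Fin.suc i) = 0 ∷ unit i

expDeg-unit : ∀ {n} (i : Fin n) → expDeg (unit i) ≡ 1
expDeg-unit {suc n} Fin.zero = cong suc (expDeg-zeros n)
expDeg-unit (Fin.suc i) = expDeg-unit i

monVal-unit : ∀ {n} (i : Fin n) xs → monVal (unit i) xs ≡ Vec.lookup xs i
monVal-unit Fin.zero (x ∷ xs) = trans (cong₂ ℤ._*_ (ℤ.^-identityʳ x) (monVal-zeros xs)) (ℤ.*-identityʳ x)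
monVal-unit (Fin.suc i) (x ∷ xs) = trans (ℤ.*-identityˡ _) (monVal-unit i xs)

abstract

  poly-const : ∀ {n} c → IsPoly {n} 0 (λ _ → c)
  poly-const {n} c = (c , zeros n) ∷ [] , ≤-reflexive (expDeg-zeros n) ∷ [] ,
    λ xs → trans (ℤ.+-identityʳ _) (trans (cong (c ℤ.*_) (monVal-zeros xs)) (ℤ.*-identityʳ c))

  poly-var : ∀ {n} (i : Fin n) → IsPoly 1 (λ xs → Vec.lookup xs i)
  poly-var i = (+ 1 , unit i) ∷ [] , ≤-reflexive (expDeg-unit i) ∷ [] ,
    λ xs → trans (ℤ.+-identityʳ _) (trans (ℤ.*-identityˡ _) (monVal-unit i xs))

  poly-weaken : ∀ {n d d′} {f : Vec ℤ n → ℤ} → d ≤ d′ → IsPoly d f → IsPoly d′ f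
  poly-weaken h (P , p , e) = P , All.map (λ q → ≤-trans q h) p , e

  poly-+ : ∀ {n d} {f h : Vec ℤ n → ℤ} → IsPoly d f → IsPoly d h → IsPoly d (λ xs → f xs ℤ.+ h xs)
  poly-+ (P , p , e) (Q , q , e′) = P ++ Q , All.++⁺ p q , λ xs → trans (eval-++ P Q xs) (cong₂ ℤ._+_ (e xs) (e′ xs))
    where import Data.List.Relation.Unary.All.Properties as All

  poly-* : ∀ {n d d′} {f h : Vec ℤ n → ℤ} → IsPoly d f → IsPoly d′ h → IsPoly (d + d′) (λ xs → f xs ℤ.* h xs)
  poly-* (P , p , e) (Q , q , e′) = mulPoly P Q , deg-mulPoly p q , λ xs → trans (eval-mulPoly P Q xs) (cong₂ ℤ._*_ (e xs) (e′ xs))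

  poly-cong : ∀ {n d} {f h : Vec ℤ n → ℤ} → (∀ xs → f xs ≡ h xs) → IsPoly d f → IsPoly d h
  poly-cong eq (P , p , e) = P , p , λ xs → trans (e xs) (eq xs)

poly-neg : ∀ {n d} {f : Vec ℤ n → ℤ} → IsPoly d f → IsPoly d (λ xs → ℤ.- f xs)
poly-neg {f = f} p = poly-cong (λ xs → ℤ.-1*i≡-i (f xs)) (poly-* (poly-const (ℤ.- + 1)) p)

poly-^ : ∀ {n d} {f : Vec ℤ n → ℤ} k → IsPoly d f → IsPoly (k * d) (λ xs → f xs ℤ.^ k)
poly-^ zero p = poly-const (+ 1)
poly-^ (suc k) p = poly-* p (poly-^ k p)

-- Degrees of the form p 𝔫 + q, with p and q numerals.
module Graded {n : ℕ} (𝔫 : ℕ) where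

  record Poly⟨_,_⟩ (p q : ℕ) (f : Vec ℤ n → ℤ) : Set where
    constructor graded
    field
      isPoly : IsPoly (p * 𝔫 + q) f

  open Poly⟨_,_⟩ public

  infixl 6 _+ᵖ_ _-ᵖ_
  infixl 7 _*ᵖ_

  constᵖ : ∀ c → Poly⟨ 0 , 0 ⟩ (λ _ → c)
  constᵖ c = graded (poly-const c)

  varᵖ : ∀ i → Poly⟨ 0 , 1 ⟩ (λ xs → Vec.lookup xs i)
  varᵖ i = graded (poly-var i)

  private
    weaken : ∀ {p q p′ q′} {f : Vec ℤ n → ℤ} → p ≤ p′ → q ≤ q′ → IsPoly (p * 𝔫 + q) f → IsPoly (p′ * 𝔫 + q′) f
    weaken h h′ = poly-weaken (+-mono-≤ (*-monoˡ-≤ 𝔫 h) h′)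

  _+ᵖ_ : ∀ {p q p′ q′ f h} → Poly⟨ p , q ⟩ f → Poly⟨ p′ , q′ ⟩ h → Poly⟨ p ⊔ p′ , q ⊔ q′ ⟩ (λ xs → f xs ℤ.+ h xs)
  _+ᵖ_ {p} {q} {p′} {q′} (graded a) (graded b) = graded (poly-+ (weaken (m≤m⊔n p p′) (m≤m⊔n q q′) a) (weaken (m≤n⊔m p p′) (m≤n⊔m q q′) b))

  _-ᵖ_ : ∀ {p q p′ q′ f h} → Poly⟨ p , q ⟩ f → Poly⟨ p′ , q′ ⟩ h → Poly⟨ p ⊔ p′ , q ⊔ q′ ⟩ (λ xs → f xs ℤ.- h xs)
  a -ᵖ (graded b) = a +ᵖ graded (poly-neg b)

  _*ᵖ_ : ∀ {p q p′ q′ f h} → Poly⟨ p , q ⟩ f → Poly⟨ p′ , q′ ⟩ h → Poly⟨ p + p′ , q + q′ ⟩ (λ xs → f xs ℤ.* h xs)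
  _*ᵖ_ {p} {q} {p′} {q′} (graded a) (graded b) = graded (poly-weaken (≤-reflexive (l p q p′ q′ 𝔫)) (poly-* a b))
    where
    l : ∀ p q p′ q′ n → p * n + q + (p′ * n + q′) ≡ (p + p′) * n + (q + q′)
    l = solve-∀

  by-def : ∀ {p q f h} → (∀ xs → h xs ≡ f xs) → Poly⟨ p , q ⟩ f → Poly⟨ p , q ⟩ h
  by-def e (graded a) = graded (poly-cong (λ xs → sym (e xs)) a)

module SystemPoly {n 𝔫 : ℕ} (s : Vec ℤ n → Vars) where

  open Graded {n} 𝔫

  module _
    (pX : Poly⟨ 3 , 0 ⟩ (λ xs → Xᵛ (s xs))) (pY : Poly⟨ 2 , 0 ⟩ (λ xs → Yᵛ (s xs)))
    (pbb : Poly⟨ 0 , 2 ⟩ (λ xs → bbᵛ (s xs))) (pM₀ : Poly⟨ 1 , 0 ⟩ (λ xs → M₀ᵛ (s xs)))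
    (pa : Poly⟨ 0 , 1 ⟩ (λ xs → aᵛ (s xs))) (pb̂ : Poly⟨ 0 , 1 ⟩ (λ xs → b̂ᵛ (s xs)))
    (pg : Poly⟨ 0 , 1 ⟩ (λ xs → gᵛ (s xs))) (ph : Poly⟨ 0 , 1 ⟩ (λ xs → hᵛ (s xs)))
    (pk : Poly⟨ 0 , 1 ⟩ (λ xs → kᵛ (s xs))) (pl : Poly⟨ 0 , 1 ⟩ (λ xs → lᵛ (s xs)))
    (pw : Poly⟨ 0 , 1 ⟩ (λ xs → wᵛ (s xs))) (px : Poly⟨ 0 , 1 ⟩ (λ xs → xᵛ (s xs)))
    (py : Poly⟨ 0 , 1 ⟩ (λ xs → yᵛ (s xs))) (pu : Poly⟨ 0 , 1 ⟩ (λ xs → uᵛ (s xs)))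
    (pv : Poly⟨ 0 , 1 ⟩ (λ xs → vᵛ (s xs))) (pn : Poly⟨ 0 , 1 ⟩ (λ xs → nᵛ (s xs)))
    where

    pellFormᵖ : ∀ {p q p′ q′ f h} → Poly⟨ p , q ⟩ f → Poly⟨ p′ , q′ ⟩ h → Poly⟨ _ , _ ⟩ (λ xs → pellForm (f xs) (h xs))
    pellFormᵖ α z = (α *ᵖ α -ᵖ constᵖ (+ 1)) *ᵖ (z *ᵖ z) +ᵖ constᵖ (+ 1)

    pW = by-def (Sys.W-def ∘ s) (pb̂ *ᵖ pw)
    pV = by-def (Sys.V-def ∘ s) (constᵖ (+ 16) *ᵖ (pY *ᵖ (constᵖ (+ 1) +ᵖ pW *ᵖ pW)))
    pL = by-def (Sys.L-def ∘ s) (pY *ᵖ (constᵖ (+ 2) *ᵖ pl +ᵖ constᵖ (+ 1)))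
    pU = by-def (Sys.U-def ∘ s) (constᵖ (+ 64) *ᵖ (constᵖ (+ 1) +ᵖ pX *ᵖ pX *ᵖ (pL *ᵖ pL)))
    pα = by-def (Sys.α-def ∘ s) (pU *ᵖ (constᵖ (+ 1) +ᵖ pV))
    pκ = by-def (Sys.κ-def ∘ s) (constᵖ (+ 2) *ᵖ (pU *ᵖ pU *ᵖ pV))
    pB = by-def (Sys.B-def ∘ s) (constᵖ (+ 1) +ᵖ (pX +ᵖ pX))
    pC = by-def (Sys.C-def ∘ s) (pB +ᵖ (pα -ᵖ constᵖ (+ 1)) *ᵖ ph)
    pK = by-def (Sys.K-def ∘ s) (constᵖ (+ 1) +ᵖ pX +ᵖ (pκ -ᵖ constᵖ (+ 1)) *ᵖ pk)
    pS₂ = by-def (Sys.S₂-def ∘ s) (pellFormᵖ pκ pK)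
    pD = by-def (Sys.D-def ∘ s) (pellFormᵖ pα pC)
    pE = by-def (Sys.E-def ∘ s) (constᵖ (+ 2) *ᵖ (pC *ᵖ pC) *ᵖ pD *ᵖ pS₂ *ᵖ px)
    pF = by-def (Sys.F-def ∘ s) (pellFormᵖ pα pE)
    pG = by-def (Sys.G-def ∘ s) (pα +ᵖ pF *ᵖ (pF -ᵖ pα))
    pH = by-def (Sys.H-def ∘ s) (pC +ᵖ pF *ᵖ (pB +ᵖ (constᵖ (+ 2) *ᵖ py -ᵖ constᵖ (+ 1)) *ᵖ pC))
    pI = by-def (Sys.I-def ∘ s) (pellFormᵖ pG pH)
    pJ = by-def (Sys.J-def ∘ s) (pS₂ *ᵖ (pF *ᵖ pI))
    pM = by-def (Sys.M-def ∘ s) (pbb *ᵖ pM₀)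
    pCKL = pC -ᵖ pK *ᵖ pL
    pR = by-def (Sys.R-def ∘ s) (px *ᵖ px *ᵖ (pK *ᵖ pK *ᵖ (pM *ᵖ pM -ᵖ (pg *ᵖ pg +ᵖ pa *ᵖ pa *ᵖ (pM₀ *ᵖ pM₀))) -ᵖ constᵖ (+ 16) *ᵖ (pM *ᵖ pM) *ᵖ (pCKL *ᵖ pCKL)))
    pS₀ = by-def (Sys.S₀-def ∘ s) (constᵖ (+ 4) *ᵖ pα -ᵖ constᵖ (+ 5))
    pT₀ = by-def (Sys.T₀-def ∘ s) (constᵖ (+ 3) *ᵖ (pW *ᵖ pC) -ᵖ constᵖ (+ 2) *ᵖ (pW *ᵖ pW -ᵖ constᵖ (+ 1)))
    pyy = by-def (Sys.yy-def ∘ s) ((constᵖ (+ 2) *ᵖ pu +ᵖ constᵖ (+ 1)) *ᵖ (constᵖ (+ 3) *ᵖ pv +ᵖ constᵖ (+ 1)))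
    pQ = by-def (Sys.Q-def ∘ s) (pJ *ᵖ ((constᵖ (+ 4) *ᵖ pR -ᵖ constᵖ (+ 2)) *ᵖ pJ *ᵖ (pyy *ᵖ pyy) +ᵖ constᵖ (+ 1)))
    pST = pS₀ *ᵖ pn +ᵖ pT₀

    -- The leading product is S₀² J² R times the square of `yy`. Here S₀ has degree (12, 6), J has
    -- (2520, 1184), R has (50, 26) and the square of `yy` has (0, 4), whence 24 + 5040 + 50 and 12
    -- + 2368 + 26 + 4.
    equationᵖ : Poly⟨ 5114 , 2410 ⟩ (λ xs → Sys.equation (s xs))
    equationᵖ = by-def (Sys.equation-def ∘ s) (pST *ᵖ pST -ᵖ pS₀ *ᵖ pS₀ *ᵖ pQ)

-- The coding numbers as polynomials in a, b and g

combineX : ℤ → ℤ → ℤ → ℤ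
combineX S T N = S ℤ.+ T ℤ.+ N ℤ.* ((N ℤ.- + 1 ℤ.- S) ℤ.+ N ℤ.* (N ℤ.- + 1 ℤ.- T))

combineT : ℤ → ℤ → ℤ → ℤ → ℤ
combineT M g P Q = + 2 ℤ.* M ℤ.+ g ℤ.+ P ℤ.* Q

combineQ : ℕ → ℤ → ℤ → ℤ → ℤ → ℤ → ℤ → ℤ → ℤ
combineQ δ a B g D R P H = (+ 1 ℤ.+ a ℤ.* B ℤ.+ g) ℤ.^ δ ℤ.* D ℤ.+ R ℤ.+ P ℤ.* H

combineS : ℤ → ℤ → ℤ → ℤ → ℤ
combineS F P R B = F ℤ.+ P ℤ.* (R ℤ.* (B ℤ.- + 2))

module CodingPoly (k δ : ℕ) (1≤δ : 1 ≤ δ) (P : Poly (suc k)) (degP : All (λ mon → expDeg (proj₂ mon) ≤ δ) P) where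

  open Coefficients (suc k) δ using (enc)
  open Layout δ
  private module Cd = Coding k δ 1≤δ P degP
  open Cd using (coeffs; c; m; t; t-def; em)

  ℬz : ℤ → ℤ
  ℬz bb = + c ℤ.* bb ℤ.^ suc δ

  maskz : ℤ → ℤ → ℕ → ℕ → ℤ
  maskz B bb w zero = + 2 ℤ.* bb ℤ.- + 1
  maskz B bb w (suc k) = (B ℤ.^ (w * δ) ℤ.- bb) ℤ.+ B ℤ.^ (w * δ) ℤ.* maskz B bb (w * β) k

  fullz : ℤ → ℤ → ℤ
  fullz B bb = (B ℤ.^ β ℤ.- + 1) ℤ.+ B ℤ.^ β ℤ.* maskz B bb β k

  Dz : ℤ → Poly (suc k) → ℤ
  Dz B = Σℤ (λ (d , e) → d ℤ.* B ℤ.^ (m ∸ enc e))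

  Sz : ℤ → ℤ → ℤ
  Sz B bb = combineS (fullz B bb) (B ℤ.^ suc m) (B ℤ.^ m) B

  Tz : ℤ → ℤ → ℤ → ℤ → ℤ
  Tz B bb a g = combineT (bb ℤ.* B ℤ.^ m) g (B ℤ.^ suc m) (combineQ δ a B g (Dz B coeffs) (B ℤ.^ m) (B ℤ.^ suc m) (B ℤ.^ (suc m * δ)))

  Xz : ℤ → ℤ → ℤ → ℤ → ℤ
  Xz B bb a g = combineX (Sz B bb) (Tz B bb a g) (B ℤ.^ t)

  module _ (bb : ℕ) (1≤bb : 1 ≤ bb) where

    private
      module A = Cd.At bb 1≤bb
      module MD = MaskDefs A.ℬ bb δ 1≤δ 1≤bb A.4bb≤ℬ
      module Dg = Digits (suc k) δ A.ℬ Cd.m′ A.0<ℬ em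

    ∸-cast : ∀ {x y} → y ≤ x → + x ℤ.- + y ≡ + (x ∸ y)
    ∸-cast {x} {y} h = trans (ℤ.m-n≡m⊖n x y) (ℤ.⊖-≥ h)

    ℬ-cast : ℬz (+ bb) ≡ + A.ℬ
    ℬ-cast = trans (cong (+ c ℤ.*_) (sym (pos-^ bb (suc δ)))) (sym (ℤ.pos-* c (bb ^ suc δ)))

    B^-cast : ∀ i → (+ A.ℬ) ℤ.^ i ≡ + (A.ℬ ^ i)
    B^-cast i = sym (pos-^ A.ℬ i)

    mask-cast : ∀ w j → 0 < w → maskz (+ A.ℬ) (+ bb) w j ≡ + MD.mask w j
    mask-cast w zero _ = trans (cong (ℤ._- + 1) (sym (ℤ.pos-* 2 bb))) (∸-cast MD.1≤2bb)
    mask-cast w (suc j) 0<w = trans (cong₂ ℤ._+_ (trans (cong (ℤ._- + bb) (B^-cast (w * δ))) (∸-cast (MD.bb≤ℬ^ {w} 0<w)))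
                                (trans (cong₂ ℤ._*_ (B^-cast (w * δ)) (mask-cast (w * β) j (MD.0<w*β {w} 0<w))) (sym (ℤ.pos-* (A.ℬ ^ (w * δ)) (MD.mask (w * β) j)))))
                              (sym (ℤ.pos-+ (A.ℬ ^ (w * δ) ∸ bb) (A.ℬ ^ (w * δ) * MD.mask (w * β) j)))

    full-cast : fullz (+ A.ℬ) (+ bb) ≡ + MD.fullMask k m em
    full-cast = trans (cong₂ ℤ._+_ (trans (cong (ℤ._- + 1) (B^-cast β)) (∸-cast (m^n>0 A.ℬ ⦃ >-nonZero A.0<ℬ ⦄ β)))
                                (trans (cong₂ ℤ._*_ (B^-cast β) (mask-cast β k z<s)) (sym (ℤ.pos-* (A.ℬ ^ β) (MD.mask β k)))))
                              (sym (ℤ.pos-+ (A.ℬ ^ β ∸ 1) (A.ℬ ^ β * MD.mask β k)))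

    D-cast : ∀ D → Dz (+ A.ℬ) D ≡ Dg.Dval D
    D-cast = Σℤ-cong (λ (d , e) → cong (d ℤ.*_) (B^-cast (m ∸ enc e)))

    S-cast : Sz (+ A.ℬ) (+ bb) ≡ + A.S
    S-cast = trans (step (+ A.ℬ) full-cast (B^-cast (suc m)) (B^-cast m) (∸-cast {A.ℬ} {2} (≤-trans (≤-of-+ {2} {8} 6 refl) A.8≤ℬ)))
      (sym (trans (ℤ.pos-+ (MD.fullMask k m em) (A.ℬ ^ suc m * (A.ℬ ^ m * (A.ℬ ∸ 2)))) (cong (ℤ._+_ (+ MD.fullMask k m em))
        (trans (ℤ.pos-* (A.ℬ ^ suc m) (A.ℬ ^ m * (A.ℬ ∸ 2))) (cong (+ (A.ℬ ^ suc m) ℤ.*_) (ℤ.pos-* (A.ℬ ^ m) (A.ℬ ∸ 2)))))))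
      where
      step : ∀ {f f′ p p′ r r′ : ℤ} b {b′} → f ≡ f′ → p ≡ p′ → r ≡ r′ → b ℤ.- + 2 ≡ b′ → combineS f p r b ≡ f′ ℤ.+ p′ ℤ.* (r′ ℤ.* b′)
      step {f} {_} {p} {_} {r} _ refl refl refl e = cong (λ z → f ℤ.+ p ℤ.* (r ℤ.* z)) e

    T-cast : ∀ a g → Tz (+ A.ℬ) (+ bb) (+ a) g ≡ A.Tℤ a g
    T-cast a g = flip trans (sym (A.Tℤ-def a g)) $ step (+ bb ℤ.* (+ A.ℬ) ℤ.^ m) (trans (cong (λ z → + 2 ℤ.* (+ bb ℤ.* z)) (B^-cast m)) (sym (trans (ℤ.pos-* 2 A.M) (cong (+ 2 ℤ.*_) (ℤ.pos-* bb (A.ℬ ^ m))))))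
                   (B^-cast (suc m)) (flip trans (sym (A.Qℤ-def a g)) $ stepQ (D-cast coeffs) (B^-cast m) (B^-cast (suc m)) (B^-cast (suc m * δ)))
      where
      step : ∀ M {M′ P P′ Q Q′ : ℤ} → + 2 ℤ.* M ≡ M′ → P ≡ P′ → Q ≡ Q′ → combineT M g P Q ≡ M′ ℤ.+ g ℤ.+ P′ ℤ.* Q′
      step M {P = P} {Q = Q} e refl refl = cong (λ z → z ℤ.+ g ℤ.+ P ℤ.* Q) e
      stepQ : ∀ {D D′ R R′ P P′ H H′ : ℤ} → D ≡ D′ → R ≡ R′ → P ≡ P′ → H ≡ H′ → combineQ δ (+ a) (+ A.ℬ) g D R P H ≡ (+ 1 ℤ.+ + a ℤ.* + A.ℬ ℤ.+ g) ℤ.^ δ ℤ.* D′ ℤ.+ R′ ℤ.+ P′ ℤ.* H′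
      stepQ refl refl refl refl = refl

    X-cast : ∀ a g → Xz (ℬz (+ bb)) (+ bb) (+ a) g ≡ A.Xℤ a g
    X-cast a g = flip trans (sym (A.Xℤ-def a g)) $ trans (cong (λ B → Xz B (+ bb) (+ a) g) ℬ-cast) (step S-cast (T-cast a g) (B^-cast t))
      where
      step : ∀ {S S′ T T′ N N′ : ℤ} → S ≡ S′ → T ≡ T′ → N ≡ N′ → combineX S T N ≡ S′ ℤ.+ T′ ℤ.+ N′ ℤ.* ((N′ ℤ.- + 1 ℤ.- S′) ℤ.+ N′ ℤ.* (N′ ℤ.- + 1 ℤ.- T′))
      step refl refl refl = refl

  -- With bb of degree 2 the base has degree 2 (δ + 1), and 𝔫 bounds the degree of N, its t-th
  -- power. S, T and M₀ stay within the same bound, so 𝔫 is the unit in which all degrees are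
  -- measured.
  dB 𝔫 : ℕ
  dB = 2 * suc δ
  𝔫 = t * dB

  module Degree {n : ℕ} {B bb a g : Vec ℤ n → ℤ} (pB : IsPoly dB B) (pbb : IsPoly 2 bb) (pa : IsPoly 1 a) (pg : IsPoly 1 g) where

    open Graded {n} 𝔫

    private
      2≤dB : 2 ≤ dB
      2≤dB = *-monoʳ-≤ 2 {1} {suc δ} (s≤s z≤n)

    mask-poly : ∀ w j → IsPoly (len w j * dB + 2) (λ xs → maskz (B xs) (bb xs) w j)
    mask-poly w zero = poly-+ (poly-* (poly-const (+ 2)) pbb) (poly-neg (poly-weaken z≤n (poly-const (+ 1))))
    mask-poly w (suc j) = poly-+ (poly-+ (poly-weaken (≤-trans (*-monoˡ-≤ dB (m≤m+n (w * δ) (len (w * β) j))) (m≤m+n _ 2)) (poly-^ (w * δ) pB))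
                                         (poly-neg (poly-weaken (m≤n+m 2 _) pbb)))
                                 (poly-weaken (≤-reflexive (l (w * δ) dB (len (w * β) j))) (poly-* (poly-^ (w * δ) pB) (mask-poly (w * β) j)))
      where
      l : ∀ p d q → p * d + (q * d + 2) ≡ (p + q) * d + 2
      l = solve-∀

    m≡ : β + len β k ≡ m
    m≡ = trans (len-≡ β k) (sym em)

    full-poly : IsPoly (suc m * dB) (λ xs → fullz (B xs) (bb xs))
    full-poly = poly-+ (poly-+ (poly-weaken (*-monoˡ-≤ dB (≤-trans (m≤m+n β (len β k)) (≤-trans (≤-reflexive m≡) (n≤1+n m)))) (poly-^ β pB)) (poly-neg (poly-weaken z≤n (poly-const (+ 1)))))
                       (poly-weaken bound (poly-* (poly-^ β pB) (mask-poly β k)))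
      where
      open ≤-Reasoning
      l : ∀ p d q → p * d + (q * d + 2) ≡ (p + q) * d + 2
      l = solve-∀
      bound : β * dB + (len β k * dB + 2) ≤ suc m * dB
      bound = begin
        β * dB + (len β k * dB + 2) ≡⟨ l β dB (len β k) ⟩
        (β + len β k) * dB + 2      ≡⟨ cong (λ z → z * dB + 2) m≡ ⟩
        m * dB + 2                  ≤⟨ +-monoʳ-≤ (m * dB) 2≤dB ⟩
        m * dB + dB                 ≡⟨ +-comm (m * dB) dB ⟩
        suc m * dB                  ∎

    ≤t : ∀ {i} → i ≤ suc m * (2 + δ) + 2 → i * dB ≤ 𝔫
    ≤t h = *-monoˡ-≤ dB (≤-trans h (≤-reflexive (sym t-def)))

    to𝔫 : ∀ {d} {f : Vec ℤ n → ℤ} → d ≤ 𝔫 → IsPoly d f → Poly⟨ 1 , 0 ⟩ f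
    to𝔫 h p = graded (poly-weaken (≤-trans h (≤-reflexive (trans (sym (+-identityʳ 𝔫)) (sym (+-identityʳ _))))) p)

    S-poly : Poly⟨ 1 , 0 ⟩ (λ xs → Sz (B xs) (bb xs))
    S-poly = to𝔫 bound (poly-+ (poly-weaken (m≤m+n (suc m * dB) _) full-poly)
      (poly-* (poly-^ (suc m) pB) (poly-* (poly-^ m pB) (poly-+ pB (poly-neg (poly-weaken z≤n (poly-const (+ 2))))))))
      where
      l : ∀ m d → suc m * d + (m * d + d) ≡ suc m * 2 * d
      l = solve-∀
      bound : suc m * dB + (m * dB + dB) ≤ 𝔫
      bound = ≤-trans (≤-reflexive (l m dB)) (≤t (≤-trans (*-monoʳ-≤ (suc m) (m≤m+n 2 δ)) (m≤m+n _ 2)))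

    D-poly : ∀ D → IsPoly (m * dB) (λ xs → Dz (B xs) D)
    D-poly [] = poly-weaken z≤n (poly-const (+ 0))
    D-poly ((d , e) ∷ D) = poly-+ (poly-weaken (*-monoˡ-≤ dB (m∸n≤m m (enc e))) (poly-* (poly-const d) (poly-^ (m ∸ enc e) pB))) (D-poly D)

    T-poly : Poly⟨ 1 , 0 ⟩ (λ xs → Tz (B xs) (bb xs) (a xs) (g xs))
    T-poly = to𝔫 tail≤ (poly-+ (poly-+ (poly-* (poly-const (+ 2)) (poly-weaken Mb (poly-* pbb (poly-^ m pB)))) (poly-weaken gb pg))
                  (poly-* (poly-^ (suc m) pB) Q-poly))
      where
      h = suc m * dB + suc m * δ * dB
      mdB≤ : m * dB ≤ h
      mdB≤ = ≤-trans (*-monoˡ-≤ dB (n≤1+n m)) (m≤m+n _ _)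
      Z-poly : IsPoly (1 + dB) (λ xs → + 1 ℤ.+ a xs ℤ.* B xs ℤ.+ g xs)
      Z-poly = poly-+ (poly-+ (poly-weaken z≤n (poly-const (+ 1))) (poly-* pa pB)) (poly-weaken (s≤s z≤n) pg)
      Zb : δ * (1 + dB) + m * dB ≤ h
      Zb = ≤-trans (≤-reflexive (+-comm (δ * (1 + dB)) (m * dB))) (+-mono-≤ (*-monoˡ-≤ dB (n≤1+n m))
             (≤-trans (*-monoʳ-≤ δ (+-monoˡ-≤ dB (≤-trans (s≤s z≤n) 2≤dB))) (≤-trans (≤-reflexive (l δ dB)) (*-monoˡ-≤ dB (*-monoˡ-≤ δ (s≤s (s≤s (z≤n {Cd.m′}))))))))
        where
        l : ∀ δ d → δ * (d + d) ≡ 2 * δ * d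
        l = solve-∀
      Q-poly : IsPoly h (λ xs → combineQ δ (a xs) (B xs) (g xs) (Dz (B xs) coeffs) (B xs ℤ.^ m) (B xs ℤ.^ suc m) (B xs ℤ.^ (suc m * δ)))
      Q-poly = poly-+ (poly-+ (poly-weaken Zb (poly-* (poly-^ δ Z-poly) (D-poly coeffs))) (poly-weaken mdB≤ (poly-^ m pB)))
                      (poly-* (poly-^ (suc m) pB) (poly-^ (suc m * δ) pB))
      Mb : 2 + m * dB ≤ suc m * dB + h
      Mb = ≤-trans (+-monoˡ-≤ (m * dB) 2≤dB) (m≤m+n _ h)
      gb : 1 ≤ suc m * dB + h
      gb = ≤-trans (s≤s z≤n) Mb
      tail≤ : suc m * dB + h ≤ 𝔫
      tail≤ = ≤-trans (≤-reflexive (l (suc m) δ dB)) (≤t (m≤m+n (suc m * (2 + δ)) 2))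
        where
        l : ∀ m δ d → m * d + (m * d + m * δ * d) ≡ m * (2 + δ) * d
        l = solve-∀

    N-poly : Poly⟨ 1 , 0 ⟩ (λ xs → B xs ℤ.^ t)
    N-poly = to𝔫 ≤-refl (poly-^ t pB)

    M₀-poly : Poly⟨ 1 , 0 ⟩ (λ xs → B xs ℤ.^ m)
    M₀-poly = to𝔫 (≤t (≤-trans (n≤1+n m) (≤-trans (m≤m*n (suc m) (2 + δ)) (m≤m+n _ 2)))) (poly-^ m pB)

    X-poly : Poly⟨ 3 , 0 ⟩ (λ xs → Xz (B xs) (bb xs) (a xs) (g xs))
    X-poly = S-poly +ᵖ T-poly +ᵖ N-poly *ᵖ ((N-poly -ᵖ constᵖ (+ 1) -ᵖ S-poly) +ᵖ N-poly *ᵖ (N-poly -ᵖ constᵖ (+ 1) -ᵖ T-poly))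

-- The universal polynomial

vars-≡ : ∀ s {X Y bb M₀ a b̂ g} → Xᵛ s ≡ X → Yᵛ s ≡ Y → bbᵛ s ≡ bb → M₀ᵛ s ≡ M₀ → aᵛ s ≡ a → b̂ᵛ s ≡ b̂ → gᵛ s ≡ g →
  vars X Y bb M₀ a b̂ g (hᵛ s) (kᵛ s) (lᵛ s) (wᵛ s) (xᵛ s) (yᵛ s) (uᵛ s) (vᵛ s) (nᵛ s) ≡ s
vars-≡ s refl refl refl refl refl refl refl = refl

VecSum : ∀ {n} → Vec ℕ n → ℕ
VecSum [] = 0
VecSum (z ∷ zs) = z + VecSum zs

VecSum-bound : ∀ {n b} (z : Vec ℕ n) → VecSum z < b → VAll.All (_< b) z
VecSum-bound [] _ = []
VecSum-bound (z ∷ zs) h = ≤-<-trans (m≤m+n z _) h ∷ VecSum-bound zs (≤-<-trans (m≤n+m _ z) h)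

module Main (k δ : ℕ) (1≤δ : 1 ≤ δ) (P : Poly (suc k)) (degP : All (λ mon → expDeg (proj₂ mon) ≤ δ) P) where

  private
    module Cd = Coding k δ 1≤δ P degP
  open CodingPoly k δ 1≤δ P degP

  -- Never zero, and every power of two is attained up to sign. Its square bb is thus a positive
  -- number for every integer b, without a condition on the sign.
  b̂-of : ℤ → ℤ
  b̂-of b = + 3 ℤ.* b ℤ.+ + 1

  assign : ℤ → ℤ → ℤ → (h k l w x y u v n : ℤ) → Vars
  assign a b g = vars (Xz (ℬz (b̂-of b ℤ.* b̂-of b)) (b̂-of b ℤ.* b̂-of b) a g) (ℬz (b̂-of b ℤ.* b̂-of b) ℤ.^ Cd.t ℤ.* ℬz (b̂-of b ℤ.* b̂-of b) ℤ.^ Cd.t)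
    (b̂-of b ℤ.* b̂-of b) (ℬz (b̂-of b ℤ.* b̂-of b) ℤ.^ Cd.m) a (b̂-of b) g

  varsOf : Vec ℤ 12 → Vars
  varsOf xs = assign (x₀ (# 0)) (x₀ (# 1)) (x₀ (# 2)) (x₀ (# 3)) (x₀ (# 4)) (x₀ (# 5)) (x₀ (# 6)) (x₀ (# 7)) (x₀ (# 8)) (x₀ (# 9)) (x₀ (# 10)) (x₀ (# 11))
    where
    x₀ : Fin 12 → ℤ
    x₀ = Vec.lookup xs

  module _ (b : ℤ) where

    b̂ : ℤ
    b̂ = b̂-of b

    bb : ℕ
    bb = ∣ b̂ ∣ * ∣ b̂ ∣

    1≤bb : 1 ≤ bb
    1≤bb = *-pos (∣i∣>0 (1+3-≢0 b)) (∣i∣>0 (1+3-≢0 b))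

    module A = Cd.At bb 1≤bb

    bb-cast : b̂ ℤ.* b̂ ≡ + bb
    bb-cast = sym (∣∣-sq b̂)

    B-cast : ℬz (b̂ ℤ.* b̂) ≡ + A.ℬ
    B-cast = trans (cong ℬz bb-cast) (ℬ-cast bb 1≤bb)

    Y-cast : ℬz (b̂ ℤ.* b̂) ℤ.^ Cd.t ℤ.* ℬz (b̂ ℤ.* b̂) ℤ.^ Cd.t ≡ + (A.N * A.N)
    Y-cast = trans (cong (λ z → z ℤ.* z) (trans (cong (ℤ._^ Cd.t) B-cast) (B^-cast bb 1≤bb Cd.t))) (sym (ℤ.pos-* A.N A.N))

    M₀-cast : ℬz (b̂ ℤ.* b̂) ℤ.^ Cd.m ≡ + A.M₀
    M₀-cast = trans (cong (ℤ._^ Cd.m) B-cast) (B^-cast bb 1≤bb Cd.m)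

    X-value : ∀ a g → Xz (ℬz (b̂ ℤ.* b̂)) (b̂ ℤ.* b̂) (+ a) g ≡ A.Xℤ a g
    X-value a g = trans (cong (λ z → Xz (ℬz z) z (+ a) g) bb-cast) (X-cast bb 1≤bb a g)

    0<NN : 0 < A.N * A.N
    0<NN = *-pos 0<N 0<N
      where
      0<N : 0 < A.N
      0<N = m^n>0 A.ℬ ⦃ >-nonZero A.0<ℬ ⦄ Cd.t

  sound : ∀ a (z : Vec ℤ 11) → Sys.equation (varsOf (+ a ∷ z)) ≡ + 0 → ∃ λ (z : Vec ℕ k) → eval P (+ a ∷ Vec.map +_ z) ≡ + 0
  sound a (b ∷ g ∷ h ∷ k′ ∷ l ∷ w ∷ x ∷ y ∷ u ∷ v ∷ n ∷ []) root =
    Ab.coding-sound pow {a} {g} R S.a<bb (proj₂ concl)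
    where
    module Ab = Cd.At (bb b) (1≤bb b)
    s : Vars
    s = assign (+ a) b g h k′ l w x y u v n
    module S = SystemSound (Ab.N * Ab.N) (bb b) (Ab.M₀) a (0<NN b) s (Y-cast b) (bb-cast b) (M₀-cast b) refl root
    R : Ab.Range a g
    R = Ab.range a g S.a<bb S.∣g∣<M
    concl : (∣ b̂ b ∣ ∣ 2 ^ suc (Ab.Range.X₀ R + Ab.Range.X₀ R)) × (Ab.N * Ab.N ∣ binom (Ab.Range.X₀ R + Ab.Range.X₀ R) (Ab.Range.X₀ R))
    concl = S.conclusion (Ab.Range.X₀ R) (≤-trans (Ab.1≤M) (Ab.Range.X≥ R)) (trans (X-value b a g) (Ab.Range.Xℤ≡ R))
    pow : IsPow2 (bb b)
    pow = pow2-* p p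
      where
      p : IsPow2 (∣ b̂ b ∣)
      p = ∣2^⇒2^ (suc (Ab.Range.X₀ R + Ab.Range.X₀ R)) (proj₁ concl)

  complete : ∀ a (z : Vec ℕ k) → eval P (+ a ∷ Vec.map +_ z) ≡ + 0 → ∃ λ (z : Vec ℤ 11) → Sys.equation (varsOf (+ a ∷ z)) ≡ + 0
  complete a z root = construct (power-of-two-mod-3 j)
    where
    j : ℕ
    -- Large enough that bb, the square of 2ʲ, exceeds 2a and every component of z.
    j = suc (2 * a + VecSum z)
    construct : (∃ λ b → ∣ + 3 ℤ.* b ℤ.+ + 1 ∣ ≡ 2 ^ j) → ∃ λ (z : Vec ℤ 11) → Sys.equation (varsOf (+ a ∷ z)) ≡ + 0
    construct (b , eb) = finish (proj₂ coded R)
      where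
      module Ab = Cd.At (bb b) (1≤bb b)
      j<2^j : suc j ≤ 2 ^ j
      j<2^j = n<2^n j
      2^j≤bb : 2 ^ j ≤ bb b
      2^j≤bb = ≤-trans (m≤m*n (2 ^ j) (2 ^ j) ⦃ m^n≢0 2 j ⦄) (≤-reflexive (cong₂ _*_ (sym eb) (sym eb)))
      j<bb : suc j ≤ bb b
      j<bb = ≤-trans j<2^j 2^j≤bb
      pow : IsPow2 (bb b)
      pow = pow2-* (j , eb) (j , eb)
      2a≤bb : 2 * a ≤ bb b
      2a≤bb = ≤-trans (≤-trans (m≤m+n (2 * a) (VecSum z)) (≤-trans (n≤1+n _) (n≤1+n j))) j<bb
      a<bb : a < bb b
      a<bb = ≤-trans (s≤s (≤-trans (m≤m+n a (a + 0)) (≤-trans (m≤m+n (2 * a) (VecSum z)) (n≤1+n _)))) j<bb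
      pz : VAll.All (_< bb b) z
      pz = VecSum-bound z (≤-trans (s≤s (≤-trans (m≤n+m (VecSum z) (2 * a)) (n≤1+n _))) j<bb)
      2≤bb : 2 ≤ bb b
      2≤bb = ≤-trans (s≤s (s≤s z≤n)) j<bb
      coded = Ab.coding-complete pow {a} z a<bb pz root
      g : ℕ
      g = Ab.ℬ ^ suc δ * MaskDefs.code (Ab.ℬ) (bb b) δ 1≤δ (1≤bb b) (Ab.4bb≤ℬ) (suc δ) z
      2g≤M : 2 * g ≤ Ab.M
      2g≤M = *-mono-≤ 2≤bb (<⇒≤ (proj₁ coded))
      R : Ab.Range a (+ g)
      R = Ab.range a (+ g) a<bb (<-≤-trans (proj₁ coded) (m≤n*m (Ab.M₀) (bb b) ⦃ >-nonZero (1≤bb b) ⦄))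
      X₀ : ℕ
      X₀ = Ab.Range.X₀ R
      M≤X : Ab.M ≤ X₀
      M≤X = Ab.Range.X≥ R
      bb≤X : bb b ≤ X₀
      bb≤X = ≤-trans (m≤m*n (bb b) (Ab.M₀) ⦃ m^n≢0 (Ab.ℬ) Cd.m ⦃ >-nonZero (Ab.0<ℬ) ⦄ ⦄) M≤X
      j≤ : j ≤ suc (X₀ + X₀)
      j≤ = ≤-trans (≤-trans (n≤1+n j) j<bb) (≤-trans bb≤X (≤-trans (m≤m+n X₀ X₀) (n≤1+n _)))
      finish : (∃ λ o → Odd o × binom (X₀ + X₀) X₀ ≡ Ab.N * Ab.N * o) → ∃ λ (z : Vec ℤ 11) → Sys.equation (varsOf (+ a ∷ z)) ≡ + 0
      finish (o , odd-o , eo) = from-solution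
        (SystemComplete.solution X₀ (Ab.N * Ab.N) (bb b) (Ab.M₀) a j (b̂ b) (+ g) (≤-trans (Ab.1≤M) M≤X) (0<NN b) (Ab.1≤M) eb j≤ 2g≤M 2a≤bb odd-o eo)
        where
        from-solution : (∃ λ s → Xᵛ s ≡ + X₀ × Yᵛ s ≡ + (Ab.N * Ab.N) × bbᵛ s ≡ + bb b × M₀ᵛ s ≡ + Ab.M₀ × aᵛ s ≡ + a × b̂ᵛ s ≡ b̂ b × gᵛ s ≡ + g × Sys.equation s ≡ + 0) →
          ∃ λ (z : Vec ℤ 11) → Sys.equation (varsOf (+ a ∷ z)) ≡ + 0
        from-solution (s , eX , eY , ebb , eM₀ , ea , eb̂ , eg , eq) =
          b ∷ + g ∷ hᵛ s ∷ kᵛ s ∷ lᵛ s ∷ wᵛ s ∷ xᵛ s ∷ yᵛ s ∷ uᵛ s ∷ vᵛ s ∷ nᵛ s ∷ [] ,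
          trans (cong Sys.equation (vars-≡ s (trans eX (sym (trans (X-value b a (+ g)) (Ab.Range.Xℤ≡ R)))) (trans eY (sym (Y-cast b))) (trans ebb (sym (bb-cast b))) (trans eM₀ (sym (M₀-cast b))) ea eb̂ eg)) eq

  open Graded {12} 𝔫

  b̂-poly : Poly⟨ 0 , 1 ⟩ (λ xs → b̂-of (Vec.lookup xs (# 1)))
  b̂-poly = constᵖ (+ 3) *ᵖ varᵖ (# 1) +ᵖ constᵖ (+ 1)

  bb-poly : Poly⟨ 0 , 2 ⟩ (λ xs → b̂-of (Vec.lookup xs (# 1)) ℤ.* b̂-of (Vec.lookup xs (# 1)))
  bb-poly = b̂-poly *ᵖ b̂-poly

  ℬ-poly : IsPoly dB (λ xs → ℬz (b̂-of (Vec.lookup xs (# 1)) ℤ.* b̂-of (Vec.lookup xs (# 1))))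
  ℬ-poly = poly-weaken (≤-reflexive (*-comm (suc δ) 2)) (poly-* (poly-const (+ Cd.c)) (poly-^ (suc δ) (isPoly bb-poly)))

  equation-poly : Poly⟨ 5114 , 2410 ⟩ (λ xs → Sys.equation (varsOf xs))
  equation-poly = SystemPoly.equationᵖ varsOf Dg.X-poly (Dg.N-poly *ᵖ Dg.N-poly) bb-poly Dg.M₀-poly (varᵖ (# 0)) b̂-poly
    (varᵖ (# 2)) (varᵖ (# 3)) (varᵖ (# 4)) (varᵖ (# 5)) (varᵖ (# 6)) (varᵖ (# 7)) (varᵖ (# 8)) (varᵖ (# 9)) (varᵖ (# 10)) (varᵖ (# 11))
    where
    module Dg = Degree ℬ-poly (isPoly bb-poly) (poly-var (# 0)) (poly-var (# 2))

  -- Stated for variables so that the numerals of η are never unfolded.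
  degree-bound′ : ∀ ν {p q e₀ e₁ e₂ e₃} → k ≤ ν → p * 32 ≤ e₃ → q ≤ e₀ →
    p * 𝔫 + q ≤ e₀ + e₁ * δ + e₂ * δ * (2 * δ + 1) ^ (ν + 1) + e₃ * δ ^ 2 * (2 * δ + 1) ^ (ν + 1)
  degree-bound′ ν {p} {q} {e₀} {e₁} {e₂} {e₃} k≤ν p≤ q≤ = begin
    p * 𝔫 + q                              ≤⟨ +-mono-≤ (*-monoʳ-≤ p 𝔫≤) q≤ ⟩
    p * (32 * (δ * δ * β^)) + e₀           ≡⟨ cong (_+ e₀) (sym (*-assoc p 32 (δ * δ * β^))) ⟩
    p * 32 * (δ * δ * β^) + e₀             ≤⟨ +-monoˡ-≤ e₀ (*-monoˡ-≤ (δ * δ * β^) p≤) ⟩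
    e₃ * (δ * δ * β^) + e₀                 ≡⟨ cong (_+ e₀) (trans (sym (*-assoc e₃ (δ * δ) β^)) (cong (λ z → e₃ * z * β^) (cong (δ *_) (sym (*-identityʳ δ))))) ⟩
    e₃ * δ ^ 2 * β^ + e₀                   ≡⟨ +-comm (e₃ * δ ^ 2 * β^) e₀ ⟩
    e₀ + e₃ * δ ^ 2 * β^                   ≤⟨ +-monoˡ-≤ (e₃ * δ ^ 2 * β^) (≤-trans (m≤m+n e₀ (e₁ * δ)) (m≤m+n (e₀ + e₁ * δ) (e₂ * δ * β^))) ⟩
    e₀ + e₁ * δ + e₂ * δ * β^ + e₃ * δ ^ 2 * β^ ∎
    where
    open ≤-Reasoning
    β^ : ℕ
    β^ = (2 * δ + 1) ^ (ν + 1)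
    m≤β^ : Cd.m ≤ β^
    m≤β^ = begin
      Cd.m                  ≡⟨ Cd.em ⟩
      suc δ ^ suc k         ≤⟨ ^-monoʳ-≤ (suc δ) (≤-trans (s≤s k≤ν) (≤-reflexive (+-comm 1 ν))) ⟩
      suc δ ^ (ν + 1)       ≤⟨ ^-monoˡ-≤ (ν + 1) (≤-trans (≤-reflexive (+-comm 1 δ)) (+-monoˡ-≤ 1 (m≤m+n δ (δ + 0)))) ⟩
      β^                    ∎
    1≤β^ : 1 ≤ β^
    1≤β^ = ≤-trans (s≤s z≤n) m≤β^
    -- By 1 ≤ δ and 1 ≤ β^, the factors are bounded by m + 1 ≤ 2 β^, 2 + δ ≤ 3 δ, 2 ≤ 2 β^ δ and 2
    -- (δ + 1) ≤ 4 δ; the constant is (2 · 3 + 2) · 4.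
    𝔫≤ : 𝔫 ≤ 32 * (δ * δ * β^)
    𝔫≤ = begin
      𝔫                                       ≡⟨ cong (_* (2 * suc δ)) Cd.t-def ⟩
      (suc Cd.m * (2 + δ) + 2) * (2 * suc δ)
        ≤⟨ *-mono-≤ (+-mono-≤ (*-mono-≤ (+-mono-≤ 1≤β^ m≤β^) (+-monoˡ-≤ δ (*-monoʳ-≤ 2 1≤δ))) (*-monoʳ-≤ 2 (*-mono-≤ {x = 1} {y = β^} {u = 1} {v = δ} 1≤β^ 1≤δ))) (*-monoʳ-≤ 2 (+-monoˡ-≤ δ 1≤δ)) ⟩
      ((β^ + β^) * (2 * δ + δ) + 2 * (β^ * δ)) * (2 * (δ + δ))
        ≡⟨ l β^ δ ⟩
      32 * (δ * δ * β^) ∎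
      where
      l : ∀ b d → ((b + b) * (2 * d + d) + 2 * (b * d)) * (2 * (d + d)) ≡ 32 * (d * d * b)
      l = solve-∀

  -- 5114 · 32 = 163648 is below the last coefficient of η, and 2410 is below its constant term.
  degree-bound : ∀ ν → k ≤ ν → 5114 * 𝔫 + 2410 ≤ η ν δ
  degree-bound ν k≤ν = degree-bound′ ν {5114} {2410} {15616} {233856} {233952} {467712} k≤ν (≤ᵇ⇒≤ (5114 * 32) 467712 _) (≤ᵇ⇒≤ 2410 15616 _)

  representation : ∀ {d} → 5114 * 𝔫 + 2410 ≤ d → Σ (Poly 12) λ Q → deg≤ d Q ×
    (∀ a → (∃ λ (z : Vec ℕ k) → eval P (+ a ∷ Vec.map +_ z) ≡ + 0) ⇔ (∃ λ (z : Vec ℤ 11) → eval Q (+ a ∷ z) ≡ + 0))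
  representation {d} h = conclude (poly-weaken h (isPoly equation-poly))
    where
    conclude : IsPoly d (λ xs → Sys.equation (varsOf xs)) → Σ (Poly 12) λ Q → deg≤ d Q ×
      (∀ a → (∃ λ (z : Vec ℕ k) → eval P (+ a ∷ Vec.map +_ z) ≡ + 0) ⇔ (∃ λ (z : Vec ℤ 11) → eval Q (+ a ∷ z) ≡ + 0))
    conclude (Q , degQ , evalQ) = Q , degQ , λ a → mk⇔
      (λ (z , root) → proj₁ (complete a z root) , trans (evalQ (+ a ∷ proj₁ (complete a z root))) (proj₂ (complete a z root)))
      (λ (z , root) → sound a z (trans (sym (evalQ (+ a ∷ z))) root))

-- `DegreeAtMost` disregards monomials with coefficient 0, whereas the coding needs every listed
-- exponent vector to have degree at most δ.
dropZeros : ∀ {n} → Poly n → Poly n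
dropZeros [] = []
dropZeros ((c , e) ∷ P) with c ℤ.≟ + 0
... | yes _ = dropZeros P
... | no _ = (c , e) ∷ dropZeros P

eval-dropZeros : ∀ {n} (P : Poly n) xs → eval (dropZeros P) xs ≡ eval P xs
eval-dropZeros [] xs = refl
eval-dropZeros ((c , e) ∷ P) xs with c ℤ.≟ + 0
... | yes refl = trans (eval-dropZeros P xs) (sym (trans (cong (ℤ._+ eval P xs) (ℤ.*-zeroˡ (monVal e xs))) (ℤ.+-identityˡ _)))
... | no _ = cong (ℤ._+_ (c ℤ.* monVal e xs)) (eval-dropZeros P xs)

deg-dropZeros : ∀ {n δ} (P : Poly n) → DegreeAtMost δ P → deg≤ δ (dropZeros P)
deg-dropZeros [] [] = []
deg-dropZeros ((c , e) ∷ P) (p ∷ ps) with c ℤ.≟ + 0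
... | yes _ = deg-dropZeros P ps
... | no c≢0 = p c≢0 ∷ deg-dropZeros P ps

eval-degree-0 : ∀ {n} {P : Poly n} → deg≤ 0 P → ∀ xs ys → eval P xs ≡ eval P ys
eval-degree-0 [] xs ys = refl
eval-degree-0 {P = (c , e) ∷ P} (p ∷ ps) xs ys = cong₂ (λ u v → c ℤ.* u ℤ.+ v) (trans (one xs) (sym (one ys))) (eval-degree-0 ps xs ys)
  where
  one : ∀ xs → monVal e xs ≡ + 1
  one xs = trans (cong (λ z → monVal z xs) (expDeg≡0⇒zeros e (n≤0⇒n≡0 p))) (monVal-zeros xs)

Representableℤ : ℕ → (ℕ → Set) → Set
Representableℤ d A = Σ ℕ λ k → k ≤ 11 × Σ (Poly (suc k)) λ P → DegreeAtMost d P × RepresentsOverℤ A P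

-- The coding needs δ ≥ 1. In degree 0 the polynomial is a constant, so the set is empty or
-- everything, and the same constant without unknowns represents it.
representable-degree-0 : ∀ {A k d} {P : Poly (suc k)} → DegreeAtMost 0 P → RepresentsOverℕ A P → Representableℤ d A
representable-degree-0 {A} {k} {d} {P} degP rep =
  0 , z≤n , proj₁ constant , All.map (λ p _ → ≤-trans p z≤n) (proj₁ (proj₂ constant)) , λ a → mk⇔ (to a) (from a)
  where
  value : ℕ → Vec ℕ k → ℤ
  value a z = eval P (+ a ∷ Vec.map +_ z)
  base : Vec ℕ k
  base = zeros k
  constant : IsPoly {1} 0 (λ _ → value 0 base)
  constant = poly-const (value 0 base)
  independent : ∀ a z → value a z ≡ value 0 base
  independent a z = trans (sym (eval-dropZeros P _)) (trans (eval-degree-0 (deg-dropZeros P degP) _ _) (eval-dropZeros P _))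
  to : ∀ a → A a → Σ (Vec ℤ 0) λ z → eval (proj₁ constant) (+ a ∷ z) ≡ + 0
  to a h = let z , root = Equivalence.to (rep a) h in [] , trans (proj₂ (proj₂ constant) (+ a ∷ [])) (trans (sym (independent a z)) root)
  from : ∀ a → (Σ (Vec ℤ 0) λ z → eval (proj₁ constant) (+ a ∷ z) ≡ + 0) → A a
  from a (z , root) = Equivalence.from (rep a) (base , trans (independent a base) (trans (sym (proj₂ (proj₂ constant) (+ a ∷ z))) root))

representable : ∀ {A k δ d} (1≤δ : 1 ≤ δ) {P : Poly (suc k)} (degP : DegreeAtMost δ P) → RepresentsOverℕ A P →
  5114 * CodingPoly.𝔫 k δ 1≤δ (dropZeros P) (deg-dropZeros P degP) + 2410 ≤ d → Representableℤ d A
representable {A} {k} {δ} {d} 1≤δ {P} degP rep h = finish (Main.representation k δ 1≤δ (dropZeros P) (deg-dropZeros P degP) h)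
  where
  finish : (Σ (Poly 12) λ Q → deg≤ d Q ×
    (∀ a → (∃ λ (z : Vec ℕ k) → eval (dropZeros P) (+ a ∷ Vec.map +_ z) ≡ + 0) ⇔ (∃ λ (z : Vec ℤ 11) → eval Q (+ a ∷ z) ≡ + 0))) → Representableℤ d A
  finish (Q , degQ , equiv) = 11 , ≤-refl , Q , All.map (λ p _ → p) degQ , λ a → mk⇔
    (λ x → let z , root = Equivalence.to (rep a) x in Equivalence.to (equiv a) (z , trans (eval-dropZeros P (+ a ∷ Vec.map +_ z)) root))
    (λ x → let z , root = Equivalence.from (equiv a) x in Equivalence.from (rep a) (z , trans (sym (eval-dropZeros P (+ a ∷ Vec.map +_ z))) root))

theorem1 : (ν δ : ℕ) → UniversalPairℕ ν δ → UniversalPairℤ 11 (η ν δ)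
theorem1 ν δ universal A dioph = conclude (universal A dioph) (m≤n⇒m<n∨m≡n (z≤n {δ}))
  where
  conclude : (Σ ℕ λ k → k ≤ ν × Σ (Poly (suc k)) λ P → DegreeAtMost δ P × RepresentsOverℕ A P) → 0 < δ ⊎ 0 ≡ δ → Representableℤ (η ν δ) A
  conclude (k , k≤ν , P , degP , rep) (inj₁ 1≤δ) =
    representable 1≤δ degP rep (Main.degree-bound k δ 1≤δ (dropZeros P) (deg-dropZeros P degP) ν k≤ν)
  conclude (k , k≤ν , P , degP , rep) (inj₂ 0≡δ) =
    representable-degree-0 (subst (λ d → DegreeAtMost d P) (sym 0≡δ) degP) rep
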